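{- Let $a,u,d,d',k$ be positive integers and $p$ an odd prime. Let $G$ be a finite abelian group of order $up^{d'}$ and exponent $up^d$. Suppose: (a) $\gcd(u,p)=\gcd(p,k)=1$; (b) there is an integer $t$ coprime to $up$ such that (i) the automorphism $\sigma_t:\zeta_{up^d}\mapsto\zeta_{up^d}^t$ fixes every prime ideal of $\mathbb{Z}[\zeta_{up^d}]$ dividing $k$; (ii) $t\equiv1\pmod u$; (iii) with $w=\mathrm{ord}_p(t)$, either $k$ is self-conjugate modulo $u$ and $2^{\delta(u)}a<k<w-2^{\delta(u)}a$, or $\frac{ua}{\sqrt{\varphi(u)}}<k<\frac{w}{2\sqrt{\varphi(u)}}$. Then there is no $G$-invariant $IW_a(up^{d'},k^2)$.
   Context: A $G$-invariant $IW_a(v,n)$, $v=|G|$, is an element $D=\sum_ga_gg\in\mathbb{Z}[G]$ with all $a_g\in\{0,\pm1,\dots,\pm a\}$ and $DD^{(-1)}=n$, where $D^{(-1)}=\sum_ga_gg^{ -1}$. $\delta(u)$ is the number of distinct prime divisors of $u$, $\varphi$ is Euler's totient function, $\mathrm{ord}_p(t)$ the multiplicative order of $t$ mod $p$, $\zeta_m$ a primitive $m$-th root of unity. For a prime $\ell$ and integer $x$, $x(\ell)$ is the $\ell$-free part of $x$; a prime $\ell$ is self-conjugate modulo $v$ if $\ell^j\equiv-1\pmod{v(\ell)}$ for some $j$, and a composite integer is self-conjugate modulo $v$ if every prime divisor of it is. -}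

module Defs where

open import Level using (0ℓ)
open import Data.Nat as ℕ using (ℕ; zero; suc)
open import Data.Nat.Divisibility using (_∣?_)
open import Data.Nat.Primality using (Prime; prime?)
open import Data.Nat.GCD using (gcd)
open import Data.Integer as ℤ using (ℤ; +_; 0ℤ; 1ℤ; -_; _-_)
open import Data.Integer.Divisibility as ℤD using ()
open import Data.Fin using (Fin)
open import Data.List using (List; []; _∷_; length; filter; map; upTo; foldr; allFin)
open import Data.Product using (Σ; _×_; ∃)
open import Data.Sum using (_⊎_)
open import Relation.Nullary using (¬_)
open import Relation.Nullary.Decidable using (_×-dec_)
open import Relation.Binary.PropositionalEquality using (_≡_; _≢_)
open import Function.Bundles using (_⇔_)

δ : ℕ → ℕ
δ u = length (filter (λ ℓ → prime? ℓ ×-dec ℓ ∣? u) (upTo (suc u)))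

φ : ℕ → ℕ
φ u = length (filter (λ i → gcd i u ℕ.≟ 1) (map suc (upTo u)))

infix 4 _≡ᵐ_[mod_]
_≡ᵐ_[mod_] : ℤ → ℤ → ℕ → Set
x ≡ᵐ y [mod m ] = (+ m) ℤD.∣ (x - y)

IsOrd : ℕ → ℤ → ℕ → Set
IsOrd p t w =
  1 ℕ.≤ w × (t ℤ.^ w) ≡ᵐ 1ℤ [mod p ] ×
  (∀ w′ → 1 ℕ.≤ w′ → w′ ℕ.< w → ¬ ((t ℤ.^ w′) ≡ᵐ 1ℤ [mod p ]))

IsFreePart : ℕ → ℕ → ℕ → Set
IsFreePart ℓ x y = Σ ℕ λ e → (x ≡ ℓ ℕ.^ e ℕ.* y) × ¬ (ℓ Data.Nat.Divisibility.∣ y)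

SelfConjPrime : ℕ → ℕ → Set
SelfConjPrime ℓ v = Σ ℕ λ vℓ → IsFreePart ℓ v vℓ ×
  Σ ℕ λ j → (+ ℓ) ℤ.^ j ≡ᵐ - 1ℤ [mod vℓ ]

SelfConj : ℕ → ℕ → Set
SelfConj k v = ∀ ℓ → Prime ℓ → ℓ Data.Nat.Divisibility.∣ k → SelfConjPrime ℓ v

-- Polynomials over ℤ (coefficient lists, lowest degree first)

Poly : Set
Poly = List ℤ

coeff : Poly → ℕ → ℤ
coeff []       _       = 0ℤ
coeff (c ∷ f)  zero    = c
coeff (c ∷ f)  (suc i) = coeff f i

_≈ₚ_ : Poly → Poly → Set
f ≈ₚ g = ∀ i → coeff f i ≡ coeff g i

_+ₚ_ : Poly → Poly → Poly
[]      +ₚ g       = g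
(c ∷ f) +ₚ []      = c ∷ f
(c ∷ f) +ₚ (d ∷ g) = (c ℤ.+ d) ∷ (f +ₚ g)

scale : ℤ → Poly → Poly
scale c = map (c ℤ.*_)

_*ₚ_ : Poly → Poly → Poly
[]      *ₚ g = []
(c ∷ f) *ₚ g = scale c g +ₚ (0ℤ ∷ (f *ₚ g))

constₚ : ℤ → Poly
constₚ c = c ∷ []

monomial : ℕ → Poly
monomial zero    = 1ℤ ∷ []
monomial (suc e) = 0ℤ ∷ monomial e

xpowMinus1 : ℕ → Poly
xpowMinus1 e = monomial e +ₚ constₚ (- 1ℤ)

substPow : ℕ → Poly → Poly
substPow r []      = []
substPow r (c ∷ f) = constₚ c +ₚ (monomial r *ₚ substPow r f)

prodDiv : (ℕ → Poly) → ℕ → Poly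
prodDiv Φ e = foldr (λ c acc → Φ c *ₚ acc) (constₚ 1ℤ)
                    (filter (λ c → c ∣? e) (map suc (upTo e)))

-- Φ is the family of cyclotomic polynomials:  x^e - 1 = ∏_{c ∣ e} Φ_c  for all e ≥ 1
-- (this determines Φ_e uniquely for every e ≥ 1, since ℤ[x] is a domain)
IsCyclotomicFamily : (ℕ → Poly) → Set
IsCyclotomicFamily Φ = ∀ e → 1 ℕ.≤ e → xpowMinus1 e ≈ₚ prodDiv Φ e

record IsPrimeIdeal (P : Poly → Set) : Set where
  field
    resp   : ∀ {f g} → f ≈ₚ g → P f → P g
    zero∈  : P []
    +-closed : ∀ {f g} → P f → P g → P (f +ₚ g)
    *-closed : ∀ h {f} → P f → P (h *ₚ f)
    proper : ¬ P (constₚ 1ℤ)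
    prime  : ∀ f g → P (f *ₚ g) → P f ⊎ P g

-- σ_t fixes every prime ideal of ℤ[ζ_m] dividing k.
-- Prime ideals of ℤ[ζ_m] ≅ ℤ[x]/(Φ_m) are the prime ideals P of ℤ[x] containing Φ_m;
-- such an ideal divides k iff it contains k; σ_t acts by x ↦ x^r for any r ≥ 0 with r ≡ t (mod m).
-- σ_t(P̄) = P̄  ⇔  ∀ f, f ∈ P ⇔ f(x^r) ∈ P.
FixesPrimesAbove : ℕ → ℤ → ℕ → Set₁
FixesPrimesAbove m t k =
  ∀ (Φ : ℕ → Poly) → IsCyclotomicFamily Φ →
  ∀ (P : Poly → Set) → IsPrimeIdeal P → P (Φ m) → P (constₚ (+ k)) →
  ∀ (r : ℕ) → (+ r) ≡ᵐ t [mod m ] →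
  ∀ f → P f ⇔ P (substPow r f)

record FinAbGroup (v : ℕ) : Set where
  field
    _∙_   : Fin v → Fin v → Fin v
    e     : Fin v
    inv   : Fin v → Fin v
    assoc : ∀ x y z → (x ∙ y) ∙ z ≡ x ∙ (y ∙ z)
    comm  : ∀ x y → x ∙ y ≡ y ∙ x
    idˡ   : ∀ x → e ∙ x ≡ x
    invˡ  : ∀ x → inv x ∙ x ≡ e

  pow : Fin v → ℕ → Fin v
  pow g zero    = e
  pow g (suc n) = g ∙ pow g n

IsExponent : ∀ {v} → FinAbGroup v → ℕ → Set
IsExponent G m = 1 ℕ.≤ m × (∀ g → pow g m ≡ e) ×
  (∀ m′ → 1 ℕ.≤ m′ → (∀ g → pow g m′ ≡ e) → m ℕ.≤ m′)
  where open FinAbGroup G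

sumℤ : ∀ {v} → (Fin v → ℤ) → ℤ
sumℤ {v} f = foldr (λ g acc → f g ℤ.+ acc) 0ℤ (allFin v)

-- D = Σ_g D(g) g ∈ ℤ[G] is an IW_a(v, n):  all |D(g)| ≤ a and D D^(-1) = n.
-- The coefficient of h in D D^(-1) is Σ_g D(g) D(h⁻¹ g).
IsIW : ∀ {v} → FinAbGroup v → ℕ → ℕ → (Fin v → ℤ) → Set
IsIW {v} G a n D =
  (∀ g → ℤ.∣ D g ∣ ℕ.≤ a) ×
  (∀ h → sumℤ (λ g → D g ℤ.* D (inv h ∙ g)) ≡ (if⁇ h))
  where
    open FinAbGroup G
    open import Data.Fin.Properties using () renaming (_≟_ to _≟F_)
    open import Relation.Nullary using (yes; no)
    if⁇ : Fin v → ℤ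
    if⁇ h with h ≟F e
    ... | yes _ = + n
    ... | no  _ = 0ℤ

{-# OPTIONS --safe #-}

-- Let U be the subgroup of order u, θ_q an element of order q in U, and X the product of 1 - θ_q over the primes q dividing u;
-- multiplication by X discards the characters of G that are not faithful on the θ_q.  With r ≡ t, the automorphism σ : g ↦ gʳ acts
-- modulo every prime above k as a power of the Frobenius automorphism, and hence σ(D) D* X is divisible by k².  The quotient Y
-- satisfies Y Y* = X X*, and an element of this least possible norm that is killed by the 1 + θ_q + … + θ_q^(q-1) is supported on
-- one coset of U, whence σ(D X) = g D X for some g ∈ G.  After a translation of D, the element D X is fixed by σ.
--
-- Outside U a suitable power of σ has orbits of length w.  So the image of D X in ℤ[U] is congruent modulo w to the restriction of
-- D X to U, whose coefficients are at most 2^δ(u) a.  If k is self-conjugate modulo u, the image of D is k times a unit, the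
-- coefficients of its product with X are 0 and ± k, and the bounds on k contradict the congruence.  Otherwise comparing ℓ²-norms
-- turns the congruence into an equality, and the bound on k contradicts the comparison of the Hermitian forms of D and of its image.

module Submission where

open import Algebra.Bundles using (CommutativeRing)
open import Data.Empty using (⊥)
open import Data.Fin.Base as Fin using (Fin; toℕ; fromℕ<)
open import Data.Integer.Base as ℤ using (ℤ; -[1+_]; 0ℤ; 1ℤ)
open import Data.List.Base using (List; []; _∷_; length; map)
open import Data.List.Membership.Propositional using (_∈_)
open import Data.List.Relation.Unary.All as All using (All)
open import Data.List.Relation.Unary.AllPairs using (AllPairs)
open import Data.List.Relation.Unary.Any as Any using (here; there)
open import Data.Nat.Base as ℕ using (ℕ; zero; suc)
open import Data.Nat.Coprimality as Coprimality using (Coprime; prime⇒coprime; coprime-divisor; coprime-Bézout)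
open import Data.Nat.Divisibility as ℕ∣ using (_∣_; divides; ∣-trans; ∣-refl; n∣m*n; m∣m*n)
open import Data.Nat.GCD using (gcd; gcd[m,n]∣m; gcd[m,n]∣n; gcd-GCD)
open import Data.Nat.ListAction using (product)
open import Data.Nat.Primality using (Prime; prime?; prime⇒nonZero; prime⇒nonTrivial; prime⇒irreducible; euclidsLemma; ¬prime[1])
open import Data.Product.Base using (Σ; ∃; _,_; _×_; proj₁; proj₂)
open import Data.Sum.Base using (inj₁; inj₂; _⊎_)
open import Defs using (FinAbGroup)
open import Function.Bundles using (Equivalence)
open import Level using (0ℓ)
open import Relation.Binary.Definitions using (tri<; tri≈; tri>)
open import Relation.Binary.PropositionalEquality as ≡ using (_≡_; _≢_; cong; cong₂)
open import Relation.Nullary using (¬_; Dec; yes; no; contradiction; ¬?)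
open import Relation.Nullary.Decidable as Dec using (_×-dec_; decidable-stable)
import Data.Fin.Properties as Finₚ
import Data.Integer.Properties as ℤₚ
import Data.List.Membership.Propositional.Properties as Membershipₚ
import Data.List.Properties as Listₚ
import Data.List.Relation.Unary.All.Properties as Allₚ
import Data.List.Relation.Unary.AllPairs.Properties as AllPairsₚ
import Data.List.Relation.Unary.Unique.Propositional.Properties as Uniqueₚ
import Data.Nat.Properties as ℕₚ

-- Neither characters nor rings of integers occur: the work is done in ℤ[G] and, in place of
-- cyclotomic fields, in quotients of ℤ[G] by an annihilator of X. The primes ℓ dividing u force
-- this: in ℤ[G] the natural parameter ζ - 1, for ζ in U of ℓ-power order, is a zero divisor, while
-- modulo the annihilator of X the element ζ satisfies its cyclotomic equation and ζ - 1 becomes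
-- regular.
--
-- Divisibility of z = σ(D) D* by k² is read off from norms instead of ideal factorisations. The
-- product of the σ-conjugates of z telescopes to a power of k², and modulo a parameter at ℓ this
-- product is a power of z itself, so parameters can be divided out of z one at a time.
--
-- The hypothesis on prime ideals concerns ideals of ℤ[x] that contain a cyclotomic polynomial. To
-- use it, a cyclotomic family is constructed, and for every prime ℓ dividing k a prime ideal of
-- ℤ[G] above ℓ is found by a finite search and pulled back to ℤ[x]. That it is fixed yields r ≡ ℓ^j
-- modulo the ℓ-free part of u p^d.

module Arith where

  open import Data.Nat.Base
  open import Data.Nat.Properties
  open import Data.Nat.Combinatorics using (_C_; nC1≡n; k>n⇒nCk≡0; nCk+nC[k+1]≡[n+1]C[k+1])
  open import Data.Nat.Divisibility
  open import Data.Nat.DivMod using (_/_; _%_; m/n*n≡m; m%n<n; m≡m%n+[m/n]*n)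
  open import Data.Nat.Primality.Factorisation using (factorise)
  open import Data.Nat.GCD using (module Bézout)
  open import Data.List.Base using (filter; upTo)
  open import Data.List.Relation.Unary.All using ([]; _∷_)
  open import Data.Nat.Induction using (Acc; acc; <-wellFounded)
  open import Relation.Binary.PropositionalEquality
  open import Defs using (_≡ᵐ_[mod_])

  -- Absorption gives k C(ℓ, k) = ℓ C(ℓ-1, k-1), and ℓ is coprime to k.
  prime∣C : ∀ {ℓ} → Prime ℓ → ∀ k → 0 < k → k < ℓ → ℓ ∣ ℓ C k
  prime∣C {ℓ} pr (suc k) _ k<ℓ = coprime-divisor (prime⇒coprime pr k<ℓ)
    (divides ((ℓ ∸ 1) C k) (trans (absorption ℓ k (≤-<-trans z≤n k<ℓ)) (*-comm ℓ _)))
    where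
    absorption : ∀ n k → 0 < n → suc k * (n C suc k) ≡ n * ((n ∸ 1) C k)
    absorption (suc n) k _ = go n k
      where
      open ≡-Reasoning
      go : ∀ n k → suc k * (suc n C suc k) ≡ suc n * (n C k)
      go n zero rewrite nC1≡n (suc n) = trans (+-identityʳ _) (sym (*-identityʳ _))
      go zero (suc k) rewrite k>n⇒nCk≡0 {1} {suc (suc k)} (s≤s (s≤s z≤n)) | k>n⇒nCk≡0 {0} {suc k} (s≤s z≤n) = *-zeroʳ k
      go (suc n) (suc k) = step
        where
        a = suc n C suc k
        b = suc n C suc (suc k)
        step : suc (suc k) * (suc (suc n) C suc (suc k)) ≡ suc (suc n) * (suc n C suc k)
        step = begin
          suc (suc k) * (suc (suc n) C suc (suc k))    ≡⟨ cong (suc (suc k) *_) (nCk+nC[k+1]≡[n+1]C[k+1] (suc n) (suc k)) ⟨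
          suc (suc k) * (a + b)                      ≡⟨ *-distribˡ-+ (suc (suc k)) a b ⟩
          (a + suc k * a) + suc (suc k) * b      ≡⟨ cong₂ (λ x y → (a + x) + y) (go n k) (go n (suc k)) ⟩
          (a + suc n * (n C k)) + suc n * (n C suc k)   ≡⟨ +-assoc a _ _ ⟩
          a + (suc n * (n C k) + suc n * (n C suc k))   ≡⟨ cong (a +_) (*-distribˡ-+ (suc n) (n C k) (n C suc k)) ⟨
          a + suc n * (n C k + n C suc k)          ≡⟨ cong (λ x → a + suc n * x) (nCk+nC[k+1]≡[n+1]C[k+1] n k) ⟩
          a + suc n * a                              ∎

  -- This is 1 + Q + ... + Q^(f-1), the exponent that a norm over f steps becomes when each step is
  -- the Q-th power map.
  geometric : ℕ → ℕ → ℕ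
  geometric Q zero    = 0
  geometric Q (suc f) = suc (Q * geometric Q f)

  -- Serves to make z^(Q^f) a multiple of z^(1 + Q + ... + Q^(f-1)) in `N≡0⇒≡0`.
  geometric<^ : ∀ {Q} → 2 ≤ Q → ∀ f → geometric Q f < Q ^ f
  geometric<^ 2≤Q zero    = s≤s z≤n
  geometric<^ {Q} 2≤Q (suc f) = begin-strict
    suc (Q * geometric Q f)  <⟨ +-monoˡ-≤ (Q * geometric Q f) 2≤Q ⟩
    Q + Q * geometric Q f    ≡⟨ *-suc Q (geometric Q f) ⟨
    Q * suc (geometric Q f)  ≤⟨ *-monoʳ-≤ Q (geometric<^ 2≤Q f) ⟩
    Q * Q ^ f                ∎
    where open ≤-Reasoning

  ∤⇒coprime : ∀ {q n} → Prime q → ¬ (q ∣ n) → Coprime q n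
  ∤⇒coprime pr q∤n (d∣q , d∣n) with prime⇒irreducible pr d∣q
  ... | inj₁ d≡1 = d≡1
  ... | inj₂ d≡q = contradiction (subst (_∣ _) d≡q d∣n) q∤n

  prime∣prime⇒≡ : ∀ {p q} → Prime p → Prime q → p ∣ q → p ≡ q
  prime∣prime⇒≡ pp pq p∣q with prime⇒irreducible pq p∣q
  ... | inj₁ p≡1 = contradiction (subst Prime p≡1 pp) ¬prime[1]
  ... | inj₂ p≡q = p≡q

  prime∤1 : ∀ {q} → Prime q → ¬ (q ∣ 1)
  prime∤1 pr q∣1 = contradiction (subst Prime (∣1⇒≡1 q∣1) pr) ¬prime[1]

  coprime-product : ∀ {q L} → Prime q → All Prime L → All (q ≢_) L → Coprime q (product L)
  coprime-product {q} pr = λ ps ds → ∤⇒coprime pr (go ps ds)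
    where
    go : ∀ {L} → All Prime L → All (q ≢_) L → ¬ (q ∣ product L)
    go []       []       q∣ = prime∤1 pr q∣
    go {p ∷ L} (pp ∷ ps) (d ∷ ds) q∣ with euclidsLemma p (product L) pr q∣
    ... | inj₁ q∣p = d (prime∣prime⇒≡ pr pp q∣p)
    ... | inj₂ q∣L = go ps ds q∣L

  inverse-mod : ∀ {m n} → Coprime m n → 1 ≤ m → ∃ λ h → ∃ λ l → m * h ≡ 1 + n * l
  inverse-mod {m} {n} c 1≤m with coprime-Bézout c
  ... | Bézout.+- x y eq = x , y , trans (*-comm m x) (trans (sym eq) (cong suc (*-comm y n)))
  inverse-mod {suc m} {n} c 1≤m | Bézout.-+ zero y eq = 1 , m , cong suc (trans (*-identityʳ m) (sym (trans (cong (_* m) n≡1) (+-identityʳ m))))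
    where
    n≡1 : n ≡ 1
    n≡1 = m*n≡1⇒n≡1 y n (sym eq)
  -- Bézout with this sign says m x ≡ -1, so the inverse is x · (x m): its product with m is (x m)²
  -- ≡ 1.
  inverse-mod {suc m} {n} c 1≤m | Bézout.-+ (suc x) y eq = suc x * a , (m + x * suc m) * y , (begin
      suc m * (suc x * a)                ≡⟨ *-assoc (suc m) (suc x) a ⟨
      suc m * suc x * a                  ≡⟨ cong (_* a) (*-comm (suc m) (suc x)) ⟩
      a * a                              ≡⟨ cong suc (lemma (m + x * suc m)) ⟩
      1 + (m + x * suc m) * suc a        ≡⟨ cong (λ z → 1 + (m + x * suc m) * z) (trans eq (*-comm y n)) ⟩
      1 + (m + x * suc m) * (n * y)      ≡⟨ cong suc (trans (cong ((m + x * suc m) *_) (*-comm n y)) (trans (sym (*-assoc (m + x * suc m) y n)) (*-comm _ n))) ⟩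
      1 + n * ((m + x * suc m) * y)      ∎)
    where
    open ≡-Reasoning
    a = suc x * suc m
    lemma : ∀ b → b + b * suc b ≡ b * suc (suc b)
    lemma b = sym (*-suc b (suc b))

  -- Enumerated as in δ, so that δ n is length (primes n) by definition

  primes : ℕ → List ℕ
  primes n = filter (λ ℓ → prime? ℓ ×-dec ℓ ∣? n) (upTo (suc n))

  primes-distinct : ∀ n → AllPairs _≢_ (primes n)
  primes-distinct n = Uniqueₚ.filter⁺ (λ ℓ → prime? ℓ ×-dec ℓ ∣? n) (Uniqueₚ.upTo⁺ (suc n))

  ∈primes⁻ : ∀ {n q} → q ∈ primes n → Prime q × q ∣ n
  ∈primes⁻ {n} q∈ = proj₂ (Membershipₚ.∈-filter⁻ (λ ℓ → prime? ℓ ×-dec ℓ ∣? n) {xs = upTo (suc n)} q∈)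

  ∈primes⁺ : ∀ {n q} → 1 ≤ n → Prime q → q ∣ n → q ∈ primes n
  ∈primes⁺ {n} 1≤n pr q∣n = Membershipₚ.∈-filter⁺ (λ ℓ → prime? ℓ ×-dec ℓ ∣? n) (Membershipₚ.∈-upTo⁺ (s≤s (∣⇒≤ {{>-nonZero 1≤n}} q∣n))) (pr , q∣n)

  primes-prime : ∀ n → All Prime (primes n)
  primes-prime n = All.tabulate (λ q∈ → proj₁ (∈primes⁻ {n} q∈))

  prime-factor : ∀ {n} → 2 ≤ n → ∃ λ q → Prime q × q ∣ n
  prime-factor {n@(suc _)} 2≤n with factorise n
  ... | record { factors = [] ; isFactorisation = eq } = contradiction (≤-trans 2≤n (≤-reflexive eq)) λ { (s≤s ()) }
  ... | record { factors = q ∷ qs ; isFactorisation = eq ; factorsPrime = pr ∷ _ } = q , pr , divides (product qs) (trans eq (*-comm q (product qs)))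

  infixl 7 _/₀_
  -- Total, so that exponents such as m / q can be written for every q without a `NonZero` instance;
  -- 0 is the default at q = 0.
  _/₀_ : ℕ → ℕ → ℕ
  m /₀ zero  = 0
  m /₀ suc q = m / suc q

  /₀-* : ∀ {m q} → Prime q → q ∣ m → q * (m /₀ q) ≡ m
  /₀-* {m} {suc q} pr q∣m = trans (*-comm (suc q) (m / suc q)) (m/n*n≡m q∣m)
  /₀-* {m} {zero}  pr q∣m = contradiction refl (≢-nonZero⁻¹ 0 {{prime⇒nonZero pr}})

  /₀-cancel : ∀ {q k} → Prime q → (q * k) /₀ q ≡ k
  /₀-cancel {q} {k} pr = *-cancelˡ-≡ _ k q {{prime⇒nonZero pr}} (/₀-* pr (m∣m*n k))

  coprime-^ : ∀ {ℓ n} → Coprime ℓ n → ∀ i → Coprime (ℓ ^ i) n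
  coprime-^ c zero    (d∣1 , _) = ∣1⇒≡1 d∣1
  coprime-^ {ℓ} {n} c (suc i) {d} (d∣ , d∣n) = coprime-^ c i (coprime-divisor (λ { {e} (e∣d , e∣ℓ) → c (e∣ℓ , ∣-trans e∣d d∣n) }) d∣ , d∣n)

  -- By the pigeonhole principle two of the n + 1 powers ℓ⁰, ..., ℓⁿ agree modulo n, and the smaller
  -- one cancels. The form `suc J` records that the period is positive.
  power-period : ∀ {ℓ n} → 1 ≤ ℓ → 1 ≤ n → Coprime ℓ n → ∃ λ J → n ∣ ℓ ^ suc J ∸ 1
  power-period {ℓ} {n} 1≤ℓ 1≤n c with Finₚ.pigeonhole (n<1+n n) (λ i → fromℕ< (m%n<n (ℓ ^ toℕ i) n {{>-nonZero 1≤n}}))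
  ... | i , j , i<j , eq = toℕ j ∸ suc (toℕ i) , coprime-divisor (Coprimality.sym (coprime-^ c (toℕ i))) (subst (n ∣_) difference
      (n∣difference (sym (trans (sym (Finₚ.toℕ-fromℕ< _)) (trans (cong toℕ eq) (Finₚ.toℕ-fromℕ< _))))))
    where
    instance _ = >-nonZero 1≤n
    K = toℕ j ∸ suc (toℕ i)
    exponent : toℕ j ≡ toℕ i + suc K
    exponent = trans (sym (m+[n∸m]≡n i<j)) (sym (+-suc (toℕ i) K))
    difference : ℓ ^ toℕ j ∸ ℓ ^ toℕ i ≡ ℓ ^ toℕ i * (ℓ ^ suc K ∸ 1)
    difference = trans (cong (λ k → ℓ ^ k ∸ ℓ ^ toℕ i) exponent) (trans (cong₂ _∸_ (^-distribˡ-+-* ℓ (toℕ i) (suc K)) (sym (*-identityʳ (ℓ ^ toℕ i))))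
      (sym (*-distribˡ-∸ (ℓ ^ toℕ i) (ℓ ^ suc K) 1)))
    n∣difference : ∀ {x y} → x % n ≡ y % n → n ∣ x ∸ y
    n∣difference {x} {y} eq = subst (n ∣_) (sym (trans (cong₂ _∸_ (m≡m%n+[m/n]*n x n) (m≡m%n+[m/n]*n y n)) (trans (cong (λ z → z + x / n * n ∸ (y % n + y / n * n)) eq)
      (trans ([m+n]∸[m+o]≡n∸o (y % n) _ _) (sym (*-distribʳ-∸ n (x / n) (y / n))))))) (n∣m*n (x / n ∸ y / n))

  infix 4 _≅_[_]
  -- Congruence without subtraction: exponents of group elements are natural numbers, and the two
  -- multiples of n can be fed to `pow` as they stand.
  record _≅_[_] (a b n : ℕ) : Set where
    constructor shifts
    field
      {left right} : ℕ
      equality     : a + left * n ≡ b + right * n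

  ≅-sym : ∀ {a b n} → a ≅ b [ n ] → b ≅ a [ n ]
  ≅-sym (shifts {i} {j} eq) = shifts {left = j} {right = i} (sym eq)

  ∣∸⇒≅ : ∀ {a b n} → a ≤ b → n ∣ b ∸ a → a ≅ b [ n ]
  ∣∸⇒≅ {a} {b} {n} a≤b (divides c eq) = shifts {left = c} {right = 0} (trans (cong (a +_) (sym eq)) (trans (m+[n∸m]≡n a≤b) (sym (+-identityʳ b))))

  ≡ᵐ⇒≅ : ∀ {a b n} → (ℤ.+ a) ≡ᵐ (ℤ.+ b) [mod n ] → a ≅ b [ n ]
  ≡ᵐ⇒≅ {a} {b} {n} n∣ with ≤-total a b
  ... | inj₁ a≤b = ∣∸⇒≅ a≤b (subst (n ∣_) (trans (cong ℤ.∣_∣ (ℤₚ.m-n≡m⊖n a b)) (trans (ℤₚ.∣m⊖n∣≡∣n⊖m∣ a b) (cong ℤ.∣_∣ (ℤₚ.⊖-≥ a≤b)))) n∣)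
  ... | inj₂ b≤a = ≅-sym (∣∸⇒≅ b≤a (subst (n ∣_) (cong ℤ.∣_∣ (trans (ℤₚ.m-n≡m⊖n a b) (ℤₚ.⊖-≥ b≤a))) n∣))

  prime∣^ : ∀ {q n} → Prime q → ∀ i → q ∣ n ^ i → q ∣ n
  prime∣^ pr zero    q∣ = contradiction q∣ (prime∤1 pr)
  prime∣^ {q} {n} pr (suc i) q∣ with euclidsLemma n (n ^ i) pr q∣
  ... | inj₁ q∣n = q∣n
  ... | inj₂ q∣^ = prime∣^ pr i q∣^

  prime-power-part : ∀ {q} → Prime q → ∀ n → 1 ≤ n → ∃ λ b → ∃ λ n′ → n ≡ q ^ b * n′ × ¬ (q ∣ n′)
  prime-power-part {q} pr n = go n (<-wellFounded n)
    where
    go : ∀ n → Acc _<_ n → 1 ≤ n → ∃ λ b → ∃ λ n′ → n ≡ q ^ b * n′ × ¬ (q ∣ n′)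
    go n (acc rec) 1≤n with q ∣? n
    ... | no  q∤n = 0 , n , sym (+-identityʳ n) , q∤n
    ... | yes (divides k n≡) with go k (rec k<n) 1≤k
      where
      1≤k : 1 ≤ k
      1≤k = n≢0⇒n>0 (λ k≡0 → <⇒≱ 1≤n (≤-reflexive (trans n≡ (cong (_* q) k≡0))))
      k<n : k < n
      k<n = subst (k <_) (sym n≡) (m<m*n k q {{>-nonZero 1≤k}} (nonTrivial⇒n>1 q {{prime⇒nonTrivial pr}}))
    ...   | b , n′ , k≡ , q∤n′ = suc b , n′ , trans n≡ (trans (*-comm k q) (trans (cong (q *_) k≡) (sym (*-assoc q (q ^ b) n′)))) , q∤n′

  least : ∀ {P : ℕ → Set} → (∀ n → Dec (P n)) → ∀ {n} → 1 ≤ n → P n →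
          ∃ λ r → 1 ≤ r × P r × (∀ s → 1 ≤ s → s < r → ¬ P s)
  least {P} P? {n} 1≤n p = go n (<-wellFounded n) 1≤n p
    where
    go : ∀ n → Acc _<_ n → 1 ≤ n → P n → ∃ λ r → 1 ≤ r × P r × (∀ s → 1 ≤ s → s < r → ¬ P s)
    go n (acc rec) 1≤n p with anyUpTo? (λ s → (1 ≤? s) ×-dec P? s) n
    ... | yes (s , s<n , 1≤s , q) = go s (rec s<n) 1≤s q
    ... | no  none = n , 1≤n , p , λ s 1≤s s<n q → none (s , s<n , 1≤s , q)

-- Commutative rings: the map from ℤ, a solver, congruences modulo an element, binomial congruences.

module RingKit (R : CommutativeRing 0ℓ 0ℓ) where

  open import Algebra.Bundles using (RawRing)
  open import Data.Nat.Combinatorics using (_C_; nC1≡n; nCn≡1)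
  open Arith using (prime∣C)
  import Algebra.Properties.CommutativeSemiring.Binomial as Binomial
  open import Data.Integer.Base using (+_; _⊖_)
  open import Data.Vec.Functional using (init; last)
  open import Data.Maybe.Base using (Maybe; just; nothing)
  open import Algebra.Solver.Ring.AlmostCommutativeRing using (fromCommutativeRing; _-Raw-AlmostCommutative⟶_)
  import Algebra.Solver.Ring

  open CommutativeRing R public hiding (zero)
  open import Algebra.Properties.Ring ring public using (-‿distribˡ-*; -‿distribʳ-*; -0#≈0#; -‿+-comm; -‿involutive)
  open import Algebra.Properties.Semiring.Mult.TCOptimised semiring using (×-homo-+; ×1-homo-*; 1+×; ×ᵤ≈×)
    renaming (_×_ to _·_) public
  open import Algebra.Properties.Semiring.Exp semiring public using (_^_; ^-congˡ; ^-homo-*; ^-assocʳ)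
  open import Algebra.Properties.CommutativeSemiring.Exp commutativeSemiring public using (^-distrib-*)
  open import Algebra.Properties.Semiring.Sum semiring public
    using (sum; sum-init-last; sum-cong-≋; *-distribˡ-sum)
  open import Relation.Binary.Reasoning.Setoid setoid

  -- The canonical homomorphism from ℤ. It is the coefficient map of `Solver`, which thereby handles
  -- signs and integer constants in any ring R.
  ι : ℤ → Carrier
  ι (+ n)    = n · 1#
  ι -[1+ n ] = - (suc n · 1#)

  private
    cancel-+ : ∀ a b c → (a + b) - (a + c) ≈ b - c
    cancel-+ a b c = begin
      (a + b) + - (a + c)      ≈⟨ +-congˡ (-‿+-comm a c) ⟨
      (a + b) + (- a + - c)    ≈⟨ +-congʳ (+-comm a b) ⟩
      (b + a) + (- a + - c)    ≈⟨ +-assoc b a _ ⟩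
      b + (a + (- a + - c))    ≈⟨ +-congˡ (+-assoc a (- a) (- c)) ⟨
      b + ((a + - a) + - c)    ≈⟨ +-congˡ (+-congʳ (-‿inverseʳ a)) ⟩
      b + (0# + - c)           ≈⟨ +-congˡ (+-identityˡ _) ⟩
      b + - c                  ∎

    ι-⊖ : ∀ m n → ι (m ⊖ n) ≈ m · 1# - n · 1#
    ι-⊖ zero    zero    = sym (-‿inverseʳ 0#)
    ι-⊖ zero    (suc n) = sym (+-identityˡ _)
    ι-⊖ (suc m) zero    = begin
      suc m · 1#          ≈⟨ +-identityʳ _ ⟨
      suc m · 1# + 0#     ≈⟨ +-congˡ -0#≈0# ⟨
      suc m · 1# - 0#     ∎
    ι-⊖ (suc m) (suc n) = begin
      ι (suc m ⊖ suc n)                 ≡⟨ ≡.cong ι (ℤₚ.[1+m]⊖[1+n]≡m⊖n m n) ⟩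
      ι (m ⊖ n)                         ≈⟨ ι-⊖ m n ⟩
      m · 1# - n · 1#                   ≈⟨ cancel-+ 1# _ _ ⟨
      (1# + m · 1#) - (1# + n · 1#)     ≈⟨ +-cong (1+× m 1#) (-‿cong (1+× n 1#)) ⟨
      suc m · 1# - suc n · 1#           ∎

  ι-+ : ∀ x y → ι (x ℤ.+ y) ≈ ι x + ι y
  ι-+ (+ m)    (+ n)    = ×-homo-+ 1# m n
  ι-+ (+ m)    -[1+ n ] = ι-⊖ m (suc n)
  ι-+ -[1+ m ] (+ n)    = trans (ι-⊖ n (suc m)) (+-comm _ _)
  ι-+ -[1+ m ] -[1+ n ] = begin
    - (suc (suc (m ℕ.+ n)) · 1#)      ≡⟨ ≡.cong (λ k → - (suc k · 1#)) (ℕₚ.+-suc m n) ⟨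
    - ((suc m ℕ.+ suc n) · 1#)        ≈⟨ -‿cong (×-homo-+ 1# (suc m) (suc n)) ⟩
    - (suc m · 1# + suc n · 1#)       ≈⟨ -‿+-comm _ _ ⟨
    - (suc m · 1#) - suc n · 1#       ∎

  ι-neg : ∀ x → ι (ℤ.- x) ≈ - ι x
  ι-neg (+ zero)  = sym -0#≈0#
  ι-neg (+ suc n) = refl
  ι-neg -[1+ n ]  = sym (-‿involutive _)

  private
    ι-*-+ : ∀ m y → ι (+ m ℤ.* y) ≈ ι (+ m) * ι y
    ι-*-+ m (+ n) = trans (reflexive (≡.cong ι (≡.sym (ℤₚ.pos-* m n)))) (×1-homo-* m n)
    ι-*-+ m -[1+ n ] = begin
      ι (+ m ℤ.* -[1+ n ])               ≡⟨ ≡.cong ι (ℤₚ.neg-distribʳ-* (+ m) (+ suc n)) ⟨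
      ι (ℤ.- (+ m ℤ.* + suc n))          ≈⟨ ι-neg (+ m ℤ.* + suc n) ⟩
      - ι (+ m ℤ.* + suc n)              ≈⟨ -‿cong (ι-*-+ m (+ suc n)) ⟩
      - (ι (+ m) * ι (+ suc n))          ≈⟨ -‿distribʳ-* _ _ ⟩
      ι (+ m) * ι -[1+ n ]               ∎

  ι-* : ∀ x y → ι (x ℤ.* y) ≈ ι x * ι y
  ι-* (+ m)    y = ι-*-+ m y
  ι-* -[1+ m ] y = begin
    ι (-[1+ m ] ℤ.* y)          ≡⟨ ≡.cong ι (ℤₚ.neg-distribˡ-* (+ suc m) y) ⟨
    ι (ℤ.- (+ suc m ℤ.* y))     ≈⟨ ι-neg (+ suc m ℤ.* y) ⟩
    - ι (+ suc m ℤ.* y)         ≈⟨ -‿cong (ι-*-+ (suc m) y) ⟩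
    - (ι (+ suc m) * ι y)       ≈⟨ -‿distribˡ-* _ _ ⟩
    ι -[1+ m ] * ι y            ∎

  ℤ-rawRing : RawRing 0ℓ 0ℓ
  ℤ-rawRing = CommutativeRing.rawRing ℤₚ.+-*-commutativeRing

  ι-homomorphism : ℤ-rawRing -Raw-AlmostCommutative⟶ fromCommutativeRing R
  ι-homomorphism = record
    { ⟦_⟧ = ι ; +-homo = ι-+ ; *-homo = ι-* ; -‿homo = ι-neg ; 0-homo = refl ; 1-homo = refl }

  private
    ι-≟ : ∀ x y → Maybe (ι x ≈ ι y)
    ι-≟ x y with x ℤₚ.≟ y
    ... | yes x≡y = just (reflexive (≡.cong ι x≡y))
    ... | no  _   = nothing

  module Solver = Algebra.Solver.Ring ℤ-rawRing (fromCommutativeRing R) ι-homomorphism ι-≟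
    using (solve; _:=_; _:+_; _:*_; _:-_; :-_; con; _:^_)
  open Solver

  1^n≈1 : ∀ n → 1# ^ n ≈ 1#
  1^n≈1 zero    = refl
  1^n≈1 (suc n) = trans (*-identityˡ _) (1^n≈1 n)

  infix 4 _∣∣_ _≡_[_]

  record _∣∣_ (a x : Carrier) : Set where
    constructor quot
    field
      quotient : Carrier
      equality : x ≈ a * quotient

  record _≡_[_] (x y a : Carrier) : Set where
    constructor diff
    field
      quotient : Carrier
      equality : x ≈ y + a * quotient

  ≡-refl : ∀ {a x y} → x ≈ y → x ≡ y [ a ]
  ≡-refl {a} x≈y = diff 0# (trans x≈y (sym (trans (+-congˡ (zeroʳ a)) (+-identityʳ _))))

  ≡-sym : ∀ {a x y} → x ≡ y [ a ] → y ≡ x [ a ]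
  ≡-sym {a} {x} {y} (diff q e) = diff (- q) (begin
    y                        ≈⟨ solve 3 (λ y a q → y := (y :+ a :* q) :+ a :* (:- q)) refl y a q ⟩
    (y + a * q) + a * - q    ≈⟨ +-congʳ e ⟨
    x + a * - q              ∎)

  ≡-trans : ∀ {a x y z} → x ≡ y [ a ] → y ≡ z [ a ] → x ≡ z [ a ]
  ≡-trans {a} {x} {y} {z} (diff q e) (diff r f) = diff (r + q) (begin
    x                        ≈⟨ trans e (+-congʳ f) ⟩
    (z + a * r) + a * q      ≈⟨ solve 4 (λ z a r q → (z :+ a :* r) :+ a :* q := z :+ a :* (r :+ q)) refl z a r q ⟩
    z + a * (r + q)          ∎)

  ≡-+ : ∀ {a x y z w} → x ≡ y [ a ] → z ≡ w [ a ] → x + z ≡ y + w [ a ]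
  ≡-+ {a} {x} {y} {z} {w} (diff q e) (diff r f) = diff (q + r) (begin
    x + z                        ≈⟨ +-cong e f ⟩
    (y + a * q) + (w + a * r)    ≈⟨ solve 5 (λ y w a r q → (y :+ a :* q) :+ (w :+ a :* r) := (y :+ w) :+ a :* (q :+ r)) refl y w a r q ⟩
    (y + w) + a * (q + r)        ∎)

  ≡-* : ∀ {a x y z w} → x ≡ y [ a ] → z ≡ w [ a ] → x * z ≡ y * w [ a ]
  ≡-* {a} {x} {y} {z} {w} (diff q e) (diff r f) = diff (y * r + q * w + a * q * r) (begin
    x * z                        ≈⟨ *-cong e f ⟩
    (y + a * q) * (w + a * r)    ≈⟨ solve 5 (λ y w a r q → (y :+ a :* q) :* (w :+ a :* r) := y :* w :+ a :* (y :* r :+ q :* w :+ a :* q :* r)) refl y w a r q ⟩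
    y * w + a * (y * r + q * w + a * q * r)        ∎)

  ≡-neg : ∀ {a x y} → x ≡ y [ a ] → - x ≡ - y [ a ]
  ≡-neg {a} {x} {y} (diff q e) = diff (- q) (trans (-‿cong e)
    (solve 3 (λ y a q → :- (y :+ a :* q) := :- y :+ a :* (:- q)) refl y a q))

  ≡-^ : ∀ {a x y} n → x ≡ y [ a ] → x ^ n ≡ y ^ n [ a ]
  ≡-^ zero    p = ≡-refl refl
  ≡-^ (suc n) p = ≡-* p (≡-^ n p)

  ≡-weaken : ∀ {a b x y} → a ∣∣ b → x ≡ y [ b ] → x ≡ y [ a ]
  ≡-weaken {a} {b} {x} {y} (quot c e) (diff q f) = diff (c * q) (trans f (+-congˡ (trans (*-congʳ e) (*-assoc a c q))))

  ∣⇒≡0 : ∀ {a x} → a ∣∣ x → x ≡ 0# [ a ]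
  ∣⇒≡0 (quot q e) = diff q (trans e (sym (+-identityˡ _)))

  ≡0⇒∣ : ∀ {a x} → x ≡ 0# [ a ] → a ∣∣ x
  ≡0⇒∣ (diff q e) = quot q (trans e (+-identityˡ _))

  ∣∣-trans : ∀ {a b c} → a ∣∣ b → b ∣∣ c → a ∣∣ c
  ∣∣-trans {a} (quot q e) (quot r f) = quot (q * r) (trans f (trans (*-congʳ e) (*-assoc a q r)))

  private
    module _ (n : ℕ) (x y : Carrier) where
      open Binomial commutativeSemiring using (binomialTerm; theorem)

      term : Fin (suc n) → Carrier
      term k = ι (+ (n C toℕ k)) * (x ^ toℕ k * y ^ (n ℕ.∸ toℕ k))

      binomialTerm≈term : ∀ k → binomialTerm x y n k ≈ term k
      binomialTerm≈term k = trans (×ᵤ≈× (n C toℕ k) b) (go (n C toℕ k))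
        where
        b = x ^ toℕ k * y ^ (n ℕ.∸ toℕ k)
        go : ∀ c → c · b ≈ (c · 1#) * b
        go zero    = sym (zeroˡ b)
        go (suc c) = begin
          suc c · b              ≈⟨ 1+× c b ⟩
          b + c · b              ≈⟨ +-cong (sym (*-identityˡ b)) (go c) ⟩
          1# * b + (c · 1#) * b  ≈⟨ distribʳ b 1# _ ⟨
          (1# + c · 1#) * b      ≈⟨ *-congʳ (1+× c 1#) ⟨
          (suc c · 1#) * b       ∎

      binomial-theorem : (x + y) ^ n ≈ sum term
      binomial-theorem = trans (theorem n x y) (sum-cong-≋ binomialTerm≈term)

    first-term : ∀ n x y → term n x y Fin.zero ≈ y ^ n
    first-term n x y = trans (*-identityˡ _) (*-identityˡ _)

    last-term : ∀ n x y → term n x y (Fin.fromℕ n) ≈ x ^ n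
    last-term n x y rewrite Finₚ.toℕ-fromℕ n | nCn≡1 n | ℕₚ.n∸n≡0 n = trans (*-identityˡ _) (*-identityʳ _)

    sum≡last : ∀ {a n} (t : Fin (suc n) → Carrier) →
               (∀ i → a ∣∣ t (Fin.inject₁ i)) → sum t ≡ t (Fin.fromℕ n) [ a ]
    sum≡last {a} {n} t p = ≡-trans (≡-refl (sum-init-last t)) (≡-trans
      (≡-+ (sum≡0 (init t) p) (≡-refl {y = last t} refl)) (≡-refl (+-identityˡ _)))
      where
      sum≡0 : ∀ {n} (f : Fin n → Carrier) → (∀ i → a ∣∣ f i) → sum f ≡ 0# [ a ]
      sum≡0 {zero}  f p = ≡-refl refl
      sum≡0 {suc n} f p = ≡-trans (≡-+ (∣⇒≡0 (p Fin.zero)) (sum≡0 (λ i → f (Fin.suc i)) (λ i → p (Fin.suc i))))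
        (≡-refl (+-identityˡ _))

    ι-divides : ∀ {m n} → m ∣ n → ι (+ m) ∣∣ ι (+ n)
    ι-divides {m} (divides q ≡.refl) = quot (ι (+ q)) (trans (reflexive (≡.cong (λ k → ι (+ k)) (ℕₚ.*-comm q m)))
      (trans (reflexive (≡.cong ι (ℤₚ.pos-* m q))) (ι-* (+ m) (+ q))))

  freshman : ∀ {ℓ} → Prime ℓ → ∀ x y → (x + y) ^ ℓ ≡ x ^ ℓ + y ^ ℓ [ ι (+ ℓ) ]
  freshman {suc (suc l)} pr x y = ≡-trans (≡-refl (binomial-theorem ℓ x y))
    (≡-trans (≡-+ (≡-refl (first-term ℓ x y)) (≡-trans (sum≡last (λ i → t (Fin.suc i)) small) (≡-refl (last-term ℓ x y))))
             (≡-refl (+-comm _ _)))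
    where
    ℓ = suc (suc l)
    t = term ℓ x y
    small : ∀ i → ι (+ ℓ) ∣∣ t (Fin.suc (Fin.inject₁ i))
    small i = ∣∣-trans (ι-divides (prime∣C pr (suc (toℕ (Fin.inject₁ i))) (ℕ.s≤s ℕ.z≤n)
        (ℕ.s≤s (≡.subst (ℕ._< suc l) (≡.sym (Finₚ.toℕ-inject₁ i)) (Finₚ.toℕ<n i)))))
      (quot _ refl)

  -- The terms of degree 2 to ℓ - 1 carry both ℓ and x². Keeping the linear term and the factor x²
  -- in the modulus allows a later division by x, which a congruence modulo ℓ alone would not.
  freshman² : ∀ {ℓ} → Prime ℓ → ∀ x →
              (1# + x) ^ ℓ ≡ 1# + ι (+ ℓ) * x + x ^ ℓ [ ι (+ ℓ) * (x * x) ]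
  freshman² {suc (suc l)} pr x = ≡-trans (≡-refl (trans (^-congˡ ℓ (+-comm 1# x)) (binomial-theorem ℓ x 1#)))
    (≡-trans (≡-+ (≡-refl (trans (first-term ℓ x 1#) (1^n≈1 ℓ)))
       (≡-+ (≡-refl second) (≡-trans (sum≡last (λ i → t (Fin.suc (Fin.suc i))) small) (≡-refl (last-term ℓ x 1#)))))
       (≡-refl (sym (+-assoc _ _ _))))
    where
    ℓ = suc (suc l)
    t = term ℓ x 1#
    second : t (Fin.suc Fin.zero) ≈ ι (+ ℓ) * x
    second = *-cong (reflexive (≡.cong (λ k → ι (+ k)) (nC1≡n ℓ)))
      (trans (*-cong (*-identityʳ x) (1^n≈1 (suc l))) (*-identityʳ x))
    small : ∀ i → ι (+ ℓ) * (x * x) ∣∣ t (Fin.suc (Fin.suc (Fin.inject₁ i)))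
    small i with ι-divides (prime∣C pr (suc (suc (toℕ (Fin.inject₁ i)))) (ℕ.s≤s ℕ.z≤n)
        (ℕ.s≤s (ℕ.s≤s (≡.subst (ℕ._< l) (≡.sym (Finₚ.toℕ-inject₁ i)) (Finₚ.toℕ<n i)))))
    ... | quot q e = quot (q * (z * w)) (trans (*-congʳ e)
        (solve 5 (λ p q x z w → (p :* q) :* ((x :* (x :* z)) :* w) := (p :* (x :* x)) :* (q :* (z :* w))) refl (ι (+ ℓ)) q x z w))
      where
      z = x ^ toℕ (Fin.inject₁ i)
      w = 1# ^ (l ℕ.∸ toℕ (Fin.inject₁ i))

  freshman-^ : ∀ {ℓ a} → Prime ℓ → a ∣∣ ι (+ ℓ) → ∀ j x y → (x + y) ^ (ℓ ℕ.^ j) ≡ x ^ (ℓ ℕ.^ j) + y ^ (ℓ ℕ.^ j) [ a ]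
  freshman-^ pr a∣ℓ zero    x y = ≡-refl (trans (*-identityʳ _) (sym (+-cong (*-identityʳ x) (*-identityʳ y))))
  freshman-^ {ℓ} pr a∣ℓ (suc j) x y = ≡-trans (≡-refl (shift (x + y))) (≡-trans (≡-^ ℓ (freshman-^ pr a∣ℓ j x y))
    (≡-trans (≡-weaken a∣ℓ (freshman pr (x ^ (ℓ ℕ.^ j)) (y ^ (ℓ ℕ.^ j)))) (≡-refl (sym (+-cong (shift x) (shift y))))))
    where
    shift : ∀ z → z ^ (ℓ ℕ.^ suc j) ≈ (z ^ (ℓ ℕ.^ j)) ^ ℓ
    shift z = trans (reflexive (≡.cong (z ^_) (ℕₚ.*-comm ℓ (ℓ ℕ.^ j)))) (sym (^-assocʳ z (ℓ ℕ.^ j) ℓ))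

-- Norms with respect to an endomorphism, and divisibility by primes deduced from norms.

module NormKit (R : CommutativeRing 0ℓ 0ℓ)
  (σ : CommutativeRing.Carrier R → CommutativeRing.Carrier R)
  (σ-cong : ∀ {x y} → CommutativeRing._≈_ R x y → CommutativeRing._≈_ R (σ x) (σ y))
  (σ-* : ∀ x y → CommutativeRing._≈_ R (σ (CommutativeRing._*_ R x y)) (CommutativeRing._*_ R (σ x) (σ y)))
  (σ-1 : CommutativeRing._≈_ R (σ (CommutativeRing.1# R)) (CommutativeRing.1# R))
  where


  open import Data.Integer.Base using (+_)
  open import Data.List.Relation.Unary.All using ([]; _∷_)

  open Arith using (geometric; geometric<^)
  open RingKit R
  open Solver
  open import Relation.Binary.Reasoning.Setoid setoid

  iter : ℕ → Carrier → Carrier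
  iter zero    x = x
  iter (suc f) x = σ (iter f x)

  -- The product of z, σ z, ..., σ^(f-1) z.
  N : ℕ → Carrier → Carrier
  N zero    z = 1#
  N (suc f) z = z * σ (N f z)

  N-cong : ∀ f {x y} → x ≈ y → N f x ≈ N f y
  N-cong zero    p = refl
  N-cong (suc f) p = *-cong p (σ-cong (N-cong f p))

  *-swap : ∀ a b c d → (a * b) * (c * d) ≈ (a * c) * (b * d)
  *-swap = solve 4 (λ a b c d → (a :* b) :* (c :* d) := (a :* c) :* (b :* d)) refl

  N-* : ∀ f x y → N f (x * y) ≈ N f x * N f y
  N-* zero    x y = sym (*-identityˡ 1#)
  N-* (suc f) x y = begin
    (x * y) * σ (N f (x * y))          ≈⟨ *-congˡ (trans (σ-cong (N-* f x y)) (σ-* _ _)) ⟩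
    (x * y) * (σ (N f x) * σ (N f y))  ≈⟨ *-swap x y _ _ ⟩
    (x * σ (N f x)) * (y * σ (N f y))  ∎

  N-1 : ∀ f → N f 1# ≈ 1#
  N-1 zero    = refl
  N-1 (suc f) = trans (*-identityˡ _) (trans (σ-cong (N-1 f)) σ-1)

  N-^ : ∀ f x n → N f (x ^ n) ≈ N f x ^ n
  N-^ f x zero    = N-1 f
  N-^ f x (suc n) = trans (N-* f x (x ^ n)) (*-congˡ (N-^ f x n))

  σ-^ : ∀ x n → σ (x ^ n) ≈ σ x ^ n
  σ-^ x zero    = σ-1
  σ-^ x (suc n) = trans (σ-* _ _) (*-congˡ (σ-^ x n))

  N-fixed : ∀ f {x} → σ x ≈ x → N f x ≈ x ^ f
  N-fixed zero    p = refl
  N-fixed (suc f) {x} p = *-congˡ (trans (σ-cong (N-fixed f p)) (trans (σ-^ x f) (^-congˡ f p)))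

  -- The factors are σⁱ⁺¹(x) σⁱ(y), and each σⁱ(y) meets the σⁱ(x) of its neighbour in σⁱ(x y) = n.
  -- When σ^f = 1 this computes the norm of σ(x) y although σ(x) y itself is unknown.
  N-telescope : ∀ f x y n → x * y ≈ n → σ n ≈ n → x * N f (σ x * y) ≈ n ^ f * iter f x
  N-telescope zero    x y n p q = *-comm x 1#
  N-telescope (suc f) x y n p q = begin
    x * ((σ x * y) * σ (N f z))      ≈⟨ solve 4 (λ x s y t → x :* ((s :* y) :* t) := (x :* y) :* (s :* t)) refl x (σ x) y _ ⟩
    (x * y) * (σ x * σ (N f z))      ≈⟨ *-cong p (sym (σ-* _ _)) ⟩
    n * σ (x * N f z)                ≈⟨ *-congˡ (trans (σ-cong (N-telescope f x y n p q)) (σ-* _ _)) ⟩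
    n * (σ (n ^ f) * iter (suc f) x) ≈⟨ *-congˡ (*-congʳ (trans (σ-^ n f) (^-congˡ f q))) ⟩
    n * (n ^ f * iter (suc f) x)     ≈⟨ *-assoc _ _ _ ⟨
    n ^ suc f * iter (suc f) x       ∎
    where z = σ x * y

  module Reduced (π : Carrier) (Q : ℕ) (2≤Q : 2 ℕ.≤ Q) (frobenius : ∀ x → σ x ≡ x ^ Q [ π ]) where

    iter-frobenius : ∀ f x → iter f x ≡ x ^ (Q ℕ.^ f) [ π ]
    iter-frobenius zero    x = ≡-refl (sym (*-identityʳ x))
    iter-frobenius (suc f) x = ≡-trans (frobenius _) (≡-trans (≡-^ Q (iter-frobenius f x))
      (≡-refl (trans (^-assocʳ x (Q ℕ.^ f) Q) (reflexive (≡.cong (x ^_) (ℕₚ.*-comm (Q ℕ.^ f) Q))))))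

    N-frobenius : ∀ f z → N f z ≡ z ^ geometric Q f [ π ]
    N-frobenius zero    z = ≡-refl refl
    N-frobenius (suc f) z = ≡-* (≡-refl refl) (≡-trans (frobenius _) (≡-trans (≡-^ Q (N-frobenius f z))
      (≡-refl (trans (^-assocʳ z (geometric Q f) Q) (reflexive (≡.cong (z ^_) (ℕₚ.*-comm (geometric Q f) Q)))))))

    -- Modulo π the norm is a power of z, and z is a higher power of itself.
    N≡0⇒≡0 : ∀ f {z} → iter f z ≈ z → N f z ≡ 0# [ π ] → z ≡ 0# [ π ]
    N≡0⇒≡0 f {z} fixed p = ≡-trans (≡-sym (≡-trans (≡-sym (iter-frobenius f z)) (≡-refl fixed)))
      (≡-trans (≡-refl (trans (reflexive (≡.cong (z ^_) (≡.sym (ℕₚ.m+[n∸m]≡n (ℕₚ.<⇒≤ (geometric<^ 2≤Q f))))))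
                              (^-homo-* z (geometric Q f) _)))
      (≡-trans (≡-* (≡-trans (≡-sym (N-frobenius f z)) p) (≡-refl refl)) (≡-refl (zeroˡ _))))

  cancel-^ : ∀ {a} → (∀ x → a * x ≈ 0# → x ≈ 0#) → ∀ n x → a ^ n * x ≈ 0# → x ≈ 0#
  cancel-^ nz zero    x p = trans (sym (*-identityˡ x)) p
  cancel-^ {a} nz (suc n) x p = cancel-^ nz n x (nz _ (trans (sym (*-assoc a (a ^ n) x)) p))

  cancel : ∀ {a} → (∀ x → a * x ≈ 0# → x ≈ 0#) → ∀ {x y} → a * x ≈ a * y → x ≈ y
  cancel {a} nz {x} {y} p = begin
    x              ≈⟨ solve 2 (λ x y → x := (x :- y) :+ y) refl x y ⟩
    (x - y) + y    ≈⟨ +-congʳ (nz (x - y) (begin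
      a * (x - y)    ≈⟨ solve 3 (λ a x y → a :* (x :- y) := a :* x :- a :* y) refl a x y ⟩
      a * x - a * y  ≈⟨ +-congʳ p ⟩
      a * y - a * y  ≈⟨ -‿inverseʳ _ ⟩
      0#             ∎)) ⟩
    0# + y         ≈⟨ +-identityˡ y ⟩
    y              ∎

  -- A local parameter at all primes above ℓ at once: π^E is ℓ times an element invertible modulo π,
  -- the norm of π is π^f up to a unit, and σ acts on R/π as the Q-th power map. R/π may have zero
  -- divisors, so no prime above ℓ has to be singled out.
  record Uniformizer (ℓ f : ℕ) : Set where
    field
      π g g′ ε ε′ : Carrier
      E Q         : ℕ
      2≤Q         : 2 ℕ.≤ Q
      frobenius   : ∀ x → σ x ≡ x ^ Q [ π ]
      regular     : ∀ x → π * x ≈ 0# → x ≈ 0#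
      ramified    : π ^ E ≈ ι (+ ℓ) * g
      g-unit      : g * g′ ≡ 1# [ π ]
      N-π         : N f π ≈ ε * π ^ f
      ε-unit      : ε * ε′ ≈ 1#

  module _ {ℓ f : ℕ} (1≤f : 1 ℕ.≤ f) (fixed : ∀ x → iter f x ≈ x) (U : Uniformizer ℓ f) where
    open Uniformizer U
    open Reduced π Q 2≤Q frobenius

    -- Suppose z = πⁱ w with i < E. Since ℓ^f is π^(E f) up to a factor invertible modulo π,
    -- cancelling π^(i f) from N z shows that π divides N w, hence w. After E such steps π^E, and
    -- with it ℓ, divides z.
    ∣N⇒∣ : ∀ z m → N f z ≈ ι (+ ℓ) ^ f * m → ι (+ ℓ) ∣∣ z
    ∣N⇒∣ z m Nz = finish (extract E ℕₚ.≤-refl)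
      where
      L = ι (+ ℓ)

      ∣^ : ∀ {a b} n → 1 ℕ.≤ n → a ∣∣ b → a ∣∣ b ^ n
      ∣^ (suc n) _ a∣b = ∣∣-trans a∣b (quot _ refl)

      step : ∀ i w → i ℕ.< E → z ≈ π ^ i * w → π ∣∣ w
      step i w i<E z≈ = ≡0⇒∣ (N≡0⇒≡0 f (fixed w) (≡-trans (≡-sym unit) small))
        where
        -- εⁱ πⁱᶠ N w = N z and gᶠ N z = πᴱᶠ m
        A = ε ^ i * (N f w * g ^ f)
        rest = E ℕ.∸ i
        eq : (π ^ f) ^ i * A ≈ (π ^ f) ^ i * ((π ^ f) ^ rest * m)
        eq = begin
          (π ^ f) ^ i * (ε ^ i * (N f w * g ^ f))  ≈⟨ solve 4 (λ a e n g → a :* (e :* (n :* g)) := ((e :* a) :* n) :* g) refl _ _ _ _ ⟩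
          ((ε ^ i * (π ^ f) ^ i) * N f w) * g ^ f  ≈⟨ *-congʳ (*-congʳ (trans (sym (^-distrib-* ε (π ^ f) i)) (sym (^-congˡ i N-π)))) ⟩
          (N f π ^ i * N f w) * g ^ f              ≈⟨ *-congʳ (trans (*-congʳ (sym (N-^ f π i))) (sym (N-* f _ _))) ⟩
          N f (π ^ i * w) * g ^ f                  ≈⟨ *-congʳ (trans (N-cong f (sym z≈)) Nz) ⟩
          (L ^ f * m) * g ^ f                      ≈⟨ solve 3 (λ l m g → (l :* m) :* g := (l :* g) :* m) refl _ _ _ ⟩
          (L ^ f * g ^ f) * m                      ≈⟨ *-congʳ (trans (sym (^-distrib-* L g f)) (^-congˡ f (sym ramified))) ⟩
          (π ^ E) ^ f * m                          ≈⟨ *-congʳ (trans (^-assocʳ π E f) (trans (reflexive (≡.cong (π ^_) (ℕₚ.*-comm E f))) (sym (^-assocʳ π f E)))) ⟩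
          (π ^ f) ^ E * m                          ≈⟨ *-congʳ (trans (reflexive (≡.cong ((π ^ f) ^_) (≡.sym (ℕₚ.m+[n∸m]≡n (ℕₚ.<⇒≤ i<E))))) (^-homo-* (π ^ f) i rest)) ⟩
          ((π ^ f) ^ i * (π ^ f) ^ rest) * m       ≈⟨ *-assoc _ _ _ ⟩
          (π ^ f) ^ i * ((π ^ f) ^ rest * m)       ∎
        A≈ : A ≈ (π ^ f) ^ rest * m
        A≈ = cancel (cancel-^ (cancel-^ regular f) i) eq
        -- Inverts the factor εⁱ gᶠ of A modulo π, leaving N f w.
        B = ε′ ^ i * g′ ^ f
        small : B * A ≡ 0# [ π ]
        small = ≡-trans (≡-* (≡-refl refl) (≡-trans (≡-refl A≈) (≡-* (∣⇒≡0 divides-power) (≡-refl refl))))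
                        (≡-refl (trans (*-congˡ (zeroˡ m)) (zeroʳ _)))
          where
          divides-power : π ∣∣ (π ^ f) ^ rest
          divides-power = ∣^ rest (ℕₚ.m<n⇒0<n∸m i<E) (∣^ f 1≤f (quot 1# (sym (*-identityʳ π))))
        unit : B * A ≡ N f w [ π ]
        unit = ≡-trans (≡-refl (begin
            (ε′ ^ i * g′ ^ f) * (ε ^ i * (N f w * g ^ f))  ≈⟨ solve 5 (λ a b c d n → (a :* b) :* (c :* (n :* d)) := ((c :* a) :* (d :* b)) :* n) refl _ _ _ _ _ ⟩
            ((ε ^ i * ε′ ^ i) * (g ^ f * g′ ^ f)) * N f w  ≈⟨ *-congʳ (*-cong (trans (sym (^-distrib-* ε ε′ i)) (trans (^-congˡ i ε-unit) (1^n≈1 i))) (sym (^-distrib-* g g′ f))) ⟩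
            (1# * (g * g′) ^ f) * N f w                    ≈⟨ *-congʳ (*-identityˡ _) ⟩
            (g * g′) ^ f * N f w                           ∎))
          (≡-trans (≡-* (≡-^ f g-unit) (≡-refl refl)) (≡-refl (trans (*-congʳ (1^n≈1 f)) (*-identityˡ _))))

      extract : ∀ i → i ℕ.≤ E → π ^ i ∣∣ z
      extract zero    _   = quot z (sym (*-identityˡ z))
      extract (suc i) i<E = divide (extract i (ℕₚ.<⇒≤ i<E))
        where
        divide : π ^ i ∣∣ z → π ^ suc i ∣∣ z
        divide (quot w z≈) = divide′ (step i w i<E z≈)
          where
          divide′ : π ∣∣ w → π ^ suc i ∣∣ z
          divide′ (quot w′ w≈) = quot w′ (begin
            z                  ≈⟨ trans z≈ (*-congˡ w≈) ⟩
            π ^ i * (π * w′)   ≈⟨ solve 3 (λ a b c → a :* (b :* c) := (b :* a) :* c) refl (π ^ i) π w′ ⟩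
            π ^ suc i * w′     ∎)

      finish : π ^ E ∣∣ z → L ∣∣ z
      finish (quot w z≈) = quot (g * w) (trans z≈ (trans (*-congʳ ramified) (*-assoc _ _ _)))

  module _ {f : ℕ} (1≤f : 1 ℕ.≤ f) (fixed : ∀ x → iter f x ≈ x) (σ-ι : ∀ n → σ (ι (+ n)) ≈ ι (+ n))
           (torsion-free : ∀ {ℓ} → Prime ℓ → ∀ x → ι (+ ℓ) * x ≈ 0# → x ≈ 0#) where

    -- Primes are divided out one by one, with multiplicity: once z = ℓ w, torsion-freeness cancels
    -- ℓ^f from the norm equation, and w satisfies the same equation for the remaining primes.
    N≈^⇒∣ : ∀ ps → All Prime ps → All (λ ℓ → Uniformizer ℓ f) ps →
            ∀ z → N f z ≈ ι (+ product ps) ^ f → ι (+ product ps) ∣∣ z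
    N≈^⇒∣ []       _          _        z _  = quot z (sym (*-identityˡ z))
    N≈^⇒∣ (ℓ ∷ ps) (pr ∷ prs) (U ∷ Us) z Nz = conclude (∣N⇒∣ 1≤f fixed U z (P ^ f) Nz′)
      where
      L = ι (+ ℓ)
      P = ι (+ product ps)
      split : ι (+ product (ℓ ∷ ps)) ≈ L * P
      split = trans (reflexive (≡.cong ι (ℤₚ.pos-* ℓ (product ps)))) (ι-* (+ ℓ) (+ product ps))
      Nz′ : N f z ≈ L ^ f * P ^ f
      Nz′ = trans Nz (trans (^-congˡ f split) (^-distrib-* L P f))
      conclude : L ∣∣ z → ι (+ product (ℓ ∷ ps)) ∣∣ z
      conclude (quot w z≈) = conclude′ (N≈^⇒∣ ps prs Us w (cancel (cancel-^ (torsion-free pr) f) (begin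
          L ^ f * N f w    ≈⟨ *-congʳ (N-fixed f (σ-ι ℓ)) ⟨
          N f L * N f w    ≈⟨ N-* f L w ⟨
          N f (L * w)      ≈⟨ N-cong f z≈ ⟨
          N f z            ≈⟨ Nz′ ⟩
          L ^ f * P ^ f    ∎)))
        where
        conclude′ : P ∣∣ w → ι (+ product (ℓ ∷ ps)) ∣∣ z
        conclude′ (quot w′ w≈) = quot w′ (trans z≈ (trans (*-congˡ w≈) (trans (sym (*-assoc _ _ _)) (*-congʳ (sym split)))))

-- Total ramification of ζ - 1 above ℓ for a root of unity ζ of ℓ-power order.

module Ramified (R : CommutativeRing 0ℓ 0ℓ) where

  open import Data.Integer.Base using (+_)

  open RingKit R
  open Solver
  open import Relation.Binary.Reasoning.Setoid setoid

  -- The sum 1 + x + ... + x^(n-1) in Horner form. It plays three roles: the quotient of xⁿ - 1 by x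
  -- - 1, the norm element of a cyclic group, and the polynomial Φ_ℓ.
  geo : Carrier → ℕ → Carrier
  geo x zero    = 0#
  geo x (suc n) = 1# + x * geo x n

  geo-* : ∀ x n → (x - 1#) * geo x n ≈ x ^ n - 1#
  geo-* x zero    = trans (zeroʳ _) (sym (-‿inverseʳ 1#))
  geo-* x (suc n) = begin
    (x - 1#) * (1# + x * geo x n)            ≈⟨ solve 2 (λ x g → (x :- con (+ 1)) :* (con (+ 1) :+ x :* g) := (x :- con (+ 1)) :+ x :* ((x :- con (+ 1)) :* g)) refl x (geo x n) ⟩
    (x - 1#) + x * ((x - 1#) * geo x n)      ≈⟨ +-congˡ (*-congˡ (geo-* x n)) ⟩
    (x - 1#) + x * (x ^ n - 1#)              ≈⟨ solve 2 (λ x y → (x :- con (+ 1)) :+ x :* (y :- con (+ 1)) := x :* y :- con (+ 1)) refl x (x ^ n) ⟩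
    x * x ^ n - 1#                           ∎

  ≡1 : ∀ x → x ≡ 1# [ x - 1# ]
  ≡1 x = diff 1# (solve 1 (λ x → x := con (+ 1) :+ (x :- con (+ 1)) :* con (+ 1)) refl x)

  ι-suc : ∀ n → ι (+ suc n) ≈ 1# + ι (+ n)
  ι-suc n = ι-+ (+ 1) (+ n)

  geo-≡ : ∀ {a} x n → x ≡ 1# [ a ] → geo x n ≡ ι (+ n) [ a ]
  geo-≡ x zero    p = ≡-refl refl
  geo-≡ x (suc n) p = ≡-trans (≡-+ (≡-refl refl) (≡-* p (geo-≡ x n p)))
    (≡-refl (trans (+-congˡ (*-identityˡ _)) (sym (ι-suc n))))

  *-monoˡ-∣ : ∀ c {a b} → a ∣∣ b → c * a ∣∣ c * b
  *-monoˡ-∣ c (quot q e) = quot q (trans (*-congˡ e) (sym (*-assoc _ _ _)))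

  module _ {ℓ : ℕ} (pr : Prime ℓ) (ζ : Carrier) where
    private
      L = ι (+ ℓ)
      π = ζ - 1#

    π∣ : ∀ n → π ∣∣ ζ ^ n - 1#
    π∣ n = quot (geo ζ n) (sym (geo-* ζ n))

    -- Modulo ℓπ, raising 1 + π to the ℓⁱ-th power is additive.
    tower : ∀ i → ζ ^ (ℓ ℕ.^ i) - 1# ≡ π ^ (ℓ ℕ.^ i) [ L * π ]
    tower zero    = ≡-refl (trans (+-congʳ (*-identityʳ ζ)) (sym (*-identityʳ π)))
    tower (suc i) = ≡-trans (≡-refl lhs) (≡-trans (≡-+ expansion (≡-refl refl))
        (≡-trans (≡-refl (solve 2 (λ a b → con (+ 1) :+ a :+ b :- con (+ 1) := a :+ b) refl (L * τ) (τ ^ ℓ)))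
        (≡-trans (≡-+ (∣⇒≡0 (*-monoˡ-∣ L (π∣ (ℓ ℕ.^ i)))) (≡-^ ℓ (tower i)))
        (≡-refl (trans (+-identityˡ _) (trans (^-assocʳ π (ℓ ℕ.^ i) ℓ) (reflexive (≡.cong (π ^_) (ℕₚ.*-comm (ℓ ℕ.^ i) ℓ)))))))))
      where
      τ = ζ ^ (ℓ ℕ.^ i) - 1#
      1+τ : ζ ^ (ℓ ℕ.^ i) ≈ 1# + τ
      1+τ = solve 1 (λ x → x := con (+ 1) :+ (x :- con (+ 1))) refl (ζ ^ (ℓ ℕ.^ i))
      lhs : ζ ^ (ℓ ℕ.^ suc i) - 1# ≈ (1# + τ) ^ ℓ - 1#
      lhs = +-congʳ (trans (reflexive (≡.cong (ζ ^_) (ℕₚ.*-comm ℓ (ℓ ℕ.^ i))))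
        (trans (sym (^-assocʳ ζ (ℓ ℕ.^ i) ℓ)) (^-congˡ ℓ 1+τ)))
      expansion : (1# + τ) ^ ℓ ≡ 1# + L * τ + τ ^ ℓ [ L * π ]
      expansion = ≡-weaken (*-monoˡ-∣ L (∣∣-trans (π∣ (ℓ ℕ.^ i)) (quot τ refl))) (freshman² pr τ)

    -- The hypothesis `cyclotomic` is the equation Φ(ζ) = 0 for the cyclotomic polynomial of index
    -- ℓ^(e+1), which is Φ_ℓ at the ℓ^e-th power.
    module _ (e : ℕ) (cyclotomic : geo (ζ ^ (ℓ ℕ.^ e)) ℓ ≈ 0#)
      (torsion-free : ∀ x → L * x ≈ 0# → x ≈ 0#) where

      private
        r = ℓ ℕ.^ e
        θ = ζ ^ r
        τ = θ - 1#

        -- Modulo θ - 1 the sum `geo θ ℓ` equals ℓ, and it vanishes.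
        τ∣L : τ ∣∣ L
        τ∣L = ≡0⇒∣ (≡-trans (≡-sym (geo-≡ θ ℓ (≡1 θ))) (≡-refl cyclotomic))

        regular-∣ : ∀ {a b} → a ∣∣ b → (∀ x → b * x ≈ 0# → x ≈ 0#) → ∀ x → a * x ≈ 0# → x ≈ 0#
        regular-∣ {a} {b} (quot q e) reg x p = reg x (begin
          b * x          ≈⟨ *-congʳ e ⟩
          (a * q) * x    ≈⟨ solve 3 (λ a q x → (a :* q) :* x := q :* (a :* x)) refl a q x ⟩
          q * (a * x)    ≈⟨ *-congˡ p ⟩
          q * 0#         ≈⟨ zeroʳ q ⟩
          0#             ∎)

        τ-regular : ∀ x → τ * x ≈ 0# → x ≈ 0#
        τ-regular = regular-∣ τ∣L torsion-free

      π∣ℓ : π ∣∣ L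
      π∣ℓ = ∣∣-trans (π∣ r) τ∣L

      π-regular : ∀ x → π * x ≈ 0# → x ≈ 0#
      π-regular = regular-∣ (π∣ r) τ-regular

      private
        θ^ℓ≈1 : θ ^ ℓ ≈ 1#
        θ^ℓ≈1 = begin
          θ ^ ℓ                   ≈⟨ solve 1 (λ x → x := (x :- con (+ 1)) :+ con (+ 1)) refl (θ ^ ℓ) ⟩
          (θ ^ ℓ - 1#) + 1#       ≈⟨ +-congʳ (geo-* θ ℓ) ⟨
          τ * geo θ ℓ + 1#        ≈⟨ +-congʳ (trans (*-congˡ cyclotomic) (zeroʳ τ)) ⟩
          0# + 1#                 ≈⟨ +-identityˡ 1# ⟩
          1#                      ∎

        -- Expanding (1 + τ)^ℓ = θ^ℓ = 1 by `freshman²` gives ℓ τ + τ^ℓ + ℓ τ² d = 0. As τ is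
        -- regular, one factor τ cancels.
        τ^[ℓ-1] : ∃ λ d → τ ^ ℕ.pred ℓ ≈ L * (- (1# + τ * d))
        τ^[ℓ-1] with freshman² pr τ
        ... | diff d e = d , solution
          where
          suc-pred : suc (ℕ.pred ℓ) ≡ ℓ
          suc-pred = ℕₚ.suc-pred ℓ {{prime⇒nonZero pr}}
          T = τ ^ ℕ.pred ℓ
          vanish : τ * (L + T + L * (τ * d)) ≈ 0#
          vanish = begin
            τ * (L + T + L * (τ * d))                                    ≈⟨ solve 4 (λ t l p d → t :* (l :+ p :+ l :* (t :* d)) := (con (+ 1) :+ l :* t :+ t :* p :+ (l :* (t :* t)) :* d) :- con (+ 1)) refl τ L T d ⟩
            (1# + L * τ + τ * T + (L * (τ * τ)) * d) - 1#                ≈⟨ +-congʳ (+-congʳ (+-congˡ (reflexive (≡.cong (τ ^_) suc-pred)))) ⟩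
            (1# + L * τ + τ ^ ℓ + (L * (τ * τ)) * d) - 1#                ≈⟨ +-congʳ e ⟨
            (1# + τ) ^ ℓ - 1#                                            ≈⟨ +-congʳ (^-congˡ ℓ (solve 1 (λ x → con (+ 1) :+ (x :- con (+ 1)) := x) refl θ)) ⟩
            θ ^ ℓ - 1#                                                   ≈⟨ +-congʳ θ^ℓ≈1 ⟩
            1# - 1#                                                      ≈⟨ -‿inverseʳ 1# ⟩
            0#                                                           ∎
          solution : T ≈ L * (- (1# + τ * d))
          solution = begin
            T                                                            ≈⟨ solve 4 (λ t l p d → p := (l :+ p :+ l :* (t :* d)) :+ l :* (:- (con (+ 1) :+ t :* d))) refl τ L T d ⟩
            (L + T + L * (τ * d)) + L * (- (1# + τ * d))                 ≈⟨ +-congʳ (τ-regular _ vanish) ⟩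
            0# + L * (- (1# + τ * d))                                    ≈⟨ +-identityˡ _ ⟩
            L * (- (1# + τ * d))                                         ∎

      -- By `tower`, π^r agrees with τ modulo ℓ π, so π^(r (ℓ-1)) agrees with τ^(ℓ-1) = -ℓ (1 + τ d)
      -- modulo ℓ π. Dividing by ℓ leaves a factor g ≡ -1 modulo π, which is its own inverse there.
      ramification : ∃ λ g → π ^ (r ℕ.* ℕ.pred ℓ) ≈ L * g × g * (- 1#) ≡ 1# [ π ]
      ramification = go τ^[ℓ-1] (≡-^ (ℕ.pred ℓ) (≡-sym (tower e)))
        where
        go : (∃ λ d → τ ^ ℕ.pred ℓ ≈ L * (- (1# + τ * d))) → (π ^ r) ^ ℕ.pred ℓ ≡ τ ^ ℕ.pred ℓ [ L * π ] → _
        go (d , eq) (diff c eq′) = (- (1# + τ * d)) + π * c , power , unit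
          where
          power : π ^ (r ℕ.* ℕ.pred ℓ) ≈ L * ((- (1# + τ * d)) + π * c)
          power = begin
            π ^ (r ℕ.* ℕ.pred ℓ)                   ≈⟨ ^-assocʳ π r (ℕ.pred ℓ) ⟨
            (π ^ r) ^ ℕ.pred ℓ                     ≈⟨ eq′ ⟩
            τ ^ ℕ.pred ℓ + (L * π) * c             ≈⟨ +-congʳ eq ⟩
            L * (- (1# + τ * d)) + (L * π) * c     ≈⟨ solve 4 (λ l x p c → l :* x :+ (l :* p) :* c := l :* (x :+ p :* c)) refl L (- (1# + τ * d)) π c ⟩
            L * ((- (1# + τ * d)) + π * c)         ∎
          unit : ((- (1# + τ * d)) + π * c) * (- 1#) ≡ 1# [ π ]
          unit = ≡-trans (≡-* (≡-+ (≡-neg (≡-+ (≡-refl refl) (∣⇒≡0 (∣∣-trans (π∣ r) (quot d refl))))) (∣⇒≡0 (quot c refl))) (≡-refl refl))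
            (≡-refl (solve 0 (((:- (con (+ 1) :+ con (+ 0))) :+ con (+ 0)) :* (:- con (+ 1)) := con (+ 1)) refl))

-- Residue domains of decidable prime ideals: roots of polynomials, the prime field, minimal
-- polynomials.

module PrimeIdeal (R : CommutativeRing 0ℓ 0ℓ) where

  open import Data.Integer.Base using (+_)

  open import Data.Nat.GCD using (module Bézout)
  open import Data.List.Base using (replicate; _++_; tabulate)
  open import Data.List.Relation.Unary.All using ([]; _∷_)
  open import Data.List.Relation.Unary.AllPairs using ([]; _∷_)
  open import Data.List.Relation.Binary.Pointwise.Base as Pointwise using (Pointwise; []; _∷_)

  open RingKit R
  open Solver
  open import Relation.Binary.Reasoning.Setoid setoid

  eval : List Carrier → Carrier → Carrier
  eval []      y = 0#
  eval (c ∷ f) y = c + y * eval f y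

  record IsDecPrimeIdeal (I : Carrier → Set) : Set where
    field
      resp   : ∀ {x y} → x ≈ y → I x → I y
      zero∈  : I 0#
      +∈     : ∀ {x y} → I x → I y → I (x + y)
      *∈     : ∀ x {y} → I y → I (x * y)
      proper : ¬ I 1#
      prime  : ∀ x y → I (x * y) → I x ⊎ I y
      _∈?    : ∀ x → Dec (I x)

  module _ {I : Carrier → Set} (isPrime : IsDecPrimeIdeal I) where
    open IsDecPrimeIdeal isPrime

    infix 4 _∼_
    record _∼_ (x y : Carrier) : Set where
      constructor mk
      field difference : I (x - y)
    open _∼_ public

    ∼-reflexive : ∀ {x y} → x ≈ y → x ∼ y
    ∼-reflexive {x} {y} p = mk (resp (sym (trans (+-congʳ p) (-‿inverseʳ y))) zero∈)

    ∼-sym : ∀ {x y} → x ∼ y → y ∼ x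
    ∼-sym {x} {y} (mk p) = mk (resp (solve 2 (λ x y → (:- con (+ 1)) :* (x :- y) := y :- x) refl x y) (*∈ (- 1#) p))

    ∼-trans : ∀ {x y z} → x ∼ y → y ∼ z → x ∼ z
    ∼-trans {x} {y} {z} (mk p) (mk q) = mk (resp (solve 3 (λ x y z → (x :- y) :+ (y :- z) := x :- z) refl x y z) (+∈ p q))

    ∼-+ : ∀ {x y z w} → x ∼ y → z ∼ w → x + z ∼ y + w
    ∼-+ {x} {y} {z} {w} (mk p) (mk q) = mk (resp (solve 4 (λ x y z w → (x :- y) :+ (z :- w) := (x :+ z) :- (y :+ w)) refl x y z w) (+∈ p q))

    ∼-* : ∀ {x y z w} → x ∼ y → z ∼ w → x * z ∼ y * w
    ∼-* {x} {y} {z} {w} (mk p) (mk q) = mk (resp (solve 4 (λ x y z w → z :* (x :- y) :+ y :* (z :- w) := (x :* z) :- (y :* w)) refl x y z w) (+∈ (*∈ z p) (*∈ y q)))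

    ∼-neg : ∀ {x y} → x ∼ y → - x ∼ - y
    ∼-neg {x} {y} (mk p) = mk (resp (solve 2 (λ x y → (:- con (+ 1)) :* (x :- y) := (:- x) :- (:- y)) refl x y) (*∈ (- 1#) p))

    ∼-^ : ∀ {x y} n → x ∼ y → x ^ n ∼ y ^ n
    ∼-^ zero    p = ∼-reflexive refl
    ∼-^ (suc n) p = ∼-* p (∼-^ n p)

    ∼⇒∈ : ∀ {x y} → x ∼ y → I y → I x
    ∼⇒∈ {x} {y} (mk p) q = resp (solve 2 (λ x y → (x :- y) :+ y := x) refl x y) (+∈ p q)

    ≡⇒∼ : ∀ {a x y} → I a → x ≡ y [ a ] → x ∼ y
    ≡⇒∼ {a} {x} {y} p (diff q e) = mk (resp (begin
      q * a             ≈⟨ solve 3 (λ q a y → q :* a := (y :+ a :* q) :- y) refl q a y ⟩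
      (y + a * q) - y   ≈⟨ +-congʳ e ⟨
      x - y             ∎) (*∈ q p))

    ^∈ : ∀ n {x} → I (x ^ n) → I x
    ^∈ zero    p = contradiction p proper
    ^∈ (suc n) {x} p with prime x (x ^ n) p
    ... | inj₁ q = q
    ... | inj₂ q = ^∈ n q

    private
      bézout∈ : ∀ x y a b → 1 ℕ.+ y ℕ.* b ≡ x ℕ.* a → I (ι (+ a)) → I (ι (+ b)) → I 1#
      bézout∈ x y a b eq pa pb = resp (begin
        ι (+ x) * ι (+ a) + (- ι (+ y)) * ι (+ b)         ≈⟨ +-congʳ (trans (sym (ι-* (+ x) (+ a))) (reflexive (≡.cong ι (≡.sym (ℤₚ.pos-* x a))))) ⟩
        ι (+ (x ℕ.* a)) + (- ι (+ y)) * ι (+ b)           ≡⟨ ≡.cong (λ n → ι (+ n) + (- ι (+ y)) * ι (+ b)) eq ⟨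
        ι (+ (1 ℕ.+ y ℕ.* b)) + (- ι (+ y)) * ι (+ b)     ≈⟨ +-congʳ (trans (ι-+ (+ 1) (+ (y ℕ.* b))) (+-congˡ (trans (reflexive (≡.cong ι (ℤₚ.pos-* y b))) (ι-* (+ y) (+ b))))) ⟩
        (1# + ι (+ y) * ι (+ b)) + (- ι (+ y)) * ι (+ b)  ≈⟨ solve 2 (λ y b → (con (+ 1) :+ y :* b) :+ (:- y) :* b := con (+ 1)) refl (ι (+ y)) (ι (+ b)) ⟩
        1#                                                ∎) (+∈ (*∈ (ι (+ x)) pa) (*∈ (- ι (+ y)) pb))

    coprime∈ : ∀ {a b} → Coprime a b → I (ι (+ a)) → ¬ I (ι (+ b))
    coprime∈ {a} {b} cop pa pb with coprime-Bézout cop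
    ... | Bézout.+- x y eq = proper (bézout∈ x y a b eq pa pb)
    ... | Bézout.-+ x y eq = proper (bézout∈ y x b a eq pb pa)

    -- Synthetic division by X - a: the coefficients of the quotient are the values at a of the
    -- successive tails.
    quo : Carrier → List Carrier → List Carrier
    quo a []          = []
    quo a (c ∷ [])    = []
    quo a (c ∷ d ∷ f) = eval (d ∷ f) a ∷ quo a (d ∷ f)

    length-quo : ∀ a c f → length (quo a (c ∷ f)) ≡ length f
    length-quo a c []      = ≡.refl
    length-quo a c (d ∷ f) = ≡.cong suc (length-quo a d f)

    eval-quo : ∀ a f y → eval f y ≈ (y - a) * eval (quo a f) y + eval f a
    eval-quo a []      y = solve 2 (λ y a → con (+ 0) := (y :- a) :* con (+ 0) :+ con (+ 0)) refl y a
    eval-quo a (c ∷ []) y = solve 3 (λ y a c → c :+ y :* con (+ 0) := (y :- a) :* con (+ 0) :+ (c :+ a :* con (+ 0))) refl y a c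
    eval-quo a (c ∷ d ∷ f) y = begin
      c + y * eval g y                             ≈⟨ +-congˡ (*-congˡ (eval-quo a (d ∷ f) y)) ⟩
      c + y * ((y - a) * Q + eval g a)             ≈⟨ solve 5 (λ c y a q e → c :+ y :* ((y :- a) :* q :+ e) := (y :- a) :* (e :+ y :* q) :+ (c :+ a :* e)) refl c y a Q (eval g a) ⟩
      (y - a) * (eval g a + y * Q) + (c + a * eval g a) ∎
      where
      g = d ∷ f
      Q = eval (quo a g) y

    All-quo : ∀ a f → I (eval f a) → All I (quo a f) → All I f
    All-quo a []          p _        = []
    All-quo a (c ∷ [])    p _        = resp (solve 2 (λ c a → c :+ a :* con (+ 0) := c) refl c a) p ∷ []
    All-quo a (c ∷ d ∷ f) p (q ∷ qs) =
      resp (solve 3 (λ c a e → (c :+ a :* e) :+ (:- a) :* e := c) refl c a (eval (d ∷ f) a)) (+∈ p (*∈ (- a) q))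
      ∷ All-quo a (d ∷ f) q qs

    -- A polynomial over a domain has at most as many roots as its degree. In terms of coefficient
    -- lists: one root per coefficient is one too many, so all coefficients vanish. Dividing by X -
    -- a keeps the other roots, since none of them is congruent to a.
    too-many-roots : ∀ as f → length as ≡ length f → AllPairs (λ a b → ¬ (b ∼ a)) as →
                     All (λ a → I (eval f a)) as → All I f
    too-many-roots []       []      _  _        _        = []
    too-many-roots (a ∷ as) (c ∷ f) eq (d ∷ ds) (p ∷ ps) = All-quo a (c ∷ f) p
      (too-many-roots as (quo a (c ∷ f)) (≡.trans (ℕₚ.suc-injective eq) (≡.sym (length-quo a c f))) ds
        (All.zipWith (λ { {b} (¬b∼a , pb) → root b ¬b∼a pb }) (d , ps)))
      where
      root : ∀ b → ¬ (b ∼ a) → I (eval (c ∷ f) b) → I (eval (quo a (c ∷ f)) b)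
      root b ¬b∼a pb with prime (b - a) (eval (quo a (c ∷ f)) b)
        (resp (trans (+-congʳ (eval-quo a (c ∷ f) b)) (solve 2 (λ x e → (x :+ e) :+ (:- con (+ 1)) :* e := x) refl ((b - a) * eval (quo a (c ∷ f)) b) (eval (c ∷ f) a)))
          (+∈ pb (*∈ (- 1#) p)))
      ... | inj₁ q = contradiction (mk q) ¬b∼a
      ... | inj₂ q = q

    module _ {ℓ : ℕ} (pr : Prime ℓ) (ℓ∈I : I (ι (+ ℓ))) where

      ∼-freshman : ∀ x y → (x + y) ^ ℓ ∼ x ^ ℓ + y ^ ℓ
      ∼-freshman x y = ≡⇒∼ ℓ∈I (freshman pr x y)

      0^ℓ : 0# ^ ℓ ≈ 0#
      0^ℓ = trans (reflexive (≡.cong (0# ^_) (≡.sym (ℕₚ.suc-pred ℓ {{prime⇒nonZero pr}})))) (zeroˡ _)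

      ∼-neg-^ : ∀ x → (- x) ^ ℓ ∼ - (x ^ ℓ)
      ∼-neg-^ x = ∼-trans (∼-reflexive (solve 2 (λ a b → a := (b :+ a) :- b) refl ((- x) ^ ℓ) (x ^ ℓ)))
        (∼-trans (∼-+ (∼-trans (∼-sym (∼-freshman x (- x))) (∼-reflexive (trans (^-congˡ ℓ (-‿inverseʳ x)) 0^ℓ))) (∼-reflexive refl))
        (∼-reflexive (+-identityˡ _)))

      fermat : ∀ c → ι (+ c) ^ ℓ ∼ ι (+ c)
      fermat zero    = ∼-reflexive 0^ℓ
      fermat (suc c) = ∼-trans (∼-reflexive (^-congˡ ℓ (ι-+ (+ 1) (+ c)))) (∼-trans (∼-freshman 1# (ι (+ c)))
        (∼-trans (∼-+ (∼-reflexive (1^n≈1 ℓ)) (fermat c)) (∼-reflexive (sym (ι-+ (+ 1) (+ c))))))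

      private
        apart : ∀ {i j} → i ℕ.< j → j ℕ.< ℓ → ¬ (ι (+ j) ∼ ι (+ i))
        apart {i} {j} i<j j<ℓ (mk p) = coprime∈ (prime⇒coprime pr {{ℕ.>-nonZero (ℕₚ.m<n⇒0<n∸m i<j)}} (ℕₚ.≤-<-trans (ℕₚ.m∸n≤m j i) j<ℓ)) ℓ∈I
          (resp (begin
            ι (+ j) - ι (+ i)       ≈⟨ +-congˡ (ι-neg (+ i)) ⟨
            ι (+ j) + ι (ℤ.- + i)   ≈⟨ ι-+ (+ j) (ℤ.- + i) ⟨
            ι (+ j ℤ.- + i)         ≡⟨ ≡.cong ι (≡.trans (ℤₚ.m-n≡m⊖n j i) (ℤₚ.⊖-≥ (ℕₚ.<⇒≤ i<j))) ⟩
            ι (+ (j ℕ.∸ i))         ∎) p)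

      ι-injective : ∀ {i j} → i ℕ.< ℓ → j ℕ.< ℓ → i ≢ j → ¬ (ι (+ i) ∼ ι (+ j))
      ι-injective {i} {j} i<ℓ j<ℓ i≢j i∼j with ℕₚ.<-cmp i j
      ... | tri< i<j _ _ = apart i<j j<ℓ (∼-sym i∼j)
      ... | tri≈ _ i≡j _ = i≢j i≡j
      ... | tri> _ _ j<i = apart j<i i<ℓ i∼j

      -- The residues 0, ..., ℓ - 1 are already ℓ roots of X^ℓ - X. If θ were congruent to none of
      -- them, there would be ℓ + 1 roots for ℓ + 1 coefficients, and the leading coefficient 1
      -- would lie in I.
      frobenius-fixed : ∀ θ → θ ^ ℓ ∼ θ → ∃ λ c → θ ∼ ι (+ c)
      frobenius-fixed θ θ^ℓ∼θ with Finₚ.any? (λ (i : Fin ℓ) → (θ - ι (+ toℕ i)) ∈?)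
      ... | yes (i , p) = toℕ i , mk p
      ... | no  none    = contradiction (leading coefficients∈I) proper
        where
        l = ℓ ℕ.∸ 2
        2+l≡ℓ : 2 ℕ.+ l ≡ ℓ
        2+l≡ℓ = ℕₚ.m+[n∸m]≡n (ℕ.nonTrivial⇒n>1 ℓ {{prime⇒nonTrivial pr}})
        X^ℓ-X = 0# ∷ (- 1#) ∷ replicate l 0# ++ 1# ∷ []

        eval-monomial : ∀ n y → eval (replicate n 0# ++ 1# ∷ []) y ≈ y ^ n
        eval-monomial zero    y = solve 1 (λ y → con (+ 1) :+ y :* con (+ 0) := con (+ 1)) refl y
        eval-monomial (suc n) y = trans (+-identityˡ _) (*-congˡ (eval-monomial n y))

        root : ∀ y → y ^ ℓ ∼ y → I (eval X^ℓ-X y)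
        root y (mk p) = resp (begin
          y ^ ℓ - y                                 ≡⟨ ≡.cong (λ n → y ^ n - y) 2+l≡ℓ ⟨
          y * (y * y ^ l) - y                       ≈⟨ solve 2 (λ y m → y :* (y :* m) :- y := con (+ 0) :+ y :* (:- con (+ 1) :+ y :* m)) refl y (y ^ l) ⟩
          0# + y * (- 1# + y * y ^ l)               ≈⟨ +-congˡ (*-congˡ (+-congˡ (*-congˡ (eval-monomial l y)))) ⟨
          eval X^ℓ-X y                              ∎) p

        residues = tabulate {n = ℓ} (λ i → ι (+ toℕ i))

        coefficients∈I : All I X^ℓ-X
        coefficients∈I = too-many-roots (θ ∷ residues) X^ℓ-X
          (≡.cong suc (≡.trans (Listₚ.length-tabulate _) (≡.trans (≡.sym 2+l≡ℓ) (≡.cong suc (≡.sym (≡.trans (Listₚ.length-++ (replicate l 0#))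
            (≡.trans (≡.cong (ℕ._+ 1) (Listₚ.length-replicate l)) (ℕₚ.+-comm l 1))))))))
          (Allₚ.tabulate⁺ (λ i p → none (i , difference (∼-sym p)))
            ∷ AllPairsₚ.tabulate⁺ (λ {i} {j} i≢j p → ι-injective (Finₚ.toℕ<n j) (Finₚ.toℕ<n i) (λ e → i≢j (≡.sym (Finₚ.toℕ-injective e))) p))
          (root θ θ^ℓ∼θ ∷ Allₚ.tabulate⁺ (λ i → root _ (fermat (toℕ i))))

        leading : All I X^ℓ-X → I 1#
        leading (_ ∷ _ ∷ ps) = All.head (Allₚ.++⁻ʳ (replicate l 0#) ps)

      -- (X - β) · f + p
      mulLin : Carrier → Carrier → List Carrier → List Carrier
      mulLin β p []      = p ∷ []
      mulLin β p (c ∷ f) = (p - β * c) ∷ mulLin β c f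

      eval-mulLin : ∀ β p f y → eval (mulLin β p f) y ≈ p + (y - β) * eval f y
      eval-mulLin β p []      y = solve 3 (λ b p y → p :+ y :* con (+ 0) := p :+ (y :- b) :* con (+ 0)) refl β p y
      eval-mulLin β p (c ∷ f) y = trans (+-congˡ (*-congˡ (eval-mulLin β c f y)))
        (solve 5 (λ b p c y e → (p :- b :* c) :+ y :* (c :+ (y :- b) :* e) := p :+ (y :- b) :* (c :+ y :* e)) refl β p c y (eval f y))

      infix 4 _≋_
      _≋_ : List Carrier → List Carrier → Set
      _≋_ = Pointwise _∼_

      ≋-refl : ∀ f → f ≋ f
      ≋-refl []      = []
      ≋-refl (c ∷ f) = ∼-reflexive refl ∷ ≋-refl f

      ≋-trans : ∀ {f g h} → f ≋ g → g ≋ h → f ≋ h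
      ≋-trans []       []       = []
      ≋-trans (p ∷ ps) (q ∷ qs) = ∼-trans p q ∷ ≋-trans ps qs

      ≋-sym : ∀ {f g} → f ≋ g → g ≋ f
      ≋-sym []       = []
      ≋-sym (p ∷ ps) = ∼-sym p ∷ ≋-sym ps

      mulLin-cong : ∀ {β γ p q f g} → β ∼ γ → p ∼ q → f ≋ g → mulLin β p f ≋ mulLin γ q g
      mulLin-cong b p []       = p ∷ []
      mulLin-cong b p (c ∷ cs) = ∼-+ p (∼-neg (∼-* b c)) ∷ mulLin-cong b c cs

      -- Linear factors commute. The two carries p and p′ are kept apart because the recursion
      -- reaches carries that depend on the order of the factors.
      mulLin-comm : ∀ β γ p p′ q f → p - β * q ≈ p′ - γ * q →
                    mulLin β p (mulLin γ q f) ≋ mulLin γ p′ (mulLin β q f)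
      mulLin-comm β γ p p′ q []      e = ∼-reflexive e ∷ ∼-reflexive refl ∷ []
      mulLin-comm β γ p p′ q (c ∷ f) e = ∼-reflexive (begin
          p - β * (q - γ * c)          ≈⟨ solve 5 (λ p b q g c → p :- b :* (q :- g :* c) := (p :- b :* q) :+ b :* g :* c) refl p β q γ c ⟩
          (p - β * q) + β * γ * c      ≈⟨ +-congʳ e ⟩
          (p′ - γ * q) + β * γ * c     ≈⟨ solve 5 (λ p b q g c → (p :- g :* q) :+ b :* g :* c := p :- g :* (q :- b :* c)) refl p′ β q γ c ⟩
          p′ - γ * (q - β * c)         ∎)
        ∷ mulLin-comm β γ (q - γ * c) (q - β * c) c f
            (solve 4 (λ q g b c → (q :- g :* c) :- b :* c := (q :- b :* c) :- g :* c) refl q γ β c)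

      Frob : List Carrier → List Carrier
      Frob = map (_^ ℓ)

      mulLin-Frob : ∀ β p f → Frob (mulLin β p f) ≋ mulLin (β ^ ℓ) (p ^ ℓ) (Frob f)
      mulLin-Frob β p []      = ∼-reflexive refl ∷ []
      mulLin-Frob β p (c ∷ f) = ∼-trans (∼-freshman p (- (β * c))) (∼-+ (∼-reflexive refl) (∼-trans (∼-neg-^ (β * c)) (∼-neg (∼-reflexive (^-distrib-* β c ℓ)))))
        ∷ mulLin-Frob β c f

      -- ∏_{i<n} (X - β i)
      fromRoots : (ℕ → Carrier) → ℕ → List Carrier
      fromRoots β zero    = 1# ∷ []
      fromRoots β (suc n) = mulLin (β 0) 0# (fromRoots (λ i → β (suc i)) n)

      -- Splits off the last root instead of the first, so that a cyclic rotation of the roots can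
      -- be undone.
      fromRoots-snoc : ∀ β n → fromRoots β (suc n) ≋ mulLin (β n) 0# (fromRoots β n)
      fromRoots-snoc β zero    = ≋-refl _
      fromRoots-snoc β (suc n) = ≋-trans (mulLin-cong (∼-reflexive refl) (∼-reflexive refl) (fromRoots-snoc (λ i → β (suc i)) n))
        (mulLin-comm (β 0) (β (suc n)) 0# 0# 0# _ (solve 2 (λ a b → con (+ 0) :- a :* con (+ 0) := con (+ 0) :- b :* con (+ 0)) refl (β 0) (β (suc n))))

      fromRoots-Frob : ∀ β n → Frob (fromRoots β n) ≋ fromRoots (λ i → β i ^ ℓ) n
      fromRoots-Frob β zero    = ∼-reflexive (1^n≈1 ℓ) ∷ []
      fromRoots-Frob β (suc n) = ≋-trans (mulLin-Frob (β 0) 0# (fromRoots (λ i → β (suc i)) n))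
        (mulLin-cong (∼-reflexive refl) (∼-reflexive 0^ℓ) (fromRoots-Frob (λ i → β (suc i)) n))

      fromRoots-cong : ∀ {β γ} n → (∀ i → β i ∼ γ i) → fromRoots β n ≋ fromRoots γ n
      fromRoots-cong zero    e = ≋-refl _
      fromRoots-cong (suc n) e = mulLin-cong (e 0) (∼-reflexive refl) (fromRoots-cong n (λ i → e (suc i)))

      root-of : ∀ β n y → I (eval (fromRoots β n) y) → ∃ λ i → y ∼ β i
      root-of β zero    y p = contradiction (resp (solve 1 (λ y → con (+ 1) :+ y :* con (+ 0) := con (+ 1)) refl y) p) proper
      root-of β (suc n) y p with prime (y - β 0) (eval tail y) (resp (trans (eval-mulLin (β 0) 0# tail y) (+-identityˡ _)) p)
        where tail = fromRoots (λ i → β (suc i)) n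
      ... | inj₁ q = 0 , mk q
      ... | inj₂ q with root-of (λ i → β (suc i)) n y q
      ...   | i , r = suc i , r

      eval-cong : ∀ {f g} y → f ≋ g → eval f y ∼ eval g y
      eval-cong y []       = ∼-reflexive refl
      eval-cong y (p ∷ ps) = ∼-+ p (∼-* (∼-reflexive refl) (eval-cong y ps))

      -- The product of X - α^(ℓⁱ) over a full Frobenius orbit has coefficients in the prime field.
      integral-minimal-polynomial : ∀ α J → α ^ (ℓ ℕ.^ suc J) ∼ α →
        Σ (List ℤ) λ cs → I (eval (map ι cs) α) × (∀ β → I (eval (map ι cs) β) → ∃ λ j → β ∼ α ^ (ℓ ℕ.^ j))
      integral-minimal-polynomial α J periodic = proj₁ lift , ∼⇒∈ (eval-cong α (≋-sym (proj₂ lift)))  α-root , (λ β p → root-of conj (suc J) β (∼⇒∈ (eval-cong β (proj₂ lift)) p))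
        where
        conj : ℕ → Carrier
        conj i = α ^ (ℓ ℕ.^ i)
        h = fromRoots conj (suc J)
        tail = fromRoots (λ i → conj (suc i)) J

        α-root : I (eval h α)
        α-root = resp (begin
          0#                                         ≈⟨ solve 2 (λ a e → con (+ 0) := con (+ 0) :+ (a :- a) :* e) refl α (eval tail α) ⟩
          0# + (α - α) * eval tail α                 ≈⟨ +-congˡ (*-congʳ (+-congˡ (-‿cong (*-identityʳ α)))) ⟨
          0# + (α - conj 0) * eval tail α            ≈⟨ eval-mulLin (conj 0) 0# tail α ⟨
          eval h α                                   ∎) zero∈

        conj-^ : ∀ i → conj i ^ ℓ ∼ conj (suc i)
        conj-^ i = ∼-reflexive (trans (^-assocʳ α (ℓ ℕ.^ i) ℓ) (reflexive (≡.cong (α ^_) (ℕₚ.*-comm (ℓ ℕ.^ i) ℓ))))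

        -- Raising coefficients to the ℓ-th power raises the roots to it, which rotates the orbit:
        -- the conjugate after the last one is α again. So every coefficient is fixed by the
        -- Frobenius map and hence is an integer modulo I.
        fixed : Frob h ≋ h
        fixed = ≋-trans (fromRoots-Frob conj (suc J)) (≋-trans (fromRoots-cong (suc J) conj-^)
          (≋-trans (fromRoots-snoc (λ i → conj (suc i)) J)
            (mulLin-cong (∼-trans periodic (∼-reflexive (sym (*-identityʳ α)))) (∼-reflexive refl) (≋-refl tail))))

        lift : Σ (List ℤ) λ cs → h ≋ map ι cs
        lift = go h fixed
          where
          go : ∀ f → Frob f ≋ f → Σ (List ℤ) λ cs → f ≋ map ι cs
          go []      []       = [] , []
          go (c ∷ f) (p ∷ ps) with frobenius-fixed c p | go f ps
          ... | n , q | ns , qs = + n ∷ ns , q ∷ qs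

-- Finite sums of integers and indicators.

module Sums where

  open import Data.Integer.Base hiding (suc)
  open import Data.Integer.Properties renaming (_≟_ to _≟ℤ_)
  open import Data.List.Base using (foldr; tabulate)
  open import Data.Empty using (⊥-elim)
  open import Relation.Binary.PropositionalEquality
  open import Algebra.Bundles using (CommutativeSemiring)
  import Algebra.Properties.Semiring.Sum (CommutativeSemiring.semiring +-*-commutativeSemiring) as Sum
  import Algebra.Properties.CommutativeMonoid.Sum +-0-commutativeMonoid as CommutativeSum

  open import Defs using (sumℤ)

  opaque

    -- Opaque: outside this block a sum is handled through the laws stated here and never unfolds
    -- inside a goal.
    sum : ∀ {n} → (Fin n → ℤ) → ℤ
    sum = Sum.sum

    sum-[] : ∀ (f : Fin zero → ℤ) → sum f ≡ 0ℤ
    sum-[] f = refl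

    sum-∷ : ∀ {n} (f : Fin (suc n) → ℤ) → sum f ≡ f Fin.zero + sum (λ i → f (Fin.suc i))
    sum-∷ f = refl

    sum-cong : ∀ {n} {f g : Fin n → ℤ} → (∀ i → f i ≡ g i) → sum f ≡ sum g
    sum-cong {n} = Sum.sum-cong-≗ {n}

    ∑-distrib-+ : ∀ {n} (f g : Fin n → ℤ) → sum (λ i → f i + g i) ≡ sum f + sum g
    ∑-distrib-+ = CommutativeSum.∑-distrib-+

    ∑-comm : ∀ {m n} (f : Fin m → Fin n → ℤ) → sum (λ i → sum (λ j → f i j)) ≡ sum (λ j → sum (λ i → f i j))
    ∑-comm = CommutativeSum.∑-comm

    sum-*ˡ : ∀ {n} c (f : Fin n → ℤ) → sum (λ i → c * f i) ≡ c * sum f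
    sum-*ˡ c f = sym (Sum.*-distribˡ-sum c f)

    sum-*ʳ : ∀ {n} c (f : Fin n → ℤ) → sum (λ i → f i * c) ≡ sum f * c
    sum-*ʳ c f = sym (Sum.*-distribʳ-sum c f)

    sum-zero : ∀ {n} (f : Fin n → ℤ) → (∀ i → f i ≡ 0ℤ) → sum f ≡ 0ℤ
    sum-zero {n} f p = trans (Sum.sum-cong-≗ {n} p) (Sum.sum-replicate-zero n)

    sumℤ≡sum : ∀ {v} (f : Fin v → ℤ) → sumℤ f ≡ sum f
    sumℤ≡sum {v} f = go v (λ i → i)
      where
      go : ∀ n (h : Fin n → Fin v) → foldr (λ g acc → f g + acc) 0ℤ (tabulate h) ≡ sum (λ i → f (h i))
      go zero    h = refl
      go (suc n) h = cong (_+_ (f (h Fin.zero))) (go n (λ i → h (Fin.suc i)))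

  sum-const : ∀ n c → sum {n} (λ _ → c) ≡ + n * c
  sum-const zero    c = trans (sum-[] _) (sym (*-zeroˡ c))
  sum-const (suc n) c = trans (sum-∷ {n} (λ _ → c)) (trans (cong (_+_ c) (sum-const n c)) (sym (suc-* (+ n) c)))

  sum-mono : ∀ {n} (f g : Fin n → ℤ) → (∀ i → f i ≤ g i) → sum f ≤ sum g
  sum-mono {zero}  f g p = ≤-reflexive (trans (sum-[] f) (sym (sum-[] g)))
  sum-mono {suc n} f g p = subst₂ _≤_ (sym (sum-∷ f)) (sym (sum-∷ g))
    (+-mono-≤ (p Fin.zero) (sum-mono (λ i → f (Fin.suc i)) (λ i → g (Fin.suc i)) (λ i → p (Fin.suc i))))

  sum-nonneg : ∀ {n} (f : Fin n → ℤ) → (∀ i → 0ℤ ≤ f i) → 0ℤ ≤ sum f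
  sum-nonneg {n} f p = subst (_≤ sum f) (sum-zero {n} (λ _ → 0ℤ) (λ _ → refl)) (sum-mono (λ _ → 0ℤ) f p)

  term≤sum : ∀ {n} (f : Fin n → ℤ) → (∀ i → 0ℤ ≤ f i) → ∀ i → f i ≤ sum f
  term≤sum {suc n} f p Fin.zero    = subst (f Fin.zero ≤_) (sym (sum-∷ f))
    (subst (_≤ f Fin.zero + sum (λ i → f (Fin.suc i))) (+-identityʳ _) (+-monoʳ-≤ (f Fin.zero) (sum-nonneg (λ i → f (Fin.suc i)) (λ i → p (Fin.suc i)))))
  term≤sum {suc n} f p (Fin.suc i) = subst (f (Fin.suc i) ≤_) (sym (sum-∷ f))
    (subst (_≤ f Fin.zero + sum (λ i → f (Fin.suc i))) (+-identityˡ _) (+-mono-≤ (p Fin.zero) (term≤sum (λ i → f (Fin.suc i)) (λ i → p (Fin.suc i)) i)))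

  -- The Iverson bracket. Counting and selecting arguments become identities between integer sums.
  ⟦_⟧ : ∀ {P : Set} → Dec P → ℤ
  ⟦ yes _ ⟧ = 1ℤ
  ⟦ no _  ⟧ = 0ℤ

  ⟦yes⟧ : ∀ {P : Set} (d : Dec P) → P → ⟦ d ⟧ ≡ 1ℤ
  ⟦yes⟧ (yes _) p = refl
  ⟦yes⟧ (no ¬p) p = contradiction p ¬p

  ⟦no⟧ : ∀ {P : Set} (d : Dec P) → ¬ P → ⟦ d ⟧ ≡ 0ℤ
  ⟦no⟧ (yes p) ¬p = contradiction p ¬p
  ⟦no⟧ (no _)  ¬p = refl

  ⟦⟧-cong : ∀ {P Q : Set} (d : Dec P) (e : Dec Q) → (P → Q) → (Q → P) → ⟦ d ⟧ ≡ ⟦ e ⟧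
  ⟦⟧-cong (yes p) e f g = sym (⟦yes⟧ e (f p))
  ⟦⟧-cong (no ¬p) e f g = sym (⟦no⟧ e (λ q → ¬p (g q)))

  ⟦⟧-nonneg : ∀ {P : Set} (d : Dec P) → 0ℤ ≤ ⟦ d ⟧
  ⟦⟧-nonneg (yes _) = +≤+ ℕ.z≤n
  ⟦⟧-nonneg (no _)  = +≤+ ℕ.z≤n

  infix 5 _≟_
  _≟_ : ∀ {n} (x y : Fin n) → Dec (x ≡ y)
  _≟_ = Finₚ._≟_

  sum-single : ∀ {n} (f : Fin n → ℤ) y → (∀ x → x ≢ y → f x ≡ 0ℤ) → sum f ≡ f y
  sum-single {suc n} f Fin.zero p = trans (sum-∷ f) (trans (cong (_+_ (f Fin.zero)) (sum-zero _ (λ i → p (Fin.suc i) λ ()))) (+-identityʳ _))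
  sum-single {suc n} f (Fin.suc y) p = trans (sum-∷ f) (trans (cong₂ _+_ (p Fin.zero λ ())
    (sum-single (λ i → f (Fin.suc i)) y (λ x x≢y → p (Fin.suc x) (λ e → x≢y (Finₚ.suc-injective e))))) (+-identityˡ _))

  sum-⟦≟⟧ : ∀ {n} (f : Fin n → ℤ) y → sum (λ x → f x * ⟦ x ≟ y ⟧) ≡ f y
  sum-⟦≟⟧ f y = trans (sum-single _ y (λ x x≢y → trans (cong (f x *_) (⟦no⟧ (x ≟ y) x≢y)) (*-zeroʳ (f x))))
    (trans (cong (f y *_) (⟦yes⟧ (y ≟ y) refl)) (*-identityʳ (f y)))

  -- Write f (φ x) as a sum over y against the indicator of y = φ x and exchange the sums: each y is
  -- met once, at x = ψ y.
  sum-reindex : ∀ {n} (φ ψ : Fin n → Fin n) → (∀ x → ψ (φ x) ≡ x) → (∀ x → φ (ψ x) ≡ x) →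
                ∀ f → sum (λ x → f (φ x)) ≡ sum f
  sum-reindex φ ψ ψφ φψ f = begin
    sum (λ x → f (φ x))                              ≡⟨ sum-cong (λ x → sum-⟦≟⟧ f (φ x)) ⟨
    sum (λ x → sum (λ y → f y * ⟦ y ≟ φ x ⟧))        ≡⟨ ∑-comm (λ x y → f y * ⟦ y ≟ φ x ⟧) ⟩
    sum (λ y → sum (λ x → f y * ⟦ y ≟ φ x ⟧))        ≡⟨ sum-cong (λ y → sum-*ˡ (f y) (λ x → ⟦ y ≟ φ x ⟧)) ⟩
    sum (λ y → f y * sum (λ x → ⟦ y ≟ φ x ⟧))        ≡⟨ sum-cong (λ y → cong (f y *_) (count y)) ⟩
    sum (λ y → f y * 1ℤ)                             ≡⟨ sum-cong (λ y → *-identityʳ (f y)) ⟩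
    sum f                                            ∎
    where
    open ≡-Reasoning
    count : ∀ y → sum (λ x → ⟦ y ≟ φ x ⟧) ≡ 1ℤ
    count y = trans (sum-single _ (ψ y) (λ x x≢ → ⟦no⟧ (y ≟ φ x) (λ y≡ → x≢ (trans (sym (ψφ x)) (cong ψ (sym y≡))))))
      (⟦yes⟧ (y ≟ φ (ψ y)) (sym (φψ y)))

  square : ∀ z → z * z ≡ + (∣ z ∣ ℕ.* ∣ z ∣)
  square (+ n)    = sym (pos-* n n)
  square -[1+ n ] = refl

  square-nonneg : ∀ z → 0ℤ ≤ z * z
  square-nonneg z = subst (0ℤ ≤_) (sym (square z)) (+≤+ ℕ.z≤n)

  nonzero? : ∀ (z : ℤ) → Dec (z ≢ 0ℤ)
  nonzero? z = ¬? (z ≟ℤ 0ℤ)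

  ⟦nonzero⟧≤square : ∀ z → ⟦ nonzero? z ⟧ ≤ z * z
  ⟦nonzero⟧≤square z with z ≟ℤ 0ℤ
  ... | yes _  = square-nonneg z
  ... | no z≢0 = subst (1ℤ ≤_) (sym (square z)) (+≤+ (ℕₚ.*-mono-≤ 1≤ 1≤))
    where
    1≤ : 1 ℕ.≤ ∣ z ∣
    1≤ = ℕₚ.n≢0⇒n>0 (λ p → z≢0 (∣i∣≡0⇒i≡0 p))

  *-nonneg : ∀ {a b} → 0ℤ ≤ a → 0ℤ ≤ b → 0ℤ ≤ a * b
  *-nonneg {a} {b} p q = subst (_≤ a * b) (*-zeroˡ b) (*-monoʳ-≤-nonNeg b {{nonNegative q}} p)

  ⟦⟧≤1 : ∀ {P : Set} (d : Dec P) → ⟦ d ⟧ ≤ 1ℤ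
  ⟦⟧≤1 (yes _) = ≤-refl
  ⟦⟧≤1 (no _)  = +≤+ ℕ.z≤n

  exclusive : ∀ {P Q S : Set} (p : Dec P) (q : Dec Q) (s : Dec S) → (P → S) → (Q → S) → (P → Q → ⊥) →
              ⟦ p ⟧ + ⟦ q ⟧ ≤ ⟦ s ⟧
  exclusive (yes p) (yes q) s P⇒S Q⇒S disjoint = ⊥-elim (disjoint p q)
  exclusive (yes p) (no _)  s P⇒S Q⇒S disjoint = ≤-reflexive (sym (⟦yes⟧ s (P⇒S p)))
  exclusive (no _)  (yes q) s P⇒S Q⇒S disjoint = ≤-reflexive (sym (⟦yes⟧ s (Q⇒S q)))
  exclusive (no _)  (no _)  s P⇒S Q⇒S disjoint = ⟦⟧-nonneg s

  square≤1 : ∀ z → z * z ≤ 1ℤ → ∣ z ∣ ℕ.≤ 1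
  square≤1 z p with ℕₚ.<-cmp ∣ z ∣ 2
  ... | tri< (ℕ.s≤s q) _ _ = q
  ... | tri≈ _ q _ = ⊥-elim (<⇒≱ (+<+ {1} {4} (ℕ.s≤s (ℕ.s≤s ℕ.z≤n))) (subst (_≤ 1ℤ) (trans (square z) (cong (λ n → + (n ℕ.* n)) q)) p))
  ... | tri> _ _ q = ⊥-elim (<⇒≱ (+<+ (ℕₚ.<-≤-trans (ℕ.s≤s (ℕ.s≤s ℕ.z≤n)) (ℕₚ.*-mono-≤ (ℕₚ.<⇒≤ q) (ℕₚ.<⇒≤ q)))) (subst (_≤ 1ℤ) (square z) p))

-- The commutative ring ℤ[x] of coefficient lists.

module Polys where

  open import Data.Integer.Base using (+_; _+_; _*_; -_)
  open import Data.Integer.Properties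
  open import Data.Integer.Tactic.RingSolver using (solve-∀)
  open import Relation.Binary.PropositionalEquality
  open import Defs using (Poly; coeff; _≈ₚ_; _+ₚ_; scale; _*ₚ_; constₚ)

  infix 4 _≈_
  record _≈_ (f g : Poly) : Set where
    constructor coefficientwise
    field at : f ≈ₚ g
  open _≈_ public

  coeff-+ : ∀ f g i → coeff (f +ₚ g) i ≡ coeff f i + coeff g i
  coeff-+ []      g       i       = sym (+-identityˡ _)
  coeff-+ (c ∷ f) []      i       = sym (+-identityʳ _)
  coeff-+ (c ∷ f) (d ∷ g) zero    = refl
  coeff-+ (c ∷ f) (d ∷ g) (suc i) = coeff-+ f g i

  coeff-scale : ∀ c f i → coeff (scale c f) i ≡ c * coeff f i
  coeff-scale c []      i       = sym (*-zeroʳ c)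
  coeff-scale c (d ∷ f) zero    = refl
  coeff-scale c (d ∷ f) (suc i) = coeff-scale c f i

  refl≈ : ∀ {f} → f ≈ f
  refl≈ = coefficientwise λ _ → refl

  sym≈ : ∀ {f g} → f ≈ g → g ≈ f
  sym≈ p = coefficientwise λ i → sym (at p i)

  trans≈ : ∀ {f g h} → f ≈ g → g ≈ h → f ≈ h
  trans≈ p q = coefficientwise λ i → trans (at p i) (at q i)

  +-cong : ∀ {f f′ g g′} → f ≈ f′ → g ≈ g′ → f +ₚ g ≈ f′ +ₚ g′
  +-cong {f} {f′} {g} {g′} p q = coefficientwise λ i →
    trans (coeff-+ f g i) (trans (cong₂ _+_ (at p i) (at q i)) (sym (coeff-+ f′ g′ i)))

  +-comm≈ : ∀ f g → f +ₚ g ≈ g +ₚ f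
  +-comm≈ f g = coefficientwise λ i → trans (coeff-+ f g i) (trans (+-comm (coeff f i) (coeff g i)) (sym (coeff-+ g f i)))

  +-assoc≈ : ∀ f g h → (f +ₚ g) +ₚ h ≈ f +ₚ (g +ₚ h)
  +-assoc≈ f g h = coefficientwise λ i → trans (coeff-+ (f +ₚ g) h i) (trans (cong (_+ coeff h i) (coeff-+ f g i))
    (trans (+-assoc (coeff f i) _ _) (sym (trans (coeff-+ f (g +ₚ h) i) (cong (ℤ._+_ (coeff f i)) (coeff-+ g h i))))))

  +-identityʳ≈ : ∀ f → f +ₚ [] ≈ f
  +-identityʳ≈ f = coefficientwise λ i → trans (coeff-+ f [] i) (+-identityʳ _)

  scale-cong : ∀ {c d f g} → c ≡ d → f ≈ g → scale c f ≈ scale d g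
  scale-cong {c} {d} {f} {g} p q = coefficientwise λ i → trans (coeff-scale c f i) (trans (cong₂ _*_ p (at q i)) (sym (coeff-scale d g i)))

  scale-+ : ∀ c f g → scale c (f +ₚ g) ≈ scale c f +ₚ scale c g
  scale-+ c f g = coefficientwise λ i → trans (coeff-scale c (f +ₚ g) i) (trans (cong (c *_) (coeff-+ f g i))
    (trans (*-distribˡ-+ c _ _) (sym (trans (coeff-+ (scale c f) (scale c g) i) (cong₂ _+_ (coeff-scale c f i) (coeff-scale c g i))))))

  +-scale : ∀ c d f → scale (c + d) f ≈ scale c f +ₚ scale d f
  +-scale c d f = coefficientwise λ i → trans (coeff-scale (c + d) f i)
    (trans (*-distribʳ-+ (coeff f i) c d) (sym (trans (coeff-+ (scale c f) (scale d f) i) (cong₂ _+_ (coeff-scale c f i) (coeff-scale d f i)))))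

  scale-scale : ∀ c d f → scale (c * d) f ≈ scale c (scale d f)
  scale-scale c d f = coefficientwise λ i → trans (coeff-scale (c * d) f i)
    (trans (*-assoc c d _) (sym (trans (coeff-scale c (scale d f) i) (cong (c *_) (coeff-scale d f i)))))

  scale-0 : ∀ f → scale 0ℤ f ≈ []
  scale-0 f = coefficientwise λ i → trans (coeff-scale 0ℤ f i) (*-zeroˡ (coeff f i))

  ∷-cong : ∀ {c d f g} → c ≡ d → f ≈ g → c ∷ f ≈ d ∷ g
  ∷-cong p q = coefficientwise λ { zero → p ; (suc i) → at q i }

  tail≈ : ∀ {c d f g} → c ∷ f ≈ d ∷ g → f ≈ g
  tail≈ p = coefficientwise λ i → at p (suc i)

  0∷[]≈[] : 0ℤ ∷ [] ≈ []
  0∷[]≈[] = coefficientwise λ { zero → refl ; (suc _) → refl }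

  *-zeroʳ≈ : ∀ f → f *ₚ [] ≈ []
  *-zeroʳ≈ []      = refl≈
  *-zeroʳ≈ (c ∷ f) = trans≈ (∷-cong refl (*-zeroʳ≈ f)) 0∷[]≈[]

  private
    ≈[]-* : ∀ f g → f ≈ [] → f *ₚ g ≈ []
    ≈[]-* []      g p = refl≈
    ≈[]-* (c ∷ f) g p = trans≈ (+-cong (trans≈ (scale-cong {c} {0ℤ} {g} (at p 0) refl≈) (scale-0 g))
      (∷-cong refl (≈[]-* f g (coefficientwise λ i → at p (suc i))))) 0∷[]≈[]

    *-congʳ≈ : ∀ f {g g′} → g ≈ g′ → f *ₚ g ≈ f *ₚ g′
    *-congʳ≈ []      p = refl≈
    *-congʳ≈ (c ∷ f) p = +-cong (scale-cong {c = c} refl p) (∷-cong refl (*-congʳ≈ f p))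

    *-congˡ≈ : ∀ f f′ g → f ≈ f′ → f *ₚ g ≈ f′ *ₚ g
    *-congˡ≈ []      f′       g p = sym≈ (≈[]-* f′ g (sym≈ p))
    *-congˡ≈ (c ∷ f) []       g p = ≈[]-* (c ∷ f) g p
    *-congˡ≈ (c ∷ f) (d ∷ f′) g p = +-cong (scale-cong {c} {d} {g} (at p 0) refl≈) (∷-cong refl (*-congˡ≈ f f′ g (tail≈ p)))

  *-cong≈ : ∀ {f f′ g g′} → f ≈ f′ → g ≈ g′ → f *ₚ g ≈ f′ *ₚ g′
  *-cong≈ {f} {f′} {g} {g′} p q = trans≈ (*-congˡ≈ f f′ g p) (*-congʳ≈ f′ q)

  +-interchange : ∀ f g h k → (f +ₚ g) +ₚ (h +ₚ k) ≈ (f +ₚ h) +ₚ (g +ₚ k)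
  +-interchange f g h k = coefficientwise λ i → trans (expand f g h k i) (trans (lemma (coeff f i) (coeff g i) (coeff h i) (coeff k i)) (sym (expand f h g k i)))
    where
    expand : ∀ f g h k i → coeff ((f +ₚ g) +ₚ (h +ₚ k)) i ≡ (coeff f i + coeff g i) + (coeff h i + coeff k i)
    expand f g h k i = trans (coeff-+ (f +ₚ g) (h +ₚ k) i) (cong₂ _+_ (coeff-+ f g i) (coeff-+ h k i))
    lemma : ∀ a b c d → (a + b) + (c + d) ≡ (a + c) + (b + d)
    lemma = solve-∀

  *-distribʳ≈ : ∀ h f g → (f +ₚ g) *ₚ h ≈ (f *ₚ h) +ₚ (g *ₚ h)
  *-distribʳ≈ h []      g       = refl≈
  *-distribʳ≈ h (c ∷ f) []      = sym≈ (+-identityʳ≈ _)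
  *-distribʳ≈ h (c ∷ f) (d ∷ g) = trans≈ (+-cong (+-scale c d h) (∷-cong refl (*-distribʳ≈ h f g)))
    (+-interchange (scale c h) (scale d h) (0ℤ ∷ (f *ₚ h)) (0ℤ ∷ (g *ₚ h)))

  *-∷ : ∀ f d g → f *ₚ (d ∷ g) ≈ scale d f +ₚ (0ℤ ∷ (f *ₚ g))
  *-∷ []      d g = sym≈ 0∷[]≈[]
  *-∷ (c ∷ f) d g = ∷-cong (cong (_+ 0ℤ) (*-comm c d)) (trans≈ (+-cong (refl≈ {scale c g}) (*-∷ f d g))
    (trans≈ (sym≈ (+-assoc≈ (scale c g) (scale d f) _)) (trans≈ (+-cong (+-comm≈ (scale c g) (scale d f)) refl≈) (+-assoc≈ (scale d f) (scale c g) _))))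

  *-comm≈ : ∀ f g → f *ₚ g ≈ g *ₚ f
  *-comm≈ []      g = sym≈ (*-zeroʳ≈ g)
  *-comm≈ (c ∷ f) g = trans≈ (+-cong (refl≈ {scale c g}) (∷-cong refl (*-comm≈ f g))) (sym≈ (*-∷ g c f))

  scale-* : ∀ c f g → scale c f *ₚ g ≈ scale c (f *ₚ g)
  scale-* c []      g = refl≈
  scale-* c (d ∷ f) g = trans≈ (+-cong (scale-scale c d g) (∷-cong (sym (*-zeroʳ c)) (scale-* c f g)))
    (sym≈ (scale-+ c (scale d g) (0ℤ ∷ (f *ₚ g))))

  0∷-* : ∀ f g → (0ℤ ∷ f) *ₚ g ≈ 0ℤ ∷ (f *ₚ g)
  0∷-* f g = +-cong {scale 0ℤ g} {[]} (scale-0 g) refl≈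

  *-assoc≈ : ∀ f g h → (f *ₚ g) *ₚ h ≈ f *ₚ (g *ₚ h)
  *-assoc≈ []      g h = refl≈
  *-assoc≈ (c ∷ f) g h = trans≈ (*-distribʳ≈ h (scale c g) (0ℤ ∷ (f *ₚ g)))
    (+-cong (scale-* c g h) (trans≈ (0∷-* (f *ₚ g) h) (∷-cong refl (*-assoc≈ f g h))))

  *-identityˡ≈ : ∀ f → constₚ 1ℤ *ₚ f ≈ f
  *-identityˡ≈ f = trans≈ (+-cong (coefficientwise λ i → trans (coeff-scale 1ℤ f i) (*-identityˡ _)) 0∷[]≈[]) (+-identityʳ≈ f)

  negₚ : Poly → Poly
  negₚ = scale (- 1ℤ)

  neg-inverse : ∀ f → negₚ f +ₚ f ≈ []
  neg-inverse f = coefficientwise λ i → trans (coeff-+ (negₚ f) f i) (trans (cong (_+ coeff f i) (coeff-scale (- 1ℤ) f i)) (lemma (coeff f i)))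
    where
    lemma : ∀ a → - 1ℤ * a + a ≡ 0ℤ
    lemma = solve-∀

  ℤ[x] : CommutativeRing 0ℓ 0ℓ
  ℤ[x] = record
    { Carrier = Poly
    ; _≈_ = _≈_
    ; _+_ = _+ₚ_
    ; _*_ = _*ₚ_
    ; -_ = negₚ
    ; 0# = []
    ; 1# = constₚ 1ℤ
    ; isCommutativeRing = record
      { isRing = record
        { +-isAbelianGroup = record
          { isGroup = record
            { isMonoid = record
              { isSemigroup = record
                { isMagma = record
                  { isEquivalence = record { refl = refl≈ ; sym = sym≈ ; trans = trans≈ }
                  ; ∙-cong = +-cong }
                ; assoc = +-assoc≈ }
              ; identity = (λ f → refl≈) , +-identityʳ≈ }
            ; inverse = neg-inverse , (λ f → trans≈ (+-comm≈ f (negₚ f)) (neg-inverse f))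
            ; ⁻¹-cong = scale-cong {c = - 1ℤ} refl }
          ; comm = +-comm≈ }
        ; *-cong = *-cong≈
        ; *-assoc = *-assoc≈
        ; *-identity = *-identityˡ≈ , (λ f → trans≈ (*-comm≈ f (constₚ 1ℤ)) (*-identityˡ≈ f))
        ; distrib = (λ h f g → trans≈ (*-comm≈ h (f +ₚ g)) (trans≈ (*-distribʳ≈ h f g) (+-cong (*-comm≈ f h) (*-comm≈ g h)))) , *-distribʳ≈ }
      ; *-comm = *-comm≈ } }

-- Existence of the cyclotomic polynomials.

module Cyclotomic where

  open import Data.Nat.Base using (_≤_; _<_; z≤n; s≤s)
  open import Data.Nat.Divisibility using (_∣?_; ∣⇒≤; *-cancelˡ-∣)
  open import Data.Nat.GCD using (module GCD)
  open import Data.Integer.Base using (+_; -1ℤ)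
  open import Data.Integer.Tactic.RingSolver using (solve-∀)
  open import Data.List.Base using (_++_; filter; foldr; upTo)
  open import Defs using (Poly; coeff; _+ₚ_; scale; _*ₚ_; constₚ; monomial; xpowMinus1; prodDiv; IsCyclotomicFamily)
  open Polys using (ℤ[x]; at; coefficientwise; coeff-+; coeff-scale; *-∷; *-zeroʳ≈; *-identityˡ≈; 0∷-*; ∷-cong; negₚ)
  open Arith using (inverse-mod)
  open RingKit ℤ[x]
  open Solver
  open Ramified ℤ[x] using (geo; geo-*; geo-≡; ≡1)
  open import Relation.Binary.Reasoning.Setoid setoid

  x : Poly
  x = 0ℤ ∷ 1ℤ ∷ []

  monomial≈^ : ∀ n → monomial n ≈ x ^ n
  monomial≈^ zero    = refl
  monomial≈^ (suc n) = sym (trans (0∷-* (1ℤ ∷ []) (x ^ n)) (∷-cong ≡.refl (trans (*-identityˡ≈ (x ^ n)) (sym (monomial≈^ n)))))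

  xpowMinus1≈ : ∀ n → xpowMinus1 n ≈ x ^ n - 1#
  xpowMinus1≈ n = +-congʳ (monomial≈^ n)

  coeff-*₀ : ∀ f g → coeff (f * g) 0 ≡ coeff f 0 ℤ.* coeff g 0
  coeff-*₀ []      g = ≡.sym (ℤₚ.*-zeroˡ (coeff g 0))
  coeff-*₀ (c ∷ f) g = ≡.trans (coeff-+ (scale c g) (0ℤ ∷ (f *ₚ g)) 0) (≡.trans (ℤₚ.+-identityʳ _) (coeff-scale c g 0))

  -- Takes the place of monicity. A unit as constant term permits division from the lowest degree
  -- upwards, which is insensitive to trailing zeros of a coefficient list.
  UnitConst : Poly → Set
  UnitConst f = ∃ λ u → coeff f 0 ℤ.* u ≡ 1ℤ

  xpow-unit : ∀ n → 1 ≤ n → coeff (x ^ n - 1#) 0 ≡ -1ℤ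
  xpow-unit (suc n) _ = ≡.trans (≡.sym (at (xpowMinus1≈ (suc n)) 0)) ≡.refl

  UnitConst-factor : ∀ {h} f g → h ≈ f * g → coeff h 0 ≡ -1ℤ → UnitConst f
  UnitConst-factor {h} f g e p = ℤ.- coeff g 0 , ≡.trans (≡.sym (ℤₚ.neg-distribʳ-* (coeff f 0) (coeff g 0)))
    (≡.cong ℤ.-_ (≡.trans (≡.sym (coeff-*₀ f g)) (≡.trans (≡.sym (at e 0)) p)))

  private
    scale-inj : ∀ n .{{_ : ℤ.NonZero n}} s → scale n s ≈ [] → s ≈ []
    scale-inj n s p = coefficientwise λ i → ℤₚ.*-cancelˡ-≡ n (coeff s i) 0ℤ
      (≡.trans (≡.sym (coeff-scale n s i)) (≡.trans (at p i) (≡.sym (ℤₚ.*-zeroʳ n))))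

    tail : Poly → Poly
    tail []      = []
    tail (c ∷ f) = f

    coeff-tail : ∀ f i → coeff (tail f) i ≡ coeff f (suc i)
    coeff-tail []      i = ≡.refl
    coeff-tail (c ∷ f) i = ≡.refl

  -- Comparing coefficients from the lowest degree upwards, the integer n can be divided out.
  exact-division : ∀ n .{{_ : ℤ.NonZero n}} B → UnitConst B → ∀ q s → scale n s ≈ B * q → B ∣∣ s
  exact-division n B (u , B₀u≡1) = go
    where
    open ≡.≡-Reasoning using () renaming (begin_ to begin≡_; step-≡-⟩ to step≡; step-≡-⟨ to step≡˘; _∎ to _∎≡)
    b₀ = coeff B 0
    go : ∀ q s → scale n s ≈ B * q → B ∣∣ s
    go []      s p = quot [] (trans (scale-inj n s (trans p (*-zeroʳ≈ B))) (sym (*-zeroʳ≈ B)))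
    go (c ∷ q) s p = conclude (go q s₁ s₁≈)
      where
      s₀ = coeff s 0
      -- The lowest coefficient of the quotient of s by B, as u inverts the constant term of B.
      -- Subtracting c′ B from s leaves a multiple of x.
      c′ = u ℤ.* s₀
      r = s +ₚ negₚ (scale c′ B)
      s₁ = tail r
      coeff-s₁ : ∀ i → coeff s₁ i ≡ coeff s (suc i) ℤ.- c′ ℤ.* coeff B (suc i)
      coeff-s₁ i = ≡.trans (coeff-tail r i) (≡.trans (coeff-+ s (negₚ (scale c′ B)) (suc i))
        (≡.cong (ℤ._+_ (coeff s (suc i))) (≡.trans (coeff-scale -1ℤ (scale c′ B) (suc i))
          (≡.trans (ℤₚ.-1*i≡-i _) (≡.cong ℤ.-_ (coeff-scale c′ B (suc i)))))))
      coeff-product : ∀ d g i → coeff (B * (d ∷ g)) (suc i) ≡ d ℤ.* coeff B (suc i) ℤ.+ coeff (B * g) i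
      coeff-product d g i = ≡.trans (at (*-∷ B d g) (suc i)) (≡.trans (coeff-+ (scale d B) (0ℤ ∷ (B *ₚ g)) (suc i))
        (≡.cong (ℤ._+ coeff (B * g) i) (coeff-scale d B (suc i))))
      coeff-product₀ : ∀ d g → coeff (B * (d ∷ g)) 0 ≡ b₀ ℤ.* d
      coeff-product₀ d g = coeff-*₀ B (d ∷ g)
      c≡ : c ≡ n ℤ.* c′
      c≡ = ≡.trans (≡.sym (ℤₚ.*-identityˡ c)) (≡.trans (≡.cong (ℤ._* c) (≡.sym B₀u≡1)) (≡.trans (lemma b₀ u c)
        (≡.trans (≡.cong (u ℤ.*_) (≡.trans (≡.sym (coeff-product₀ c q)) (≡.trans (≡.sym (at p 0)) (coeff-scale n s 0)))) (lemma′ u n s₀))))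
        where
        lemma : ∀ b u c → b ℤ.* u ℤ.* c ≡ u ℤ.* (b ℤ.* c)
        lemma = solve-∀
        lemma′ : ∀ u n s → u ℤ.* (n ℤ.* s) ≡ n ℤ.* (u ℤ.* s)
        lemma′ = solve-∀
      s₁≈ : scale n s₁ ≈ B * q
      s₁≈ = coefficientwise λ i → ≡.trans (coeff-scale n s₁ i) (≡.trans (≡.cong (n ℤ.*_) (coeff-s₁ i))
        (≡.trans (lemma n (coeff s (suc i)) c′ (coeff B (suc i))) (≡.trans (≡.cong₂ ℤ._-_
          (≡.trans (≡.sym (coeff-scale n s (suc i))) (≡.trans (at p (suc i)) (coeff-product c q i))) (≡.cong (ℤ._* coeff B (suc i)) (≡.sym c≡)))
        (lemma′ (c ℤ.* coeff B (suc i)) (coeff (B * q) i)))))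
        where
        lemma : ∀ n s c b → n ℤ.* (s ℤ.- c ℤ.* b) ≡ n ℤ.* s ℤ.- n ℤ.* c ℤ.* b
        lemma = solve-∀
        lemma′ : ∀ a b → a ℤ.+ b ℤ.- a ≡ b
        lemma′ = solve-∀
      conclude : B ∣∣ s₁ → B ∣∣ s
      conclude (quot q′ e) = quot (c′ ∷ q′) (coefficientwise λ
        { zero    → ≡.sym (≡.trans (coeff-product₀ c′ q′) (≡.trans (≡.sym (ℤₚ.*-assoc b₀ u s₀)) (≡.trans (≡.cong (ℤ._* s₀) B₀u≡1) (ℤₚ.*-identityˡ s₀))))
        ; (suc i) → ≡.sym (≡.trans (coeff-product c′ q′ i) (≡.trans (≡.cong (ℤ._+_ (c′ ℤ.* coeff B (suc i))) (≡.trans (≡.sym (at e i)) (coeff-s₁ i)))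
                      (lemma (c′ ℤ.* coeff B (suc i)) (coeff s (suc i))))) })
        where
        lemma : ∀ a b → a ℤ.+ (b ℤ.- a) ≡ b
        lemma = solve-∀

  ι≈scale : ∀ n s → ι n * s ≈ scale n s
  ι≈scale n s = trans (*-congʳ (ι≈const n)) (trans (+-congˡ {x = scale n s} Polys.0∷[]≈[]) (+-identityʳ _))
    where
    nat : ∀ n → n · 1# ≈ constₚ (+ n)
    nat zero    = coefficientwise λ { zero → ≡.refl ; (suc i) → ≡.refl }
    nat (suc n) = trans (1+× n 1#) (+-congˡ (nat n))
    ι≈const : ∀ n → ι n ≈ constₚ n
    ι≈const (+ n)      = nat n
    ι≈const ℤ.-[1+ n ] = trans (-‿cong (nat (suc n))) (∷-cong (ℤₚ.-1*i≡-i (+ suc n)) refl)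

  regular : ∀ B → UnitConst B → ∀ q → B * q ≈ [] → q ≈ []
  regular B (u , B₀u≡1) = go
    where
    go : ∀ q → B * q ≈ [] → q ≈ []
    go []      p = refl
    go (c ∷ q) p = trans (∷-cong c≡0 (go q Bq≈[])) Polys.0∷[]≈[]
      where
      c≡0 : c ≡ 0ℤ
      c≡0 = ≡.trans (≡.sym (ℤₚ.*-identityˡ c)) (≡.trans (≡.cong (ℤ._* c) (≡.trans (≡.sym B₀u≡1) (ℤₚ.*-comm (coeff B 0) u)))
        (≡.trans (ℤₚ.*-assoc u (coeff B 0) c) (≡.trans (≡.cong (u ℤ.*_) (≡.trans (≡.sym (coeff-*₀ B (c ∷ q))) (at p 0))) (ℤₚ.*-zeroʳ u))))
      Bq≈[] : B * q ≈ []
      Bq≈[] = coefficientwise λ i → ≡.trans (≡.sym (≡.trans (≡.cong (λ d → d ℤ.* coeff B (suc i) ℤ.+ coeff (B * q) i) c≡0)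
        (≡.trans (≡.cong (ℤ._+ coeff (B * q) i) (ℤₚ.*-zeroˡ (coeff B (suc i)))) (ℤₚ.+-identityˡ _))))
        (≡.trans (≡.sym (≡.trans (at (*-∷ B c q) (suc i)) (≡.trans (coeff-+ (scale c B) (0ℤ ∷ (B *ₚ q)) (suc i)) (≡.cong (ℤ._+ coeff (B * q) i) (coeff-scale c B (suc i))))))
        (at p (suc i)))

  factor : (ℕ → Poly) → ∀ {e} c → Dec (c ∣ e) → Poly
  factor Φ c (yes _) = Φ c
  factor Φ c (no _)  = 1#

  -- The product of the Φ c over the divisors c ≤ b of e. The separate bound b is what inductions
  -- run on, which the filtered list of `prodDiv` does not offer.
  Π : (ℕ → Poly) → ℕ → ℕ → Poly
  Π Φ e zero    = 1#
  Π Φ e (suc b) = factor Φ (suc b) (suc b ∣? e) * Π Φ e b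

  prodDiv≈Π : ∀ Φ e → prodDiv Φ e ≈ Π Φ e e
  prodDiv≈Π Φ e = go e
    where
    _⊙_ : ℕ → Poly → Poly
    c ⊙ f = Φ c * f
    upto = λ b → filter (λ c → c ∣? e) (map suc (upTo b))
    foldr-⊙ : ∀ cs f → foldr _⊙_ f cs ≈ f * foldr _⊙_ 1# cs
    foldr-⊙ []       f = sym (*-identityʳ f)
    foldr-⊙ (c ∷ cs) f = trans (*-congˡ {Φ c} (foldr-⊙ cs f)) (solve 3 (λ a b c → a :* (b :* c) := b :* (a :* c)) refl (Φ c) f (foldr _⊙_ 1# cs))
    snoc : ∀ b → upto (suc b) ≡ upto b ++ filter (λ c → c ∣? e) (suc b ∷ [])
    snoc b = ≡.trans (≡.cong (λ cs → filter (λ c → c ∣? e) (map suc cs)) (≡.sym (Listₚ.upTo-∷ʳ b)))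
      (≡.trans (≡.cong (filter (λ c → c ∣? e)) (Listₚ.map-++ suc (upTo b) (b ∷ []))) (Listₚ.filter-++ (λ c → c ∣? e) (map suc (upTo b)) (suc b ∷ [])))
    last : ∀ c → foldr _⊙_ 1# (filter (λ c → c ∣? e) (c ∷ [])) ≈ factor Φ c (c ∣? e)
    last c with c ∣? e
    ... | yes _ = *-identityʳ (Φ c)
    ... | no  _ = refl
    go : ∀ b → foldr _⊙_ 1# (upto b) ≈ Π Φ e b
    go zero    = refl
    go (suc b) = begin
      foldr _⊙_ 1# (upto (suc b))                                                    ≡⟨ ≡.trans (≡.cong (foldr _⊙_ 1#) (snoc b)) (Listₚ.foldr-++ _⊙_ 1# (upto b) _) ⟩
      foldr _⊙_ (foldr _⊙_ 1# (filter (λ c → c ∣? e) (suc b ∷ []))) (upto b)         ≈⟨ foldr-⊙ (upto b) _ ⟩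
      foldr _⊙_ 1# (filter (λ c → c ∣? e) (suc b ∷ [])) * foldr _⊙_ 1# (upto b)      ≈⟨ *-cong (last (suc b)) (go b) ⟩
      Π Φ e (suc b)                                                                  ∎

  factor-yes : ∀ Φ {e} c (d : Dec (c ∣ e)) → c ∣ e → factor Φ c d ≈ Φ c
  factor-yes Φ c (yes _) p = refl
  factor-yes Φ c (no ¬p) p = contradiction p ¬p

  factor-no : ∀ Φ {e} c (d : Dec (c ∣ e)) → ¬ (c ∣ e) → factor Φ c d ≈ 1#
  factor-no Φ c (yes p) ¬p = contradiction p ¬p
  factor-no Φ c (no _)  ¬p = refl

  Π-∣ : ∀ Φ {g e} → g ∣ e → ∀ b → Π Φ g b ∣∣ Π Φ e b
  Π-∣ Φ g∣e zero    = quot 1# (sym (*-identityˡ 1#))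
  Π-∣ Φ {g} {e} g∣e (suc b) = go (suc b ∣? g) (suc b ∣? e) (Π-∣ Φ g∣e b)
    where
    go : (d : Dec (suc b ∣ g)) (d′ : Dec (suc b ∣ e)) → Π Φ g b ∣∣ Π Φ e b → factor Φ (suc b) d * Π Φ g b ∣∣ factor Φ (suc b) d′ * Π Φ e b
    go (yes p) (no ¬q) _          = contradiction (∣-trans p g∣e) ¬q
    go (yes p) (yes q) (quot r e) = quot r (trans (*-congˡ {Φ (suc b)} e) (sym (*-assoc (Φ (suc b)) (Π Φ g b) r)))
    go (no p)  d′      (quot r e) = quot (factor Φ (suc b) d′ * r) (trans (*-congˡ {factor Φ (suc b) d′} e)
      (solve 3 (λ f p r → f :* (p :* r) := (con (+ 1) :* p) :* (f :* r)) refl (factor Φ (suc b) d′) (Π Φ g b) r))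

  Π-stable : ∀ Φ e → 1 ≤ e → ∀ k → Π Φ e (k ℕ.+ e) ≈ Π Φ e e
  Π-stable Φ e 1≤e zero    = refl
  Π-stable Φ e 1≤e (suc k) = trans (*-cong (factor-no Φ (suc (k ℕ.+ e)) (suc (k ℕ.+ e) ∣? e) (λ d → ℕₚ.<⇒≱ (s≤s (ℕₚ.m≤n+m e k)) (∣⇒≤ {{ℕ.>-nonZero 1≤e}} d))) (Π-stable Φ e 1≤e k)) (*-identityˡ _)

  Π-cong : ∀ Φ Ψ e b → (∀ c → c ≤ b → Φ c ≡ Ψ c) → Π Φ e b ≈ Π Ψ e b
  Π-cong Φ Ψ e zero    p = refl
  Π-cong Φ Ψ e (suc b) p = *-cong (go (suc b ∣? e)) (Π-cong Φ Ψ e b (λ c c≤b → p c (ℕₚ.m≤n⇒m≤1+n c≤b)))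
    where
    go : (d : Dec (suc b ∣ e)) → factor Φ (suc b) d ≈ factor Ψ (suc b) d
    go (yes _) = reflexive (p (suc b) ℕₚ.≤-refl)
    go (no _)  = refl

  Valid : (ℕ → Poly) → ℕ → Set
  Valid Φ n = ∀ e → 1 ≤ e → e ≤ n → x ^ e - 1# ≈ Π Φ e e

  module _ {Φ n} (valid : Valid Φ n) where

    Φ-unit : ∀ c → 1 ≤ c → c ≤ n → UnitConst (Φ c)
    Φ-unit (suc c) 1≤c c≤n = UnitConst-factor (Φ (suc c)) (Π Φ (suc c) c)
      (trans (valid (suc c) 1≤c c≤n) (*-congʳ (factor-yes Φ (suc c) (suc c ∣? suc c) ∣-refl))) (xpow-unit (suc c) 1≤c)

    Φ∣x^c-1 : ∀ c → 1 ≤ c → c ≤ n → Φ c ∣∣ x ^ c - 1#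
    Φ∣x^c-1 (suc c) 1≤c c≤n = quot (Π Φ (suc c) c) (trans (valid (suc c) 1≤c c≤n) (*-congʳ (factor-yes Φ (suc c) (suc c ∣? suc c) ∣-refl)))

    -- Every cyclotomic factor of x^g - 1 has index at most g < g k, so it also occurs among the
    -- factors of x^(g k) - 1 other than the last. Cancelling x^g - 1 leaves Φ (g k) in the
    -- quotient.
    Φ∣geo : ∀ g k → 1 ≤ g → 2 ≤ k → g ℕ.* k ≤ n → Φ (g ℕ.* k) ∣∣ geo (x ^ g) k
    Φ∣geo g k 1≤g 2≤k c≤n = result (suc-pred c 1≤c)
      where
      c = g ℕ.* k
      suc-pred : ∀ c → 1 ≤ c → ∃ λ c′ → c ≡ suc c′
      suc-pred (suc c) _ = c , ≡.refl
      g<c : g < c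
      g<c = ℕₚ.<-≤-trans (ℕₚ.m<m+n g 1≤g) (ℕₚ.≤-trans (ℕₚ.≤-reflexive (≡.trans (≡.cong (g ℕ.+_) (≡.sym (ℕₚ.+-identityʳ g))) (ℕₚ.*-comm 2 g))) (ℕₚ.*-monoʳ-≤ g 2≤k))
      1≤c : 1 ≤ c
      1≤c = ℕₚ.≤-trans 1≤g (ℕₚ.<⇒≤ g<c)
      y = x ^ g
      y-unit : UnitConst (y - 1#)
      y-unit = -1ℤ , ≡.cong (ℤ._* -1ℤ) (xpow-unit g 1≤g)
      result : (∃ λ c′ → c ≡ suc c′) → Φ c ∣∣ geo y k
      result (c′ , c≡) = finish (Π-∣ Φ (divides k (ℕₚ.*-comm g k)) c′)
        where
        g≤c′ : g ≤ c′
        g≤c′ = ℕ.s≤s⁻¹ (≡.subst (g <_) c≡ g<c)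
        finish : Π Φ g c′ ∣∣ Π Φ c c′ → Φ c ∣∣ geo y k
        finish (quot r e) = quot r (difference (regular (y - 1#) y-unit _ (begin
            (y - 1#) * (geo y k - Φ c * r)                ≈⟨ solve 4 (λ y g p r → y :* (g :- p :* r) := y :* g :- p :* (y :* r)) refl (y - 1#) (geo y k) (Φ c) r ⟩
            (y - 1#) * geo y k - Φ c * ((y - 1#) * r)     ≈⟨ +-cong left (-‿cong (*-congˡ {Φ c} (*-congʳ (trans (valid g 1≤g (ℕₚ.≤-trans (ℕₚ.<⇒≤ g<c) c≤n)) Πg)))) ⟩
            Φ c * Π Φ c c′ - Φ c * (Π Φ g c′ * r)         ≈⟨ +-congˡ (-‿cong (*-congˡ {Φ c} (sym e))) ⟩
            Φ c * Π Φ c c′ - Φ c * Π Φ c c′               ≈⟨ -‿inverseʳ (Φ c * Π Φ c c′) ⟩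
            []                                            ∎)))
          where
          Πg : Π Φ g g ≈ Π Φ g c′
          Πg = sym (trans (reflexive (≡.cong (Π Φ g) (≡.sym (ℕₚ.m∸n+n≡m g≤c′)))) (Π-stable Φ g 1≤g (c′ ℕ.∸ g)))
          left : (y - 1#) * geo y k ≈ Φ c * Π Φ c c′
          left = begin
            (y - 1#) * geo y k             ≈⟨ geo-* y k ⟩
            y ^ k - 1#                     ≈⟨ +-congʳ (^-assocʳ x g k) ⟩
            x ^ c - 1#                     ≈⟨ valid c 1≤c c≤n ⟩
            Π Φ c c                        ≈⟨ reflexive (≡.cong (Π Φ c) c≡) ⟩
            Π Φ c (suc c′)                 ≈⟨ *-congʳ {Π Φ c c′} (trans (factor-yes Φ (suc c′) (suc c′ ∣? c) (≡.subst (suc c′ ∣_) (≡.sym c≡) ∣-refl)) (reflexive (≡.cong Φ (≡.sym c≡)))) ⟩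
            Φ c * Π Φ c c′                 ∎
          difference : geo y k - Φ c * r ≈ [] → geo y k ≈ Φ c * r
          difference p = begin
            geo y k                            ≈⟨ solve 2 (λ a b → a := (a :- b) :+ b) refl (geo y k) (Φ c * r) ⟩
            (geo y k - Φ c * r) + Φ c * r      ≈⟨ +-congʳ p ⟩
            [] + Φ c * r                       ≈⟨ +-identityˡ _ ⟩
            Φ c * r                            ∎

    -- Distinct cyclotomic polynomials are coprime over ℚ.
    bezout : ∀ c c′ → 1 ≤ c′ → c′ < c → c ≤ n → ∃ λ k → 1 ≤ k × ∃ λ a → Φ c′ * a ≡ ι (+ k) [ Φ c ]
    bezout c c′ 1≤c′ c′<c c≤n = go (gcd[m,n]∣m c c′) (gcd[m,n]∣n c c′)
      where
      g = gcd c c′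
      go : g ∣ c → g ∣ c′ → ∃ λ k → 1 ≤ k × ∃ λ a → Φ c′ * a ≡ ι (+ k) [ Φ c ]
      go (divides k c≡) (divides m c′≡) = k , ℕₚ.<⇒≤ 2≤k , a , congruent
        where
        1≤g : 1 ≤ g
        1≤g = ℕₚ.n≢0⇒n>0 (λ g≡0 → ℕₚ.<⇒≱ c′<c (ℕₚ.≤-trans (ℕₚ.≤-reflexive (≡.trans c≡ (≡.trans (≡.cong (k ℕ.*_) g≡0) (ℕₚ.*-zeroʳ k)))) z≤n))
        1≤m : 1 ≤ m
        1≤m = ℕₚ.n≢0⇒n>0 (λ m≡0 → ℕₚ.<⇒≱ 1≤c′ (ℕₚ.≤-reflexive (≡.trans c′≡ (≡.cong (ℕ._* g) m≡0))))
        m<k : m < k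
        m<k = ℕₚ.*-cancelʳ-< g m k (≡.subst₂ _<_ c′≡ c≡ c′<c)
        2≤k : 2 ≤ k
        2≤k = ℕₚ.≤-trans (s≤s 1≤m) m<k
        coprime : Coprime m k
        coprime {d} (d∣m , d∣k) = Data.Nat.Divisibility.∣1⇒≡1 (*-cancelˡ-∣ g {{ℕ.>-nonZero 1≤g}} (≡.subst (g ℕ.* d ∣_) (≡.sym (ℕₚ.*-identityʳ g))
          (Data.Nat.GCD.gcd-greatest (scaled d∣k c≡) (scaled d∣m c′≡))))
          where
          scaled : ∀ {j z} → d ∣ j → z ≡ j ℕ.* g → g ℕ.* d ∣ z
          scaled {j} d∣j z≡ = ≡.subst (g ℕ.* d ∣_) (≡.trans (ℕₚ.*-comm g j) (≡.sym z≡)) (Data.Nat.Divisibility.*-monoʳ-∣ g d∣j)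
        -- Modulo Φ c the element y satisfies 1 + y + ... + y^(k-1) = 0, so y - 1 divides k. As m is
        -- invertible modulo k, y is a power of z = y^m = x^c′; hence Φ c′ divides z - 1, which
        -- divides y - 1, which divides k.
        y = x ^ g
        inv = inverse-mod coprime 1≤m
        h = proj₁ inv
        l = proj₁ (proj₂ inv)
        Φc∣geo : Φ c ∣∣ geo y k
        Φc∣geo = ≡.subst (λ z → Φ z ∣∣ geo y k) (≡.trans (ℕₚ.*-comm g k) (≡.sym c≡)) (Φ∣geo g k 1≤g 2≤k (≡.subst (_≤ n) (≡.trans c≡ (ℕₚ.*-comm k g)) c≤n))
        q = _≡_[_].quotient (≡-sym (geo-≡ y k (≡1 y)))
        -- k ≡ (y - 1) q modulo Φ c
        k≡ : (y - 1#) * q ≡ ι (+ k) [ Φ c ]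
        k≡ = ≡-trans (≡-sym (≡-trans (≡-+ (∣⇒≡0 Φc∣geo) (≡-refl {x = (y - 1#) * q} refl)) (≡-refl (+-identityˡ ((y - 1#) * q))))) (≡-refl (sym (_≡_[_].equality (≡-sym (geo-≡ y k (≡1 y))))))
        y^k≡1 : y ^ k ≡ 1# [ Φ c ]
        y^k≡1 = ≡-trans (≡-refl (begin
            y ^ k                          ≈⟨ solve 1 (λ z → z := (z :- con (+ 1)) :+ con (+ 1)) refl (y ^ k) ⟩
            (y ^ k - 1#) + 1#              ≈⟨ +-congʳ (sym (geo-* y k)) ⟩
            (y - 1#) * geo y k + 1#        ∎))
          (≡-trans (≡-+ (≡-* (≡-refl {x = y - 1#} refl) (∣⇒≡0 Φc∣geo)) (≡-refl {x = 1#} refl)) (≡-refl (trans (+-congʳ (zeroʳ (y - 1#))) (+-identityˡ 1#))))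
        z = y ^ m
        z^h≡y : z ^ h ≡ y [ Φ c ]
        z^h≡y = ≡-trans (≡-refl (trans (^-assocʳ y m h) (trans (reflexive (≡.cong (y ^_) (proj₂ (proj₂ inv)))) (*-congˡ {y} (sym (^-assocʳ y k l))))))
          (≡-trans (≡-* (≡-refl {x = y} refl) (≡-^ l y^k≡1)) (≡-refl (trans (*-congˡ {y} (1^n≈1 l)) (*-identityʳ y))))
        z-1 : z - 1# ≈ x ^ c′ - 1#
        z-1 = +-congʳ (trans (^-assocʳ x g m) (reflexive (≡.cong (x ^_) (≡.trans (ℕₚ.*-comm g m) (≡.sym c′≡)))))
        Φc′∣ : Φ c′ ∣∣ z - 1#
        Φc′∣ = ∣∣-trans (Φ∣x^c-1 c′ 1≤c′ (ℕₚ.≤-trans (ℕₚ.<⇒≤ c′<c) c≤n)) (quot 1# (trans z-1 (sym (*-identityʳ _))))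
        r = _∣∣_.quotient Φc′∣
        a = r * geo z h * q
        congruent : Φ c′ * a ≡ ι (+ k) [ Φ c ]
        congruent = ≡-trans (≡-refl (begin
            Φ c′ * (r * geo z h * q)           ≈⟨ solve 4 (λ p r g q → p :* (r :* g :* q) := ((p :* r) :* g) :* q) refl (Φ c′) r (geo z h) q ⟩
            ((Φ c′ * r) * geo z h) * q         ≈⟨ *-congʳ {q} (*-congʳ {geo z h} (sym (_∣∣_.equality Φc′∣))) ⟩
            ((z - 1#) * geo z h) * q           ≈⟨ *-congʳ {q} (geo-* z h) ⟩
            (z ^ h - 1#) * q                   ∎))
          (≡-trans (≡-* (≡-+ z^h≡y (≡-refl {x = - 1#} refl)) (≡-refl {x = q} refl)) k≡)

    bezout-Π : ∀ e c → c ≤ n → ∀ b → b < c → ∃ λ k → 1 ≤ k × ∃ λ a → Π Φ e b * a ≡ ι (+ k) [ Φ c ]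
    bezout-Π e c c≤n zero    b<c = 1 , ℕₚ.≤-refl , 1# , ≡-refl (*-identityˡ 1#)
    bezout-Π e c c≤n (suc b) b<c = go (suc b ∣? e) (bezout-Π e c c≤n b (ℕₚ.<⇒≤ b<c)) (bezout c (suc b) (s≤s z≤n) b<c c≤n)
      where
      go : (d : Dec (suc b ∣ e)) → (∃ λ k → 1 ≤ k × ∃ λ a → Π Φ e b * a ≡ ι (+ k) [ Φ c ]) → (∃ λ k → 1 ≤ k × ∃ λ a → Φ (suc b) * a ≡ ι (+ k) [ Φ c ]) →
           ∃ λ k → 1 ≤ k × ∃ λ a → factor Φ (suc b) d * Π Φ e b * a ≡ ι (+ k) [ Φ c ]
      go (no _)  (k , 1≤k , a , p) _ = k , 1≤k , a , ≡-trans (≡-refl (*-congʳ (*-identityˡ (Π Φ e b)))) p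
      go (yes _) (k , 1≤k , a , p) (k′ , 1≤k′ , a′ , p′) = k′ ℕ.* k , ℕₚ.*-mono-≤ 1≤k′ 1≤k , a′ * a ,
        ≡-trans (≡-refl (solve 4 (λ f p a b → (f :* p) :* (a :* b) := (f :* a) :* (p :* b)) refl (Φ (suc b)) (Π Φ e b) a′ a))
        (≡-trans (≡-* p′ p) (≡-refl (sym (trans (reflexive (≡.cong ι (ℤₚ.pos-* k′ k))) (ι-* (+ k′) (+ k))))))

    -- Coprimality over ℚ yields only that Φ c divides a positive integer times the cofactor s;
    -- `exact-division` removes that integer.
    Π∣ : ∀ e Y → (∀ c → 1 ≤ c → c ≤ n → c ∣ e → Φ c ∣∣ Y) → ∀ b → b ≤ n → Π Φ e b ∣∣ Y
    Π∣ e Y p zero    _   = quot Y (sym (*-identityˡ Y))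
    Π∣ e Y p (suc b) b<n = go (suc b ∣? e) (Π∣ e Y p b (ℕₚ.<⇒≤ b<n)) (bezout-Π e (suc b) b<n b ℕₚ.≤-refl)
      where
      c = suc b
      go : (d : Dec (c ∣ e)) → Π Φ e b ∣∣ Y → (∃ λ k → 1 ≤ k × ∃ λ a → Π Φ e b * a ≡ ι (+ k) [ Φ c ]) → factor Φ c d * Π Φ e b ∣∣ Y
      go (no _)  (quot s Y≈) _ = quot s (trans Y≈ (*-congʳ (sym (*-identityˡ (Π Φ e b)))))
      go (yes c∣e) (quot s Y≈) (suc k , _ , a , cong′) = finish (≡0⇒∣ (≡-trans (≡-* (≡-sym cong′) (≡-refl {y = s} refl)) (≡-trans (≡-refl (begin
          (Π Φ e b * a) * s          ≈⟨ solve 3 (λ p a s → (p :* a) :* s := a :* (p :* s)) refl (Π Φ e b) a s ⟩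
          a * (Π Φ e b * s)          ≈⟨ *-congˡ {a} (sym Y≈) ⟩
          a * Y                      ∎)) (≡-trans (≡-* (≡-refl {x = a} refl) (∣⇒≡0 (p c (s≤s z≤n) b<n c∣e))) (≡-refl (zeroʳ a))))))
        where
        finish : Φ c ∣∣ ι (+ suc k) * s → Φ c * Π Φ e b ∣∣ Y
        finish (quot q e′) = finish′ (exact-division (+ suc k) (Φ c) (Φ-unit c (s≤s z≤n) b<n) q s (trans (sym (ι≈scale (+ suc k) s)) e′))
          where
          finish′ : Φ c ∣∣ s → Φ c * Π Φ e b ∣∣ Y
          finish′ (quot s′ s≈) = quot s′ (trans Y≈ (trans (*-congˡ {Π Φ e b} s≈) (solve 3 (λ p f s → p :* (f :* s) := (f :* p) :* s) refl (Π Φ e b) (Φ c) s′)))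

  private
    update : (ℕ → Poly) → ℕ → Poly → ℕ → Poly
    update Φ n ψ c with c ℕₚ.≟ n
    ... | yes _ = ψ
    ... | no  _ = Φ c

    update-≡ : ∀ Φ n ψ → update Φ n ψ n ≡ ψ
    update-≡ Φ n ψ with n ℕₚ.≟ n
    ... | yes _   = ≡.refl
    ... | no  n≢n = contradiction ≡.refl n≢n

    update-≢ : ∀ Φ n ψ c → c ≢ n → update Φ n ψ c ≡ Φ c
    update-≢ Φ n ψ c c≢n with c ℕₚ.≟ n
    ... | yes c≡n = contradiction c≡n c≢n
    ... | no  _   = ≡.refl

    Approximation : ℕ → Set
    Approximation n = Σ (ℕ → Poly) λ Φ → Valid Φ n

    x^c∣x^e : ∀ {c e} → c ∣ e → x ^ c - 1# ∣∣ x ^ e - 1#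
    x^c∣x^e {c} (divides k ≡.refl) = quot (geo (x ^ c) k) (sym (trans (geo-* (x ^ c) k) (+-congʳ (trans (^-assocʳ x c k) (reflexive (≡.cong (x ^_) (ℕₚ.*-comm c k)))))))

    quotient : ∀ n (A : Approximation n) → Π (proj₁ A) (suc n) n ∣∣ x ^ suc n - 1#
    quotient n (Φ , valid) = Π∣ valid (suc n) (x ^ suc n - 1#) (λ c 1≤c c≤n c∣ → ∣∣-trans (Φ∣x^c-1 valid c 1≤c c≤n) (x^c∣x^e c∣)) n ℕₚ.≤-refl

    -- The next polynomial is by definition the quotient of x^(n+1) - 1 by the product over the
    -- divisors of n + 1 up to n. The earlier entries stay as they are.
    extend : ∀ n → Approximation n → Approximation (suc n)
    extend n (Φ , valid) = Φ′ , valid′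
      where
      ψ = _∣∣_.quotient (quotient n (Φ , valid))
      Φ′ = update Φ (suc n) ψ
      agree : ∀ c → c ≤ n → Φ c ≡ Φ′ c
      agree c c≤n = ≡.sym (update-≢ Φ (suc n) ψ c (λ c≡ → ℕₚ.<⇒≱ (ℕₚ.≤-reflexive (≡.sym c≡)) c≤n))
      valid′ : Valid Φ′ (suc n)
      valid′ e 1≤e e≤ with ℕₚ.m≤n⇒m<n∨m≡n e≤
      ... | inj₁ (s≤s e≤n) = trans (valid e 1≤e e≤n) (Π-cong Φ Φ′ e e (λ c c≤e → agree c (ℕₚ.≤-trans c≤e e≤n)))
      ... | inj₂ ≡.refl    = trans (_∣∣_.equality (quotient n (Φ , valid))) (trans (*-comm (Π Φ e n) ψ)
        (*-cong (sym (trans (factor-yes Φ′ e (e ∣? e) ∣-refl) (reflexive (update-≡ Φ e ψ)))) (Π-cong Φ Φ′ e n agree)))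

    approximation : ∀ n → Approximation n
    approximation zero    = (λ _ → []) , λ e 1≤e e≤0 → contradiction (ℕₚ.≤-trans 1≤e e≤0) λ ()
    approximation (suc n) = extend n (approximation n)

    stable : ∀ n c → c ≤ n → proj₁ (approximation n) c ≡ proj₁ (approximation c) c
    stable n c c≤n with ℕₚ.m≤n⇒m<n∨m≡n c≤n
    ... | inj₂ ≡.refl = ≡.refl
    stable (suc n) c _ | inj₁ (s≤s c≤n) = ≡.trans (update-≢ (proj₁ (approximation n)) (suc n) _ c (λ c≡ → ℕₚ.<⇒≱ (ℕₚ.≤-reflexive (≡.sym c≡)) c≤n)) (stable n c c≤n)

  -- The diagonal of the approximations; `stable` shows that later approximations agree with it.
  cyclotomic : ℕ → Poly
  cyclotomic e = proj₁ (approximation e) e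

  cyclotomic-valid : ∀ n → Valid cyclotomic n
  cyclotomic-valid n e 1≤e _ = trans (proj₂ (approximation e) e 1≤e ℕₚ.≤-refl) (Π-cong _ cyclotomic e e (λ c c≤e → stable e c c≤e))

  -- `FixesPrimesAbove` is quantified over such families and can be applied only once one is
  -- exhibited.
  isCyclotomicFamily : IsCyclotomicFamily cyclotomic
  isCyclotomicFamily e 1≤e = at (trans (xpowMinus1≈ e) (trans (cyclotomic-valid e e 1≤e ℕₚ.≤-refl) (sym (prodDiv≈Π cyclotomic e))))

-- A maximal ideal above a decidable ideal of finite index.

module MaximalIdeal (R : CommutativeRing 0ℓ 0ℓ) where

  open import Data.Integer.Base using (+_)
  open import Data.List.Relation.Unary.Any using (Any)

  open RingKit R
  open Solver
  open PrimeIdeal R using (IsDecPrimeIdeal)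

  record IsDecIdeal (I : Carrier → Set) : Set where
    field
      resp   : ∀ {x y} → x ≈ y → I x → I y
      zero∈  : I 0#
      +∈     : ∀ {x y} → I x → I y → I (x + y)
      *∈     : ∀ x {y} → I y → I (x * y)
      _∈?    : ∀ x → Dec (I x)

  module _ {I₀ : Carrier → Set} (ideal₀ : IsDecIdeal I₀) (proper₀ : ¬ I₀ 1#)
           (reps : List Carrier) (complete : ∀ x → ∃ λ c → c ∈ reps × I₀ (x - c)) where

    record Ideal : Set₁ where
      field
        I       : Carrier → Set
        isIdeal : IsDecIdeal I
        proper  : ¬ I 1#
        ⊇       : ∀ {x} → I₀ x → I x
      open IsDecIdeal isIdeal public

    module _ (J : Ideal) (b : Carrier) where
      open Ideal J

      -- The ideal I + (b). Multipliers are drawn from the finite list of representatives modulo I₀,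
      -- which keeps membership decidable.
      Ext : Carrier → Set
      Ext x = Any (λ c → I (x - c * b)) reps

      ext : ∀ x c → I (x - c * b) → Ext x
      ext x c p = Any.map (λ { {c′} ≡.refl → resp (solve 4 (λ x c c′ b → (x :- c :* b) :+ b :* (c :- c′) := x :- c′ :* b) refl x c c′ b)
          (+∈ p (*∈ b (⊇ (proj₂ (proj₂ (complete c)))))) }) (proj₁ (proj₂ (complete c)))

      unext : ∀ {x} → Ext x → ∃ λ c → I (x - c * b)
      unext p = Any.satisfied p

      Ext-isIdeal : IsDecIdeal Ext
      Ext-isIdeal = record
        { resp  = λ {x} {y} x≈y p → Any.map (λ q → resp (+-congʳ x≈y) q) p
        ; zero∈ = ext 0# 0# (resp (solve 1 (λ b → con (+ 0) := con (+ 0) :- con (+ 0) :* b) refl b) zero∈)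
        ; +∈    = λ {x} {y} p q → plus x y (unext p) (unext q)
        ; *∈    = λ x {y} p → times x y (unext p)
        ; _∈?   = λ x → Any.any? (λ c → (x - c * b) ∈?) reps }
        where
        plus : ∀ x y → ∃ (λ c → I (x - c * b)) → ∃ (λ c → I (y - c * b)) → Ext (x + y)
        plus x y (c , p) (d , q) = ext (x + y) (c + d) (resp (solve 5 (λ x y c d b → (x :- c :* b) :+ (y :- d :* b) := (x :+ y) :- (c :+ d) :* b) refl x y c d b) (+∈ p q))
        times : ∀ x y → ∃ (λ c → I (y - c * b)) → Ext (x * y)
        times x y (c , p) = ext (x * y) (x * c) (resp (solve 4 (λ x y c b → x :* (y :- c :* b) := x :* y :- (x :* c) :* b) refl x y c b) (*∈ x p))

      ⊆Ext : ∀ {x} → I x → Ext x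
      ⊆Ext {x} p = ext x 0# (resp (solve 2 (λ x b → x := x :- con (+ 0) :* b) refl x b) p)

      b∈Ext : Ext b
      b∈Ext = ext b 1# (resp (solve 1 (λ b → con (+ 0) := b :- con (+ 1) :* b) refl b) zero∈)

    record Maximal (bs : List Carrier) (J : Ideal) : Set₁ where
      open Ideal J
      field
        result  : Ideal
        bigger  : ∀ {x} → I x → Ideal.I result x
        maximal : ∀ b → b ∈ bs → Ideal.I result b ⊎ ∃ λ c → Ideal.I result (1# - c * b)

    -- A single pass is enough: if b is rejected because 1 lies in I + (b), then b is invertible
    -- modulo I and stays so modulo every larger ideal.
    maximalise : ∀ bs J → Maximal bs J
    maximalise []       J = record { result = J ; bigger = λ p → p ; maximal = λ _ () }
    maximalise (b ∷ bs) J = go (IsDecIdeal._∈? (Ext-isIdeal J b) 1#)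
      where
      open Ideal J using (⊇)
      go : Dec (Ext J b 1#) → Maximal (b ∷ bs) J
      go (yes p) = record { result = result ; bigger = bigger ; maximal = λ
          { _ (here ≡.refl) → inj₂ (proj₁ (unext J b p) , bigger (proj₂ (unext J b p)))
          ; c (there c∈)    → maximal c c∈ } }
        where open Maximal (maximalise bs J)
      go (no ¬p) = record { result = result ; bigger = λ q → bigger (⊆Ext J b q) ; maximal = λ
          { _ (here ≡.refl) → inj₁ (bigger (b∈Ext J b))
          ; c (there c∈)    → maximal c c∈ } }
        where
        extended : Ideal
        extended = record { I = Ext J b ; isIdeal = Ext-isIdeal J b ; proper = ¬p ; ⊇ = λ q → ⊆Ext J b (⊇ q) }
        open Maximal (maximalise bs extended)

    private
      M = maximalise reps (record { I = I₀ ; isIdeal = ideal₀ ; proper = proper₀ ; ⊇ = λ p → p })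
      open Maximal M
      open Ideal result

    maximalIdeal : Carrier → Set
    maximalIdeal = I

    ⊆maximalIdeal : ∀ {x} → I₀ x → maximalIdeal x
    ⊆maximalIdeal = ⊇

    maximalIdeal-prime : IsDecPrimeIdeal maximalIdeal
    maximalIdeal-prime = record
      { resp = resp ; zero∈ = zero∈ ; +∈ = +∈ ; *∈ = *∈ ; proper = proper ; prime = prime ; _∈? = _∈? }
      where
      -- x is congruent to a representative b, and b either lies in I or is invertible modulo I; in
      -- the second case x y ∈ I gives y ∈ I.
      prime : ∀ x y → I (x * y) → I x ⊎ I y
      prime x y xy∈ = go (complete x)
        where
        go : (∃ λ b → b ∈ reps × I₀ (x - b)) → I x ⊎ I y
        go (b , b∈ , x-b) = go′ (maximal b b∈)
          where
          go′ : (I b ⊎ ∃ λ c → I (1# - c * b)) → I x ⊎ I y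
          go′ (inj₁ b∈I) = inj₁ (resp (solve 2 (λ x b → (x :- b) :+ b := x) refl x b) (+∈ (⊇ x-b) b∈I))
          go′ (inj₂ (c , p)) = inj₂ (resp (solve 4 (λ x y b c → (y :* (con (+ 1) :- c :* b) :+ (:- (c :* y)) :* (x :- b)) :+ c :* (x :* y) := y) refl x y b c)
            (+∈ (+∈ (*∈ y p) (*∈ (- (c * y)) (⊇ x-b))) (*∈ c xy∈)))

-- Evaluation of integer polynomials in a commutative ring.

module Evaluation (R : CommutativeRing 0ℓ 0ℓ) where

  open import Data.Integer.Base using (+_)
  open import Defs using (Poly; _≈ₚ_; _+ₚ_; scale; _*ₚ_; constₚ; monomial; substPow)

  open RingKit R
  open Solver
  open PrimeIdeal R using (eval)
  open import Relation.Binary.Reasoning.Setoid setoid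

  ev : Carrier → Poly → Carrier
  ev y f = eval (map ι f) y

  module _ (y : Carrier) where

    ev-+ : ∀ f g → ev y (f +ₚ g) ≈ ev y f + ev y g
    ev-+ []      g       = sym (+-identityˡ _)
    ev-+ (c ∷ f) []      = sym (+-identityʳ _)
    ev-+ (c ∷ f) (d ∷ g) = begin
      ι (c ℤ.+ d) + y * ev y (f +ₚ g)            ≈⟨ +-cong (ι-+ c d) (*-congˡ (ev-+ f g)) ⟩
      (ι c + ι d) + y * (ev y f + ev y g)        ≈⟨ solve 5 (λ c d y f g → (c :+ d) :+ y :* (f :+ g) := (c :+ y :* f) :+ (d :+ y :* g)) refl (ι c) (ι d) y (ev y f) (ev y g) ⟩
      (ι c + y * ev y f) + (ι d + y * ev y g)    ∎

    ev-scale : ∀ c f → ev y (scale c f) ≈ ι c * ev y f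
    ev-scale c []      = sym (zeroʳ _)
    ev-scale c (d ∷ f) = begin
      ι (c ℤ.* d) + y * ev y (scale c f)     ≈⟨ +-cong (ι-* c d) (*-congˡ (ev-scale c f)) ⟩
      ι c * ι d + y * (ι c * ev y f)         ≈⟨ solve 4 (λ c d y f → c :* d :+ y :* (c :* f) := c :* (d :+ y :* f)) refl (ι c) (ι d) y (ev y f) ⟩
      ι c * (ι d + y * ev y f)               ∎

    ev-∷0 : ∀ f → ev y (0ℤ ∷ f) ≈ y * ev y f
    ev-∷0 f = +-identityˡ _

    ev-* : ∀ f g → ev y (f *ₚ g) ≈ ev y f * ev y g
    ev-* []      g = sym (zeroˡ _)
    ev-* (c ∷ f) g = begin
      ev y (scale c g +ₚ (0ℤ ∷ (f *ₚ g)))        ≈⟨ ev-+ (scale c g) (0ℤ ∷ (f *ₚ g)) ⟩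
      ev y (scale c g) + ev y (0ℤ ∷ (f *ₚ g))    ≈⟨ +-cong (ev-scale c g) (trans (ev-∷0 (f *ₚ g)) (*-congˡ (ev-* f g))) ⟩
      ι c * ev y g + y * (ev y f * ev y g)       ≈⟨ solve 4 (λ c g y f → c :* g :+ y :* (f :* g) := (c :+ y :* f) :* g) refl (ι c) (ev y g) y (ev y f) ⟩
      (ι c + y * ev y f) * ev y g                ∎

    ev-const : ∀ c → ev y (constₚ c) ≈ ι c
    ev-const c = trans (+-congˡ (zeroʳ y)) (+-identityʳ _)

    ev-monomial : ∀ n → ev y (monomial n) ≈ y ^ n
    ev-monomial zero    = ev-const 1ℤ
    ev-monomial (suc n) = trans (ev-∷0 (monomial n)) (*-congˡ (ev-monomial n))

    ev-substPow : ∀ r f → ev y (substPow r f) ≈ ev (y ^ r) f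
    ev-substPow r []      = refl
    ev-substPow r (c ∷ f) = begin
      ev y (constₚ c +ₚ (monomial r *ₚ substPow r f))           ≈⟨ ev-+ (constₚ c) (monomial r *ₚ substPow r f) ⟩
      ev y (constₚ c) + ev y (monomial r *ₚ substPow r f)       ≈⟨ +-cong (ev-const c) (trans (ev-* (monomial r) (substPow r f)) (*-cong (ev-monomial r) (ev-substPow r f))) ⟩
      ι c + y ^ r * ev (y ^ r) f                                ∎

    ev-resp : ∀ f g → f ≈ₚ g → ev y f ≈ ev y g
    ev-resp []      []      p = refl
    ev-resp []      (d ∷ g) p = sym (≈0 (d ∷ g) (λ i → ≡.sym (p i)))
      where
      ≈0 : ∀ f → f ≈ₚ [] → ev y f ≈ 0#
      ≈0 []      p = refl
      ≈0 (c ∷ f) p = trans (+-cong (reflexive (≡.cong ι (p 0))) (trans (*-congˡ (≈0 f (λ i → p (suc i)))) (zeroʳ y))) (+-identityˡ 0#)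
    ev-resp (c ∷ f) []      p = trans (+-cong (reflexive (≡.cong ι (p 0))) (trans (*-congˡ (ev-resp f [] (λ i → p (suc i)))) (zeroʳ y))) (+-identityˡ 0#)
    ev-resp (c ∷ f) (d ∷ g) p = +-cong (reflexive (≡.cong ι (p 0))) (*-congˡ (ev-resp f g (λ i → p (suc i))))

-- Sums of invariant functions over free orbits.

module Orbits where

  open import Data.Integer.Base using (+_)
  open import Relation.Binary.PropositionalEquality
  open Sums

  argmin : ∀ {n} → 1 ℕ.≤ n → (f : Fin n → ℕ) → ∃ λ i → ∀ j → f i ℕ.≤ f j
  argmin {suc zero}    _ f = Fin.zero , λ { Fin.zero → ℕₚ.≤-refl }
  argmin {suc (suc n)} _ f with argmin (ℕ.s≤s ℕ.z≤n) (λ i → f (Fin.suc i))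
  ... | i , p with ℕₚ.≤-total (f Fin.zero) (f (Fin.suc i))
  ...   | inj₁ q = Fin.zero , λ { Fin.zero → ℕₚ.≤-refl ; (Fin.suc j) → ℕₚ.≤-trans q (p j) }
  ...   | inj₂ q = Fin.suc i , λ { Fin.zero → q ; (Fin.suc j) → p j }

  -- Every orbit is represented by its least point.
  module _ {v n} (1≤n : 1 ℕ.≤ n) (T S : Fin n → Fin v → Fin v)
    (ST : ∀ i x → S i (T i x) ≡ x) (TS : ∀ i x → T i (S i x) ≡ x)
    (closed : ∀ i j x → ∃ λ l → T j (T i x) ≡ T l x)
    (transitive : ∀ i j x → ∃ λ l → T l (T i x) ≡ T j x)
    (f : Fin v → ℤ) (invariant : ∀ i x → f (T i x) ≡ f x)
    (free : ∀ x → f x ≢ 0ℤ → ∀ i j → T i x ≡ T j x → i ≡ j)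
    where

    private
      least? : ∀ x → Dec (∀ j → toℕ x ℕ.≤ toℕ (T j x))
      least? x = Finₚ.all? (λ j → toℕ x ℕₚ.≤? toℕ (T j x))

      unique : ∀ x → f x ≢ 0ℤ → sum (λ i → ⟦ least? (T i x) ⟧) ≡ 1ℤ
      unique x fx≢0 = go (argmin 1≤n (λ i → toℕ (T i x)))
        where
        go : (∃ λ i → ∀ j → toℕ (T i x) ℕ.≤ toℕ (T j x)) → sum (λ i → ⟦ least? (T i x) ⟧) ≡ 1ℤ
        go (i , p) = trans (sum-single (λ i → ⟦ least? (T i x) ⟧) i (λ k k≢i → ⟦no⟧ (least? (T k x)) (λ q → k≢i (free x fx≢0 k i (same k q)))))
          (⟦yes⟧ (least? (T i x)) (λ j → subst (λ z → toℕ (T i x) ℕ.≤ toℕ z) (sym (proj₂ (closed i j x))) (p (proj₁ (closed i j x)))))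
          where
          same : ∀ k → (∀ j → toℕ (T k x) ℕ.≤ toℕ (T j (T k x))) → T k x ≡ T i x
          same k q = Finₚ.toℕ-injective (ℕₚ.≤-antisym (subst (λ z → toℕ (T k x) ℕ.≤ toℕ z) (proj₂ (transitive k i x)) (q (proj₁ (transitive k i x)))) (p k))

    orbit-sum : ∃ λ c → sum f ≡ + n ℤ.* c
    orbit-sum = sum (λ y → f y ℤ.* ⟦ least? y ⟧) , (begin
      sum f                                                        ≡⟨ sum-cong spread ⟩
      sum (λ x → sum (λ i → f x ℤ.* ⟦ least? (T i x) ⟧))           ≡⟨ ∑-comm (λ x i → f x ℤ.* ⟦ least? (T i x) ⟧) ⟩
      sum (λ i → sum (λ x → f x ℤ.* ⟦ least? (T i x) ⟧))           ≡⟨ sum-cong (λ i → trans (sum-cong (λ x → cong (ℤ._* ⟦ least? (T i x) ⟧) (sym (invariant i x))))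
                                                                       (sum-reindex (T i) (S i) (ST i) (TS i) (λ y → f y ℤ.* ⟦ least? y ⟧))) ⟩
      sum {n} (λ _ → sum (λ y → f y ℤ.* ⟦ least? y ⟧))         ≡⟨ sum-const n (sum (λ y → f y ℤ.* ⟦ least? y ⟧)) ⟩
      + n ℤ.* sum (λ y → f y ℤ.* ⟦ least? y ⟧)                 ∎)
      where
      open ≡-Reasoning
      -- Freeness is assumed only where f is non-zero. Elsewhere the number of least points met
      -- along the orbit is multiplied by 0.
      spread : ∀ x → f x ≡ sum (λ i → f x ℤ.* ⟦ least? (T i x) ⟧)
      spread x = trans (decide (f x ℤₚ.≟ 0ℤ)) (sym (sum-*ˡ (f x) (λ i → ⟦ least? (T i x) ⟧)))
        where
        decide : Dec (f x ≡ 0ℤ) → f x ≡ f x ℤ.* sum (λ i → ⟦ least? (T i x) ⟧)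
        decide (yes p) = trans p (sym (trans (cong (ℤ._* sum (λ i → ⟦ least? (T i x) ⟧)) p) (ℤₚ.*-zeroˡ (sum (λ i → ⟦ least? (T i x) ⟧)))))
        decide (no  p) = sym (trans (cong (f x ℤ.*_) (unique x p)) (ℤₚ.*-identityʳ (f x)))

-- A bound for Euler's function by counting the integers prime to a list of primes.

module Totient where

  open import Data.Nat.Base
  open import Data.Nat.Properties
  open import Data.Nat.Divisibility
  open import Data.Nat.GCD using (gcd-greatest)
  open import Data.Nat.Tactic.RingSolver using (solve-∀)
  open import Data.List.Base using (filter; upTo)
  open import Data.List.Relation.Unary.All using ([]; _∷_; all?)
  open import Data.List.Relation.Unary.AllPairs using ([]; _∷_)
  open import Relation.Unary using (Decidable)
  open import Relation.Binary.PropositionalEquality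
  open import Defs using (φ)
  open Arith

  bit : ∀ {P : Set} → Dec P → ℕ
  bit (yes _) = 1
  bit (no _)  = 0

  bit-mono : ∀ {P Q : Set} (p : Dec P) (q : Dec Q) → (P → Q) → bit p ≤ bit q
  bit-mono (yes p) (yes _) f = ≤-refl
  bit-mono (yes p) (no ¬q) f = contradiction (f p) ¬q
  bit-mono (no _)  q       f = z≤n

  bit-no : ∀ {P : Set} (p : Dec P) → ¬ P → bit p ≡ 0
  bit-no (yes p) ¬p = contradiction p ¬p
  bit-no (no _)  _  = refl

  bit-cong : ∀ {P Q : Set} (p : Dec P) (q : Dec Q) → (P → Q) → (Q → P) → bit p ≡ bit q
  bit-cong p q f g = ≤-antisym (bit-mono p q f) (bit-mono q p g)

  count : ∀ {P : ℕ → Set} → Decidable P → ℕ → ℕ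
  count P? zero    = 0
  count P? (suc n) = count P? n + bit (P? (suc n))

  count-mono : ∀ {P Q : ℕ → Set} (P? : Decidable P) (Q? : Decidable Q) n → (∀ i → i ≤ n → P i → Q i) → count P? n ≤ count Q? n
  count-mono P? Q? zero    f = z≤n
  count-mono P? Q? (suc n) f = +-mono-≤ (count-mono P? Q? n (λ i i≤n → f i (m≤n⇒m≤1+n i≤n))) (bit-mono (P? (suc n)) (Q? (suc n)) (f (suc n) ≤-refl))

  length-filter : ∀ {P : ℕ → Set} (P? : Decidable P) n → length (filter P? (map suc (upTo n))) ≡ count P? n
  length-filter P? zero    = refl
  length-filter P? (suc n) = trans (cong (λ cs → length (filter P? (map suc cs))) (sym (Listₚ.upTo-∷ʳ n)))
    (trans (cong (λ cs → length (filter P? cs)) (Listₚ.map-++ suc (upTo n) (n ∷ []))) (trans (cong length (Listₚ.filter-++ P? (map suc (upTo n)) (suc n ∷ [])))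
    (trans (Listₚ.length-++ (filter P? (map suc (upTo n)))) (cong₂ _+_ (length-filter P? n) (last (suc n))))))
    where
    last : ∀ c → length (filter P? (c ∷ [])) ≡ bit (P? c)
    last c with P? c
    ... | yes _ = refl
    ... | no  _ = refl

  φ≡count : ∀ u → φ u ≡ count (λ i → gcd i u ≟ 1) u
  φ≡count u = length-filter (λ i → gcd i u ≟ 1) u

  1≤φ : ∀ u → 1 ≤ u → 1 ≤ φ u
  1≤φ u 1≤u = subst (1 ≤_) (sym (φ≡count u)) (go u 1≤u)
    where
    Q = λ i → gcd i u ≟ 1
    gcd1 : gcd 1 u ≡ 1
    gcd1 = Data.Nat.GCD.gcd-zeroˡ u
    go : ∀ n → 1 ≤ n → 1 ≤ count Q n
    go (suc zero)    _ = ≤-reflexive (sym (bit-cong (Q 1) (yes gcd1) (λ p → p) (λ p → p)))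
    go (suc (suc n)) _ = m≤n⇒m≤n+o (bit (Q (suc (suc n)))) (go (suc n) (s≤s z≤n))

  Avoids : List ℕ → ℕ → Set
  Avoids L i = All (λ q → ¬ (q ∣ i)) L

  avoids? : ∀ L → Decidable (Avoids L)
  avoids? L i = all? (λ q → ¬? (q ∣? i)) L

  module _ {q} (pr : Prime q) {L} (primes : All Prime L) (distinct : All (q ≢_) L) where
    private
      multiple? : Decidable (λ i → q ∣ i × Avoids L i)
      multiple? i = (q ∣? i) ×-dec avoids? L i

      split : ∀ n → count (avoids? (q ∷ L)) n + count multiple? n ≡ count (avoids? L) n
      split zero    = refl
      split (suc n) = trans (rearrange (count (avoids? (q ∷ L)) n) (bit (avoids? (q ∷ L) (suc n))) (count multiple? n) (bit (multiple? (suc n))))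
        (cong₂ _+_ (split n) (one (suc n)))
        where
        rearrange : ∀ a b c d → (a + b) + (c + d) ≡ (a + c) + (b + d)
        rearrange = solve-∀
        one : ∀ i → bit (avoids? (q ∷ L) i) + bit (multiple? i) ≡ bit (avoids? L i)
        one i = decide (q ∣? i)
          where
          decide : Dec (q ∣ i) → bit (avoids? (q ∷ L) i) + bit (multiple? i) ≡ bit (avoids? L i)
          decide (yes d) = cong₂ _+_ (bit-no (avoids? (q ∷ L) i) λ { (¬d ∷ _) → ¬d d }) (bit-cong (multiple? i) (avoids? L i) proj₂ (d ,_))
          decide (no ¬d) = trans (cong₂ _+_ (bit-cong (avoids? (q ∷ L) i) (avoids? L i) (λ { (_ ∷ a) → a }) (¬d ∷_)) (bit-no (multiple? i) λ { (d , _) → ¬d d })) (+-identityʳ _)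

      skip : ∀ k j → j < q → count multiple? (j + k * q) ≡ count multiple? (k * q)
      skip k zero    _   = refl
      skip k (suc j) j<q = trans (cong (_+ bit (multiple? (suc j + k * q))) (skip k j (<⇒≤ j<q)))
        (trans (cong (count multiple? (k * q) +_) (bit-no (multiple? (suc j + k * q)) not)) (+-identityʳ _))
        where
        not : ¬ (q ∣ suc j + k * q × Avoids L (suc j + k * q))
        not (d , _) = <⇒≱ j<q (∣⇒≤ (∣m+n∣m⇒∣n (subst (q ∣_) (+-comm (suc j) (k * q)) d) (n∣m*n k)))

      -- The bijection is i ↦ q i: multiplying by a prime outside L does not affect divisibility by
      -- the primes in L.
      multiples : ∀ k → count multiple? (k * q) ≡ count (avoids? L) k
      multiples zero    = refl
      multiples (suc k) = trans (cong (count multiple?) (sym sucpred)) (cong₂ _+_ (trans (skip k (pred q) (≤-reflexive suc-pred-q)) (multiples k))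
        (bit-cong (multiple? (suc (pred q + k * q))) (avoids? L (suc k)) to from))
        where
        suc-pred-q : suc (pred q) ≡ q
        suc-pred-q = suc-pred q {{prime⇒nonZero pr}}
        sucpred : suc (pred q + k * q) ≡ suc k * q
        sucpred = cong (_+ k * q) suc-pred-q
        to : q ∣ suc (pred q + k * q) × Avoids L (suc (pred q + k * q)) → Avoids L (suc k)
        to (_ , a) = All.map (λ {p} p∤ p∣ → p∤ (subst (p ∣_) (sym sucpred) (∣-trans p∣ (m∣m*n q)))) a
        from : Avoids L (suc k) → q ∣ suc (pred q + k * q) × Avoids L (suc (pred q + k * q))
        from a = subst (q ∣_) (sym sucpred) (n∣m*n (suc k)) , All.zipWith (λ { {p} ((pp , q≢p) , p∤) p∣ → stay p pp q≢p p∤ (subst (p ∣_) sucpred p∣) }) (All.zip (primes , distinct) , a)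
          where
          stay : ∀ p → Prime p → q ≢ p → ¬ (p ∣ suc k) → ¬ (p ∣ suc k * q)
          stay p pp q≢p p∤ p∣ with euclidsLemma (suc k) q pp p∣
          ... | inj₁ d = p∤ d
          ... | inj₂ d = q≢p (sym (prime∣prime⇒≡ pp pr d))

    count-avoids-∷ : ∀ k → count (avoids? (q ∷ L)) (k * q) + count (avoids? L) k ≡ count (avoids? L) (k * q)
    count-avoids-∷ k = trans (cong (count (avoids? (q ∷ L)) (k * q) +_) (sym (multiples k))) (split (k * q))

  -- The density ∏ (1 - 1/q) with denominators cleared. The free factor k is there for the
  -- induction, which uses the shorter list at both k and k q.
  count-avoids : ∀ {L} → All Prime L → AllPairs _≢_ L → ∀ k → count (avoids? L) (k * product L) * product L ≡ k * product L * product (map pred L)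
  count-avoids []       _        k = cong (_* 1) (all-count (k * 1))
    where
    all-count : ∀ n → count (avoids? []) n ≡ n
    all-count zero    = refl
    all-count (suc n) = trans (cong (_+ 1) (all-count n)) (+-comm n 1)
  count-avoids {q ∷ L} (pr ∷ ps) (d ∷ ds) k = +-cancelʳ-≡ (q * (b * P)) (a * (q * P)) _ (begin
      a * (q * P) + q * (b * P)                         ≡⟨ lemma₁ a b q P ⟩
      q * ((a + b) * P)                                 ≡⟨ cong (λ z → q * (z * P)) (trans (cong (λ z → count (avoids? (q ∷ L)) z + b) n≡) (trans (count-avoids-∷ pr ps d (k * P)) (cong (count (avoids? L)) (lemma₂ k P q)))) ⟩
      q * (count (avoids? L) (k * q * P) * P)           ≡⟨ cong (q *_) (count-avoids ps ds (k * q)) ⟩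
      q * (k * q * P * R)                               ≡⟨ cong (λ z → z * (k * q * P * R)) (sym (suc-pred q {{prime⇒nonZero pr}})) ⟩
      suc (pred q) * (k * q * P * R)                    ≡⟨ lemma₃ (pred q) k q P R ⟩
      k * (q * P) * (pred q * R) + q * (k * P * R)      ≡⟨ cong (λ z → k * (q * P) * (pred q * R) + q * z) (count-avoids ps ds k) ⟨
      k * (q * P) * (pred q * R) + q * (b * P)          ∎)
    where
    open ≡-Reasoning
    P = product L
    R = product (map pred L)
    a = count (avoids? (q ∷ L)) (k * (q * P))
    b = count (avoids? L) (k * P)
    n≡ : k * (q * P) ≡ k * P * q
    n≡ = trans (cong (k *_) (*-comm q P)) (sym (*-assoc k P q))
    lemma₁ : ∀ a b q P → a * (q * P) + q * (b * P) ≡ q * ((a + b) * P)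
    lemma₁ = solve-∀
    lemma₂ : ∀ k P q → k * P * q ≡ k * q * P
    lemma₂ = solve-∀
    lemma₃ : ∀ r k q P R → suc r * (k * q * P * R) ≡ k * (q * P) * (r * R) + q * (k * P * R)
    lemma₃ = solve-∀

  product∣ : ∀ {L n} → All Prime L → AllPairs _≢_ L → All (_∣ n) L → product L ∣ n
  product∣ []       _        _        = 1∣ _
  product∣ {q ∷ L} {n} (pr ∷ ps) (d ∷ ds) (q∣n ∷ ∣n) with product∣ {L} {n} ps ds ∣n
  ... | divides c n≡ = ∣-trans (*-monoˡ-∣ (product L) (coprime-divisor (coprime-product pr ps d) (subst (q ∣_) (trans n≡ (*-comm c (product L))) q∣n))) (divides 1 (trans n≡ (sym (*-identityˡ _))))

  -- φ(u)/u ≤ ∏ (1 - 1/q) over the primes q dividing u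
  φ-bound : ∀ u → 1 ≤ u → φ u * product (primes u) ≤ u * product (map pred (primes u))
  φ-bound u 1≤u = bound (product∣ (primes-prime u) (primes-distinct u) (All.tabulate (λ q∈ → proj₂ (∈primes⁻ {u} q∈))))
    where
    L = primes u
    P = product L
    bound : P ∣ u → φ u * P ≤ u * product (map pred L)
    bound (divides k u≡) = begin
      φ u * P                                   ≤⟨ *-monoˡ-≤ P (≤-trans (≤-reflexive (φ≡count u)) (count-mono (λ i → gcd i u ≟ 1) (avoids? L) u coprime⇒avoids)) ⟩
      count (avoids? L) u * P                   ≡⟨ cong (λ z → count (avoids? L) z * P) u≡ ⟩
      count (avoids? L) (k * P) * P             ≡⟨ count-avoids (primes-prime u) (primes-distinct u) k ⟩
      k * P * product (map pred L)              ≡⟨ cong (_* product (map pred L)) u≡ ⟨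
      u * product (map pred L)                  ∎
      where
      open ≤-Reasoning
      coprime⇒avoids : ∀ i → i ≤ u → gcd i u ≡ 1 → Avoids L i
      coprime⇒avoids i _ g = All.tabulate (λ {q} q∈ q∣i → prime∤1 (proj₁ (∈primes⁻ {u} q∈)) (subst (q ∣_) g (gcd-greatest q∣i (proj₂ (∈primes⁻ {u} q∈)))))

-- Integer congruences: Fermat's theorem and lifting to prime powers.

module Congruences where

  open import Data.Integer.Base using (+_)
  open import Relation.Binary.PropositionalEquality
  open import Defs using (_≡ᵐ_[mod_])
  open Arith

  module K = RingKit ℤₚ.+-*-commutativeRing
  open K.Solver

  private
    signed : ∀ n z → n ∣ ℤ.∣ z ∣ → ∃ λ c → z ≡ + n ℤ.* c
    signed n (+ a)    (divides c eq) = + c , trans (cong +_ (trans eq (ℕₚ.*-comm c n))) (ℤₚ.pos-* n c)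
    signed n -[1+ a ] (divides c eq) = ℤ.- (+ c) , trans (cong (λ k → ℤ.- (+ k)) (trans eq (ℕₚ.*-comm c n))) (trans (cong ℤ.-_ (ℤₚ.pos-* n c)) (ℤₚ.neg-distribʳ-* (+ n) (+ c)))

  to-≡ : ∀ {x y n} → x ≡ᵐ y [mod n ] → x K.≡ y [ + n ]
  to-≡ {x} {y} {n} d = K.diff (proj₁ (signed n (x ℤ.- y) d)) (trans (solve 2 (λ x y → x := y :+ (x :- y)) refl x y) (cong (ℤ._+_ y) (proj₂ (signed n (x ℤ.- y) d))))

  from-≡ : ∀ {x y n} → x K.≡ y [ + n ] → x ≡ᵐ y [mod n ]
  from-≡ {x} {y} {n} (K.diff c eq) = divides ℤ.∣ c ∣ (trans (cong ℤ.∣_∣ (trans (cong (ℤ._- y) eq) (solve 2 (λ y z → (y :+ z) :- y := z) refl y (+ n ℤ.* c))))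
    (trans (ℤₚ.abs-* (+ n) c) (ℕₚ.*-comm n ℤ.∣ c ∣)))

  ^≡^ : ∀ x n → x ℤ.^ n ≡ x K.^ n
  ^≡^ x zero    = refl
  ^≡^ x (suc n) = cong (x ℤ.*_) (^≡^ x n)

  pos-^ : ∀ r n → + (r ℕ.^ n) ≡ (+ r) K.^ n
  pos-^ r zero    = refl
  pos-^ r (suc n) = trans (ℤₚ.pos-* r (r ℕ.^ n)) (cong ((+ r) ℤ.*_) (pos-^ r n))

  ≡-∣ : ∀ {m n x y} → m ∣ n → x K.≡ y [ + n ] → x K.≡ y [ + m ]
  ≡-∣ {m} (divides k eq) = K.≡-weaken (K.quot (+ k) (trans (cong +_ (trans eq (ℕₚ.*-comm k m))) (ℤₚ.pos-* m k)))

  ι≡ : ∀ z → K.ι z ≡ z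
  ι≡ (+ n) = nat n
    where
    nat : ∀ n → n K.· 1ℤ ≡ + n
    nat zero    = refl
    nat (suc n) = trans (K.1+× n 1ℤ) (cong (ℤ._+_ 1ℤ) (nat n))
  ι≡ -[1+ n ] = cong ℤ.-_ (ι≡ (+ suc n))

  fermat : ∀ {p} → Prime p → ∀ c → (+ c) K.^ p K.≡ + c [ + p ]
  fermat {p} pr zero    = K.≡-refl (trans (cong ((+ 0) K.^_) (sym (ℕₚ.suc-pred p {{prime⇒nonZero pr}}))) (ℤₚ.*-zeroˡ ((+ 0) K.^ ℕ.pred p)))
  fermat {p} pr (suc c) = K.≡-trans (subst (λ z → (1ℤ ℤ.+ + c) K.^ p K.≡ 1ℤ K.^ p ℤ.+ (+ c) K.^ p [ z ]) (ι≡ (+ p)) (K.freshman pr 1ℤ (+ c)))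
    (K.≡-+ (K.≡-refl (K.1^n≈1 p)) (fermat pr c))

  fermat-^ : ∀ {p} → Prime p → ∀ i c → (+ c) K.^ (p ℕ.^ i) K.≡ + c [ + p ]
  fermat-^ pr zero    c = K.≡-refl (ℤₚ.*-identityʳ (+ c))
  fermat-^ {p} pr (suc i) c = K.≡-trans (K.≡-refl (trans (cong ((+ c) K.^_) (ℕₚ.*-comm p (p ℕ.^ i))) (sym (K.^-assocʳ (+ c) (p ℕ.^ i) p))))
    (K.≡-trans (K.≡-^ p (fermat-^ pr i c)) (fermat pr c))

  -- (xᵖ - 1)/(x - 1) = 1 + x + … + xᵖ⁻¹ ≡ p (mod x - 1)
  lift-≡1 : ∀ {p x} i → x K.≡ 1ℤ [ + p ] → x K.^ (p ℕ.^ i) K.≡ 1ℤ [ + (p ℕ.^ suc i) ]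
  lift-≡1 {p} {x} zero    h = subst (λ z → x K.^ 1 K.≡ 1ℤ [ + z ]) (sym (ℕₚ.*-identityʳ p)) (K.≡-trans (K.≡-refl (ℤₚ.*-identityʳ x)) h)
  lift-≡1 {p} {x} (suc i) h = step (lift-≡1 i h)
    where
    y = x K.^ (p ℕ.^ i)
    step : y K.≡ 1ℤ [ + (p ℕ.^ suc i) ] → x K.^ (p ℕ.^ suc i) K.≡ 1ℤ [ + (p ℕ.^ suc (suc i)) ]
    step y≡1@(K.diff c eq) = go (K.≡0⇒∣ (K.≡-trans (Ramified.geo-≡ ℤₚ.+-*-commutativeRing y p (≡-∣ (ℕ∣.m∣m*n (p ℕ.^ i)) y≡1))
        (K.≡-trans (K.≡-refl (ι≡ (+ p))) (K.∣⇒≡0 (K.quot 1ℤ (sym (ℤₚ.*-identityʳ (+ p))))))))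
      where
      geo = Ramified.geo ℤₚ.+-*-commutativeRing y p
      go : + p K.∣∣ geo → x K.^ (p ℕ.^ suc i) K.≡ 1ℤ [ + (p ℕ.^ suc (suc i)) ]
      go (K.quot d eq′) = K.diff (c ℤ.* d) (begin
        x K.^ (p ℕ.^ suc i)                            ≡⟨ trans (cong (x K.^_) (ℕₚ.*-comm p (p ℕ.^ i))) (sym (K.^-assocʳ x (p ℕ.^ i) p)) ⟩
        y K.^ p                                        ≡⟨ solve 1 (λ z → z := con 1ℤ :+ (z :- con 1ℤ)) refl (y K.^ p) ⟩
        1ℤ ℤ.+ (y K.^ p ℤ.- 1ℤ)                        ≡⟨ cong (ℤ._+_ 1ℤ) (Ramified.geo-* ℤₚ.+-*-commutativeRing y p) ⟨
        1ℤ ℤ.+ (y ℤ.- 1ℤ) ℤ.* geo                      ≡⟨ cong (ℤ._+_ 1ℤ) (cong₂ ℤ._*_ (trans (cong (ℤ._- 1ℤ) eq) (solve 1 (λ z → (con 1ℤ :+ z) :- con 1ℤ := z) refl (+ (p ℕ.^ suc i) ℤ.* c))) eq′) ⟩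
        1ℤ ℤ.+ (+ (p ℕ.^ suc i) ℤ.* c) ℤ.* (+ p ℤ.* d) ≡⟨ cong (ℤ._+_ 1ℤ) (solve 4 (λ q c p d → (q :* c) :* (p :* d) := (p :* q) :* (c :* d)) refl (+ (p ℕ.^ suc i)) c (+ p) d) ⟩
        1ℤ ℤ.+ (+ p ℤ.* + (p ℕ.^ suc i)) ℤ.* (c ℤ.* d) ≡⟨ cong (λ z → 1ℤ ℤ.+ z ℤ.* (c ℤ.* d)) (ℤₚ.pos-* p (p ℕ.^ suc i)) ⟨
        1ℤ ℤ.+ + (p ℕ.^ suc (suc i)) ℤ.* (c ℤ.* d)     ∎)
        where open ≡-Reasoning

  ≡⇒≅ : ∀ {a b n} → + a K.≡ + b [ + n ] → a ≅ b [ n ]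
  ≡⇒≅ h = ≡ᵐ⇒≅ (from-≡ h)

-- The group ring ℤ[G].

module _ {v} (G : FinAbGroup v) where

  module GroupRing where

    open import Data.Integer.Base using (+_; _+_; _*_; -_)
    open import Data.Integer.Properties hiding (_≟_)
    open import Data.Integer.Tactic.RingSolver using (solve-∀)
    open import Relation.Binary.PropositionalEquality
    open Sums
    open ≡-Reasoning

    open FinAbGroup G public

    idʳ : ∀ x → x ∙ e ≡ x
    idʳ x = trans (comm x e) (idˡ x)

    invʳ : ∀ x → x ∙ inv x ≡ e
    invʳ x = trans (comm x (inv x)) (invˡ x)

    inv-∙-cancel : ∀ x y → inv x ∙ (x ∙ y) ≡ y
    inv-∙-cancel x y = trans (sym (assoc _ x y)) (trans (cong (_∙ y) (invˡ x)) (idˡ y))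

    ∙-inv-cancel : ∀ x y → x ∙ (inv x ∙ y) ≡ y
    ∙-inv-cancel x y = trans (sym (assoc x _ y)) (trans (cong (_∙ y) (invʳ x)) (idˡ y))

    ∙-cancelˡ : ∀ x {y z} → x ∙ y ≡ x ∙ z → y ≡ z
    ∙-cancelˡ x {y} {z} p = trans (sym (inv-∙-cancel x y)) (trans (cong (inv x ∙_) p) (inv-∙-cancel x z))

    inv-unique : ∀ x y → x ∙ y ≡ e → y ≡ inv x
    inv-unique x y p = trans (sym (inv-∙-cancel x y)) (trans (cong (inv x ∙_) p) (idʳ _))

    inv-inv : ∀ x → inv (inv x) ≡ x
    inv-inv x = sym (inv-unique (inv x) x (invˡ x))

    swap∙ : ∀ a b c d → (a ∙ b) ∙ (c ∙ d) ≡ (a ∙ c) ∙ (b ∙ d)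
    swap∙ a b c d = begin
      (a ∙ b) ∙ (c ∙ d)  ≡⟨ assoc a b _ ⟩
      a ∙ (b ∙ (c ∙ d))  ≡⟨ cong (a ∙_) (trans (sym (assoc b c d)) (trans (cong (_∙ d) (comm b c)) (assoc c b d))) ⟩
      a ∙ (c ∙ (b ∙ d))  ≡⟨ assoc a c _ ⟨
      (a ∙ c) ∙ (b ∙ d)  ∎

    inv-∙ : ∀ x y → inv (x ∙ y) ≡ inv x ∙ inv y
    inv-∙ x y = sym (inv-unique (x ∙ y) _ (trans (swap∙ x y (inv x) (inv y)) (trans (cong₂ _∙_ (invʳ x) (invʳ y)) (idˡ e))))

    inv-e : inv e ≡ e
    inv-e = sym (inv-unique e e (idˡ e))

    pow-+ : ∀ g m n → pow g (m ℕ.+ n) ≡ pow g m ∙ pow g n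
    pow-+ g zero    n = sym (idˡ _)
    pow-+ g (suc m) n = trans (cong (g ∙_) (pow-+ g m n)) (sym (assoc g _ _))

    pow-∙ : ∀ g h n → pow (g ∙ h) n ≡ pow g n ∙ pow h n
    pow-∙ g h zero    = sym (idˡ e)
    pow-∙ g h (suc n) = trans (cong ((g ∙ h) ∙_) (pow-∙ g h n)) (swap∙ g h _ _)

    pow-e : ∀ n → pow e n ≡ e
    pow-e zero    = refl
    pow-e (suc n) = trans (idˡ _) (pow-e n)

    pow-* : ∀ g m n → pow g (m ℕ.* n) ≡ pow (pow g m) n
    pow-* g m zero    = cong (pow g) (ℕₚ.*-zeroʳ m)
    pow-* g m (suc n) = trans (cong (pow g) (ℕₚ.*-suc m n)) (trans (pow-+ g m (m ℕ.* n)) (cong (pow g m ∙_) (pow-* g m n)))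

    pow-inv : ∀ g n → pow (inv g) n ≡ inv (pow g n)
    pow-inv g zero    = sym inv-e
    pow-inv g (suc n) = trans (cong (inv g ∙_) (pow-inv g n)) (sym (inv-∙ g _))

    pow-1 : ∀ g → pow g 1 ≡ g
    pow-1 g = idʳ g

    -- Elements of ℤ[G] are compared through their pairings with test functions, so that identities between convolutions become reindexings.

    infix 4 _≈_
    record _≈_ (f g : Fin v → ℤ) : Set where
      constructor pointwise
      field at : ∀ x → f x ≡ g x
    open _≈_ public

    ⟨_,_⟩ : (Fin v → ℤ) → (Fin v → ℤ) → ℤ
    ⟨ f , T ⟩ = sum (λ x → f x * T x)

    opaque

      δ : Fin v → Fin v → ℤ
      δ g h = ⟦ h ≟ g ⟧

      infixl 7 _⋆_
      _⋆_ : (Fin v → ℤ) → (Fin v → ℤ) → Fin v → ℤ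
      (f ⋆ g) h = sum (λ x → sum (λ y → f x * g y * ⟦ h ≟ x ∙ y ⟧))

      -- The linear extension of φ to ℤ[G]: coefficients are added up along the fibres of φ. Power
      -- maps, inversion and the projection onto U all act through it.
      push : (Fin v → Fin v) → (Fin v → ℤ) → Fin v → ℤ
      push φ f h = sum (λ x → f x * ⟦ h ≟ φ x ⟧)

      δ-def : ∀ g h → δ g h ≡ ⟦ h ≟ g ⟧
      δ-def g h = refl

      ⋆-def : ∀ f g h → (f ⋆ g) h ≡ sum (λ x → sum (λ y → f x * g y * ⟦ h ≟ x ∙ y ⟧))
      ⋆-def f g h = refl

      push-def : ∀ φ f h → push φ f h ≡ sum (λ x → f x * ⟦ h ≟ φ x ⟧)
      push-def φ f h = refl

    ⟨⟩-congʳ : ∀ f {S T} → (∀ x → S x ≡ T x) → ⟨ f , S ⟩ ≡ ⟨ f , T ⟩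
    ⟨⟩-congʳ f p = sum-cong (λ x → cong (f x *_) (p x))

    ⟨⟩-congˡ : ∀ {f g} T → f ≈ g → ⟨ f , T ⟩ ≡ ⟨ g , T ⟩
    ⟨⟩-congˡ T p = sum-cong (λ x → cong (_* T x) (at p x))

    ⟨,⟦≟⟧⟩ : ∀ f h → ⟨ f , (λ x → ⟦ x ≟ h ⟧) ⟩ ≡ f h
    ⟨,⟦≟⟧⟩ f h = sum-⟦≟⟧ f h

    ⟨⟩-ext : ∀ {f g} → (∀ T → ⟨ f , T ⟩ ≡ ⟨ g , T ⟩) → f ≈ g
    ⟨⟩-ext {f} {g} p = pointwise λ h → trans (sym (⟨,⟦≟⟧⟩ f h)) (trans (p _) (⟨,⟦≟⟧⟩ g h))

    private
      *-sum : ∀ {n} (a : ℤ) (f : Fin n → ℤ) → a * sum f ≡ sum (λ x → a * f x)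
      *-sum a f = sym (sum-*ˡ a f)

    ⟨δ,⟩ : ∀ g T → ⟨ δ g , T ⟩ ≡ T g
    ⟨δ,⟩ g T = trans (sum-cong (λ x → trans (*-comm _ (T x)) (cong (T x *_) (δ-def g x)))) (sum-⟦≟⟧ T g)

    ⟨push,⟩ : ∀ φ f T → ⟨ push φ f , T ⟩ ≡ ⟨ f , (λ x → T (φ x)) ⟩
    ⟨push,⟩ φ f T = begin
      sum (λ h → push φ f h * T h)                                ≡⟨ sum-cong (λ h → trans (cong (_* T h) (push-def φ f h)) (sym (sum-*ʳ (T h) (λ x → f x * ⟦ h ≟ φ x ⟧)))) ⟩
      sum (λ h → sum (λ x → f x * ⟦ h ≟ φ x ⟧ * T h))             ≡⟨ ∑-comm (λ h x → f x * ⟦ h ≟ φ x ⟧ * T h) ⟩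
      sum (λ x → sum (λ h → f x * ⟦ h ≟ φ x ⟧ * T h))             ≡⟨ sum-cong (λ x → trans (sum-cong (λ h → lemma (f x) ⟦ h ≟ φ x ⟧ (T h))) (sum-*ˡ (f x) (λ h → T h * ⟦ h ≟ φ x ⟧))) ⟩
      sum (λ x → f x * sum (λ h → T h * ⟦ h ≟ φ x ⟧))             ≡⟨ sum-cong (λ x → cong (f x *_) (sum-⟦≟⟧ T (φ x))) ⟩
      sum (λ x → f x * T (φ x))                                   ∎
      where
      lemma : ∀ a b c → a * b * c ≡ a * (c * b)
      lemma = solve-∀

    ⟨⋆,⟩ : ∀ f g T → ⟨ f ⋆ g , T ⟩ ≡ ⟨ f , (λ x → ⟨ g , (λ y → T (x ∙ y)) ⟩) ⟩
    ⟨⋆,⟩ f g T = begin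
      sum (λ h → (f ⋆ g) h * T h)
        ≡⟨ sum-cong (λ h → trans (cong (_* T h) (⋆-def f g h)) (trans (sym (sum-*ʳ (T h) (λ x → sum (λ y → f x * g y * ⟦ h ≟ x ∙ y ⟧)))) (sum-cong (λ x → sym (sum-*ʳ (T h) (λ y → f x * g y * ⟦ h ≟ x ∙ y ⟧)))))) ⟩
      sum (λ h → sum (λ x → sum (λ y → f x * g y * ⟦ h ≟ x ∙ y ⟧ * T h)))
        ≡⟨ ∑-comm (λ h x → sum (λ y → f x * g y * ⟦ h ≟ x ∙ y ⟧ * T h)) ⟩
      sum (λ x → sum (λ h → sum (λ y → f x * g y * ⟦ h ≟ x ∙ y ⟧ * T h)))
        ≡⟨ sum-cong (λ x → ∑-comm (λ h y → f x * g y * ⟦ h ≟ x ∙ y ⟧ * T h)) ⟩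
      sum (λ x → sum (λ y → sum (λ h → f x * g y * ⟦ h ≟ x ∙ y ⟧ * T h)))
        ≡⟨ sum-cong (λ x → sum-cong (λ y → trans (sum-cong (λ h → lemma (f x) (g y) ⟦ h ≟ x ∙ y ⟧ (T h))) (trans (sum-*ˡ (f x * g y) (λ h → T h * ⟦ h ≟ x ∙ y ⟧)) (cong (f x * g y *_) (sum-⟦≟⟧ T (x ∙ y)))))) ⟩
      sum (λ x → sum (λ y → f x * g y * T (x ∙ y)))
        ≡⟨ sum-cong (λ x → trans (sum-cong (λ y → *-assoc (f x) (g y) (T (x ∙ y)))) (sum-*ˡ (f x) (λ y → g y * T (x ∙ y)))) ⟩
      sum (λ x → f x * sum (λ y → g y * T (x ∙ y)))               ∎
      where
      lemma : ∀ a b c d → a * b * c * d ≡ a * b * (d * c)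
      lemma = solve-∀

    ⟨⟩-swap : ∀ f g (T : Fin v → Fin v → ℤ) → ⟨ f , (λ x → ⟨ g , T x ⟩) ⟩ ≡ ⟨ g , (λ y → ⟨ f , (λ x → T x y) ⟩) ⟩
    ⟨⟩-swap f g T = begin
      sum (λ x → f x * sum (λ y → g y * T x y))    ≡⟨ sum-cong (λ x → *-sum (f x) (λ y → g y * T x y)) ⟩
      sum (λ x → sum (λ y → f x * (g y * T x y)))  ≡⟨ ∑-comm (λ x y → f x * (g y * T x y)) ⟩
      sum (λ y → sum (λ x → f x * (g y * T x y)))  ≡⟨ sum-cong (λ y → sum-cong (λ x → lemma (f x) (g y) (T x y))) ⟩
      sum (λ y → sum (λ x → g y * (f x * T x y)))  ≡⟨ sum-cong (λ y → sum-*ˡ (g y) (λ x → f x * T x y)) ⟩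
      sum (λ y → g y * sum (λ x → f x * T x y))    ∎
      where
      lemma : ∀ a b c → a * (b * c) ≡ b * (a * c)
      lemma = solve-∀

    opaque

      infixl 6 _⊕_
      _⊕_ : (Fin v → ℤ) → (Fin v → ℤ) → Fin v → ℤ
      (f ⊕ g) x = f x + g x

      ⊖_ : (Fin v → ℤ) → Fin v → ℤ
      (⊖ f) x = - f x

      𝟘 : Fin v → ℤ
      𝟘 _ = 0ℤ

      ⊕-at : ∀ f g x → (f ⊕ g) x ≡ f x + g x
      ⊕-at f g x = refl

      ⊖-at : ∀ f x → (⊖ f) x ≡ - f x
      ⊖-at f x = refl

      𝟘-at : ∀ x → 𝟘 x ≡ 0ℤ
      𝟘-at x = refl

      ⊕-cong : ∀ {f f′ g g′} → f ≈ f′ → g ≈ g′ → f ⊕ g ≈ f′ ⊕ g′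
      ⊕-cong p q = pointwise λ x → cong₂ _+_ (at p x) (at q x)

      ⊖-cong : ∀ {f g} → f ≈ g → ⊖ f ≈ ⊖ g
      ⊖-cong p = pointwise λ x → cong -_ (at p x)

      ⊕-assoc : ∀ f g h → (f ⊕ g) ⊕ h ≈ f ⊕ (g ⊕ h)
      ⊕-assoc f g h = pointwise λ x → +-assoc (f x) (g x) (h x)

      ⊕-comm : ∀ f g → f ⊕ g ≈ g ⊕ f
      ⊕-comm f g = pointwise λ x → +-comm (f x) (g x)

      ⊕-identityˡ : ∀ f → 𝟘 ⊕ f ≈ f
      ⊕-identityˡ f = pointwise λ x → +-identityˡ (f x)

      ⊖-inverseˡ : ∀ f → (⊖ f) ⊕ f ≈ 𝟘
      ⊖-inverseˡ f = pointwise λ x → +-inverseˡ (f x)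

    ⟨⊕,⟩ : ∀ f g T → ⟨ f ⊕ g , T ⟩ ≡ ⟨ f , T ⟩ + ⟨ g , T ⟩
    ⟨⊕,⟩ f g T = trans (sum-cong (λ x → trans (cong (_* T x) (⊕-at f g x)) (*-distribʳ-+ (T x) (f x) (g x)))) (∑-distrib-+ (λ x → f x * T x) (λ x → g x * T x))

    ⋆-cong : ∀ {f f′ g g′} → f ≈ f′ → g ≈ g′ → f ⋆ g ≈ f′ ⋆ g′
    ⋆-cong {f} {f′} {g} {g′} p q = ⟨⟩-ext λ T → begin
      ⟨ f ⋆ g , T ⟩                               ≡⟨ ⟨⋆,⟩ f g T ⟩
      ⟨ f , (λ x → ⟨ g , (λ y → T (x ∙ y)) ⟩) ⟩    ≡⟨ ⟨⟩-congˡ _ p ⟩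
      ⟨ f′ , (λ x → ⟨ g , (λ y → T (x ∙ y)) ⟩) ⟩   ≡⟨ ⟨⟩-congʳ f′ (λ x → ⟨⟩-congˡ _ q) ⟩
      ⟨ f′ , (λ x → ⟨ g′ , (λ y → T (x ∙ y)) ⟩) ⟩  ≡⟨ ⟨⋆,⟩ f′ g′ T ⟨
      ⟨ f′ ⋆ g′ , T ⟩                             ∎

    ⋆-assoc : ∀ f g h → (f ⋆ g) ⋆ h ≈ f ⋆ (g ⋆ h)
    ⋆-assoc f g h = ⟨⟩-ext λ T → begin
      ⟨ (f ⋆ g) ⋆ h , T ⟩                                                   ≡⟨ trans (⟨⋆,⟩ (f ⋆ g) h T) (⟨⋆,⟩ f g _) ⟩
      ⟨ f , (λ x → ⟨ g , (λ y → ⟨ h , (λ z → T ((x ∙ y) ∙ z)) ⟩) ⟩) ⟩          ≡⟨ ⟨⟩-congʳ f (λ x → ⟨⟩-congʳ g (λ y → ⟨⟩-congʳ h (λ z → cong T (assoc x y z)))) ⟩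
      ⟨ f , (λ x → ⟨ g , (λ y → ⟨ h , (λ z → T (x ∙ (y ∙ z))) ⟩) ⟩) ⟩          ≡⟨ ⟨⟩-congʳ f (λ x → ⟨⋆,⟩ g h _) ⟨
      ⟨ f , (λ x → ⟨ g ⋆ h , (λ w → T (x ∙ w)) ⟩) ⟩                          ≡⟨ ⟨⋆,⟩ f (g ⋆ h) T ⟨
      ⟨ f ⋆ (g ⋆ h) , T ⟩                                                   ∎

    ⋆-comm : ∀ f g → f ⋆ g ≈ g ⋆ f
    ⋆-comm f g = ⟨⟩-ext λ T → begin
      ⟨ f ⋆ g , T ⟩                               ≡⟨ ⟨⋆,⟩ f g T ⟩
      ⟨ f , (λ x → ⟨ g , (λ y → T (x ∙ y)) ⟩) ⟩    ≡⟨ ⟨⟩-swap f g (λ x y → T (x ∙ y)) ⟩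
      ⟨ g , (λ y → ⟨ f , (λ x → T (x ∙ y)) ⟩) ⟩    ≡⟨ ⟨⟩-congʳ g (λ y → ⟨⟩-congʳ f (λ x → cong T (comm x y))) ⟩
      ⟨ g , (λ y → ⟨ f , (λ x → T (y ∙ x)) ⟩) ⟩    ≡⟨ ⟨⋆,⟩ g f T ⟨
      ⟨ g ⋆ f , T ⟩                               ∎

    ⟨δ⋆,⟩ : ∀ g f T → ⟨ δ g ⋆ f , T ⟩ ≡ ⟨ f , (λ y → T (g ∙ y)) ⟩
    ⟨δ⋆,⟩ g f T = trans (⟨⋆,⟩ (δ g) f T) (⟨δ,⟩ g _)

    ⋆-identityˡ : ∀ f → δ e ⋆ f ≈ f
    ⋆-identityˡ f = ⟨⟩-ext λ T → trans (⟨δ⋆,⟩ e f T) (⟨⟩-congʳ f (λ y → cong T (idˡ y)))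

    ⋆-distribʳ : ∀ h f g → (f ⊕ g) ⋆ h ≈ (f ⋆ h) ⊕ (g ⋆ h)
    ⋆-distribʳ h f g = ⟨⟩-ext λ T → begin
      ⟨ (f ⊕ g) ⋆ h , T ⟩           ≡⟨ trans (⟨⋆,⟩ (f ⊕ g) h T) (⟨⊕,⟩ f g _) ⟩
      _                             ≡⟨ cong₂ _+_ (⟨⋆,⟩ f h T) (⟨⋆,⟩ g h T) ⟨
      ⟨ f ⋆ h , T ⟩ + ⟨ g ⋆ h , T ⟩   ≡⟨ ⟨⊕,⟩ (f ⋆ h) (g ⋆ h) T ⟨
      ⟨ (f ⋆ h) ⊕ (g ⋆ h) , T ⟩     ∎

    ≈-refl : ∀ {f} → f ≈ f
    ≈-refl = pointwise λ _ → refl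

    ≈-sym : ∀ {f g} → f ≈ g → g ≈ f
    ≈-sym p = pointwise λ x → sym (at p x)

    ≈-trans : ∀ {f g h} → f ≈ g → g ≈ h → f ≈ h
    ≈-trans p q = pointwise λ x → trans (at p x) (at q x)

    ZG : CommutativeRing 0ℓ 0ℓ
    ZG = record
      { Carrier = Fin v → ℤ
      ; _≈_ = _≈_
      ; _+_ = _⊕_
      ; _*_ = _⋆_
      ; -_ = ⊖_
      ; 0# = 𝟘
      ; 1# = δ e
      ; isCommutativeRing = record
        { isRing = record
          { +-isAbelianGroup = record
            { isGroup = record
              { isMonoid = record
                { isSemigroup = record
                  { isMagma = record
                    { isEquivalence = record { refl = ≈-refl ; sym = ≈-sym ; trans = ≈-trans }
                    ; ∙-cong = ⊕-cong }
                  ; assoc = ⊕-assoc }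
                ; identity = ⊕-identityˡ , (λ f → ≈-trans (⊕-comm f 𝟘) (⊕-identityˡ f)) }
              ; inverse = ⊖-inverseˡ , (λ f → ≈-trans (⊕-comm f (⊖ f)) (⊖-inverseˡ f))
              ; ⁻¹-cong = ⊖-cong }
            ; comm = ⊕-comm }
          ; *-cong = ⋆-cong
          ; *-assoc = ⋆-assoc
          ; *-identity = ⋆-identityˡ , (λ f → ≈-trans (⋆-comm f (δ e)) (⋆-identityˡ f))
          ; distrib = (λ h f g → ≈-trans (⋆-comm h _) (≈-trans (⋆-distribʳ h f g) (⊕-cong (⋆-comm f h) (⋆-comm g h)))) , ⋆-distribʳ }
        ; *-comm = ⋆-comm } }

    δ-∙ : ∀ g h → δ (g ∙ h) ≈ δ g ⋆ δ h
    δ-∙ g h = ⟨⟩-ext λ T → trans (⟨δ,⟩ (g ∙ h) T) (sym (trans (⟨δ⋆,⟩ g (δ h) T) (⟨δ,⟩ h _)))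

    push-cong : ∀ φ {f g} → f ≈ g → push φ f ≈ push φ g
    push-cong φ {f} {g} p = ⟨⟩-ext λ T → trans (⟨push,⟩ φ f T) (trans (⟨⟩-congˡ _ p) (sym (⟨push,⟩ φ g T)))

    push-≗ : ∀ {φ ψ} → (∀ x → φ x ≡ ψ x) → ∀ f → push φ f ≈ push ψ f
    push-≗ {φ} {ψ} p f = ⟨⟩-ext λ T → trans (⟨push,⟩ φ f T) (trans (⟨⟩-congʳ f (λ x → cong T (p x))) (sym (⟨push,⟩ ψ f T)))

    push-∘ : ∀ φ ψ f → push φ (push ψ f) ≈ push (λ x → φ (ψ x)) f
    push-∘ φ ψ f = ⟨⟩-ext λ T → trans (⟨push,⟩ φ (push ψ f) T) (trans (⟨push,⟩ ψ f _) (sym (⟨push,⟩ _ f T)))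

    push-id : ∀ f → push (λ x → x) f ≈ f
    push-id f = ⟨⟩-ext λ T → ⟨push,⟩ (λ x → x) f T

    push-⊕ : ∀ φ f g → push φ (f ⊕ g) ≈ push φ f ⊕ push φ g
    push-⊕ φ f g = ⟨⟩-ext λ T → begin
      ⟨ push φ (f ⊕ g) , T ⟩             ≡⟨ trans (⟨push,⟩ φ (f ⊕ g) T) (⟨⊕,⟩ f g _) ⟩
      _                                  ≡⟨ cong₂ _+_ (⟨push,⟩ φ f T) (⟨push,⟩ φ g T) ⟨
      ⟨ push φ f , T ⟩ + ⟨ push φ g , T ⟩  ≡⟨ ⟨⊕,⟩ (push φ f) (push φ g) T ⟨
      ⟨ push φ f ⊕ push φ g , T ⟩        ∎

    push-⊖ : ∀ φ f → push φ (⊖ f) ≈ ⊖ push φ f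
    push-⊖ φ f = pointwise λ h → begin
      push φ (⊖ f) h                       ≡⟨ push-def φ (⊖ f) h ⟩
      sum (λ x → (⊖ f) x * ⟦ h ≟ φ x ⟧)    ≡⟨ sum-cong (λ x → trans (cong (_* ⟦ h ≟ φ x ⟧) (⊖-at f x)) (lemma (f x) ⟦ h ≟ φ x ⟧)) ⟩
      sum (λ x → - 1ℤ * (f x * ⟦ h ≟ φ x ⟧)) ≡⟨ sum-*ˡ (- 1ℤ) (λ x → f x * ⟦ h ≟ φ x ⟧) ⟩
      - 1ℤ * sum (λ x → f x * ⟦ h ≟ φ x ⟧) ≡⟨ -1*i≡-i _ ⟩
      - sum (λ x → f x * ⟦ h ≟ φ x ⟧)      ≡⟨ cong -_ (push-def φ f h) ⟨
      - push φ f h                         ≡⟨ ⊖-at (push φ f) h ⟨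
      (⊖ push φ f) h                       ∎
      where
      lemma : ∀ a b → - a * b ≡ - 1ℤ * (a * b)
      lemma = solve-∀

    push-δ : ∀ φ g → push φ (δ g) ≈ δ (φ g)
    push-δ φ g = ⟨⟩-ext λ T → trans (⟨push,⟩ φ (δ g) T) (trans (⟨δ,⟩ g _) (sym (⟨δ,⟩ (φ g) T)))

    push-⋆ : ∀ φ → (∀ x y → φ (x ∙ y) ≡ φ x ∙ φ y) → ∀ f g → push φ (f ⋆ g) ≈ push φ f ⋆ push φ g
    push-⋆ φ hom f g = ⟨⟩-ext λ T → begin
      ⟨ push φ (f ⋆ g) , T ⟩                                  ≡⟨ trans (⟨push,⟩ φ (f ⋆ g) T) (⟨⋆,⟩ f g _) ⟩
      ⟨ f , (λ x → ⟨ g , (λ y → T (φ (x ∙ y))) ⟩) ⟩             ≡⟨ ⟨⟩-congʳ f (λ x → ⟨⟩-congʳ g (λ y → cong T (hom x y))) ⟩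
      ⟨ f , (λ x → ⟨ g , (λ y → T (φ x ∙ φ y)) ⟩) ⟩             ≡⟨ ⟨⟩-congʳ f (λ x → ⟨push,⟩ φ g _) ⟨
      ⟨ f , (λ x → ⟨ push φ g , (λ y → T (φ x ∙ y)) ⟩) ⟩        ≡⟨ ⟨push,⟩ φ f _ ⟨
      ⟨ push φ f , (λ x → ⟨ push φ g , (λ y → T (x ∙ y)) ⟩) ⟩   ≡⟨ ⟨⋆,⟩ (push φ f) (push φ g) T ⟨
      ⟨ push φ f ⋆ push φ g , T ⟩                             ∎

    push-bijection : ∀ φ ψ → (∀ x → ψ (φ x) ≡ x) → (∀ x → φ (ψ x) ≡ x) → ∀ f h → push φ f h ≡ f (ψ h)
    push-bijection φ ψ ψφ φψ f h = trans (push-def φ f h) (trans (sum-cong (λ x → cong (f x *_)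
      (⟦⟧-cong (h ≟ φ x) (x ≟ ψ h) (λ h≡ → trans (sym (ψφ x)) (cong ψ (sym h≡))) (λ x≡ → trans (sym (φψ h)) (cong φ (sym x≡))))))
      (sum-⟦≟⟧ f (ψ h)))

    δ⋆-at : ∀ g f h → (δ g ⋆ f) h ≡ f (inv g ∙ h)
    δ⋆-at g f h = begin
      (δ g ⋆ f) h                            ≡⟨ ⟨,⟦≟⟧⟩ (δ g ⋆ f) h ⟨
      ⟨ δ g ⋆ f , (λ x → ⟦ x ≟ h ⟧) ⟩         ≡⟨ ⟨δ⋆,⟩ g f _ ⟩
      ⟨ f , (λ y → ⟦ g ∙ y ≟ h ⟧) ⟩           ≡⟨ ⟨⟩-congʳ f (λ y → ⟦⟧-cong (g ∙ y ≟ h) (y ≟ inv g ∙ h)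
                                                  (λ p → trans (sym (inv-∙-cancel g y)) (cong (inv g ∙_) p))
                                                  (λ p → trans (cong (g ∙_) p) (∙-inv-cancel g h))) ⟩
      ⟨ f , (λ y → ⟦ y ≟ inv g ∙ h ⟧) ⟩       ≡⟨ ⟨,⟦≟⟧⟩ f (inv g ∙ h) ⟩
      f (inv g ∙ h)                          ∎

    ⋆-at : ∀ f g h → (f ⋆ g) h ≡ sum (λ x → f x * g (inv x ∙ h))
    ⋆-at f g h = begin
      (f ⋆ g) h                                               ≡⟨ ⟨,⟦≟⟧⟩ (f ⋆ g) h ⟨
      ⟨ f ⋆ g , (λ x → ⟦ x ≟ h ⟧) ⟩                            ≡⟨ ⟨⋆,⟩ f g _ ⟩
      ⟨ f , (λ x → ⟨ g , (λ y → ⟦ x ∙ y ≟ h ⟧) ⟩) ⟩             ≡⟨ ⟨⟩-congʳ f (λ x → ⟨⟩-congʳ g (λ y → ⟦⟧-cong (x ∙ y ≟ h) (y ≟ inv x ∙ h)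
                                                                 (λ p → trans (sym (inv-∙-cancel x y)) (cong (inv x ∙_) p))
                                                                 (λ p → trans (cong (x ∙_) p) (∙-inv-cancel x h)))) ⟩
      ⟨ f , (λ x → ⟨ g , (λ y → ⟦ y ≟ inv x ∙ h ⟧) ⟩) ⟩         ≡⟨ ⟨⟩-congʳ f (λ x → ⟨,⟦≟⟧⟩ g (inv x ∙ h)) ⟩
      sum (λ x → f x * g (inv x ∙ h))                         ∎

    -- The group elements generate ℤ[G] additively.
    ZG-induction : (P : (Fin v → ℤ) → Set) → (∀ {f g} → f ≈ g → P f → P g) → P 𝟘 → (∀ g → P (δ g)) →
                   (∀ {f g} → P f → P g → P (f ⊕ g)) → (∀ {f} → P f → P (⊖ f)) → ∀ f → P f
    ZG-induction P resp P0 Pδ P+ P- f = resp (pointwise expand) (all v (λ x → x))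
      where
      _·_ : ℤ → (Fin v → ℤ) → Fin v → ℤ
      (c · g) x = c * g x
      nat : ∀ n {g} → P g → P ((+ n) · g)
      nat zero    {g} p = resp (pointwise λ x → trans (𝟘-at x) (sym (*-zeroˡ (g x)))) P0
      nat (suc n) {g} p = resp (pointwise λ x → trans (⊕-at g _ x) (sym (suc-* (+ n) (g x)))) (P+ p (nat n p))
      int : ∀ c {g} → P g → P (c · g)
      int (+ n)      p = nat n p
      int ℤ.-[1+ n ] {g} p = resp (pointwise λ x → trans (⊖-at _ x) (neg-distribˡ-* (+ suc n) (g x))) (P- (nat (suc n) p))
      all : ∀ n (h : Fin n → Fin v) → P (λ x → sum (λ i → f (h i) * δ (h i) x))
      all zero    h = resp (pointwise λ x → trans (𝟘-at x) (sym (sum-[] _))) P0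
      all (suc n) h = resp (pointwise λ x → trans (⊕-at _ _ x) (sym (sum-∷ (λ i → f (h i) * δ (h i) x)))) (P+ (int (f (h Fin.zero)) (Pδ (h Fin.zero))) (all n (λ i → h (Fin.suc i))))
      expand : ∀ x → sum (λ i → f i * δ i x) ≡ f x
      expand x = trans (sum-cong (λ i → cong (f i *_) (trans (δ-def i x) (⟦⟧-cong (x ≟ i) (i ≟ x) sym sym)))) (sum-⟦≟⟧ f x)

  -- Coefficients, the involution, and supports in torsion subgroups.

  module Coefficients where

    open import Defs using (IsIW; sumℤ)

    open import Data.Nat.GCD using (module Bézout)
    open import Data.Integer.Base using (+_)
    open import Relation.Binary.PropositionalEquality using (module ≡-Reasoning)
    open Sums
    open GroupRing
    open RingKit ZG using (ι; _·_; 1+×)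
    open Ramified ZG using (geo)

    δ-e : δ e e ≡ 1ℤ
    δ-e = ≡.trans (δ-def e e) (⟦yes⟧ (e ≟ e) ≡.refl)

    δ-≢ : ∀ {g h} → h ≢ g → δ g h ≡ 0ℤ
    δ-≢ {g} {h} h≢g = ≡.trans (δ-def g h) (⟦no⟧ (h ≟ g) h≢g)

    ι-at : ∀ c h → ι c h ≡ c ℤ.* δ e h
    ι-at (+ n) h = nat n
      where
      nat : ∀ n → (n · δ e) h ≡ + n ℤ.* δ e h
      nat zero    = ≡.trans (𝟘-at h) (≡.sym (ℤₚ.*-zeroˡ (δ e h)))
      nat (suc n) = ≡.trans (at (1+× n (δ e)) h) (≡.trans (⊕-at (δ e) (n · δ e) h) (≡.trans (cong (ℤ._+_ (δ e h)) (nat n)) (≡.sym (ℤₚ.suc-* (+ n) (δ e h)))))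
    ι-at -[1+ n ] h = ≡.trans (≡.trans (⊖-at (suc n · δ e) h) (cong ℤ.-_ (ι-at (+ suc n) h))) (ℤₚ.neg-distribˡ-* (+ suc n) (δ e h))

    ι⋆-at : ∀ c f h → (ι c ⋆ f) h ≡ c ℤ.* f h
    ι⋆-at c f h = begin
      (ι c ⋆ f) h                                       ≡⟨ ⟨,⟦≟⟧⟩ (ι c ⋆ f) h ⟨
      ⟨ ι c ⋆ f , (λ x → ⟦ x ≟ h ⟧) ⟩                   ≡⟨ ⟨⋆,⟩ (ι c) f _ ⟩
      sum (λ x → ι c x ℤ.* U x)                         ≡⟨ sum-cong (λ x → ≡.trans (cong (ℤ._* U x) (ι-at c x)) (ℤₚ.*-assoc c (δ e x) (U x))) ⟩
      sum (λ x → c ℤ.* (δ e x ℤ.* U x))                 ≡⟨ sum-*ˡ c (λ x → δ e x ℤ.* U x) ⟩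
      c ℤ.* ⟨ δ e , U ⟩                                 ≡⟨ cong (c ℤ.*_) (≡.trans (⟨δ,⟩ e U) (≡.trans (⟨⟩-congʳ f (λ y → cong (λ z → ⟦ z ≟ h ⟧) (idˡ y))) (⟨,⟦≟⟧⟩ f h))) ⟩
      c ℤ.* f h                                         ∎
      where
      open ≡-Reasoning
      U : Fin v → ℤ
      U x = ⟨ f , (λ y → ⟦ x ∙ y ≟ h ⟧) ⟩

    torsion-free : ∀ n .{{_ : ℕ.NonZero n}} → ∀ f → ι (+ n) ⋆ f ≈ 𝟘 → f ≈ 𝟘
    torsion-free n f p = pointwise λ h → ≡.trans (ℤₚ.*-cancelˡ-≡ (+ n) (f h) 0ℤ {{ℕ-nonzero n}}
      (≡.trans (≡.sym (ι⋆-at (+ n) f h)) (≡.trans (≡.trans (at p h) (𝟘-at h)) (≡.sym (ℤₚ.*-zeroʳ (+ n)))))) (≡.sym (𝟘-at h))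
      where
      ℕ-nonzero : ∀ n .{{_ : ℕ.NonZero n}} → ℤ.NonZero (+ n)
      ℕ-nonzero (suc n) = _

    push-ι : ∀ φ → φ e ≡ e → ∀ c → push φ (ι c) ≈ ι c
    push-ι φ φe c = pointwise λ h → begin
      push φ (ι c) h                                  ≡⟨ push-def φ (ι c) h ⟩
      sum (λ x → ι c x ℤ.* ⟦ h ≟ φ x ⟧)               ≡⟨ sum-cong (λ x → ≡.trans (cong (ℤ._* ⟦ h ≟ φ x ⟧) (ι-at c x)) (ℤₚ.*-assoc c (δ e x) ⟦ h ≟ φ x ⟧)) ⟩
      sum (λ x → c ℤ.* (δ e x ℤ.* ⟦ h ≟ φ x ⟧))       ≡⟨ sum-*ˡ c (λ x → δ e x ℤ.* ⟦ h ≟ φ x ⟧) ⟩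
      c ℤ.* sum (λ x → δ e x ℤ.* ⟦ h ≟ φ x ⟧)         ≡⟨ cong (c ℤ.*_) (push-def φ (δ e) h) ⟨
      c ℤ.* push φ (δ e) h                            ≡⟨ cong (c ℤ.*_) (≡.trans (at (push-δ φ e) h) (cong (λ g → δ g h) φe)) ⟩
      c ℤ.* δ e h                                     ≡⟨ ι-at c h ⟨
      ι c h                                           ∎
      where open ≡-Reasoning

    push-geo : ∀ φ → (∀ x y → φ (x ∙ y) ≡ φ x ∙ φ y) → φ e ≡ e → ∀ g n → push φ (geo (δ g) n) ≈ geo (δ (φ g)) n
    push-geo φ hom φe g zero    = push-ι φ φe 0ℤ
    push-geo φ hom φe g (suc n) = ≈-trans (push-⊕ φ (δ e) (δ g ⋆ geo (δ g) n)) (⊕-cong (push-ι φ φe 1ℤ)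
      (≈-trans (push-⋆ φ hom (δ g) (geo (δ g) n)) (⋆-cong (push-δ φ g) (push-geo φ hom φe g n))))

    -- The involution D ↦ D^(-1), which is complex conjugation under every character.
    star : (Fin v → ℤ) → Fin v → ℤ
    star = push inv

    star-at : ∀ f h → star f h ≡ f (inv h)
    star-at f h = push-bijection inv inv inv-inv inv-inv f h

    star-⋆ : ∀ f g → star (f ⋆ g) ≈ star f ⋆ star g
    star-⋆ = push-⋆ inv inv-∙

    star-star : ∀ f → star (star f) ≈ f
    star-star f = ≈-trans (push-∘ inv inv f) (≈-trans (push-≗ inv-inv f) (push-id f))

    -- Through this, equations between elements f f* of ℤ[G] become equations between ℓ²-norms.
    ⟨⟩≡⋆star-e : ∀ f g → (f ⋆ star g) e ≡ ⟨ f , g ⟩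
    ⟨⟩≡⋆star-e f g = ≡.trans (⋆-at f (star g) e) (sum-cong (λ x → cong (f x ℤ.*_)
      (≡.trans (star-at g (inv x ∙ e)) (cong g (≡.trans (cong inv (idʳ (inv x))) (inv-inv x))))))

    IW⇒ : ∀ {a n D} → IsIW G a n D → D ⋆ star D ≈ ι (+ n)
    IW⇒ {a} {n} {D} (_ , iw) = pointwise λ h → ≡.trans (≡.trans (⋆-at D (star D) h) (sum-cong (λ x → cong (D x ℤ.*_)
        (≡.trans (star-at D (inv x ∙ h)) (cong D (≡.trans (inv-∙ (inv x) h) (≡.trans (cong (_∙ inv h) (inv-inv x)) (comm x (inv h)))))))))
      (≡.trans (≡.sym (sumℤ≡sum (λ g → D g ℤ.* D (inv h ∙ g)))) (delta h))
      where
      delta : ∀ h → sumℤ (λ g → D g ℤ.* D (inv h ∙ g)) ≡ ι (+ n) h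
      delta h with h Finₚ.≟ e | iw h
      ... | yes h≡e | eq = ≡.trans eq (≡.sym (≡.trans (ι-at (+ n) h) (≡.trans (cong (+ n ℤ.*_) (≡.trans (cong (δ e) h≡e) δ-e)) (ℤₚ.*-identityʳ (+ n)))))
      ... | no  h≢e | eq = ≡.trans eq (≡.sym (≡.trans (ι-at (+ n) h) (≡.trans (cong (+ n ℤ.*_) (δ-≢ h≢e)) (ℤₚ.*-zeroʳ (+ n)))))

    -- Support in the n-torsion subgroup. Given by an equation, membership is decidable, and
    -- supports for coprime m and n meet only in e.
    record Supported (n : ℕ) (f : Fin v → ℤ) : Set where
      constructor supp
      field vanish : ∀ x → pow x n ≢ e → f x ≡ 0ℤ
    open Supported public

    supported-δ : ∀ {n} g → pow g n ≡ e → Supported n (δ g)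
    supported-δ {n} g p = supp λ x x∉ → δ-≢ (λ x≡g → x∉ (≡.trans (cong (λ y → pow y n) x≡g) p))

    supported-⊕ : ∀ {n f g} → Supported n f → Supported n g → Supported n (f ⊕ g)
    supported-⊕ s t = supp λ x x∉ → ≡.trans (⊕-at _ _ x) (cong₂ ℤ._+_ (vanish s x x∉) (vanish t x x∉))

    supported-⊖ : ∀ {n f} → Supported n f → Supported n (⊖ f)
    supported-⊖ s = supp λ x x∉ → ≡.trans (⊖-at _ x) (cong ℤ.-_ (vanish s x x∉))

    supported-ι : ∀ {n} c → Supported n (ι c)
    supported-ι {n} c = supp λ x x∉ → ≡.trans (ι-at c x) (≡.trans (cong (c ℤ.*_) (vanish (supported-δ {n} e (pow-e n)) x x∉)) (ℤₚ.*-zeroʳ c))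

    supported-∣ : ∀ {m f} n → Supported m f → Supported (m ℕ.* n) f
    supported-∣ {m} n s = supp λ x x∉ → vanish s x (λ p → x∉ (≡.trans (pow-* x m n) (≡.trans (cong (λ y → pow y n) p) (pow-e n))))

    ≢⇒*≡0 : ∀ {n f g} → Supported n f → Supported n g → ∀ x h → pow h n ≢ e → f x ℤ.* g (inv x ∙ h) ≡ 0ℤ
    ≢⇒*≡0 {n} {f} {g} s t x h h∉ with pow x n ≟ e
    ... | no x∉ = ≡.trans (cong (ℤ._* g (inv x ∙ h)) (vanish s x x∉)) (ℤₚ.*-zeroˡ (g (inv x ∙ h)))
    ... | yes x∈ = ≡.trans (cong (f x ℤ.*_) (vanish t (inv x ∙ h) (λ p → h∉ (≡.trans (cong (λ y → pow y n) (≡.sym (∙-inv-cancel x h)))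
           (≡.trans (pow-∙ x (inv x ∙ h) n) (≡.trans (cong₂ _∙_ x∈ p) (idˡ e))))))) (ℤₚ.*-zeroʳ (f x))

    supported-⋆ : ∀ {n f g} → Supported n f → Supported n g → Supported n (f ⋆ g)
    supported-⋆ {n} {f} {g} s t = supp λ h h∉ → ≡.trans (⋆-at f g h) (sum-zero _ (λ x → ≢⇒*≡0 s t x h h∉))

    supported-geo : ∀ {n} g m → pow g n ≡ e → Supported n (geo (δ g) m)
    supported-geo g zero    p = supp λ x _ → 𝟘-at x
    supported-geo {n} g (suc m) p = supported-⊕ (supported-δ {n} e (pow-e n)) (supported-⋆ (supported-δ {n} g p) (supported-geo g m p))

    private
      kill : ∀ x a {m} → pow x m ≡ e → pow x (a ℕ.* m) ≡ e
      kill x a {m} p = ≡.trans (cong (pow x) (ℕₚ.*-comm a m)) (≡.trans (pow-* x m a) (≡.trans (cong (λ y → pow y a) p) (pow-e a)))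

    coprime-torsion : ∀ {m n} → Coprime m n → ∀ x → pow x m ≡ e → pow x n ≡ e → x ≡ e
    coprime-torsion {m} {n} c x p q with coprime-Bézout c
    ... | Bézout.+- a b eq = ≡.trans (≡.sym (idʳ x)) (≡.trans (cong (x ∙_) (≡.sym (kill x b q))) (≡.trans (cong (pow x) eq) (kill x a p)))
    ... | Bézout.-+ a b eq = ≡.trans (≡.sym (idʳ x)) (≡.trans (cong (x ∙_) (≡.sym (kill x a p))) (≡.trans (cong (pow x) eq) (kill x b q)))

    -- A term at x survives only if x is killed by both m and n, that is, if x = e. Coefficients at
    -- e of products over distinct primes are thus computed factor by factor.
    ⋆-e-coprime : ∀ {m n f g} → Coprime m n → Supported m f → Supported n g → (f ⋆ g) e ≡ f e ℤ.* g e
    ⋆-e-coprime {m} {n} {f} {g} c s t = ≡.trans (⋆-at f g e) (≡.trans (sum-single _ e vanish′)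
      (cong (λ y → f e ℤ.* g y) (≡.trans (idʳ (inv e)) inv-e)))
      where
      vanish′ : ∀ x → x ≢ e → f x ℤ.* g (inv x ∙ e) ≡ 0ℤ
      vanish′ x x≢e with pow x m ≟ e
      ... | no x∉ = ≡.trans (cong (ℤ._* g (inv x ∙ e)) (vanish s x x∉)) (ℤₚ.*-zeroˡ (g (inv x ∙ e)))
      ... | yes x∈ = ≡.trans (cong (f x ℤ.*_) (vanish t (inv x ∙ e) (λ p → x≢e (coprime-torsion c x x∈ (begin
          pow x n                    ≡⟨ inv-inv (pow x n) ⟨
          inv (inv (pow x n))        ≡⟨ cong inv (pow-inv x n) ⟨
          inv (pow (inv x) n)        ≡⟨ cong (λ y → inv (pow y n)) (idʳ (inv x)) ⟨
          inv (pow (inv x ∙ e) n)    ≡⟨ cong inv p ⟩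
          inv e                      ≡⟨ inv-e ⟩
          e                          ∎))))) (ℤₚ.*-zeroʳ (f x))
        where open ≡-Reasoning

  -- The elements X and W, and the least norm of elements killed by every `N̂ q`.

  module PrimeProducts (θ : ℕ → Fin v) where

    open import Data.Integer.Base using (+_)
    open import Data.List.Relation.Unary.All using ([]; _∷_)
    open import Data.List.Relation.Unary.AllPairs using ([]; _∷_)
    open import Data.Unit.Base using (tt)
    open import Relation.Binary.PropositionalEquality using (module ≡-Reasoning)
    open Arith using (coprime-product)
    open Sums
    open GroupRing
    open Coefficients
    open RingKit ZG hiding (_≈_; sum; refl; sym; trans)
    open Solver
    open Ramified ZG using (geo; geo-*)

    record PrimeOrder (q : ℕ) : Set where
      field
        isPrime : Prime q
        order   : pow (θ q) q ≡ e
        ≢e      : θ q ≢ e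
    open PrimeOrder public

    N̂ : ℕ → Fin v → ℤ
    N̂ q = geo (δ (θ q)) q

    X : List ℕ → Fin v → ℤ
    X []      = δ e
    X (q ∷ L) = (δ e ⊕ ⊖ δ (θ q)) ⋆ X L

    -- Each factor is q times the idempotent 1 - N̂/q that discards the characters trivial on θ q.
    -- So W is ∏ q times the projection onto the characters that are non-trivial on every θ q;
    -- unlike X it is self-adjoint.
    W : List ℕ → Fin v → ℤ
    W []      = δ e
    W (q ∷ L) = (ι (+ q) ⊕ ⊖ N̂ q) ⋆ W L

    δ-pow : ∀ g n → δ (pow g n) ≈ δ g ^ n
    δ-pow g zero    = ≈-refl
    δ-pow g (suc n) = ≈-trans (δ-∙ g (pow g n)) (*-congˡ (δ-pow g n))

    geo-annihilates : ∀ g n → pow g n ≡ e → (δ e ⊕ ⊖ δ g) ⋆ geo (δ g) n ≈ 𝟘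
    geo-annihilates g n p = ≈-trans (solve 2 (λ x y → (con (+ 1) :- x) :* y := :- ((x :- con (+ 1)) :* y)) ≈-refl (δ g) (geo (δ g) n))
      (≈-trans (-‿cong (≈-trans (geo-* (δ g) n) (≈-trans (+-congʳ (≈-trans (≈-sym (δ-pow g n)) (pointwise λ x → cong (λ y → δ y x) p))) (-‿inverseʳ (δ e))))) -0#≈0#)

    N̂⋆X : ∀ {q L} → All PrimeOrder L → q ∈ L → N̂ q ⋆ X L ≈ 𝟘
    N̂⋆X {q} {q ∷ L} (po ∷ _) (here ≡.refl) =
      ≈-trans (solve 3 (λ n a x → n :* (a :* x) := (a :* n) :* x) ≈-refl (N̂ q) (δ e ⊕ ⊖ δ (θ q)) (X L))
        (≈-trans (*-congʳ (geo-annihilates (θ q) q (order po))) (zeroˡ (X L)))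
    N̂⋆X {q} {p ∷ L} (_ ∷ pos) (there q∈) =
      ≈-trans (solve 3 (λ n a x → n :* (a :* x) := a :* (n :* x)) ≈-refl (N̂ q) (δ e ⊕ ⊖ δ (θ p)) (X L))
        (≈-trans (*-congˡ {x = δ e ⊕ ⊖ δ (θ p)} (N̂⋆X pos q∈)) (zeroʳ (δ e ⊕ ⊖ δ (θ p))))

    push-X : ∀ φ → (∀ x y → φ (x ∙ y) ≡ φ x ∙ φ y) → φ e ≡ e → ∀ {L} → All (λ q → φ (θ q) ≡ θ q) L → push φ (X L) ≈ X L
    push-X φ hom φe {[]}    []       = push-ι φ φe 1ℤ
    push-X φ hom φe {q ∷ L} (p ∷ ps) = ≈-trans (push-⋆ φ hom (δ e ⊕ ⊖ δ (θ q)) (X L)) (⋆-cong (≈-trans (push-⊕ φ (δ e) (⊖ δ (θ q)))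
      (⊕-cong (push-ι φ φe 1ℤ) (≈-trans (push-⊖ φ (δ (θ q))) (-‿cong (≈-trans (push-δ φ (θ q)) (pointwise λ x → cong (λ g → δ g x) p)))))) (push-X φ hom φe ps))

    -- 1 - θ = - θ (1 - θ⁻¹)
    star-X : ∀ L → ∃ λ w → X L ≈ star (X L) ⋆ w
    star-X []      = δ e , ≈-sym (≈-trans (*-identityʳ (star (δ e))) (push-ι inv inv-e 1ℤ))
    star-X (q ∷ L) = go (star-X L)
      where
      t = δ (θ q)
      t̄ = δ (inv (θ q))
      go : (∃ λ w → X L ≈ star (X L) ⋆ w) → ∃ λ w → X (q ∷ L) ≈ star (X (q ∷ L)) ⋆ w
      go (w , X≈) = (⊖ t) ⋆ w , ≈-trans (⋆-cong factor X≈) (≈-trans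
          (solve 4 (λ a t x w → (a :* t) :* (x :* w) := (a :* x) :* (t :* w)) ≈-refl (δ e ⊕ ⊖ t̄) (⊖ t) (star (X L)) w)
          (*-congʳ (≈-sym (≈-trans (star-⋆ (δ e ⊕ ⊖ t) (X L)) (*-congʳ (≈-trans (push-⊕ inv (δ e) (⊖ t)) (⊕-cong (push-ι inv inv-e 1ℤ) (≈-trans (push-⊖ inv t) (-‿cong (push-δ inv (θ q)))))))))))
        where
        factor : δ e ⊕ ⊖ t ≈ (δ e ⊕ ⊖ t̄) ⋆ (⊖ t)
        factor = ≈-trans (+-congʳ (≈-trans (pointwise λ x → cong (λ g → δ g x) (≡.sym (invˡ (θ q)))) (δ-∙ (inv (θ q)) (θ q))))
          (solve 2 (λ t s → s :* t :- t := (con (+ 1) :- s) :* (:- t)) ≈-refl t t̄)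

    supported-X : ∀ {L} → All PrimeOrder L → Supported (product L) (X L)
    supported-X []               = supported-δ e (pow-e 1)
    supported-X {q ∷ L} (po ∷ pos) = supported-⋆
      (supported-∣ {q} (product L) (supported-⊕ (supported-δ e (pow-e q)) (supported-⊖ (supported-δ (θ q) (order po)))))
      (≡.subst (λ n → Supported n (X L)) (ℕₚ.*-comm (product L) q) (supported-∣ q (supported-X pos)))

    supported-W : ∀ {L} → All PrimeOrder L → Supported (product L) (W L)
    supported-W []               = supported-δ e (pow-e 1)
    supported-W {q ∷ L} (po ∷ pos) = supported-⋆
      (supported-∣ {q} (product L) (supported-⊕ (supported-ι (+ q)) (supported-⊖ (supported-geo (θ q) q (order po)))))
      (≡.subst (λ n → Supported n (W L)) (ℕₚ.*-comm (product L) q) (supported-∣ q (supported-W pos)))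

    supported-star : ∀ {n f} → Supported n f → Supported n (star f)
    supported-star {n} {f} s = supp λ x x∉ → ≡.trans (star-at f x) (vanish s (inv x) (λ p → x∉
      (≡.trans (≡.sym (inv-inv (pow x n))) (≡.trans (cong inv (≡.trans (≡.sym (pow-inv x n)) p)) inv-e))))

    Distinct : List ℕ → Set
    Distinct = AllPairs _≢_

    private
      cop : ∀ {q L} → PrimeOrder q → All PrimeOrder L → All (q ≢_) L → Coprime q (product L)
      cop po pos ds = coprime-product (isPrime po) (All.map isPrime pos) ds

    -- One factor 1 - θ q has norm 1² + (-1)² = 2, and coefficients at e multiply across coprime
    -- supports.
    X-norm : ∀ {L} → All PrimeOrder L → Distinct L → (X L ⋆ star (X L)) e ≡ + (2 ℕ.^ length L)
    X-norm []               _        = ≡.trans (⟨⟩≡⋆star-e (δ e) (δ e)) (≡.trans (⟨δ,⟩ e (δ e)) δ-e)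
    X-norm {q ∷ L} (po ∷ pos) (d ∷ ds) = begin
      ((a ⋆ X L) ⋆ star (a ⋆ X L)) e              ≡⟨ at (≈-trans (*-congˡ (star-⋆ a (X L)))
                                                      (solve 4 (λ a x b y → (a :* x) :* (b :* y) := (a :* b) :* (x :* y)) ≈-refl a (X L) (star a) (star (X L)))) e ⟩
      ((a ⋆ star a) ⋆ (X L ⋆ star (X L))) e       ≡⟨ ⋆-e-coprime (cop po pos d) (supported-⋆ sa (supported-star sa)) (supported-⋆ (supported-X pos) (supported-star (supported-X pos))) ⟩
      (a ⋆ star a) e ℤ.* (X L ⋆ star (X L)) e     ≡⟨ cong₂ ℤ._*_ a-norm (X-norm pos ds) ⟩
      + 2 ℤ.* + (2 ℕ.^ length L)                  ≡⟨ ℤₚ.pos-* 2 (2 ℕ.^ length L) ⟨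
      + (2 ℕ.* 2 ℕ.^ length L)                    ∎
      where
      open ≡-Reasoning
      a = δ e ⊕ ⊖ δ (θ q)
      sa : Supported q a
      sa = supported-⊕ (supported-δ e (pow-e q)) (supported-⊖ (supported-δ (θ q) (order po)))
      a-at : ∀ x → a x ≡ δ e x ℤ.+ ℤ.- δ (θ q) x
      a-at x = ≡.trans (⊕-at (δ e) (⊖ δ (θ q)) x) (cong (ℤ._+_ (δ e x)) (⊖-at (δ (θ q)) x))
      a-norm : (a ⋆ star a) e ≡ + 2
      a-norm = ≡.trans (⟨⟩≡⋆star-e a a) (≡.trans (⟨⊕,⟩ (δ e) (⊖ δ (θ q)) a) (cong₂ ℤ._+_
        (≡.trans (⟨δ,⟩ e a) (≡.trans (a-at e) (cong₂ (λ x y → x ℤ.+ ℤ.- y) δ-e (δ-≢ (λ p → ≢e po (≡.sym p))))))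
        (≡.trans (sum-cong (λ x → ≡.trans (cong (ℤ._* a x) (⊖-at (δ (θ q)) x)) (≡.sym (ℤₚ.neg-distribˡ-* (δ (θ q) x) (a x))))) (≡.trans
          (sum-cong (λ x → ≡.sym (ℤₚ.-1*i≡-i (δ (θ q) x ℤ.* a x)))) (≡.trans (sum-*ˡ (ℤ.- 1ℤ) (λ x → δ (θ q) x ℤ.* a x))
          (cong (ℤ.- 1ℤ ℤ.*_) (≡.trans (⟨δ,⟩ (θ q) a) (≡.trans (a-at (θ q)) (cong₂ (λ x y → x ℤ.+ ℤ.- y) (δ-≢ (≢e po))
             (≡.trans (δ-def (θ q) (θ q)) (⟦yes⟧ (θ q ≟ θ q) ≡.refl)))))))))))

    pow-θ-≢e : ∀ {q i} → PrimeOrder q → 0 ℕ.< i → i ℕ.< q → pow (θ q) i ≢ e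
    pow-θ-≢e {q} {i} po 0<i i<q p = ≢e po (coprime-torsion (prime⇒coprime (isPrime po) {{ℕ.>-nonZero 0<i}} i<q) (θ q) (order po) p)

    geo⋆-at : ∀ g n y h → (geo (δ g) (suc n) ⋆ y) h ≡ y h ℤ.+ (geo (δ g) n ⋆ y) (inv g ∙ h)
    geo⋆-at g n y h = ≡.trans (at (⋆-distribʳ y (δ e) (δ g ⋆ geo (δ g) n)) h) (≡.trans (⊕-at _ _ h)
      (cong₂ ℤ._+_ (at (⋆-identityˡ y) h) (≡.trans (at (⋆-assoc (δ g) (geo (δ g) n) y) h) (δ⋆-at g (geo (δ g) n ⋆ y) h))))

    geo-nonvanishing : ∀ g n y h → (geo (δ g) n ⋆ y) h ≢ 0ℤ → ∃ λ i → i ℕ.< n × y (pow (inv g) i ∙ h) ≢ 0ℤ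
    geo-nonvanishing g zero    y h p = contradiction (≡.trans (at (zeroˡ y) h) (𝟘-at h)) p
    geo-nonvanishing g (suc n) y h p = split (y h ℤₚ.≟ 0ℤ)
      where
      shift : (∃ λ i → i ℕ.< n × y (pow (inv g) i ∙ (inv g ∙ h)) ≢ 0ℤ) → ∃ λ i → i ℕ.< suc n × y (pow (inv g) i ∙ h) ≢ 0ℤ
      shift (i , i<n , r) = suc i , ℕ.s≤s i<n , λ s → r (≡.trans (cong y (≡.trans (≡.sym (assoc _ _ h)) (cong (_∙ h) (comm _ _)))) s)
      split : Dec (y h ≡ 0ℤ) → ∃ λ i → i ℕ.< suc n × y (pow (inv g) i ∙ h) ≢ 0ℤ
      split (no  q) = 0 , ℕ.s≤s ℕ.z≤n , λ r → q (≡.trans (cong y (≡.sym (idˡ h))) r)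
      split (yes q) = shift (geo-nonvanishing g n y (inv g ∙ h) (λ r → p (≡.trans (geo⋆-at g n y h) (cong₂ ℤ._+_ q r))))

    N̂-e : ∀ {q} → PrimeOrder q → N̂ q e ≡ 1ℤ
    N̂-e {suc q} po = ≡.trans (≡.sym (at (≈-trans (⋆-comm (N̂ (suc q)) (δ e)) (⋆-identityˡ _)) e))
      (≡.trans (geo⋆-at (θ (suc q)) q (δ e) e) (cong₂ ℤ._+_ δ-e rest))
      where
      g = θ (suc q)
      rest : (geo (δ g) q ⋆ δ e) (inv g ∙ e) ≡ 0ℤ
      rest with (geo (δ g) q ⋆ δ e) (inv g ∙ e) ℤₚ.≟ 0ℤ
      ... | yes p = p
      ... | no  p with geo-nonvanishing g q (δ e) (inv g ∙ e) p
      ...   | i , i<q , r = contradiction (δ-≢ {e} (λ s → pow-θ-≢e po (ℕ.s≤s ℕ.z≤n) (ℕ.s≤s i<q)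
                (≡.trans (≡.sym (inv-inv _)) (≡.trans (cong inv (≡.trans (≡.sym (pow-inv g (suc i)))
                  (≡.trans (comm (inv g) (pow (inv g) i)) (≡.trans (cong (pow (inv g) i ∙_) (≡.sym (idʳ (inv g)))) s)))) inv-e)))) r
    N̂-e {zero} po = contradiction (≡.refl) (ℕ.≢-nonZero⁻¹ 0 {{prime⇒nonZero (isPrime po)}})

    W-e : ∀ {L} → All PrimeOrder L → Distinct L → W L e ≡ + product (map ℕ.pred L)
    W-e []               _        = δ-e
    W-e {q ∷ L} (po ∷ pos) (d ∷ ds) = ≡.trans (⋆-e-coprime (cop po pos d)
        (supported-⊕ (supported-ι (+ q)) (supported-⊖ (supported-geo (θ q) q (order po)))) (supported-W pos))
      (≡.trans (cong₂ ℤ._*_ (≡.trans (≡.trans (⊕-at (ι (+ q)) (⊖ N̂ q) e) (cong (ℤ._+_ (ι (+ q) e)) (⊖-at (N̂ q) e))) (≡.trans (cong₂ (λ x y → x ℤ.+ ℤ.- y) (≡.trans (ι-at (+ q) e) (≡.trans (cong (+ q ℤ.*_) δ-e) (ℤₚ.*-identityʳ (+ q)))) (N̂-e po)) (pred≡ q (isPrime po))))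
        (W-e pos ds)) (≡.sym (ℤₚ.pos-* (ℕ.pred q) (product (map ℕ.pred L)))))
      where
      pred≡ : ∀ q → Prime q → + q ℤ.+ ℤ.- 1ℤ ≡ + ℕ.pred q
      pred≡ zero    pr = contradiction ≡.refl (ℕ.≢-nonZero⁻¹ 0 {{prime⇒nonZero pr}})
      pred≡ (suc n) _  = ≡.refl

    -- A coset of ⟨θ q⟩ on which y does not vanish carries two non-zero values of y, as their sum is 0.
    support-bound : ∀ {L} → All PrimeOrder L → Distinct L → ∀ {y} → (∀ {q} → q ∈ L → N̂ q ⋆ y ≈ 𝟘) → ∀ g → y g ≢ 0ℤ →
      + (2 ℕ.^ length L) ℤ.≤ sum (λ h → ⟦ pow (inv g ∙ h) (product L) ≟ e ⟧ ℤ.* ⟦ nonzero? (y h) ⟧)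
    support-bound {[]} _ _ {y} _ g yg≢0 = ≡.subst (ℤ._≤ sum F) (cong₂ ℤ._*_
        (⟦yes⟧ (pow (inv g ∙ g) 1 ≟ e) (≡.trans (pow-1 (inv g ∙ g)) (invˡ g))) (⟦yes⟧ (nonzero? (y g)) yg≢0))
      (term≤sum F (λ h → *-nonneg (⟦⟧-nonneg (pow (inv g ∙ h) 1 ≟ e)) (⟦⟧-nonneg (nonzero? (y h)))) g)
      where
      F : Fin v → ℤ
      F h = ⟦ pow (inv g ∙ h) 1 ≟ e ⟧ ℤ.* ⟦ nonzero? (y h) ⟧
    support-bound {q ∷ L} (po ∷ pos) (d ∷ ds) {y} N̂y≈0 g yg≢0 = second (sucpred q (isPrime po)) (N̂y≈0 (here ≡.refl))
      where
      n = 2 ℕ.^ length L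
      t = inv (θ q)
      sucpred : ∀ q → Prime q → ∃ λ q′ → q ≡ suc q′
      sucpred zero    pr = contradiction ≡.refl (ℕ.≢-nonZero⁻¹ 0 {{prime⇒nonZero pr}})
      sucpred (suc q) pr = q , ≡.refl

      -- The points g and g′ both fall under the induction hypothesis for the remaining primes.
      -- Their cosets of the P-torsion are disjoint because g and g′ differ by a non-trivial element
      -- of order dividing q, which is coprime to P; so the count doubles.
      combine : ∀ i → 0 ℕ.< i → i ℕ.< q → y (pow t i ∙ g) ≢ 0ℤ →
        + (2 ℕ.* n) ℤ.≤ sum (λ h → ⟦ pow (inv g ∙ h) (q ℕ.* product L) ≟ e ⟧ ℤ.* ⟦ nonzero? (y h) ⟧)
      combine i 0<i i<q yg′≢0 = ℤₚ.≤-trans (ℤₚ.≤-trans (ℤₚ.≤-reflexive double) (ℤₚ.+-mono-≤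
            (support-bound pos ds {y} (λ q∈ → N̂y≈0 (there q∈)) g yg≢0) (support-bound pos ds {y} (λ q∈ → N̂y≈0 (there q∈)) g′ yg′≢0)))
          (ℤₚ.≤-trans (ℤₚ.≤-reflexive (≡.sym (∑-distrib-+ (λ h → A h ℤ.* nz h) (λ h → A′ h ℤ.* nz h)))) (sum-mono _ _ pointwise-≤))
        where
        P = product L
        g′ = pow t i ∙ g
        nz A A′ B : Fin v → ℤ
        nz h = ⟦ nonzero? (y h) ⟧
        A h = ⟦ pow (inv g ∙ h) P ≟ e ⟧
        A′ h = ⟦ pow (inv g′ ∙ h) P ≟ e ⟧
        B h = ⟦ pow (inv g ∙ h) (q ℕ.* P) ≟ e ⟧
        double : + (2 ℕ.* n) ≡ + n ℤ.+ + n
        double = cong (λ m → + (n ℕ.+ m)) (ℕₚ.+-identityʳ n)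
        q-torsion : pow (pow t i) q ≡ e
        q-torsion = ≡.trans (≡.sym (pow-* t i q)) (≡.trans (cong (pow t) (ℕₚ.*-comm i q)) (≡.trans (pow-* t q i)
          (≡.trans (cong (λ z → pow z i) (≡.trans (pow-inv (θ q) q) (≡.trans (cong inv (order po)) inv-e))) (pow-e i))))
        translate : ∀ h → inv g ∙ h ≡ pow t i ∙ (inv g′ ∙ h)
        translate h = begin
          inv g ∙ h                                   ≡⟨ cong (_∙ h) (∙-inv-cancel (pow t i) (inv g)) ⟨
          (pow t i ∙ (inv (pow t i) ∙ inv g)) ∙ h     ≡⟨ assoc _ _ h ⟩
          pow t i ∙ ((inv (pow t i) ∙ inv g) ∙ h)     ≡⟨ cong (λ z → pow t i ∙ (z ∙ h)) (inv-∙ (pow t i) g) ⟨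
          pow t i ∙ (inv g′ ∙ h)                      ∎
          where open ≡-Reasoning
        killP : ∀ {x} → pow x P ≡ e → pow x (q ℕ.* P) ≡ e
        killP {x} p = ≡.trans (cong (pow x) (ℕₚ.*-comm q P)) (≡.trans (pow-* x P q) (≡.trans (cong (λ z → pow z q) p) (pow-e q)))
        killq : pow (pow t i) (q ℕ.* P) ≡ e
        killq = ≡.trans (pow-* (pow t i) q P) (≡.trans (cong (λ z → pow z P) q-torsion) (pow-e P))
        A⇒B : ∀ h → pow (inv g ∙ h) P ≡ e → pow (inv g ∙ h) (q ℕ.* P) ≡ e
        A⇒B h = killP
        A′⇒B : ∀ h → pow (inv g′ ∙ h) P ≡ e → pow (inv g ∙ h) (q ℕ.* P) ≡ e
        A′⇒B h p = ≡.trans (cong (λ z → pow z (q ℕ.* P)) (translate h)) (≡.trans (pow-∙ (pow t i) (inv g′ ∙ h) (q ℕ.* P))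
          (≡.trans (cong₂ _∙_ killq (killP p)) (idˡ e)))
        disjoint : ∀ h → pow (inv g ∙ h) P ≡ e → pow (inv g′ ∙ h) P ≡ e → ⊥
        disjoint h p p′ = pow-θ-≢e po 0<i i<q (≡.trans (≡.sym (inv-inv _)) (≡.trans (cong inv (≡.trans (≡.sym (pow-inv (θ q) i))
          (coprime-torsion (cop po pos d) (pow t i) q-torsion
            (≡.trans (≡.sym (idʳ _)) (≡.trans (cong (pow (pow t i) P ∙_) (≡.sym p′)) (≡.trans (≡.sym (pow-∙ (pow t i) (inv g′ ∙ h) P))
              (≡.trans (cong (λ z → pow z P) (≡.sym (translate h))) p))))))) inv-e))
        indicators : ∀ h → A h ℤ.+ A′ h ℤ.≤ B h
        indicators h = exclusive (pow (inv g ∙ h) P ≟ e) (pow (inv g′ ∙ h) P ≟ e) (pow (inv g ∙ h) (q ℕ.* P) ≟ e) (A⇒B h) (A′⇒B h) (disjoint h)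
        pointwise-≤ : ∀ h → A h ℤ.* nz h ℤ.+ A′ h ℤ.* nz h ℤ.≤ B h ℤ.* nz h
        pointwise-≤ h = ≡.subst (ℤ._≤ B h ℤ.* nz h) (ℤₚ.*-distribʳ-+ (nz h) (A h) (A′ h))
          (ℤₚ.*-monoʳ-≤-nonNeg (nz h) {{ℤ.nonNegative (⟦⟧-nonneg (nonzero? (y h)))}} (indicators h))

      second : (∃ λ q′ → q ≡ suc q′) → N̂ q ⋆ y ≈ 𝟘 →
        + (2 ℕ.* n) ℤ.≤ sum (λ h → ⟦ pow (inv g ∙ h) (q ℕ.* product L) ≟ e ⟧ ℤ.* ⟦ nonzero? (y h) ⟧)
      second (q′ , q≡) z = conclude (geo-nonvanishing (θ q) q′ y (t ∙ g) (λ r → yg≢0 (≡.trans (≡.sym (ℤₚ.+-identityʳ (y g)))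
          (≡.trans (cong (ℤ._+_ (y g)) (≡.sym r)) (≡.trans (≡.sym (geo⋆-at (θ q) q′ y g)) (≡.trans (cong (λ k → (geo (δ (θ q)) k ⋆ y) g) (≡.sym q≡)) (≡.trans (at z g) (𝟘-at g))))))))
        where
        conclude : (∃ λ i → i ℕ.< q′ × y (pow t i ∙ (t ∙ g)) ≢ 0ℤ) → _
        conclude (i , i<q′ , r) = combine (suc i) (ℕ.s≤s ℕ.z≤n) (≡.subst (suc i ℕ.<_) (≡.sym q≡) (ℕ.s≤s i<q′))
          (λ s → r (≡.trans (cong y (≡.trans (≡.sym (assoc _ t g)) (cong (_∙ g) (comm _ t)))) s))

    module _ {L} (pos : All PrimeOrder L) (ds : Distinct L) {y : Fin v → ℤ} (N̂y≈0 : ∀ {q} → q ∈ L → N̂ q ⋆ y ≈ 𝟘) where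

      private
        n = 2 ℕ.^ length L
        nz : Fin v → ℤ
        nz h = ⟦ nonzero? (y h) ⟧
        nz≥0 : ∀ h → 0ℤ ℤ.≤ nz h
        nz≥0 h = ⟦⟧-nonneg (nonzero? (y h))

        coset≤ : ∀ g → ∀ h → ⟦ pow (inv g ∙ h) (product L) ≟ e ⟧ ℤ.* nz h ℤ.≤ nz h
        coset≤ g h = ≡.subst (⟦ pow (inv g ∙ h) (product L) ≟ e ⟧ ℤ.* nz h ℤ.≤_) (ℤₚ.*-identityˡ (nz h))
          (ℤₚ.*-monoʳ-≤-nonNeg (nz h) {{ℤ.nonNegative (nz≥0 h)}} (⟦⟧≤1 (pow (inv g ∙ h) (product L) ≟ e)))

        size≤nz : ∀ g → y g ≢ 0ℤ → + n ℤ.≤ sum nz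
        size≤nz g yg≢0 = ℤₚ.≤-trans (support-bound pos ds N̂y≈0 g yg≢0) (sum-mono _ _ (coset≤ g))

        nz≤norm : sum nz ℤ.≤ ⟨ y , y ⟩
        nz≤norm = sum-mono _ _ (λ h → ⟦nonzero⟧≤square (y h))

      norm-lower-bound : ∀ g → y g ≢ 0ℤ → + n ℤ.≤ ⟨ y , y ⟩
      norm-lower-bound g yg≢0 = ℤₚ.≤-trans (size≤nz g yg≢0) nz≤norm

      module _ (minimal : ⟨ y , y ⟩ ≡ + n) where

        -- There are at least 2^|L| non-zero values, and their squares add up to 2^|L|, so each of
        -- them is ± 1.
        minimal⇒small : ∀ g → ℤ.∣ y g ∣ ℕ.≤ 1
        minimal⇒small g with y g ℤₚ.≟ 0ℤ
        ... | yes p = ≡.subst (λ z → ℤ.∣ z ∣ ℕ.≤ 1) (≡.sym p) ℕ.z≤n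
        ... | no  p = square≤1 (y g) (ℤₚ.≤-trans (ℤₚ.≤-reflexive (≡.sym square≡nz)) (⟦⟧≤1 (nonzero? (y g))))
          where
          -- ∑ (y² - [y ≠ 0]) ≤ 0 with non-negative terms
          excess : Fin v → ℤ
          excess h = y h ℤ.* y h ℤ.+ ℤ.- 1ℤ ℤ.* nz h
          excess-sum : sum excess ℤ.≤ 0ℤ
          excess-sum = ≡.subst (ℤ._≤ 0ℤ) (≡.sym (≡.trans (∑-distrib-+ (λ h → y h ℤ.* y h) (λ h → ℤ.- 1ℤ ℤ.* nz h))
              (cong₂ ℤ._+_ minimal (≡.trans (sum-*ˡ (ℤ.- 1ℤ) nz) (ℤₚ.-1*i≡-i (sum nz))))))
            (ℤₚ.i≤j⇒i-j≤0 (size≤nz g p))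
          square≡nz : nz g ≡ y g ℤ.* y g
          square≡nz = ≡.sym (ℤₚ.i-j≡0⇒i≡j _ _ (≡.trans (cong (ℤ._+_ (y g ℤ.* y g)) (≡.sym (ℤₚ.-1*i≡-i (nz g))))
            (ℤₚ.≤-antisym (ℤₚ.≤-trans (term≤sum excess excess≥0 g) excess-sum) (excess≥0 g))))
            where
            excess≥0 : ∀ h → 0ℤ ℤ.≤ excess h
            excess≥0 h = ≡.subst (λ z → 0ℤ ℤ.≤ y h ℤ.* y h ℤ.+ z) (≡.sym (ℤₚ.-1*i≡-i (nz h))) (ℤₚ.i≤j⇒0≤j-i (⟦nonzero⟧≤square (y h)))

        -- Non-zero values in two different cosets would give two disjoint sets of 2^|L| non-zero
        -- values each, more than the norm allows.
        minimal⇒coset : ∀ g g′ → y g ≢ 0ℤ → y g′ ≢ 0ℤ → pow (inv g ∙ g′) (product L) ≡ e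
        minimal⇒coset g g′ yg≢0 yg′≢0 with pow (inv g ∙ g′) (product L) ≟ e
        ... | yes p = p
        ... | no  ∉ = contradiction too-big (ℤₚ.<⇒≱ (ℤ.+<+ (ℕₚ.m<m+n n (ℕₚ.m^n>0 2 (length L)))))
          where
          P = product L
          A A′ : Fin v → ℤ
          A h = ⟦ pow (inv g ∙ h) P ≟ e ⟧
          A′ h = ⟦ pow (inv g′ ∙ h) P ≟ e ⟧
          disjoint : ∀ h → pow (inv g ∙ h) P ≡ e → pow (inv g′ ∙ h) P ≡ e → ⊥
          disjoint h p p′ = ∉ (begin
            pow (inv g ∙ g′) P                              ≡⟨ cong (λ z → pow (inv g ∙ z) P) (≡.trans (cong (h ∙_) (≡.trans (inv-∙ (inv g′) h) (≡.trans (comm _ _) (cong (inv h ∙_) (inv-inv g′))))) (∙-inv-cancel h g′)) ⟨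
            pow (inv g ∙ (h ∙ inv (inv g′ ∙ h))) P          ≡⟨ cong (λ z → pow z P) (assoc _ _ _) ⟨
            pow ((inv g ∙ h) ∙ inv (inv g′ ∙ h)) P          ≡⟨ pow-∙ _ _ P ⟩
            pow (inv g ∙ h) P ∙ pow (inv (inv g′ ∙ h)) P    ≡⟨ cong₂ _∙_ p (≡.trans (pow-inv _ P) (≡.trans (cong inv p′) inv-e)) ⟩
            e ∙ e                                           ≡⟨ idˡ e ⟩
            e                                               ∎)
            where open ≡-Reasoning
          pointwise-≤ : ∀ h → A h ℤ.* nz h ℤ.+ A′ h ℤ.* nz h ℤ.≤ nz h
          pointwise-≤ h = ≡.subst₂ ℤ._≤_ (ℤₚ.*-distribʳ-+ (nz h) (A h) (A′ h)) (ℤₚ.*-identityˡ (nz h))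
            (ℤₚ.*-monoʳ-≤-nonNeg (nz h) {{ℤ.nonNegative (nz≥0 h)}}
              (exclusive (pow (inv g ∙ h) P ≟ e) (pow (inv g′ ∙ h) P ≟ e) (yes tt) (λ _ → tt) (λ _ → tt) (disjoint h)))
          too-big : + (n ℕ.+ n) ℤ.≤ + n
          too-big = ℤₚ.≤-trans (ℤₚ.+-mono-≤ (support-bound pos ds N̂y≈0 g yg≢0) (support-bound pos ds N̂y≈0 g′ yg′≢0))
            (ℤₚ.≤-trans (ℤₚ.≤-reflexive (≡.sym (∑-distrib-+ (λ h → A h ℤ.* nz h) (λ h → A′ h ℤ.* nz h))))
            (ℤₚ.≤-trans (sum-mono _ _ pointwise-≤) (ℤₚ.≤-trans nz≤norm (ℤₚ.≤-reflexive minimal))))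

  -- Projections up to a scalar, and bounds for the Hermitian forms that they define.

  module Idempotents (θ : ℕ → Fin v) where

    open import Data.Integer.Base using (+_)
    open import Data.List.Relation.Unary.All using ([]; _∷_)
    open Sums
    open GroupRing
    open Coefficients
    open PrimeProducts θ
    open RingKit ZG hiding (_≈_; sum; refl; sym; trans)
    open Solver
    open Ramified ZG using (geo; geo-≡; ≡1; ι-suc)
    open import Relation.Binary.Reasoning.Setoid (RingKit.setoid ZG)

    ⊖⊕-at : ∀ f g x → (f ⊕ ⊖ g) x ≡ f x ℤ.- g x
    ⊖⊕-at f g x = ≡.trans (⊕-at f (⊖ g) x) (cong (ℤ._+_ (f x)) (⊖-at g x))

    geo-fixes : ∀ y Z n → y ⋆ Z ≈ Z → geo y n ⋆ Z ≈ ι (+ n) ⋆ Z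
    geo-fixes y Z zero    p = ≈-refl
    geo-fixes y Z (suc n) p = begin
      (δ e ⊕ y ⋆ geo y n) ⋆ Z          ≈⟨ solve 3 (λ y g z → (con (+ 1) :+ y :* g) :* z := z :+ y :* (g :* z)) ≈-refl y (geo y n) Z ⟩
      Z ⊕ y ⋆ (geo y n ⋆ Z)            ≈⟨ +-congˡ (*-congˡ (geo-fixes y Z n p)) ⟩
      Z ⊕ y ⋆ (ι (+ n) ⋆ Z)            ≈⟨ solve 3 (λ y g z → z :+ y :* (g :* z) := z :+ g :* (y :* z)) ≈-refl y (ι (+ n)) Z ⟩
      Z ⊕ ι (+ n) ⋆ (y ⋆ Z)            ≈⟨ +-congˡ (*-congˡ p) ⟩
      Z ⊕ ι (+ n) ⋆ Z                  ≈⟨ solve 2 (λ g z → z :+ g :* z := (con (+ 1) :+ g) :* z) ≈-refl (ι (+ n)) Z ⟩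
      (δ e ⊕ ι (+ n)) ⋆ Z              ≈⟨ *-congʳ (ι-suc n) ⟨
      ι (+ suc n) ⋆ Z                  ∎

    δ⋆geo : ∀ g n → pow g n ≡ e → δ g ⋆ geo (δ g) n ≈ geo (δ g) n
    δ⋆geo g n p = begin
      δ g ⋆ N                          ≈⟨ solve 2 (λ x y → x :* y := y :- (con (+ 1) :- x) :* y) ≈-refl (δ g) N ⟩
      N ⊕ ⊖ ((δ e ⊕ ⊖ δ g) ⋆ N)        ≈⟨ +-congˡ (-‿cong (geo-annihilates g n p)) ⟩
      N ⊕ ⊖ 𝟘                          ≈⟨ solve 1 (λ y → y :- con (+ 0) := y) ≈-refl N ⟩
      N                                ∎
      where N = geo (δ g) n

    module _ {q} (po : PrimeOrder q) where
      private
        g = θ q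
        N = N̂ q

      N̂⋆N̂ : N ⋆ N ≈ ι (+ q) ⋆ N
      N̂⋆N̂ = geo-fixes (δ g) N q (δ⋆geo g q (order po))

      -- Both N̂ and its star absorb powers of θ q, so their product equals q times the one and q
      -- times the other; torsion-freeness cancels q.
      star-N̂ : star N ≈ N
      star-N̂ = difference (torsion-free q {{prime⇒nonZero (isPrime po)}} (star N ⊕ ⊖ N) (begin
          ι (+ q) ⋆ (star N ⊕ ⊖ N)               ≈⟨ solve 3 (λ a b c → a :* (b :- c) := a :* b :- a :* c) ≈-refl (ι (+ q)) (star N) N ⟩
          ι (+ q) ⋆ star N ⊕ ⊖ (ι (+ q) ⋆ N)     ≈⟨ ⊕-cong (≈-sym N⋆star) (-‿cong (≈-sym star⋆N)) ⟩
          N ⋆ star N ⊕ ⊖ (star N ⋆ N)            ≈⟨ solve 2 (λ a b → a :* b :- b :* a := con (+ 0)) ≈-refl N (star N) ⟩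
          𝟘                                      ∎))
        where
        difference : star N ⊕ ⊖ N ≈ 𝟘 → star N ≈ N
        difference p = begin
          star N                  ≈⟨ solve 2 (λ a b → a := (a :- b) :+ b) ≈-refl (star N) N ⟩
          (star N ⊕ ⊖ N) ⊕ N      ≈⟨ +-congʳ p ⟩
          𝟘 ⊕ N                   ≈⟨ +-identityˡ N ⟩
          N                       ∎
        inv-fixes : δ (inv g) ⋆ N ≈ N
        inv-fixes = begin
          δ (inv g) ⋆ N              ≈⟨ *-congˡ {x = δ (inv g)} (δ⋆geo g q (order po)) ⟨
          δ (inv g) ⋆ (δ g ⋆ N)      ≈⟨ *-assoc (δ (inv g)) (δ g) N ⟨
          (δ (inv g) ⋆ δ g) ⋆ N      ≈⟨ *-congʳ {x = N} (≈-trans (≈-sym (δ-∙ (inv g) g)) (pointwise λ x → cong (λ h → δ h x) (invˡ g))) ⟩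
          δ e ⋆ N                    ≈⟨ ⋆-identityˡ N ⟩
          N                          ∎
        star⋆N : star N ⋆ N ≈ ι (+ q) ⋆ N
        star⋆N = ≈-trans (*-congʳ (push-geo inv inv-∙ inv-e g q)) (geo-fixes (δ (inv g)) N q inv-fixes)
        N⋆star : N ⋆ star N ≈ ι (+ q) ⋆ star N
        N⋆star = begin
          N ⋆ star N                   ≈⟨ *-congʳ (star-star N) ⟨
          star (star N) ⋆ star N       ≈⟨ star-⋆ (star N) N ⟨
          star (star N ⋆ N)            ≈⟨ push-cong inv star⋆N ⟩
          star (ι (+ q) ⋆ N)           ≈⟨ star-⋆ (ι (+ q)) N ⟩
          star (ι (+ q)) ⋆ star N      ≈⟨ *-congʳ (push-ι inv inv-e (+ q)) ⟩
          ι (+ q) ⋆ star N             ∎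

    star-W : ∀ {L} → All PrimeOrder L → star (W L) ≈ W L
    star-W []               = push-ι inv inv-e 1ℤ
    star-W {q ∷ L} (po ∷ pos) = ≈-trans (star-⋆ (ι (+ q) ⊕ ⊖ N̂ q) (W L)) (⋆-cong (≈-trans (push-⊕ inv (ι (+ q)) (⊖ N̂ q))
      (⊕-cong (push-ι inv inv-e (+ q)) (≈-trans (push-⊖ inv (N̂ q)) (-‿cong (star-N̂ po))))) (star-W pos))

    ι-product : ∀ m n → ι (+ (m ℕ.* n)) ≈ ι (+ m) ⋆ ι (+ n)
    ι-product m n = ≈-trans (pointwise λ x → cong (λ c → ι c x) (ℤₚ.pos-* m n)) (ι-* (+ m) (+ n))

    W⋆W : ∀ {L} → All PrimeOrder L → W L ⋆ W L ≈ ι (+ product L) ⋆ W L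
    W⋆W []               = ≈-refl
    W⋆W {q ∷ L} (po ∷ pos) = begin
      ((Q ⊕ ⊖ N) ⋆ w) ⋆ ((Q ⊕ ⊖ N) ⋆ w)                   ≈⟨ solve 3 (λ q n w → ((q :- n) :* w) :* ((q :- n) :* w) := (q :* (q :- n) :- q :* n :+ n :* n) :* (w :* w)) ≈-refl Q N w ⟩
      (Q ⋆ (Q ⊕ ⊖ N) ⊕ ⊖ (Q ⋆ N) ⊕ N ⋆ N) ⋆ (w ⋆ w)       ≈⟨ ⋆-cong (+-congˡ (N̂⋆N̂ po)) (W⋆W pos) ⟩
      (Q ⋆ (Q ⊕ ⊖ N) ⊕ ⊖ (Q ⋆ N) ⊕ Q ⋆ N) ⋆ (P ⋆ w)       ≈⟨ solve 4 (λ q n p w → (q :* (q :- n) :- q :* n :+ q :* n) :* (p :* w) := (q :* p) :* ((q :- n) :* w)) ≈-refl Q N P w ⟩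
      (Q ⋆ P) ⋆ ((Q ⊕ ⊖ N) ⋆ w)                           ≈⟨ *-congʳ (ι-product q (product L)) ⟨
      ι (+ (q ℕ.* product L)) ⋆ ((Q ⊕ ⊖ N) ⋆ w)           ∎
      where
      Q = ι (+ q)
      P = ι (+ product L)
      N = N̂ q
      w = W L

    -- Z is n times an orthogonal projection, so n times the value in question is the norm of B Z.
    projection-nonneg : ∀ n .{{_ : ℕ.NonZero n}} Z → star Z ≈ Z → Z ⋆ Z ≈ ι (+ n) ⋆ Z → ∀ B → 0ℤ ℤ.≤ (B ⋆ star B ⋆ Z) e
    projection-nonneg n@(suc _) Z Z* Z² B = ℤₚ.*-cancelˡ-≤-pos 0ℤ ((B ⋆ star B ⋆ Z) e) (+ n)
      (≡.subst₂ ℤ._≤_ (≡.sym (ℤₚ.*-zeroʳ (+ n))) norm (sum-nonneg _ (λ x → square-nonneg ((B ⋆ Z) x))))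
      where
      norm : ⟨ B ⋆ Z , B ⋆ Z ⟩ ≡ + n ℤ.* (B ⋆ star B ⋆ Z) e
      norm = ≡.trans (≡.sym (⟨⟩≡⋆star-e (B ⋆ Z) (B ⋆ Z))) (≡.trans (at (begin
        (B ⋆ Z) ⋆ star (B ⋆ Z)             ≈⟨ *-congˡ (≈-trans (star-⋆ B Z) (*-congˡ Z*)) ⟩
        (B ⋆ Z) ⋆ (star B ⋆ Z)             ≈⟨ solve 3 (λ b z c → (b :* z) :* (c :* z) := (b :* c) :* (z :* z)) ≈-refl B Z (star B) ⟩
        (B ⋆ star B) ⋆ (Z ⋆ Z)             ≈⟨ *-congˡ Z² ⟩
        (B ⋆ star B) ⋆ (ι (+ n) ⋆ Z)       ≈⟨ solve 3 (λ b i z → b :* (i :* z) := i :* (b :* z)) ≈-refl (B ⋆ star B) (ι (+ n)) Z ⟩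
        ι (+ n) ⋆ (B ⋆ star B ⋆ Z)         ∎) e) (ι⋆-at (+ n) (B ⋆ star B ⋆ Z) e))

    product-nonZero : ∀ {L} → All PrimeOrder L → ℕ.NonZero (product L)
    product-nonZero []         = _
    product-nonZero {q ∷ L} (po ∷ pos) = ℕₚ.m*n≢0 q (product L) {{prime⇒nonZero (isPrime po)}} {{product-nonZero pos}}

    -- A projection does not increase norms. In the induction step the factor q - N̂ q is replaced
    -- by q; what is dropped is the form of N̂ q ⋆ W L, again a multiple of a projection and hence
    -- non-negative.
    W-bound : ∀ {L} → All PrimeOrder L → ∀ B → (B ⋆ star B ⋆ W L) e ℤ.≤ + product L ℤ.* ⟨ B , B ⟩
    W-bound []               B = ℤₚ.≤-reflexive (≡.trans (at (*-identityʳ (B ⋆ star B)) e) (≡.trans (⟨⟩≡⋆star-e B B) (≡.sym (ℤₚ.*-identityˡ ⟨ B , B ⟩))))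
    W-bound {q ∷ L} (po ∷ pos) B = ℤₚ.≤-trans (ℤₚ.≤-trans (ℤₚ.≤-reflexive expand) (ℤₚ.i-j≤i _ _ {{ℤ.nonNegative
        (projection-nonneg (q ℕ.* product L) {{product-nonZero (po ∷ pos)}} Z Z* Z² B)}}))
      (ℤₚ.≤-trans (ℤₚ.*-monoˡ-≤-nonNeg (+ q) (W-bound pos B)) (ℤₚ.≤-reflexive (≡.trans (≡.sym (ℤₚ.*-assoc (+ q) (+ product L) ⟨ B , B ⟩))
        (cong (ℤ._* ⟨ B , B ⟩) (≡.sym (ℤₚ.pos-* q (product L)))))))
      where
      N = N̂ q
      Z = N ⋆ W L
      b = B ⋆ star B
      Z* : star Z ≈ Z
      Z* = ≈-trans (star-⋆ N (W L)) (⋆-cong (star-N̂ po) (star-W pos))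
      Z² : Z ⋆ Z ≈ ι (+ (q ℕ.* product L)) ⋆ Z
      Z² = begin
        (N ⋆ W L) ⋆ (N ⋆ W L)                          ≈⟨ solve 2 (λ n w → (n :* w) :* (n :* w) := (n :* n) :* (w :* w)) ≈-refl N (W L) ⟩
        (N ⋆ N) ⋆ (W L ⋆ W L)                          ≈⟨ ⋆-cong (N̂⋆N̂ po) (W⋆W pos) ⟩
        (ι (+ q) ⋆ N) ⋆ (ι (+ product L) ⋆ W L)        ≈⟨ solve 4 (λ q n p w → (q :* n) :* (p :* w) := (q :* p) :* (n :* w)) ≈-refl (ι (+ q)) N (ι (+ product L)) (W L) ⟩
        (ι (+ q) ⋆ ι (+ product L)) ⋆ Z                ≈⟨ *-congʳ (ι-product q (product L)) ⟨
        ι (+ (q ℕ.* product L)) ⋆ Z                    ∎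
      expand : (b ⋆ ((ι (+ q) ⊕ ⊖ N) ⋆ W L)) e ≡ + q ℤ.* (b ⋆ W L) e ℤ.- (b ⋆ Z) e
      expand = ≡.trans (at (solve 4 (λ b q n w → b :* ((q :- n) :* w) := q :* (b :* w) :- b :* (n :* w)) ≈-refl b (ι (+ q)) N (W L)) e)
        (≡.trans (⊖⊕-at (ι (+ q) ⋆ (b ⋆ W L)) (b ⋆ Z) e) (cong (ℤ._- (b ⋆ Z) e) (ι⋆-at (+ q) (b ⋆ W L) e)))

    -- Since N̂ q ≡ q modulo θ q - 1, the factor q - N̂ q of W is a multiple of the factor 1 - θ q
    -- of X.
    X∣W : ∀ L → ∃ λ S → W L ≈ X L ⋆ S
    X∣W []      = δ e , ≈-sym (⋆-identityˡ (δ e))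
    X∣W (q ∷ L) = go (X∣W L) (geo-≡ (δ (θ q)) q (≡1 (δ (θ q))))
      where
      go : (∃ λ S → W L ≈ X L ⋆ S) → N̂ q ≡ ι (+ q) [ δ (θ q) ⊕ ⊖ δ e ] → ∃ λ S → W (q ∷ L) ≈ X (q ∷ L) ⋆ S
      go (S , p) (diff c r) = c ⋆ S , (begin
        (ι (+ q) ⊕ ⊖ N̂ q) ⋆ W L                                        ≈⟨ ⋆-cong (+-congˡ {x = ι (+ q)} (-‿cong r)) p ⟩
        (ι (+ q) ⊕ ⊖ (ι (+ q) ⊕ (t ⊕ ⊖ δ e) ⋆ c)) ⋆ (X L ⋆ S)          ≈⟨ solve 5 (λ q t c x s → (q :- (q :+ (t :- con (+ 1)) :* c)) :* (x :* s) := ((con (+ 1) :- t) :* x) :* (c :* s)) ≈-refl (ι (+ q)) t c (X L) S ⟩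
        ((δ e ⊕ ⊖ t) ⋆ X L) ⋆ (c ⋆ S)                                  ∎)
        where t = δ (θ q)

    -- Each factor 1 - θ q takes the difference of two coefficients and so at most doubles the
    -- bound.
    X-bound : ∀ L {y} {B} → (∀ h → ℤ.∣ y h ∣ ℕ.≤ B) → ∀ h → ℤ.∣ (X L ⋆ y) h ∣ ℕ.≤ 2 ℕ.^ length L ℕ.* B
    X-bound []      {y} {B} p h = ≡.subst₂ ℕ._≤_ (cong ℤ.∣_∣ (≡.sym (at (⋆-identityˡ y) h))) (≡.sym (ℕₚ.+-identityʳ B)) (p h)
    X-bound (q ∷ L) {y} {B} p h = ℕₚ.≤-trans (ℕₚ.≤-reflexive (cong ℤ.∣_∣ split)) (ℕₚ.≤-trans (ℤₚ.∣i-j∣≤∣i∣+∣j∣ (z h) (z (inv (θ q) ∙ h)))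
      (ℕₚ.≤-trans (ℕₚ.+-mono-≤ (X-bound L p h) (X-bound L p (inv (θ q) ∙ h))) (ℕₚ.≤-reflexive double)))
      where
      z = X L ⋆ y
      split : (((δ e ⊕ ⊖ δ (θ q)) ⋆ X L) ⋆ y) h ≡ z h ℤ.- z (inv (θ q) ∙ h)
      split = ≡.trans (at (solve 3 (λ t x y → ((con (+ 1) :- t) :* x) :* y := x :* y :- t :* (x :* y)) ≈-refl (δ (θ q)) (X L) y) h)
        (≡.trans (⊖⊕-at z (δ (θ q) ⋆ z) h) (cong (λ u → z h ℤ.- u) (δ⋆-at (θ q) z h)))
      n = 2 ℕ.^ length L
      double : n ℕ.* B ℕ.+ n ℕ.* B ≡ 2 ℕ.* n ℕ.* B
      double = ≡.trans (≡.sym (ℕₚ.*-distribʳ-+ B n n)) (cong (ℕ._* B) (cong (n ℕ.+_) (≡.sym (ℕₚ.+-identityʳ n))))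

  -- A prime ideal of ℤ[G] above ℓ that contains Φ_m(ω), for ω of order m.

  module Decomposition where

    open import Data.Nat.Divisibility using (_∣?_; ∣⇒≤)
    open import Data.Integer.Base using (+_)
    import Data.Integer.DivMod as ℤdm
    open import Data.List.Base using (concatMap; upTo)
    open import Data.List.Relation.Unary.All using ([]; _∷_)
    open import Data.List.Relation.Unary.AllPairs using (_∷_)
    open Arith
    open GroupRing
    open Coefficients
    open import Defs using (constₚ)
    open RingKit ZG hiding (_≈_; sum; refl; sym; trans)
    open Solver
    open Ramified ZG using (geo; geo-*; geo-≡; ≡1)
    open import Relation.Binary.Reasoning.Setoid (RingKit.setoid ZG)

    record HasOrder (ω : Fin v) (m : ℕ) : Set where
      field
        1≤m      : 1 ℕ.≤ m
        pow≡e    : pow ω m ≡ e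
        ∣-order  : ∀ i → pow ω i ≡ e → m ∣ i

    root : Fin v → ℕ → ℕ → Fin v
    root ω m q = pow ω (m /₀ q)

    module _ {ω m} (o : HasOrder ω m) where
      open HasOrder o
      open PrimeProducts (root ω m) using (PrimeOrder)

      root-order : ∀ {q} → Prime q → q ∣ m → PrimeOrder q
      root-order {q} pr q∣m = record
        { isPrime = pr
        ; order = ≡.trans (≡.sym (pow-* ω (m /₀ q) q)) (≡.trans (cong (pow ω) (≡.trans (ℕₚ.*-comm _ q) (/₀-* pr q∣m))) pow≡e)
        ; ≢e = λ p → ℕₚ.<⇒≱ smaller (∣⇒≤ {{ℕ.>-nonZero quotient>0}} (∣-order _ p)) }
        where
        quotient>0 : 0 ℕ.< m /₀ q
        quotient>0 = ℕₚ.n≢0⇒n>0 (λ z → ℕₚ.<⇒≱ 1≤m (ℕₚ.≤-reflexive (≡.trans (≡.sym (/₀-* pr q∣m)) (≡.trans (cong (q ℕ.*_) z) (ℕₚ.*-zeroʳ q)))))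
        smaller : m /₀ q ℕ.< m
        smaller = ≡.subst (m /₀ q ℕ.<_) (≡.trans (ℕₚ.*-comm _ q) (/₀-* pr q∣m)) (ℕₚ.m<m*n (m /₀ q) q {{ℕ.>-nonZero quotient>0}} (ℕ.nonTrivial⇒n>1 q {{Data.Nat.Primality.prime⇒nonTrivial pr}}))

    module _ (ℓ : ℕ) .{{_ : ℕ.NonZero ℓ}} where

      private
        cons : ∀ n → ℤ → (Fin n → ℤ) → Fin (suc n) → ℤ
        cons n c f Fin.zero    = c
        cons n c f (Fin.suc i) = f i

      -- Representatives modulo ℓ: all functions with values in 0, ..., ℓ - 1. They make the search
      -- for a maximal ideal finite.
      functions : ∀ n → List (Fin n → ℤ)
      functions zero    = (λ ()) ∷ []
      functions (suc n) = concatMap (λ c → map (cons n (+ c)) (functions n)) (upTo ℓ)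

      Reduction : ∀ n → (Fin n → ℤ) → Set
      Reduction n f = Σ (Fin n → ℤ) λ c → c ∈ functions n × Σ (Fin n → ℤ) λ q → ∀ i → f i ≡ c i ℤ.+ + ℓ ℤ.* q i

      functions-complete : ∀ n (f : Fin n → ℤ) → Reduction n f
      functions-complete zero    f = (λ ()) , here ≡.refl , (λ ()) , λ ()
      functions-complete (suc n) f = extend (functions-complete n (λ i → f (Fin.suc i)))
        where
        r = f Fin.zero ℤdm.%ℕ ℓ
        s = f Fin.zero ℤdm./ℕ ℓ
        extend : Reduction n (λ i → f (Fin.suc i)) →
                 Reduction (suc n) f
        extend (c , c∈ , q , eq) = cons n (+ r) c
          , Membershipₚ.∈-concat⁺′ {xss = map (λ c → map (cons n (+ c)) (functions n)) (upTo ℓ)} (Membershipₚ.∈-map⁺ (cons n (+ r)) c∈)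
              (Membershipₚ.∈-map⁺ (λ c → map (cons n (+ c)) (functions n)) (Membershipₚ.∈-upTo⁺ (ℤdm.n%ℕd<d (f Fin.zero) ℓ)))
          , cons n s q
          , λ { Fin.zero → ≡.trans (ℤdm.a≡a%ℕn+[a/ℕn]*n (f Fin.zero) ℓ) (cong (ℤ._+_ (+ r)) (ℤₚ.*-comm s (+ ℓ))) ; (Fin.suc i) → eq i }

    module PrimeAbove {ω m} (o : HasOrder ω m) {ℓ : ℕ} (pr : Prime ℓ) where
      open HasOrder o
      open PrimeProducts (root ω m)
      private
        instance ℓ≢0 = prime⇒nonZero pr
        L = ι (+ ℓ)
        Ps = primes m
        Xm = X Ps
        α = δ ω
        pos : All PrimeOrder Ps
        pos = All.tabulate (λ q∈ → root-order o (proj₁ (∈primes⁻ {m} q∈)) (proj₂ (∈primes⁻ {m} q∈)))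

      -- An ideal that contains ℓ and everything annihilated by Xm, so that ω satisfies its
      -- cyclotomic equation modulo I₀. It is proper because the coefficient of Xm at e is 1, which
      -- ℓ does not divide.
      I₀ : (Fin v → ℤ) → Set
      I₀ y = L ∣∣ y ⋆ Xm

      divisible? : ∀ y → Dec (L ∣∣ y)
      divisible? y = Dec.map′ to from (Finₚ.all? (λ h → ℓ ∣? ℤ.∣ y h ∣))
        where
        to : (∀ h → ℓ ∣ ℤ.∣ y h ∣) → L ∣∣ y
        to p = quot (λ h → proj₁ (signed (y h) (p h))) (pointwise λ h → ≡.trans (proj₂ (signed (y h) (p h))) (≡.sym (ι⋆-at (+ ℓ) _ h)))
          where
          signed : ∀ z → ℓ ∣ ℤ.∣ z ∣ → ∃ λ c → z ≡ + ℓ ℤ.* c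
          signed (+ n)      (divides c eq) = + c , ≡.trans (cong +_ (≡.trans eq (ℕₚ.*-comm c ℓ))) (ℤₚ.pos-* ℓ c)
          signed ℤ.-[1+ n ] (divides c eq) = ℤ.- (+ c) , ≡.trans (cong (λ k → ℤ.- (+ k)) (≡.trans eq (ℕₚ.*-comm c ℓ)))
            (≡.trans (cong ℤ.-_ (ℤₚ.pos-* ℓ c)) (ℤₚ.neg-distribʳ-* (+ ℓ) (+ c)))
        from : L ∣∣ y → ∀ h → ℓ ∣ ℤ.∣ y h ∣
        from (quot z eq) h = divides ℤ.∣ z h ∣ (≡.trans (cong ℤ.∣_∣ (≡.trans (at eq h) (ι⋆-at (+ ℓ) z h))) (≡.trans (ℤₚ.abs-* (+ ℓ) (z h)) (ℕₚ.*-comm ℓ _)))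

      X-e : ∀ {L} → All PrimeOrder L → Distinct L → X L e ≡ 1ℤ
      X-e []               _        = δ-e
      X-e {q ∷ L} (po ∷ pos) (d ∷ ds) = ≡.trans (⋆-e-coprime (coprime-product (isPrime po) (All.map isPrime pos) d)
          (supported-⊕ (supported-δ e (pow-e q)) (supported-⊖ (supported-δ (root ω m q) (order po)))) (supported-X pos))
        (≡.trans (≡.cong₂ ℤ._*_ (≡.trans (⊕-at (δ e) (⊖ δ (root ω m q)) e) (≡.cong₂ ℤ._+_ δ-e (≡.trans (⊖-at (δ (root ω m q)) e) (cong ℤ.-_ (δ-≢ (λ p → ≢e po (≡.sym p))))))) (X-e pos ds))
          (ℤₚ.*-identityˡ 1ℤ))

      private
        open MaximalIdeal ZG

        ideal₀ : IsDecIdeal I₀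
        ideal₀ = record
          { resp  = λ { x≈y (quot z eq) → quot z (≈-trans (*-congʳ (≈-sym x≈y)) eq) }
          ; zero∈ = quot 𝟘 (≈-trans (zeroˡ Xm) (≈-sym (zeroʳ L)))
          ; +∈    = λ { {x} {y} (quot z eq) (quot w eq′) → quot (z ⊕ w) (≈-trans (distribʳ Xm x y) (≈-trans (⊕-cong eq eq′) (≈-sym (distribˡ L z w)))) }
          ; *∈    = λ { x {y} (quot z eq) → quot (x ⋆ z) (≈-trans (*-assoc x y Xm) (≈-trans (*-congˡ {x = x} eq) (solve 3 (λ x l z → x :* (l :* z) := l :* (x :* z)) ≈-refl x L z))) }
          ; _∈?   = λ y → divisible? (y ⋆ Xm) }

        proper₀ : ¬ I₀ (δ e)
        proper₀ (quot z eq) = ℕₚ.<⇒≢ (ℕ.nonTrivial⇒n>1 ℓ {{Data.Nat.Primality.prime⇒nonTrivial pr}}) (≡.sym (ℕₚ.m*n≡1⇒m≡1 ℓ ℤ.∣ z e ∣ (≡.trans (≡.sym (ℤₚ.abs-* (+ ℓ) (z e)))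
          (cong ℤ.∣_∣ (≡.trans (≡.sym (ι⋆-at (+ ℓ) z e)) (≡.trans (≡.sym (at eq e)) (≡.trans (at (⋆-identityˡ Xm) e) (X-e pos (primes-distinct m)))))))))

        complete : ∀ y → ∃ λ c → c ∈ functions ℓ v × I₀ (y ⊕ ⊖ c)
        complete y = go (functions-complete ℓ v y)
          where
          go : Reduction ℓ v y → ∃ λ c → c ∈ functions ℓ v × I₀ (y ⊕ ⊖ c)
          go (c , c∈ , q , eq) = c , c∈ , quot (q ⋆ Xm) (≈-trans (*-congʳ (begin
              y ⊕ ⊖ c                 ≈⟨ +-congʳ (pointwise λ i → ≡.trans (eq i) (≡.trans (cong (ℤ._+_ (c i)) (≡.sym (ι⋆-at (+ ℓ) q i))) (≡.sym (⊕-at c (L ⋆ q) i)))) ⟩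
              (c ⊕ L ⋆ q) ⊕ ⊖ c       ≈⟨ solve 3 (λ c l q → (c :+ l :* q) :- c := l :* q) ≈-refl c L q ⟩
              L ⋆ q                   ∎)) (*-assoc L q Xm))

      open PrimeIdeal ZG

      I : (Fin v → ℤ) → Set
      I = maximalIdeal ideal₀ proper₀ (functions ℓ v) complete

      I-prime : IsDecPrimeIdeal I
      I-prime = maximalIdeal-prime ideal₀ proper₀ (functions ℓ v) complete

      open IsDecPrimeIdeal I-prime

      I₀⊆I : ∀ {y} → I₀ y → I y
      I₀⊆I = ⊆maximalIdeal ideal₀ proper₀ (functions ℓ v) complete

      annihilator⊆I : ∀ {y} → y ⋆ Xm ≈ 𝟘 → I y
      annihilator⊆I p = I₀⊆I (quot 𝟘 (≈-trans p (≈-sym (zeroʳ L))))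

      ℓ∈I : I L
      ℓ∈I = I₀⊆I (quot Xm ≈-refl)

      open Evaluation ZG

      α-pow : ∀ n → α ^ n ≈ δ (pow ω n)
      α-pow n = ≈-sym (δ-pow ω n)

      private
        Φ = Cyclotomic.cyclotomic

        -- Divisors of a positive integer as far as multiples of Xm are concerned. By
        -- torsion-freeness they can be cancelled from products with Xm.
        AlmostUnit : (Fin v → ℤ) → Set
        AlmostUnit y = ∃ λ n → 1 ℕ.≤ n × ∃ λ a → (y ⋆ a) ⋆ Xm ≈ ι (+ n) ⋆ Xm

        -- Choose a prime q dividing m/c. Then Φ_c(ω) divides ω^c - 1, which divides θ - 1 for θ =
        -- ω^(m/q), which divides q - N̂ q; and N̂ q annihilates Xm.
        evΦ-almostUnit : ∀ c → 1 ℕ.≤ c → c ℕ.< m → c ∣ m → AlmostUnit (ev α (Φ c))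
        evΦ-almostUnit c 1≤c c<m (divides k m≡) = go (prime-factor 2≤k)
          where
          2≤k : 2 ℕ.≤ k
          2≤k = ℕₚ.*-cancelʳ-< c 1 k (≡.subst₂ ℕ._<_ (≡.sym (ℕₚ.*-identityˡ c)) m≡ c<m)
          go : (∃ λ q → Prime q × q ∣ k) → AlmostUnit (ev α (Φ c))
          go (q , pq , divides j k≡) = q , ℕ.>-nonZero⁻¹ q {{prime⇒nonZero pq}} , a ⋆ s , (begin
              (ev α (Φ c) ⋆ (a ⋆ s)) ⋆ Xm          ≈⟨ *-congʳ (*-assoc (ev α (Φ c)) a s) ⟨
              ((ev α (Φ c) ⋆ a) ⋆ s) ⋆ Xm          ≈⟨ *-congʳ (*-congʳ φa) ⟩
              ((θ ⊕ ⊖ δ e) ⋆ s) ⋆ Xm               ≈⟨ solve 3 (λ t n x → t :* x := (n :+ t) :* x :- n :* x) ≈-refl ((θ ⊕ ⊖ δ e) ⋆ s) (N̂ q) Xm ⟩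
              (N̂ q ⊕ (θ ⊕ ⊖ δ e) ⋆ s) ⋆ Xm ⊕ ⊖ (N̂ q ⋆ Xm)  ≈⟨ ⊕-cong (*-congʳ (≈-sym q≈)) (-‿cong (N̂⋆X pos (∈primes⁺ 1≤m pq q∣m))) ⟩
              ι (+ q) ⋆ Xm ⊕ ⊖ 𝟘                   ≈⟨ solve 1 (λ x → x :- con (+ 0) := x) ≈-refl (ι (+ q) ⋆ Xm) ⟩
              ι (+ q) ⋆ Xm                         ∎)
            where
            m≡q* : m ≡ q ℕ.* (c ℕ.* j)
            m≡q* = ≡.trans m≡ (≡.trans (cong (ℕ._* c) (≡.trans k≡ (ℕₚ.*-comm j q))) (≡.trans (ℕₚ.*-assoc q j c) (cong (q ℕ.*_) (ℕₚ.*-comm j c))))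
            q∣m : q ∣ m
            q∣m = ≡.subst (q ∣_) (≡.sym m≡q*) (m∣m*n (c ℕ.* j))
            θ = δ (root ω m q)
            θ≈ : θ ≈ (α ^ c) ^ j
            θ≈ = ≈-trans (pointwise λ x → cong (λ i → δ (pow ω i) x) (≡.trans (cong (_/₀ q) m≡q*) (/₀-cancel pq))) (≈-trans (≈-sym (α-pow (c ℕ.* j))) (≈-sym (^-assocʳ α c j)))
            Φc∣ = Cyclotomic.Φ∣x^c-1 (Cyclotomic.cyclotomic-valid c) c 1≤c ℕₚ.≤-refl
            a : Fin v → ℤ
            a = ev α (RingKit._∣∣_.quotient Φc∣) ⋆ geo (α ^ c) j
            φa : ev α (Φ c) ⋆ a ≈ θ ⊕ ⊖ δ e
            φa = begin
              ev α (Φ c) ⋆ (ev α (RingKit._∣∣_.quotient Φc∣) ⋆ geo (α ^ c) j)    ≈⟨ *-assoc _ _ _ ⟨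
              (ev α (Φ c) ⋆ ev α (RingKit._∣∣_.quotient Φc∣)) ⋆ geo (α ^ c) j    ≈⟨ *-congʳ (≈-trans (≈-sym (ev-* α (Φ c) (RingKit._∣∣_.quotient Φc∣)))
                                                                                  (≈-trans (ev-resp α (Φ c Defs.*ₚ RingKit._∣∣_.quotient Φc∣) (Defs.xpowMinus1 c) (Polys.at (Polys.trans≈ (Polys.sym≈ (RingKit._∣∣_.equality Φc∣)) (Polys.sym≈ (Cyclotomic.xpowMinus1≈ c))))) (ev-xpow c))) ⟩
              (α ^ c ⊕ ⊖ δ e) ⋆ geo (α ^ c) j                                   ≈⟨ geo-* (α ^ c) j ⟩
              (α ^ c) ^ j ⊕ ⊖ δ e                                               ≈⟨ +-congʳ θ≈ ⟨
              θ ⊕ ⊖ δ e                                                         ∎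
              where
              ev-xpow : ∀ c → ev α (Defs.xpowMinus1 c) ≈ α ^ c ⊕ ⊖ δ e
              ev-xpow c = ≈-trans (ev-+ α (Defs.monomial c) (constₚ (ℤ.- 1ℤ))) (⊕-cong (ev-monomial α c) (ev-const α (ℤ.- 1ℤ)))
            s = RingKit._≡_[_].quotient (≡-sym (geo-≡ θ q (≡1 θ)))
            q≈ : ι (+ q) ≈ N̂ q ⊕ (θ ⊕ ⊖ δ e) ⋆ s
            q≈ = RingKit._≡_[_].equality (≡-sym (geo-≡ θ q (≡1 θ)))

        evΠ-almostUnit : ∀ b → b ℕ.< m → AlmostUnit (ev α (Cyclotomic.Π Φ m b))
        evΠ-almostUnit zero    _   = 1 , ℕₚ.≤-refl , δ e , *-congʳ (≈-trans (*-identityʳ _) (ev-const α 1ℤ))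
        evΠ-almostUnit (suc b) b<m = go (suc b ∣? m) (evΠ-almostUnit b (ℕₚ.<⇒≤ b<m))
          where
          P = Cyclotomic.Π Φ m b
          go : (d : Dec (suc b ∣ m)) → AlmostUnit (ev α P) → AlmostUnit (ev α (Cyclotomic.factor Φ (suc b) d Defs.*ₚ P))
          go (no _) (n , 1≤n , a , eq) = n , 1≤n , a , ≈-trans (*-congʳ (*-congʳ (≈-trans (ev-* α (constₚ 1ℤ) P) (≈-trans (*-congʳ (ev-const α 1ℤ)) (⋆-identityˡ (ev α P)))))) eq
          go (yes d) (n , 1≤n , a , eq) = combine (evΦ-almostUnit (suc b) (ℕ.s≤s ℕ.z≤n) b<m d)
            where
            F = ev α (Φ (suc b))
            combine : AlmostUnit F → AlmostUnit (ev α (Φ (suc b) Defs.*ₚ P))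
            combine (n′ , 1≤n′ , a′ , eq′) = n ℕ.* n′ , ℕₚ.*-mono-≤ 1≤n 1≤n′ , a ⋆ a′ , (begin
              (ev α (Φ (suc b) Defs.*ₚ P) ⋆ (a ⋆ a′)) ⋆ Xm   ≈⟨ *-congʳ (*-congʳ (ev-* α (Φ (suc b)) P)) ⟩
              ((F ⋆ ev α P) ⋆ (a ⋆ a′)) ⋆ Xm                 ≈⟨ solve 5 (λ f p a b x → ((f :* p) :* (a :* b)) :* x := (f :* b) :* ((p :* a) :* x)) ≈-refl F (ev α P) a a′ Xm ⟩
              (F ⋆ a′) ⋆ ((ev α P ⋆ a) ⋆ Xm)                 ≈⟨ *-congˡ eq ⟩
              (F ⋆ a′) ⋆ (ι (+ n) ⋆ Xm)                      ≈⟨ solve 4 (λ f b n x → (f :* b) :* (n :* x) := n :* ((f :* b) :* x)) ≈-refl F a′ (ι (+ n)) Xm ⟩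
              ι (+ n) ⋆ ((F ⋆ a′) ⋆ Xm)                      ≈⟨ *-congˡ eq′ ⟩
              ι (+ n) ⋆ (ι (+ n′) ⋆ Xm)                      ≈⟨ *-assoc _ _ _ ⟨
              (ι (+ n) ⋆ ι (+ n′)) ⋆ Xm                      ≈⟨ *-congʳ (≈-trans (pointwise λ x → cong (λ c → ι c x) (ℤₚ.pos-* n n′)) (ι-* (+ n) (+ n′))) ⟨
              ι (+ (n ℕ.* n′)) ⋆ Xm                          ∎)

      -- In ω^m - 1 = 0 the cyclotomic factors of index below m are almost units, so Φ_m(ω)
      -- annihilates Xm.
      Φ∈I : I (ev α (Φ m))
      Φ∈I = go (sucpred m 1≤m)
        where
        sucpred : ∀ m → 1 ℕ.≤ m → ∃ λ b → m ≡ suc b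
        sucpred (suc b) _ = b , ≡.refl
        go : (∃ λ b → m ≡ suc b) → I (ev α (Φ m))
        go (b , m≡) = annihilator⊆I (conclude (evΠ-almostUnit b (≡.subst (b ℕ.<_) (≡.sym m≡) ℕₚ.≤-refl)))
          where
          P = Cyclotomic.Π Φ m b
          split : Φ m Defs.*ₚ P Polys.≈ Defs.xpowMinus1 m
          split = Polys.sym≈ (Polys.trans≈ (Cyclotomic.xpowMinus1≈ m) (Polys.trans≈ (Cyclotomic.cyclotomic-valid m m 1≤m ℕₚ.≤-refl)
            (≡.subst (λ c → Cyclotomic.Π Φ m c Polys.≈ Φ m Defs.*ₚ P) (≡.sym m≡) (Polys.*-cong≈ (≡.subst (λ c → Cyclotomic.factor Φ (suc b) (suc b ∣? m) Polys.≈ Φ c) (≡.sym m≡)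
              (Cyclotomic.factor-yes Φ (suc b) (suc b ∣? m) (≡.subst (suc b ∣_) (≡.sym m≡) ∣-refl))) (Polys.refl≈ {P})))))
          ΦP≈𝟘 : ev α (Φ m) ⋆ ev α P ≈ 𝟘
          ΦP≈𝟘 = begin
            ev α (Φ m) ⋆ ev α P          ≈⟨ ev-* α (Φ m) P ⟨
            ev α (Φ m Defs.*ₚ P)         ≈⟨ ev-resp α (Φ m Defs.*ₚ P) (Defs.xpowMinus1 m) (Polys.at split) ⟩
            ev α (Defs.xpowMinus1 m)     ≈⟨ ≈-trans (ev-+ α (Defs.monomial m) (constₚ (ℤ.- 1ℤ))) (⊕-cong (ev-monomial α m) (ev-const α (ℤ.- 1ℤ))) ⟩
            α ^ m ⊕ ⊖ δ e                ≈⟨ +-congʳ (≈-trans (α-pow m) (pointwise λ x → cong (λ g → δ g x) pow≡e)) ⟩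
            δ e ⊕ ⊖ δ e                  ≈⟨ -‿inverseʳ (δ e) ⟩
            𝟘                            ∎
          conclude : AlmostUnit (ev α P) → ev α (Φ m) ⋆ Xm ≈ 𝟘
          conclude (n , 1≤n , a , eq) = torsion-free n {{ℕ.>-nonZero 1≤n}} (ev α (Φ m) ⋆ Xm) (begin
            ι (+ n) ⋆ (ev α (Φ m) ⋆ Xm)             ≈⟨ solve 3 (λ n f x → n :* (f :* x) := f :* (n :* x)) ≈-refl (ι (+ n)) (ev α (Φ m)) Xm ⟩
            ev α (Φ m) ⋆ (ι (+ n) ⋆ Xm)             ≈⟨ *-congˡ (≈-sym eq) ⟩
            ev α (Φ m) ⋆ ((ev α P ⋆ a) ⋆ Xm)        ≈⟨ solve 4 (λ f p a x → f :* ((p :* a) :* x) := (f :* p) :* (a :* x)) ≈-refl (ev α (Φ m)) (ev α P) a Xm ⟩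
            (ev α (Φ m) ⋆ ev α P) ⋆ (a ⋆ Xm)        ≈⟨ *-congʳ ΦP≈𝟘 ⟩
            𝟘 ⋆ (a ⋆ Xm)                            ≈⟨ zeroˡ _ ⟩
            𝟘                                       ∎)

  -- From fixed prime ideals to congruences between r and powers of ℓ.

  module FixedPrimes where

    open import Data.Nat.GCD using (module Bézout)
    open import Data.Integer.Base using (+_)
    open Arith
    open GroupRing
    open Coefficients
    open Decomposition
    open import Defs using (Poly; constₚ; IsPrimeIdeal; FixesPrimesAbove; _≡ᵐ_[mod_])
    open RingKit ZG hiding (_≈_; sum; refl; sym; trans)
    open Solver
    open Ramified ZG using (geo; geo-≡)
    open PrimeIdeal ZG
    open Evaluation ZG

    module _ {ω m} (o : HasOrder ω m) {ℓ : ℕ} (pr : Prime ℓ) (a n : ℕ) (m≡ : m ≡ ℓ ℕ.^ a ℕ.* n) (ℓ∤n : ¬ (ℓ ∣ n)) where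
      open HasOrder o
      open PrimeAbove o pr
      open IsDecPrimeIdeal I-prime
      open PrimeProducts (root ω m)
      private
        instance ℓ≢0 = prime⇒nonZero pr
        α = δ ω
        infix 4 _~_
        _~_ = _∼_ I-prime
        1≤n : 1 ℕ.≤ n
        1≤n = ℕₚ.n≢0⇒n>0 (λ n≡0 → ℕₚ.<⇒≱ 1≤m (ℕₚ.≤-reflexive (≡.trans m≡ (≡.trans (cong (ℓ ℕ.^ a ℕ.*_) n≡0) (ℕₚ.*-zeroʳ (ℓ ℕ.^ a))))))

        α^≈1 : ∀ i → pow ω i ≡ e → α ^ i ≈ δ e
        α^≈1 i p = ≈-trans (α-pow i) (pointwise λ x → cong (λ g → δ g x) p)

        power~1 : ∀ {y} k → y ~ δ e → y ^ k ~ δ e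
        power~1 k p = ∼-trans I-prime (∼-^ I-prime k p) (∼-reflexive I-prime (1^n≈1 k))

        ∣⇒~1 : ∀ {i j} → i ∣ j → α ^ i ~ δ e → α ^ j ~ δ e
        ∣⇒~1 {i} {j} (divides k j≡) p = ∼-trans I-prime (∼-reflexive I-prime (≈-trans (pointwise λ x → cong (λ z → (α ^ z) x) (≡.trans j≡ (ℕₚ.*-comm k i))) (≈-sym (^-assocʳ α i k)))) (power~1 k p)

        frobenius-power : ∀ i y → (y ⊕ ⊖ δ e) ^ (ℓ ℕ.^ i) ~ y ^ (ℓ ℕ.^ i) ⊕ ⊖ δ e
        frobenius-power zero    y = ∼-reflexive I-prime (≈-trans (*-identityʳ _) (+-congʳ (≈-sym (*-identityʳ y))))
        frobenius-power (suc i) y = ∼-trans I-prime (∼-reflexive I-prime (shift (y ⊕ ⊖ δ e)))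
          (∼-trans I-prime (∼-^ I-prime ℓ (frobenius-power i y)) (∼-trans I-prime (∼-freshman I-prime pr ℓ∈I (y ^ (ℓ ℕ.^ i)) (⊖ δ e))
          (∼-trans I-prime (∼-+ I-prime (∼-reflexive I-prime (≈-sym (shift y))) (∼-neg-^ I-prime pr ℓ∈I (δ e)))
            (∼-reflexive I-prime (+-congˡ (-‿cong (1^n≈1 ℓ)))))))
          where
          shift : ∀ z → z ^ (ℓ ℕ.^ suc i) ≈ (z ^ (ℓ ℕ.^ i)) ^ ℓ
          shift z = ≈-trans (pointwise λ x → cong (λ k → (z ^ k) x) (ℕₚ.*-comm ℓ (ℓ ℕ.^ i))) (≈-sym (^-assocʳ z (ℓ ℕ.^ i) ℓ))

        -- In characteristic ℓ, the ℓ^a-th power of αⁿ - 1 is α^m - 1 = 0, and a prime ideal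
        -- contains the roots of its elements.
        α^n~1 : α ^ n ~ δ e
        α^n~1 = mk (^∈ I-prime (ℓ ℕ.^ a) (∼⇒∈ I-prime (∼-trans I-prime (frobenius-power a (α ^ n)) (∼-reflexive I-prime (begin
            (α ^ n) ^ (ℓ ℕ.^ a) ⊕ ⊖ δ e     ≈⟨ +-congʳ (^-assocʳ α n (ℓ ℕ.^ a)) ⟩
            α ^ (n ℕ.* ℓ ℕ.^ a) ⊕ ⊖ δ e     ≈⟨ +-congʳ (α^≈1 (n ℕ.* ℓ ℕ.^ a) (≡.trans (cong (pow ω) (≡.trans (ℕₚ.*-comm n (ℓ ℕ.^ a)) (≡.sym m≡))) pow≡e)) ⟩
            δ e ⊕ ⊖ δ e                     ≈⟨ -‿inverseʳ (δ e) ⟩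
            𝟘                               ∎))) zero∈))
          where open import Relation.Binary.Reasoning.Setoid (RingKit.setoid ZG)

        cancel~ : ∀ i j → α ^ (i ℕ.+ j) ~ α ^ i → α ^ j ~ δ e
        cancel~ i j p = ∼-trans I-prime (∼-reflexive I-prime (begin
            α ^ j                                  ≈⟨ ⋆-identityˡ (α ^ j) ⟨
            δ e ⋆ α ^ j                            ≈⟨ *-congʳ inverse ⟨
            (δ (inv (pow ω i)) ⋆ α ^ i) ⋆ α ^ j    ≈⟨ *-assoc _ _ _ ⟩
            δ (inv (pow ω i)) ⋆ (α ^ i ⋆ α ^ j)    ≈⟨ *-congˡ (≈-sym (^-homo-* α i j)) ⟩
            δ (inv (pow ω i)) ⋆ α ^ (i ℕ.+ j)      ∎)) (∼-trans I-prime (∼-* I-prime (∼-reflexive I-prime (≈-refl {δ (inv (pow ω i))})) p) (∼-reflexive I-prime inverse))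
          where
          open import Relation.Binary.Reasoning.Setoid (RingKit.setoid ZG)
          inverse : δ (inv (pow ω i)) ⋆ α ^ i ≈ δ e
          inverse = ≈-trans (*-congˡ (α-pow i)) (≈-trans (≈-sym (δ-∙ (inv (pow ω i)) (pow ω i))) (pointwise λ x → cong (λ g → δ g x) (invˡ (pow ω i))))

        bezout~1 : ∀ {i j d} → Bézout.Identity d i j → α ^ i ~ δ e → α ^ j ~ δ e → α ^ d ~ δ e
        bezout~1 {i} {j} {d} (Bézout.+- x y eq) p q = cancel~ (y ℕ.* j) d (∼-trans I-prime (∼-trans I-prime
          (∼-reflexive I-prime (pointwise λ z → cong (λ k → (α ^ k) z) (≡.trans (ℕₚ.+-comm (y ℕ.* j) d) eq))) (∣⇒~1 (n∣m*n x) p)) (∼-sym I-prime (∣⇒~1 (n∣m*n y) q)))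
        bezout~1 {i} {j} {d} (Bézout.-+ x y eq) p q = cancel~ (x ℕ.* i) d (∼-trans I-prime (∼-trans I-prime
          (∼-reflexive I-prime (pointwise λ z → cong (λ k → (α ^ k) z) (≡.trans (ℕₚ.+-comm (x ℕ.* i) d) eq))) (∣⇒~1 (n∣m*n y) q)) (∼-sym I-prime (∣⇒~1 (n∣m*n x) p)))

        -- Reduction modulo I preserves the order of α away from ℓ. Otherwise α^(m/q) ∼ 1 for some
        -- prime q dividing n, and then N̂ q, which lies in I, is congruent to q; but q is coprime
        -- to ℓ ∈ I.
        order-residue : ∀ D → α ^ D ~ δ e → n ∣ D
        order-residue D p = go (gcd[m,n]∣n D n)
          where
          g = gcd D n
          α^g : α ^ g ~ δ e
          α^g = bezout~1 (Bézout.identity (gcd-GCD D n)) p α^n~1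
          go : g ∣ n → n ∣ D
          go (divides k n≡) = decide (k ℕₚ.≟ 1)
            where
            decide : Dec (k ≡ 1) → n ∣ D
            decide (yes k≡1) = ≡.subst (_∣ D) (≡.sym (≡.trans n≡ (≡.trans (cong (ℕ._* g) k≡1) (ℕₚ.+-identityʳ g)))) (gcd[m,n]∣m D n)
            decide (no k≢1) = contradiction (prime-factor 2≤k) impossible
              where
              2≤k : 2 ℕ.≤ k
              2≤k = ℕₚ.≤∧≢⇒< (ℕₚ.n≢0⇒n>0 (λ k≡0 → ℕₚ.<⇒≱ 1≤n (ℕₚ.≤-reflexive (≡.trans n≡ (cong (ℕ._* g) k≡0))))) (λ p → k≢1 (≡.sym p))
              impossible : ¬ (∃ λ q → Prime q × q ∣ k)
              impossible (q , pq , divides c k≡) = coprime∈ I-prime (∤⇒coprime pr (λ ℓ∣q → ℓ∤n (≡.subst (_∣ n) (≡.sym (prime∣prime⇒≡ pr pq ℓ∣q)) q∣n))) ℓ∈I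
                  (∼⇒∈ I-prime (∼-sym I-prime geo~q) N̂∈I)
                where
                n≡q* : n ≡ q ℕ.* (c ℕ.* g)
                n≡q* = ≡.trans n≡ (≡.trans (cong (ℕ._* g) (≡.trans k≡ (ℕₚ.*-comm c q))) (ℕₚ.*-assoc q c g))
                q∣n : q ∣ n
                q∣n = ≡.subst (q ∣_) (≡.sym n≡q*) (m∣m*n (c ℕ.* g))
                m≡q* : m ≡ q ℕ.* (ℓ ℕ.^ a ℕ.* c ℕ.* g)
                m≡q* = ≡.trans m≡ (≡.trans (cong (ℓ ℕ.^ a ℕ.*_) n≡q*) (≡.trans (≡.sym (ℕₚ.*-assoc (ℓ ℕ.^ a) q (c ℕ.* g))) (≡.trans (cong (ℕ._* (c ℕ.* g)) (ℕₚ.*-comm (ℓ ℕ.^ a) q))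
                  (≡.trans (ℕₚ.*-assoc q (ℓ ℕ.^ a) (c ℕ.* g)) (cong (q ℕ.*_) (≡.sym (ℕₚ.*-assoc (ℓ ℕ.^ a) c g)))))))
                θ~1 : δ (root ω m q) ~ δ e
                θ~1 = ∼-trans I-prime (∼-reflexive I-prime (≈-sym (α-pow (m /₀ q)))) (∣⇒~1 (≡.subst (g ∣_) (≡.sym (≡.trans (cong (_/₀ q) m≡q*) (/₀-cancel pq))) (n∣m*n (ℓ ℕ.^ a ℕ.* c))) α^g)
                N̂∈I : I (N̂ q)
                N̂∈I = annihilator⊆I (N̂⋆X (All.tabulate (λ q∈ → root-order o (proj₁ (∈primes⁻ {m} q∈)) (proj₂ (∈primes⁻ {m} q∈)))) (∈primes⁺ 1≤m pq (≡.subst (q ∣_) (≡.sym m≡q*) (m∣m*n _))))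
                geo~q : N̂ q ~ ι (+ q)
                geo~q = geo~ q
                  where
                  geo~ : ∀ i → geo (δ (root ω m q)) i ~ ι (+ i)
                  geo~ i = ≡⇒∼ I-prime (_∼_.difference θ~1) (geo-≡ (δ (root ω m q)) i (Ramified.≡1 ZG (δ (root ω m q))))

        exponents : ∀ i j → α ^ i ~ α ^ j → i ≅ j [ n ]
        exponents i j p = decide (ℕₚ.≤-total i j)
          where
          decide : i ℕ.≤ j ⊎ j ℕ.≤ i → i ≅ j [ n ]
          decide (inj₁ i≤j) = ∣∸⇒≅ i≤j (order-residue (j ℕ.∸ i) (cancel~ i (j ℕ.∸ i) (∼-trans I-prime (∼-reflexive I-prime (pointwise λ z → cong (λ k → (α ^ k) z) (ℕₚ.m+[n∸m]≡n i≤j))) (∼-sym I-prime p))))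
          decide (inj₂ j≤i) = ≅-sym (∣∸⇒≅ j≤i (order-residue (i ℕ.∸ j) (cancel~ j (i ℕ.∸ j) (∼-trans I-prime (∼-reflexive I-prime (pointwise λ z → cong (λ k → (α ^ k) z) (ℕₚ.m+[n∸m]≡n j≤i))) p))))

      private
        -- The preimage of I under x ↦ ω, a prime ideal of ℤ[x] to which `FixesPrimesAbove` applies.
        P : Poly → Set
        P f = I (ev α f)

        P-prime : IsPrimeIdeal P
        P-prime = record
          { resp     = λ {f} {g} f≈g → resp (ev-resp α f g f≈g)
          ; zero∈    = zero∈
          ; +-closed = λ {f} {g} p q → resp (≈-sym (ev-+ α f g)) (+∈ p q)
          ; *-closed = λ h {f} p → resp (≈-sym (ev-* α h f)) (*∈ (ev α h) p)
          ; proper   = λ p → proper (resp (ev-const α 1ℤ) p)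
          ; prime    = λ f g p → prime (ev α f) (ev α g) (resp (ev-* α f g) p) }

      -- If x ↦ xʳ fixes P, it maps α to a root of its minimal polynomial over 𝔽_ℓ, that is, to a Frobenius conjugate.
      frobenius-exponent : ∀ {t k r} → FixesPrimesAbove m t k → ℓ ∣ k → (+ r) ≡ᵐ t [mod m ] → ∃ λ j → r ≅ ℓ ℕ.^ j [ n ]
      frobenius-exponent {t} {k} {r} fixes (divides c k≡) r≡t = go (power-period (ℕ.>-nonZero⁻¹ ℓ) 1≤n (∤⇒coprime pr ℓ∤n))
        where
        k∈ : P (constₚ (+ k))
        k∈ = resp (≈-trans (≈-sym (ι-* (+ c) (+ ℓ))) (≈-trans (pointwise λ x → cong (λ z → ι z x) (≡.trans (≡.sym (ℤₚ.pos-* c ℓ)) (cong +_ (≡.sym k≡)))) (≈-sym (ev-const α (+ k))))) (*∈ (ι (+ c)) ℓ∈I)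
        go : (∃ λ K → n ∣ ℓ ℕ.^ suc K ℕ.∸ 1) → ∃ λ j → r ≅ ℓ ℕ.^ j [ n ]
        go (K , n∣) = conclude (integral-minimal-polynomial I-prime pr ℓ∈I α K periodic)
          where
          periodic : α ^ (ℓ ℕ.^ suc K) ~ α
          periodic = ∼-trans I-prime (∼-reflexive I-prime (≈-trans (pointwise λ x → cong (λ z → (α ^ z) x) (≡.sym (ℕₚ.m+[n∸m]≡n (ℕₚ.m^n>0 ℓ (suc K))))) (≈-refl)))
            (∼-trans I-prime (∼-* I-prime (∼-reflexive I-prime (≈-refl {α})) (∣⇒~1 n∣ α^n~1)) (∼-reflexive I-prime (*-identityʳ α)))
          conclude : (Σ (List ℤ) λ cs → I (ev α cs) × (∀ β → I (ev β cs) → ∃ λ j → _∼_ I-prime β (α ^ (ℓ ℕ.^ j)))) → ∃ λ j → r ≅ ℓ ℕ.^ j [ n ]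
          conclude (cs , α∈ , roots) = j , exponents r (ℓ ℕ.^ j) (proj₂ rooted)
            where
            rooted = roots (α ^ r) (resp (ev-substPow α r cs) (Equivalence.to (fixes Cyclotomic.cyclotomic Cyclotomic.isCyclotomicFamily P P-prime Φ∈I k∈ r r≡t cs) α∈))
            j = proj₁ rooted

  -- Structure of G: an element whose order is the exponent, and a cyclic torsion subgroup.

  module Structure where

    open import Defs using (IsExponent)

    open import Data.Nat.Base using (_+_; _*_; _∸_; _^_; _≤_; _<_)
    open import Data.Nat.Properties renaming (_≟_ to _≟ℕ_)
    open import Data.Nat.Divisibility
    open import Data.Nat.DivMod using (_/_; _%_; m≡m%n+[m/n]*n; m%n<n)
    open import Data.Nat.GCD using (module Bézout)
    open import Data.Fin.Base using (combine; remQuot)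
    open import Data.List.Relation.Unary.All using ([]; _∷_)
    open import Data.List.Relation.Unary.AllPairs using ([]; _∷_)
    open import Relation.Binary.PropositionalEquality
    open Arith
    open Sums using (_≟_; sum; sum-const)
    open Orbits using (orbit-sum)
    open GroupRing hiding (_≈_)
    open Coefficients using (coprime-torsion)
    open Decomposition using (HasOrder)

    pow-comm : ∀ g m n → pow (pow g m) n ≡ pow (pow g n) m
    pow-comm g m n = trans (sym (pow-* g m n)) (trans (cong (pow g) (*-comm m n)) (pow-* g n m))

    pow-∣ : ∀ {g m n} → m ∣ n → pow g m ≡ e → pow g n ≡ e
    pow-∣ {g} {m} (divides k n≡) p = trans (cong (pow g) (trans n≡ (*-comm k m))) (trans (pow-* g m k) (trans (cong (λ h → pow h k) p) (pow-e k)))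

    pow-≅ : ∀ {g a b n} → a ≅ b [ n ] → pow g n ≡ e → pow g a ≡ pow g b
    pow-≅ {g} {a} {b} {n} (shifts {i} {j} eq) p = trans (drop a i) (trans (cong (pow g) eq) (sym (drop b j)))
      where
      drop : ∀ a i → pow g a ≡ pow g (a + i * n)
      drop a i = sym (trans (pow-+ g a (i * n)) (trans (cong (pow g a ∙_) (pow-∣ (n∣m*n i) p)) (idʳ (pow g a))))

    -- On residues modulo the primes above ℓ, the endomorphism g ↦ φ(g)^M acts as a power of the Frobenius automorphism.
    record FrobeniusAt (γ : Fin v) (u : ℕ) (φ : Fin v → Fin v) (M ℓ : ℕ) : Set where
      field
        b u′ j : ℕ
        u≡     : u ≡ ℓ ^ b * u′
        1≤j    : 1 ≤ j
        same   : ∀ g → ∃ λ c → ∃ λ c′ → pow (φ g) M ∙ pow γ (u′ * c) ≡ pow (pow g (ℓ ^ j)) M ∙ pow γ (u′ * c′)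

    module _ {m} (exponent : IsExponent G m) where
      private
        1≤m = proj₁ exponent
        pow≡e = proj₁ (proj₂ exponent)
        minimal = proj₂ (proj₂ exponent)

        non-root : ∀ {q} → Prime q → q ∣ m → ∃ λ g → pow g (m /₀ q) ≢ e
        non-root {q} pr q∣m with Finₚ.any? (λ g → ¬? (pow g (m /₀ q) ≟ e))
        ... | yes r = r
        ... | no ¬r = contradiction (minimal (m /₀ q) quotient>0 (λ g → decidable-stable (pow g (m /₀ q) ≟ e) (λ p → ¬r (g , p)))) (<⇒≱ smaller)
          where
          quotient>0 : 0 < m /₀ q
          quotient>0 = n≢0⇒n>0 (λ z → <⇒≱ 1≤m (≤-reflexive (trans (sym (/₀-* pr q∣m)) (trans (cong (q *_) z) (*-zeroʳ q)))))
          smaller : m /₀ q < m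
          smaller = subst (m /₀ q <_) (trans (*-comm _ q) (/₀-* pr q∣m)) (m<m*n (m /₀ q) q {{ℕ.>-nonZero quotient>0}} (ℕ.nonTrivial⇒n>1 q {{prime⇒nonTrivial pr}}))

        -- If ω fails at q, it is multiplied by g^(m′), where g does not fail at q and m′ is the
        -- q-free part of m. This factor has q-power order, so it repairs q without disturbing the
        -- other primes.
        avoid : ∀ L → All (λ q → Prime q × q ∣ m) L → AllPairs _≢_ L → ∃ λ ω → All (λ q → pow ω (m /₀ q) ≢ e) L
        avoid []      _               _        = e , []
        avoid (q ∷ L) ((pr , q∣m) ∷ ps) (d ∷ ds) = step (avoid L ps ds)
          where
          step : (∃ λ ω → All (λ q → pow ω (m /₀ q) ≢ e) L) → ∃ λ ω → All (λ q → pow ω (m /₀ q) ≢ e) (q ∷ L)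
          step (ω , good) with pow ω (m /₀ q) ≟ e
          ... | no  p = ω , p ∷ good
          ... | yes p = modify (non-root pr q∣m) (prime-power-part pr m 1≤m)
            where
            modify : (∃ λ g → pow g (m /₀ q) ≢ e) → (∃ λ b → ∃ λ m′ → m ≡ q ^ b * m′ × ¬ (q ∣ m′)) → ∃ λ ω → All (λ q → pow ω (m /₀ q) ≢ e) (q ∷ L)
            modify (g , g≢) (b , m′ , m≡ , q∤m′) = ω ∙ h , at-q ∷ All.zipWith at-q′ (All.zip (ps , d) , good)
              where
              h = pow g m′
              at-q : pow (ω ∙ h) (m /₀ q) ≢ e
              at-q r = g≢ (coprime-torsion (∤⇒coprime pr q∤m′) (pow g (m /₀ q))
                (trans (sym (pow-* g (m /₀ q) q)) (trans (cong (pow g) (trans (*-comm _ q) (/₀-* pr q∣m))) (pow≡e g)))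
                (trans (pow-comm g (m /₀ q) m′) (trans (sym (idˡ _)) (trans (cong (_∙ pow h (m /₀ q)) (sym p)) (trans (sym (pow-∙ ω h (m /₀ q))) r)))))
              at-q′ : ∀ {q′} → ((Prime q′ × q′ ∣ m) × q ≢ q′) × pow ω (m /₀ q′) ≢ e → pow (ω ∙ h) (m /₀ q′) ≢ e
              at-q′ {q′} (((pr′ , q′∣m) , q≢q′) , ω≢) r = ω≢ (trans (sym (idʳ _)) (trans (cong (pow ω (m /₀ q′) ∙_) (sym trivial)) (trans (sym (pow-∙ ω h (m /₀ q′))) r)))
                where
                q′∣m′ : q′ ∣ m′
                q′∣m′ = coprime-divisor (∤⇒coprime pr′ (λ q′∣ → q≢q′ (sym (prime∣prime⇒≡ pr′ pr (prime∣^ pr′ b q′∣))))) (subst (q′ ∣_) m≡ q′∣m)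
                trivial : pow h (m /₀ q′) ≡ e
                trivial = trans (sym (pow-* g m′ (m /₀ q′))) (pow-∣ {g} {m} (multiple q′∣m′) (pow≡e g))
                  where
                  multiple : q′ ∣ m′ → m ∣ m′ * (m /₀ q′)
                  multiple (divides c eq) = divides c (trans (cong (_* (m /₀ q′)) eq) (trans (*-assoc c q′ (m /₀ q′)) (cong (c *_) (/₀-* pr′ q′∣m))))

      -- For ω from `avoid`, suppose ωⁱ = e and gcd(i, m) is a proper divisor of m. A prime q
      -- dividing the cofactor would give ω^(m/q) = e.
      exponent-attained : ∃ λ ω → HasOrder ω m
      exponent-attained = go (avoid (primes m) (All.tabulate (λ q∈ → ∈primes⁻ {m} q∈)) (primes-distinct m))
        where
        go : (∃ λ ω → All (λ q → pow ω (m /₀ q) ≢ e) (primes m)) → ∃ λ ω → HasOrder ω m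
        go (ω , good) = ω , record { 1≤m = 1≤m ; pow≡e = pow≡e ω ; ∣-order = λ i p → order i p (gcd[m,n]∣n i m) }
          where
          order : ∀ i → pow ω i ≡ e → gcd i m ∣ m → m ∣ i
          order i p (divides k m≡) with k ≟ℕ 1
          ... | yes k≡1 = subst (_∣ i) (sym (trans m≡ (trans (cong (_* gcd i m) k≡1) (+-identityʳ _)))) (gcd[m,n]∣m i m)
          ... | no  k≢1 = contradiction (prime-factor 2≤k) impossible
            where
            2≤k : 2 ≤ k
            2≤k = ≤∧≢⇒< (n≢0⇒n>0 (λ k≡0 → <⇒≱ 1≤m (≤-reflexive (trans m≡ (cong (_* gcd i m) k≡0))))) (λ r → k≢1 (sym r))
            pow-gcd : pow ω (gcd i m) ≡ e
            pow-gcd = bezout (Bézout.identity (gcd-GCD i m)) p (pow≡e ω)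
              where
              cancelled : ∀ {d z} → pow ω (d + z) ≡ e → pow ω z ≡ e → pow ω d ≡ e
              cancelled {d} {z} p q = trans (sym (idʳ _)) (trans (cong (pow ω d ∙_) (sym q)) (trans (sym (pow-+ ω d z)) p))
              bezout : ∀ {a b d} → Bézout.Identity d a b → pow ω a ≡ e → pow ω b ≡ e → pow ω d ≡ e
              bezout {a} {b} {d} (Bézout.+- x y eq) p q = cancelled {d} {y * b} (trans (cong (pow ω) eq) (pow-∣ {ω} {a} (n∣m*n x) p)) (pow-∣ {ω} {b} (n∣m*n y) q)
              bezout {a} {b} {d} (Bézout.-+ x y eq) p q = cancelled {d} {x * a} (trans (cong (pow ω) eq) (pow-∣ {ω} {b} (n∣m*n y) q)) (pow-∣ {ω} {a} (n∣m*n x) p)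
            impossible : ¬ (∃ λ q → Prime q × q ∣ k)
            impossible (q , pq , divides c k≡) = All.lookup good (∈primes⁺ 1≤m pq (divides (c * gcd i m) (trans m≡q* (*-comm q _))))
              (pow-∣ {n = m /₀ q} (subst (gcd i m ∣_) (sym (trans (cong (_/₀ q) m≡q*) (/₀-cancel pq))) (n∣m*n c)) pow-gcd)
              where
              m≡q* : m ≡ q * (c * gcd i m)
              m≡q* = trans m≡ (trans (cong (_* gcd i m) (trans k≡ (*-comm c q))) (*-assoc q c _))

    HasOrder-pow : ∀ {ω a b} → 1 ≤ a → HasOrder ω (a * b) → HasOrder (pow ω b) a
    HasOrder-pow {ω} {a} {b} 1≤a o = record
      { 1≤m = 1≤a
      ; pow≡e = trans (sym (pow-* ω b a)) (trans (cong (pow ω) (*-comm b a)) (HasOrder.pow≡e o))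
      ; ∣-order = λ i p → *-cancelˡ-∣ b {{b≢0}} (subst (_∣ b * i) (*-comm a b) (HasOrder.∣-order o (b * i) (trans (pow-* ω b i) p))) }
      where
      b≢0 : ℕ.NonZero b
      b≢0 = ℕ.≢-nonZero (λ b≡0 → <⇒≱ (HasOrder.1≤m o) (≤-reflexive (trans (cong (a *_) b≡0) (*-zeroʳ a))))

    -- Lagrange's theorem applied to ⟨γ, g⟩ shows that the u-torsion of G is ⟨γ⟩.
    module _ {γ u} (o : HasOrder γ u) {N} (v≡ : v ≡ u * N) (coprime : Coprime N u) where
      private
        open HasOrder o renaming (1≤m to 1≤u; pow≡e to γ^u≡e)
        instance u≢0 = ℕ.>-nonZero 1≤u

        Generated : Fin v → Set
        Generated g = ∃ λ (i : Fin u) → g ≡ pow γ (toℕ i)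

        generated? : ∀ g → Dec (Generated g)
        generated? g = Finₚ.any? (λ i → g ≟ pow γ (toℕ i))

        generated : ∀ a → Generated (pow γ a)
        generated a = fromℕ< (m%n<n a u) , trans (cong (pow γ) (m≡m%n+[m/n]*n a u)) (trans (pow-+ γ (a % u) (a / u * u))
          (trans (cong (pow γ (a % u) ∙_) (pow-∣ {γ} {u} (n∣m*n (a / u)) γ^u≡e)) (trans (idʳ _) (cong (pow γ) (sym (Finₚ.toℕ-fromℕ< (m%n<n a u)))))))

        γ-injective : ∀ (i j : Fin u) → pow γ (toℕ i) ≡ pow γ (toℕ j) → i ≡ j
        γ-injective i j p = decide (≤-total (toℕ i) (toℕ j))
          where
          small : ∀ d → d < u → u ∣ d → d ≡ 0
          small zero    _   _   = refl
          small (suc d) d<u u∣d = contradiction (∣⇒≤ u∣d) (<⇒≱ d<u)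
          below : ∀ a b → a ≤ b → b < u → pow γ a ≡ pow γ b → a ≡ b
          below a b a≤b b<u p = ≤-antisym a≤b (m∸n≡0⇒m≤n (small (b ∸ a) (≤-<-trans (m∸n≤m b a) b<u) (∣-order (b ∸ a) (∙-cancelˡ (pow γ a)
            (trans (sym (pow-+ γ a (b ∸ a))) (trans (cong (pow γ) (m+[n∸m]≡n a≤b)) (trans (sym p) (sym (idʳ _)))))))))
          decide : toℕ i ≤ toℕ j ⊎ toℕ j ≤ toℕ i → i ≡ j
          decide (inj₁ i≤j) = Finₚ.toℕ-injective (below (toℕ i) (toℕ j) i≤j (Finₚ.toℕ<n j) p)
          decide (inj₂ j≤i) = sym (Finₚ.toℕ-injective (below (toℕ j) (toℕ i) j≤i (Finₚ.toℕ<n i) (sym p)))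

      -- Let r be the least positive exponent with g^r in ⟨γ⟩. The u r products γⁱ gʲ form a
      -- subgroup, so u r divides u N and r divides N. By minimality r also divides u, hence r = 1.
      torsion-cyclic : ∀ g → pow g u ≡ e → ∃ λ i → g ≡ pow γ i
      torsion-cyclic g g^u≡e = conclude (least (λ r → generated? (pow g r)) 1≤u (subst Generated (sym g^u≡e) (generated 0)))
        where
        conclude : (∃ λ r → 1 ≤ r × Generated (pow g r) × (∀ s → 1 ≤ s → s < r → ¬ Generated (pow g s))) → ∃ λ i → g ≡ pow γ i
        conclude (r , 1≤r , (i₀ , g^r≡) , below) = toℕ (proj₁ gen) , proj₂ gen
          where
          instance r≢0 = ℕ.>-nonZero 1≤r
          s₀ = toℕ i₀

          κ′ : Fin u × Fin r → Fin v
          κ′ (i , j) = pow γ (toℕ i) ∙ pow g (toℕ j)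
          κ : Fin (u * r) → Fin v
          κ k = κ′ (remQuot r k)

          reduce : ∀ b → pow g b ≡ pow γ (s₀ * (b / r)) ∙ pow g (b % r)
          reduce b = trans (cong (pow g) (trans (m≡m%n+[m/n]*n b r) (trans (+-comm (b % r) _) (cong (_+ b % r) (*-comm (b / r) r))))) (trans (pow-+ g (r * (b / r)) (b % r))
            (cong (_∙ pow g (b % r)) (trans (pow-* g r (b / r)) (trans (cong (λ h → pow h (b / r)) g^r≡) (sym (pow-* γ s₀ (b / r)))))))

          κ-complete : ∀ a b → ∃ λ k → pow γ a ∙ pow g b ≡ κ k
          κ-complete a b = combine (proj₁ γ-part) j , trans (cong (pow γ a ∙_) (reduce b)) (trans (sym (assoc _ _ _))
            (trans (cong₂ _∙_ (trans (sym (pow-+ γ a (s₀ * (b / r)))) (proj₂ γ-part)) (cong (pow g) (sym (Finₚ.toℕ-fromℕ< (m%n<n b r)))))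
              (cong κ′ (sym (Finₚ.remQuot-combine (proj₁ γ-part) j)))))
            where
            γ-part = generated (a + s₀ * (b / r))
            j = fromℕ< (m%n<n b r)

          κ′-torsion : ∀ a b → pow (pow γ a ∙ pow g b) u ≡ e
          κ′-torsion a b = trans (pow-∙ (pow γ a) (pow g b) u) (trans (cong₂ _∙_
            (trans (pow-comm γ a u) (trans (cong (λ h → pow h a) γ^u≡e) (pow-e a))) (trans (pow-comm g b u) (trans (cong (λ h → pow h b) g^u≡e) (pow-e b)))) (idˡ e))

          κ-∙ : ∀ i j → ∃ λ l → κ j ∙ κ i ≡ κ l
          κ-∙ i j = proj₁ k , trans (swap∙ _ _ _ _) (trans (cong₂ _∙_ (sym (pow-+ γ a a′)) (sym (pow-+ g b b′))) (proj₂ k))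
            where
            a = toℕ (proj₁ (remQuot {u} r j))
            a′ = toℕ (proj₁ (remQuot {u} r i))
            b = toℕ (proj₂ (remQuot {u} r j))
            b′ = toℕ (proj₂ (remQuot {u} r i))
            k = κ-complete (a + a′) (b + b′)

          κ-inv : ∀ i → ∃ λ l → inv (κ i) ≡ κ l
          κ-inv i = proj₁ k , trans (sym (inv-unique (κ i) (pow (κ i) (u ∸ 1)) (trans (cong (pow (κ i)) (m+[n∸m]≡n 1≤u)) (κ′-torsion a b))))
            (trans (pow-∙ (pow γ a) (pow g b) (u ∸ 1)) (trans (cong₂ _∙_ (sym (pow-* γ a (u ∸ 1))) (sym (pow-* g b (u ∸ 1)))) (proj₂ k)))
            where
            a = toℕ (proj₁ (remQuot {u} r i))
            b = toℕ (proj₂ (remQuot {u} r i))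
            k = κ-complete (a * (u ∸ 1)) (b * (u ∸ 1))

          -- equal products γⁱ gʲ have equal j by minimality of r, and then equal i
          κ′-injective : ∀ (i i′ : Fin u) (j j′ : Fin r) → toℕ j ≤ toℕ j′ → κ′ (i , j) ≡ κ′ (i′ , j′) → (i , j) ≡ (i′ , j′)
          κ′-injective i i′ j j′ j≤j′ p = cong₂ _,_ (γ-injective i i′ (trans (sym (idʳ _)) (trans (cong (pow γ (toℕ i) ∙_) (sym (cong (pow g) d≡0))) (trans key (trans (cong (λ d → pow γ (toℕ i′) ∙ pow g d) d≡0) (idʳ _)))))) j≡j′
            where
            d = toℕ j′ ∸ toℕ j
            key′ : pow γ (toℕ i) ≡ pow γ (toℕ i′) ∙ pow g d
            key′ = ∙-cancelˡ (pow g (toℕ j)) (trans (comm _ _) (trans p (trans (cong (pow γ (toℕ i′) ∙_) (trans (cong (pow g) (sym (trans (+-comm d (toℕ j)) (m+[n∸m]≡n j≤j′)))) (pow-+ g d (toℕ j))))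
              (trans (sym (assoc _ _ _)) (comm _ _)))))
            g^d : Generated (pow g d)
            g^d = subst Generated (trans (cong (_∙ pow γ (toℕ i)) refl) (trans (cong (inv (pow γ (toℕ i′)) ∙_) key′) (inv-∙-cancel (pow γ (toℕ i′)) (pow g d)))) (subst Generated (sym shifted) (generated (toℕ i′ * (u ∸ 1) + toℕ i)))
              where
              shifted : inv (pow γ (toℕ i′)) ∙ pow γ (toℕ i) ≡ pow γ (toℕ i′ * (u ∸ 1) + toℕ i)
              shifted = trans (cong (_∙ pow γ (toℕ i)) (trans (sym (inv-unique (pow γ (toℕ i′)) (pow (pow γ (toℕ i′)) (u ∸ 1)) (trans (cong (pow (pow γ (toℕ i′))) (m+[n∸m]≡n 1≤u)) (trans (pow-comm γ (toℕ i′) u) (trans (cong (λ h → pow h (toℕ i′)) γ^u≡e) (pow-e (toℕ i′)))))))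
                (sym (pow-* γ (toℕ i′) (u ∸ 1))))) (sym (pow-+ γ (toℕ i′ * (u ∸ 1)) (toℕ i)))
            d≡0 : d ≡ 0
            d≡0 with d ≟ℕ 0
            ... | yes q = q
            ... | no  q = contradiction g^d (below d (n≢0⇒n>0 q) (≤-<-trans (m∸n≤m (toℕ j′) (toℕ j)) (Finₚ.toℕ<n j′)))
            key : pow γ (toℕ i) ∙ pow g d ≡ pow γ (toℕ i′) ∙ pow g d
            key = trans (cong (λ d → pow γ (toℕ i) ∙ pow g d) d≡0) (trans (idʳ _) key′)
            j≡j′ : j ≡ j′
            j≡j′ = Finₚ.toℕ-injective (≤-antisym j≤j′ (m∸n≡0⇒m≤n d≡0))

          κ-injective : ∀ k l → κ k ≡ κ l → k ≡ l
          κ-injective k l p = trans (sym (Finₚ.combine-remQuot {u} r k)) (trans (cong (λ (i , j) → combine i j) (pairs (≤-total _ _))) (Finₚ.combine-remQuot {u} r l))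
            where
            pairs : toℕ (proj₂ (remQuot {u} r k)) ≤ toℕ (proj₂ (remQuot {u} r l)) ⊎ toℕ (proj₂ (remQuot {u} r l)) ≤ toℕ (proj₂ (remQuot {u} r k)) → remQuot {u} r k ≡ remQuot {u} r l
            pairs (inj₁ q) = κ′-injective _ _ _ _ q p
            pairs (inj₂ q) = sym (κ′-injective _ _ _ _ q (sym p))

          -- Lagrange's theorem as an orbit count: the subgroup acts freely by translation, and the
          -- function summed is the constant 1.
          ur∣v : u * r ∣ v
          ur∣v = go (orbit-sum (*-mono-≤ 1≤u 1≤r) (λ k x → κ k ∙ x) (λ k x → inv (κ k) ∙ x) (λ k x → inv-∙-cancel (κ k) x) (λ k x → ∙-inv-cancel (κ k) x)
            (λ i j x → proj₁ (κ-∙ i j) , trans (sym (assoc _ _ x)) (cong (_∙ x) (proj₂ (κ-∙ i j))))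
            (λ i j x → proj₁ (ratio i j) , trans (sym (assoc _ _ x)) (cong (_∙ x) (proj₂ (ratio i j))))
            (λ _ → 1ℤ) (λ _ _ → refl) (λ x _ i j p → κ-injective i j (∙-cancelˡ x (trans (comm x _) (trans p (comm _ x))))))
            where
            ratio : ∀ i j → ∃ λ l → κ l ∙ κ i ≡ κ j
            ratio i j = proj₁ l , trans (cong (_∙ κ i) (sym (proj₂ l))) (trans (cong (_∙ κ i) (cong (κ j ∙_) (sym (proj₂ (κ-inv i))))) (trans (assoc _ _ _) (trans (cong (κ j ∙_) (invˡ (κ i))) (idʳ (κ j)))))
              where l = κ-∙ (proj₁ (κ-inv i)) j
            go : (∃ λ c → sum {v} (λ _ → 1ℤ) ≡ ℤ.+ (u * r) ℤ.* c) → u * r ∣ v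
            go (c , eq) = divides ℤ.∣ c ∣ (trans (cong ℤ.∣_∣ (sym (trans (sum-const v 1ℤ) (ℤₚ.*-identityʳ (ℤ.+ v))))) (trans (cong ℤ.∣_∣ eq) (trans (ℤₚ.abs-* (ℤ.+ (u * r)) c) (*-comm (u * r) ℤ.∣ c ∣))))

          r∣N : r ∣ N
          r∣N = *-cancelˡ-∣ u (subst (u * r ∣_) v≡ ur∣v)

          r∣u : r ∣ u
          r∣u with u % r ≟ℕ 0
          ... | yes p = divides (u / r) (trans (m≡m%n+[m/n]*n u r) (cong (_+ u / r * r) p))
          ... | no  p = contradiction (subst Generated (sym remainder) (generated (s₀ * (u / r) * (u ∸ 1)))) (below (u % r) (n≢0⇒n>0 p) (m%n<n u r))
            where
            h = pow γ (s₀ * (u / r))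
            remainder : pow g (u % r) ≡ pow γ (s₀ * (u / r) * (u ∸ 1))
            remainder = trans (inv-unique h (pow g (u % r)) (trans (sym (reduce u)) g^u≡e)) (trans (sym (inv-unique h (pow h (u ∸ 1)) (trans (cong (pow h) (m+[n∸m]≡n 1≤u))
              (trans (pow-comm γ (s₀ * (u / r)) u) (trans (cong (λ z → pow z (s₀ * (u / r))) γ^u≡e) (pow-e (s₀ * (u / r)))))))) (sym (pow-* γ (s₀ * (u / r)) (u ∸ 1))))

          gen : Generated g
          gen = subst Generated (trans (cong (pow g) (coprime (r∣N , r∣u))) (pow-1 g)) (i₀ , g^r≡)

  -- The quotient rings in which norms are taken.

  module Residue (M : ℕ) (X : Fin v → ℤ) where

    open import Data.Integer.Base using (+_)

    -- The ring ℤ[G] modulo the kernel of x ↦ x^(M) X, where x^(M) is the image of x under g ↦ g^M.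

    open GroupRing
    open Coefficients
    module Z = RingKit ZG
    open Z using (ι; *-cong; *-congˡ; *-congʳ; *-comm; *-assoc; zeroˡ)
    open Z.Solver
    open import Relation.Binary.Reasoning.Setoid Z.setoid

    -- Used with M = 1, where x^(M) is x itself, and with the exponent M of the projection onto U,
    -- where only the image in ℤ[U] is seen.
    ρ : (Fin v → ℤ) → Fin v → ℤ
    ρ = push (λ g → pow g M)

    ρ-⋆ : ∀ x y → ρ (x ⋆ y) ≈ ρ x ⋆ ρ y
    ρ-⋆ = push-⋆ (λ g → pow g M) (λ x y → pow-∙ x y M)

    ρ-ι : ∀ c → ρ (ι c) ≈ ι c
    ρ-ι = push-ι (λ g → pow g M) (pow-e M)

    infix 4 _≋_
    record _≋_ (x y : Fin v → ℤ) : Set where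
      constructor residue
      field scaled : ρ x ⋆ X ≈ ρ y ⋆ X
    open _≋_ public

    ≈⇒≋ : ∀ {x y} → x ≈ y → x ≋ y
    ≈⇒≋ p = residue (*-congʳ (push-cong _ p))

    A : CommutativeRing 0ℓ 0ℓ
    A = record
      { Carrier = Fin v → ℤ
      ; _≈_ = _≋_
      ; _+_ = _⊕_
      ; _*_ = _⋆_
      ; -_ = ⊖_
      ; 0# = 𝟘
      ; 1# = δ e
      ; isCommutativeRing = record
        { isRing = record
          { +-isAbelianGroup = record
            { isGroup = record
              { isMonoid = record
                { isSemigroup = record
                  { isMagma = record
                    { isEquivalence = record
                      { refl = residue ≈-refl ; sym = λ p → residue (≈-sym (scaled p)) ; trans = λ p q → residue (≈-trans (scaled p) (scaled q)) }
                    ; ∙-cong = λ {x} {y} {z} {w} p q → residue (begin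
                        ρ (x ⊕ z) ⋆ X             ≈⟨ *-congʳ (push-⊕ _ x z) ⟩
                        (ρ x ⊕ ρ z) ⋆ X           ≈⟨ ⋆-distribʳ X (ρ x) (ρ z) ⟩
                        ρ x ⋆ X ⊕ ρ z ⋆ X         ≈⟨ ⊕-cong (scaled p) (scaled q) ⟩
                        ρ y ⋆ X ⊕ ρ w ⋆ X         ≈⟨ ⋆-distribʳ X (ρ y) (ρ w) ⟨
                        (ρ y ⊕ ρ w) ⋆ X           ≈⟨ *-congʳ (push-⊕ _ y w) ⟨
                        ρ (y ⊕ w) ⋆ X             ∎) }
                  ; assoc = λ x y z → ≈⇒≋ (⊕-assoc x y z) }
                ; identity = (λ x → ≈⇒≋ (Z.+-identityˡ x)) , (λ x → ≈⇒≋ (Z.+-identityʳ x)) }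
              ; inverse = (λ x → ≈⇒≋ (Z.-‿inverseˡ x)) , (λ x → ≈⇒≋ (Z.-‿inverseʳ x))
              ; ⁻¹-cong = λ {x} {y} p → residue (begin
                  ρ (⊖ x) ⋆ X        ≈⟨ neg x ⟩
                  ⊖ (ρ x ⋆ X)        ≈⟨ ⊖-cong (scaled p) ⟩
                  ⊖ (ρ y ⋆ X)        ≈⟨ neg y ⟨
                  ρ (⊖ y) ⋆ X        ∎) }
            ; comm = λ x y → ≈⇒≋ (⊕-comm x y) }
          ; *-cong = λ {x} {y} {z} {w} p q → residue (begin
              ρ (x ⋆ z) ⋆ X            ≈⟨ *-congʳ (ρ-⋆ x z) ⟩
              (ρ x ⋆ ρ z) ⋆ X          ≈⟨ ⋆-assoc (ρ x) (ρ z) X ⟩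
              ρ x ⋆ (ρ z ⋆ X)          ≈⟨ *-congˡ (scaled q) ⟩
              ρ x ⋆ (ρ w ⋆ X)          ≈⟨ solve 3 (λ x w y → x :* (w :* y) := w :* (x :* y)) ≈-refl (ρ x) (ρ w) X ⟩
              ρ w ⋆ (ρ x ⋆ X)          ≈⟨ *-congˡ (scaled p) ⟩
              ρ w ⋆ (ρ y ⋆ X)          ≈⟨ solve 3 (λ x w y → x :* (w :* y) := (w :* x) :* y) ≈-refl (ρ w) (ρ y) X ⟩
              (ρ y ⋆ ρ w) ⋆ X          ≈⟨ *-congʳ (ρ-⋆ y w) ⟨
              ρ (y ⋆ w) ⋆ X            ∎)
          ; *-assoc = λ x y z → ≈⇒≋ (⋆-assoc x y z)
          ; *-identity = (λ x → ≈⇒≋ (Z.*-identityˡ x)) , (λ x → ≈⇒≋ (Z.*-identityʳ x))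
          ; distrib = (λ x y z → ≈⇒≋ (Z.distribˡ x y z)) , (λ x y z → ≈⇒≋ (Z.distribʳ x y z)) }
        ; *-comm = λ x y → ≈⇒≋ (⋆-comm x y) } }
      where
      neg : ∀ x → ρ (⊖ x) ⋆ X ≈ ⊖ (ρ x ⋆ X)
      neg x = ≈-trans (*-congʳ (push-⊖ _ x)) (solve 2 (λ a b → (:- a) :* b := :- (a :* b)) ≈-refl (ρ x) X)

    module K = RingKit A

    ι≋ι : ∀ c → K.ι c ≋ ι c
    ι≋ι (+ n)      = nat n
      where
      nat : ∀ n → n K.· δ e ≋ n Z.· δ e
      nat zero    = K.refl
      nat (suc n) = K.trans (K.1+× n (δ e)) (K.trans (K.+-congˡ {δ e} (nat n)) (≈⇒≋ (≈-sym (Z.1+× n (δ e)))))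
    ι≋ι ℤ.-[1+ n ] = K.-‿cong (ι≋ι (+ suc n))

    ^≋^ : ∀ x n → x K.^ n ≋ x Z.^ n
    ^≋^ x zero    = K.refl
    ^≋^ x (suc n) = K.*-congˡ {x} (^≋^ x n)

    δ-cong≋ : ∀ {g h} → pow g M ≡ pow h M → δ g ≋ δ h
    δ-cong≋ {g} {h} p = residue (*-congʳ (≈-trans (push-δ _ g) (≈-trans (pointwise λ x → cong (λ k → δ k x) p) (≈-sym (push-δ _ h)))))

    torsion-free≋ : ∀ {ℓ} → Prime ℓ → ∀ x → K.ι (+ ℓ) ⋆ x ≋ 𝟘 → x ≋ 𝟘
    torsion-free≋ {ℓ} pr x p = residue (≈-trans (torsion-free ℓ {{prime⇒nonZero pr}} (ρ x ⋆ X) (begin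
        ι (+ ℓ) ⋆ (ρ x ⋆ X)          ≈⟨ *-assoc (ι (+ ℓ)) (ρ x) X ⟨
        (ι (+ ℓ) ⋆ ρ x) ⋆ X          ≈⟨ *-congʳ (≈-trans (*-congʳ (≈-sym (ρ-ι (+ ℓ)))) (≈-sym (ρ-⋆ (ι (+ ℓ)) x))) ⟩
        ρ (ι (+ ℓ) ⋆ x) ⋆ X          ≈⟨ scaled (K.trans (K.*-congʳ {x} (K.sym (ι≋ι (+ ℓ)))) p) ⟩
        ρ 𝟘 ⋆ X                      ≈⟨ ρ0 ⟩
        𝟘                            ∎)) (≈-sym ρ0))
      where
      ρ0 : ρ 𝟘 ⋆ X ≈ 𝟘
      ρ0 = ≈-trans (*-congʳ (ρ-ι 0ℤ)) (zeroˡ X)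

    module Action (φ : Fin v → Fin v) (φ-∙ : ∀ x y → φ (x ∙ y) ≡ φ x ∙ φ y)
                  (X-stable : ∃ λ w → X ≈ push φ X ⋆ w) where

      φ-e : φ e ≡ e
      φ-e = ∙-cancelˡ (φ e) (≡.trans (≡.sym (φ-∙ e e)) (≡.trans (cong φ (idˡ e)) (≡.sym (idʳ (φ e)))))

      φ-pow : ∀ g n → φ (pow g n) ≡ pow (φ g) n
      φ-pow g zero    = φ-e
      φ-pow g (suc n) = ≡.trans (φ-∙ g (pow g n)) (cong (φ g ∙_) (φ-pow g n))

      σ : (Fin v → ℤ) → Fin v → ℤ
      σ = push φ

      σρ : ∀ x → σ (ρ x) ≈ ρ (σ x)
      σρ x = ≈-trans (push-∘ φ (λ g → pow g M) x) (≈-trans (push-≗ (λ g → φ-pow g M) x) (≈-sym (push-∘ (λ g → pow g M) φ x)))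

      -- Applying σ turns an equation between multiples of X into one between multiples of σ X;
      -- multiplying by w returns to multiples of X.
      σ-cong : ∀ {x y} → x ≋ y → σ x ≋ σ y
      σ-cong {x} {y} p = residue (≈-trans (rewrite-X x) (≈-trans (*-congʳ (push-cong φ (scaled p))) (≈-sym (rewrite-X y))))
        where
        w = proj₁ X-stable
        rewrite-X : ∀ x → ρ (σ x) ⋆ X ≈ σ (ρ x ⋆ X) ⋆ w
        rewrite-X x = begin
          ρ (σ x) ⋆ X                ≈⟨ *-cong (≈-sym (σρ x)) (proj₂ X-stable) ⟩
          σ (ρ x) ⋆ (σ X ⋆ w)        ≈⟨ *-assoc (σ (ρ x)) (σ X) w ⟨
          (σ (ρ x) ⋆ σ X) ⋆ w        ≈⟨ *-congʳ (push-⋆ φ φ-∙ (ρ x) X) ⟨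
          σ (ρ x ⋆ X) ⋆ w            ∎

      σ-⋆ : ∀ x y → σ (x ⋆ y) ≋ σ x ⋆ σ y
      σ-⋆ x y = ≈⇒≋ (push-⋆ φ φ-∙ x y)

      σ-ι : ∀ c → σ (K.ι c) ≋ K.ι c
      σ-ι c = K.trans (σ-cong (ι≋ι c)) (K.trans (≈⇒≋ (push-ι φ φ-e c)) (K.sym (ι≋ι c)))

      module Norms = NormKit A σ σ-cong σ-⋆ (K.trans (≈⇒≋ (push-δ φ e)) (≈⇒≋ (pointwise λ x → cong (λ g → δ g x) φ-e)))
      open Norms using (N; iter; Uniformizer)

      iterφ : ℕ → Fin v → Fin v
      iterφ zero    g = g
      iterφ (suc f) g = φ (iterφ f g)

      iter≈ : ∀ f x → iter f x ≈ push (iterφ f) x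
      iter≈ zero    x = ≈-sym (push-id x)
      iter≈ (suc f) x = ≈-trans (push-cong φ (iter≈ f x)) (push-∘ φ (iterφ f) x)

      iter-fixed : ∀ f → (∀ g → iterφ f g ≡ g) → ∀ x → iter f x ≋ x
      iter-fixed f p x = ≈⇒≋ (≈-trans (iter≈ f x) (≈-trans (push-≗ p x) (push-id x)))

      -- Both sides are additive modulo π, because π divides ℓ, so they need to be compared only on
      -- group elements.
      frobenius : ∀ {ℓ} → Prime ℓ → ∀ j {π} → π K.∣∣ K.ι (+ ℓ) → (∀ g → δ (φ g) K.≡ δ (pow g (ℓ ℕ.^ j)) [ π ]) →
                  ∀ x → σ x K.≡ x K.^ (ℓ ℕ.^ j) [ π ]
      frobenius {ℓ} pr j {π} π∣ℓ on-δ = ZG-induction (λ x → σ x K.≡ x K.^ Q [ π ])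
          (λ {f} {g} f≈g p → K.≡-trans (K.≡-refl (σ-cong (≈⇒≋ (≈-sym f≈g)))) (K.≡-trans p (K.≡-refl (K.^-congˡ Q (≈⇒≋ f≈g)))))
          (K.≡-refl (K.trans (σ-ι 0ℤ) (K.sym 0^Q)))
          (λ g → K.≡-trans (K.≡-refl (≈⇒≋ (push-δ φ g))) (K.≡-trans (on-δ g) (K.≡-refl (K.sym (K.trans (^≋^ (δ g) Q) (≈⇒≋ (δ^ g Q)))))))
          (λ {f} {g} p q → K.≡-trans (K.≡-refl (≈⇒≋ (push-⊕ φ f g))) (K.≡-trans (K.≡-+ p q) (K.≡-sym (K.freshman-^ pr π∣ℓ j f g))))
          (λ {f} p → K.≡-trans (K.≡-refl (≈⇒≋ (push-⊖ φ f))) (K.≡-trans (K.≡-neg p) (K.≡-sym (negate f))))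
        where
        Q = ℓ ℕ.^ j
        0^Q : 𝟘 K.^ Q ≋ 𝟘
        0^Q = K.trans (K.reflexive (cong (𝟘 K.^_) (≡.sym (ℕₚ.suc-pred Q {{ℕₚ.m^n≢0 ℓ j {{prime⇒nonZero pr}}}})))) (K.zeroˡ (𝟘 K.^ ℕ.pred Q))
        δ^ : ∀ g n → δ g Z.^ n ≈ δ (pow g n)
        δ^ g zero    = ≈-refl
        δ^ g (suc n) = ≈-trans (*-congˡ (δ^ g n)) (≈-sym (δ-∙ g (pow g n)))
        negate : ∀ f → (⊖ f) K.^ Q K.≡ ⊖ (f K.^ Q) [ π ]
        negate f = K.≡-trans (K.≡-refl (K.Solver.solve 2 (λ a b → a K.Solver.:= (b K.Solver.:+ a) K.Solver.:- b) K.refl ((⊖ f) K.^ Q) (f K.^ Q)))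
          (K.≡-trans (K.≡-+ (K.≡-trans (K.≡-sym (K.freshman-^ pr π∣ℓ j f (⊖ f))) (K.≡-refl (K.trans (K.^-congˡ Q (K.-‿inverseʳ f)) 0^Q))) (K.≡-refl {x = ⊖ (f K.^ Q)} K.refl))
          (K.≡-refl (K.+-identityˡ (⊖ (f K.^ Q)))))

      module _ {γ : Fin v} (pow-γ-M : ∀ i → pow (pow γ i) M ≡ pow γ i)
        {ℓ} (pr : Prime ℓ) (j : ℕ) (1≤j : 1 ℕ.≤ j) (u′ : ℕ) (f : ℕ)
        (same : ∀ g → ∃ λ c → ∃ λ c′ → pow (φ g) M ∙ pow γ (u′ ℕ.* c) ≡ pow (pow g (ℓ ℕ.^ j)) M ∙ pow γ (u′ ℕ.* c′)) where

        private
          ζ = δ (pow γ u′)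
          2≤Q : 2 ℕ.≤ ℓ ℕ.^ j
          2≤Q = ℕₚ.≤-trans (ℕ.nonTrivial⇒n>1 ℓ {{Data.Nat.Primality.prime⇒nonTrivial pr}}) (ℕₚ.≤-trans (ℕₚ.≤-reflexive (≡.sym (ℕₚ.*-identityʳ ℓ))) (ℕₚ.^-monoʳ-≤ ℓ {{prime⇒nonZero pr}} 1≤j))

          -- Modulo π every power of γ^(u′) becomes 1, which removes the two correction factors in
          -- `same`.
          on-δ : ∀ {π} → ζ K.≡ δ e [ π ] → ∀ g → δ (φ g) K.≡ δ (pow g (ℓ ℕ.^ j)) [ π ]
          on-δ {π} ζ≡1 g = go (same g)
            where
            ζ-power : ∀ c → δ (pow γ (u′ ℕ.* c)) K.≡ δ e [ π ]
            ζ-power c = K.≡-trans (K.≡-refl (≈⇒≋ (pointwise λ x → cong (λ h → δ h x) (pow-* γ u′ c)))) (power c)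
              where
              power : ∀ c → δ (pow (pow γ u′) c) K.≡ δ e [ π ]
              power zero    = K.≡-refl K.refl
              power (suc c) = K.≡-trans (K.≡-refl (≈⇒≋ (δ-∙ (pow γ u′) (pow (pow γ u′) c)))) (K.≡-trans (K.≡-* ζ≡1 (power c)) (K.≡-refl (K.*-identityˡ (δ e))))
            absorb : ∀ h c → δ h K.≡ δ (h ∙ pow γ (u′ ℕ.* c)) [ π ]
            absorb h c = K.≡-sym (K.≡-trans (K.≡-refl (≈⇒≋ (δ-∙ h (pow γ (u′ ℕ.* c))))) (K.≡-trans (K.≡-* (K.≡-refl {x = δ h} K.refl) (ζ-power c)) (K.≡-refl (K.*-identityʳ (δ h)))))
            power-M : ∀ h c → pow (h ∙ pow γ (u′ ℕ.* c)) M ≡ pow h M ∙ pow γ (u′ ℕ.* c)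
            power-M h c = ≡.trans (pow-∙ h _ M) (cong (pow h M ∙_) (pow-γ-M (u′ ℕ.* c)))
            go : _ → δ (φ g) K.≡ δ (pow g (ℓ ℕ.^ j)) [ π ]
            go (c , c′ , eq) = K.≡-trans (absorb (φ g) c) (K.≡-trans (K.≡-refl (δ-cong≋ (≡.trans (power-M (φ g) c) (≡.trans eq (≡.sym (power-M (pow g (ℓ ℕ.^ j)) c′))))))
              (K.≡-sym (absorb (pow g (ℓ ℕ.^ j)) c′)))

        -- Here ζ = 1 and ℓ itself is the parameter: E = 1 and all the units are 1.
        unramified : pow γ u′ ≡ e → Uniformizer ℓ f
        unramified trivial = record
          { π = L ; g = δ e ; g′ = δ e ; ε = δ e ; ε′ = δ e ; E = 1 ; Q = ℓ ℕ.^ j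
          ; 2≤Q = 2≤Q
          ; frobenius = frobenius pr j (K.quot (δ e) (K.sym (K.*-identityʳ L))) (on-δ (K.≡-refl (≈⇒≋ (pointwise λ x → cong (λ h → δ h x) trivial))))
          ; regular = torsion-free≋ pr
          ; ramified = K.refl
          ; g-unit = K.≡-refl (K.*-identityˡ (δ e))
          ; N-π = K.trans (Norms.N-fixed f (σ-ι (+ ℓ))) (K.sym (K.*-identityˡ (L K.^ f)))
          ; ε-unit = K.*-identityˡ (δ e) }
          where L = K.ι (+ ℓ)

        -- The parameter is ζ - 1 with ζ a root of the cyclotomic polynomial of index ℓ^(b+1); E is
        -- the degree of that polynomial.
        ramified : ∀ b → Ramified.geo A (ζ K.^ (ℓ ℕ.^ b)) ℓ ≋ 𝟘 →
                   (∃ λ ε → ∃ λ ε′ → N f (ζ ⊕ ⊖ δ e) ≋ ε ⋆ (ζ ⊕ ⊖ δ e) K.^ f × ε ⋆ ε′ ≋ δ e) → Uniformizer ℓ f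
        ramified b cyclotomic (ε , ε′ , N-π , unit) = build (Ramified.ramification A pr ζ b cyclotomic (torsion-free≋ pr))
          where
          π = ζ ⊕ ⊖ δ e
          build : (∃ λ g → π K.^ (ℓ ℕ.^ b ℕ.* ℕ.pred ℓ) ≋ K.ι (+ ℓ) ⋆ g × g ⋆ (⊖ δ e) K.≡ δ e [ π ]) → Uniformizer ℓ f
          build (g , ram , g-unit) = record
            { π = π ; g = g ; g′ = ⊖ δ e ; ε = ε ; ε′ = ε′ ; E = ℓ ℕ.^ b ℕ.* ℕ.pred ℓ ; Q = ℓ ℕ.^ j
            ; 2≤Q = 2≤Q
            ; frobenius = frobenius pr j (Ramified.π∣ℓ A pr ζ b cyclotomic (torsion-free≋ pr)) (on-δ (Ramified.≡1 A ζ))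
            ; regular = Ramified.π-regular A pr ζ b cyclotomic (torsion-free≋ pr)
            ; ramified = ram
            ; g-unit = g-unit
            ; N-π = N-π
            ; ε-unit = unit }

  open GroupRing
  open Decomposition using (HasOrder)

  -- U = ⟨γ⟩ is the u-torsion subgroup of G, and g ↦ g^M is a projection of G onto U.
  module TorsionSubgroup {u : ℕ} {γ : Fin v} (oγ : HasOrder γ u)
    (torsion : ∀ g → pow g u ≡ e → ∃ λ i → g ≡ pow γ i)
    (M : ℕ) (M-γ : ∀ i → pow (pow γ i) M ≡ pow γ i) (M-torsion : ∀ g → pow (pow g M) u ≡ e)
    where

    -- X over the primes dividing u, uniformizers at the primes dividing k, restriction to U.

    module Setting where

      open import Data.Integer.Base using (+_)
      open import Data.List.Relation.Unary.All using (_∷_)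
      open Arith
      open Totient using (product∣)
      open Sums
      open Coefficients
      open Decomposition using (root; root-order)
      open Structure using (FrobeniusAt)
      module Z = RingKit ZG
      open Z using (ι; *-cong; *-congˡ; *-congʳ; *-comm; *-assoc; zeroˡ; zeroʳ)
      open import Relation.Binary.Reasoning.Setoid Z.setoid

      θ : ℕ → Fin v
      θ = root γ u

      open PrimeProducts θ public

      L : List ℕ
      L = primes u

      pos : All PrimeOrder L
      pos = All.tabulate (λ q∈ → root-order oγ (proj₁ (∈primes⁻ {u} q∈)) (proj₂ (∈primes⁻ {u} q∈)))

      distinct : Distinct L
      distinct = primes-distinct u

      rad∣u : product L ∣ u
      rad∣u = product∣ (primes-prime u) distinct (All.tabulate (λ q∈ → proj₂ (∈primes⁻ {u} q∈)))

      Xᵤ : Fin v → ℤ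
      Xᵤ = X L

      supported-Xᵤ : Supported u Xᵤ
      supported-Xᵤ = go rad∣u
        where
        go : product L ∣ u → Supported u Xᵤ
        go (divides k u≡) = ≡.subst (λ n → Supported n Xᵤ) (≡.trans (ℕₚ.*-comm (product L) k) (≡.sym u≡)) (supported-∣ k (supported-X pos))

      Xᵤ-norm : (Xᵤ ⋆ star Xᵤ) e ≡ + (2 ℕ.^ length L)
      Xᵤ-norm = X-norm pos distinct

      N̂⋆Xᵤ : ∀ {q} → q ∈ L → N̂ q ⋆ Xᵤ ≈ 𝟘
      N̂⋆Xᵤ = N̂⋆X pos

      N̂⋆⋆Xᵤ : ∀ {q} → q ∈ L → ∀ f → N̂ q ⋆ (f ⋆ Xᵤ) ≈ 𝟘
      N̂⋆⋆Xᵤ {q} q∈ f = ≈-trans (Z.Solver.solve 3 (λ n f x → n Z.Solver.:* (f Z.Solver.:* x) Z.Solver.:= f Z.Solver.:* (n Z.Solver.:* x)) ≈-refl (N̂ q) f Xᵤ)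
        (≈-trans (*-congˡ (N̂⋆Xᵤ q∈)) (zeroʳ f))

      M-fixes : ∀ {s} → pow s u ≡ e → pow s M ≡ s
      M-fixes {s} p = go (torsion s p)
        where
        go : (∃ λ i → s ≡ pow γ i) → pow s M ≡ s
        go (i , s≡) = ≡.trans (cong (λ z → pow z M) s≡) (≡.trans (M-γ i) (≡.sym s≡))

      fixes-X : ∀ φ → (∀ x y → φ (x ∙ y) ≡ φ x ∙ φ y) → φ e ≡ e → (∀ i → φ (pow γ i) ≡ pow γ i) → push φ Xᵤ ≈ Xᵤ
      fixes-X φ hom φe p = push-X φ hom φe {L} (All.tabulate (λ {q} _ → p (u /₀ q)))

      module Uniformizers (M′ : ℕ) (M′-γ : ∀ i → pow (pow γ i) M′ ≡ pow γ i)
        (φ : Fin v → Fin v) (φ-∙ : ∀ x y → φ (x ∙ y) ≡ φ x ∙ φ y) (X-stable : ∃ λ w → Xᵤ ≈ push φ Xᵤ ⋆ w) where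

        open Residue M′ Xᵤ public hiding (module Z)
        open Action φ φ-∙ X-stable public
        open Norms using (N; Uniformizer)

        private
          geo-A : ∀ y z n → y ≋ z → Ramified.geo A y n ≋ Ramified.geo ZG z n
          geo-A y z zero    p = K.refl
          geo-A y z (suc n) p = K.+-congˡ {δ e} (K.*-cong p (geo-A y z n p))

        uniformizer : ∀ {ℓ} → Prime ℓ → ∀ b u′ → u ≡ ℓ ℕ.^ b ℕ.* u′ → ∀ j → 1 ℕ.≤ j → ∀ f →
          (∀ g → ∃ λ c → ∃ λ c′ → pow (φ g) M′ ∙ pow γ (u′ ℕ.* c) ≡ pow (pow g (ℓ ℕ.^ j)) M′ ∙ pow γ (u′ ℕ.* c′)) →
          (∃ λ ε → ∃ λ ε′ → N f (δ (pow γ u′) ⊕ ⊖ δ e) ≋ ε ⋆ (δ (pow γ u′) ⊕ ⊖ δ e) K.^ f × ε ⋆ ε′ ≋ δ e) →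
          Uniformizer ℓ f
        uniformizer {ℓ} pr zero    u′ u≡ j 1≤j f same _ = unramified M′-γ pr j 1≤j u′ f same
          (≡.trans (cong (pow γ) (≡.trans (≡.sym (ℕₚ.+-identityʳ u′)) (≡.sym u≡))) (HasOrder.pow≡e oγ))
        -- Now u = ℓ^(b+1) u′, so the ℓ^b-th power of ζ = γ^(u′) is γ^(u/ℓ) = θ ℓ. That `N̂ ℓ`
        -- annihilates Xᵤ is the cyclotomic equation for ζ.
        uniformizer {ℓ} pr (suc b) u′ u≡ j 1≤j f same Nπ = ramified M′-γ pr j 1≤j u′ f same b
          (K.trans (geo-A _ (δ (θ ℓ)) ℓ θ≋) (residue (≈-trans (*-congʳ (≈-trans (push-geo (λ g → pow g M′) (λ x y → pow-∙ x y M′) (pow-e M′) (θ ℓ) ℓ)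
            (pointwise λ x → cong (λ g → Ramified.geo ZG (δ g) ℓ x) (M′-γ (u /₀ ℓ))))) (≈-trans (N̂⋆Xᵤ ℓ∈L) (≈-sym (≈-trans (*-congʳ (ρ-ι 0ℤ)) (zeroˡ Xᵤ))))))) Nπ
          where
          ℓ∈L : ℓ ∈ L
          ℓ∈L = ∈primes⁺ (HasOrder.1≤m oγ) pr (≡.subst (ℓ ∣_) (≡.sym u≡) (∣-trans (m∣m*n (ℓ ℕ.^ b)) (m∣m*n u′)))
          exponent : u /₀ ℓ ≡ u′ ℕ.* ℓ ℕ.^ b
          exponent = ≡.trans (cong (_/₀ ℓ) (≡.trans u≡ (ℕₚ.*-assoc ℓ (ℓ ℕ.^ b) u′))) (≡.trans (/₀-cancel pr) (ℕₚ.*-comm (ℓ ℕ.^ b) u′))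
          θ≋ : δ (pow γ u′) K.^ (ℓ ℕ.^ b) ≋ δ (θ ℓ)
          θ≋ = K.trans (^≋^ (δ (pow γ u′)) (ℓ ℕ.^ b)) (≈⇒≋ (≈-trans (≈-sym (δ-pow (pow γ u′) (ℓ ℕ.^ b)))
            (pointwise λ x → cong (λ g → δ g x) (≡.trans (≡.sym (pow-* γ u′ (ℓ ℕ.^ b))) (cong (pow γ) (≡.sym exponent))))))

        module _ {f} (1≤f : 1 ℕ.≤ f) (fixed : ∀ g → iterφ f g ≡ g)
          (Nπ : ∀ i → ∃ λ ε → ∃ λ ε′ → N f (δ (pow γ i) ⊕ ⊖ δ e) ≋ ε ⋆ (δ (pow γ i) ⊕ ⊖ δ e) K.^ f × ε ⋆ ε′ ≋ δ e) where

          divides-from-norm : ∀ n → 1 ℕ.≤ n → (∀ ℓ → Prime ℓ → ℓ ∣ n → FrobeniusAt γ u φ M′ ℓ) →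
                              ∀ z → N f z ≋ K.ι (+ n) K.^ f → ∃ λ F → z ≋ ι (+ n) ⋆ F
          divides-from-norm n@(suc _) _ frob z Nz = go (factorise n)
            where
            open import Data.Nat.Primality.Factorisation using (factorise; PrimeFactorisation)
            go : PrimeFactorisation n → ∃ λ F → z ≋ ι (+ n) ⋆ F
            go record { factors = ps ; isFactorisation = n≡ ; factorsPrime = prs } = conclude
                (Norms.N≈^⇒∣ 1≤f (iter-fixed f fixed) (λ n → σ-ι (+ n)) torsion-free≋ ps prs (All.tabulate uniformizers) z
                  (≡.subst (λ m → N f z ≋ K.ι (+ m) K.^ f) n≡ Nz))
              where
              ∈⇒∣product : ∀ {ℓ ps} → ℓ ∈ ps → ℓ ∣ product ps
              ∈⇒∣product {ps = p ∷ ps} (here ≡.refl) = m∣m*n (product ps)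
              ∈⇒∣product {ps = p ∷ ps} (there ℓ∈)    = ∣-trans (∈⇒∣product ℓ∈) (n∣m*n p)
              uniformizers : ∀ {ℓ} → ℓ ∈ ps → Uniformizer ℓ f
              uniformizers {ℓ} ℓ∈ = uniformizer prℓ b u′ u≡ j 1≤j f same (Nπ u′)
                where
                prℓ = All.lookup prs ℓ∈
                open FrobeniusAt (frob ℓ prℓ (≡.subst (ℓ ∣_) (≡.sym n≡) (∈⇒∣product ℓ∈)))
              conclude : K.ι (+ product ps) K.∣∣ z → ∃ λ F → z ≋ ι (+ n) ⋆ F
              conclude (K.quot F eq) = F , K.trans eq (K.*-congʳ {F} (K.trans (ι≋ι (+ product ps)) (≈⇒≋ (pointwise λ x → cong (λ m → ι (+ m) x) (≡.sym n≡)))))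

      Res : (Fin v → ℤ) → Fin v → ℤ
      Res f s = ⟦ pow s u ≟ e ⟧ ℤ.* f s

      Res-∈ : ∀ {f s} → pow s u ≡ e → Res f s ≡ f s
      Res-∈ {f} {s} p = ≡.trans (cong (ℤ._* f s) (⟦yes⟧ (pow s u ≟ e) p)) (ℤₚ.*-identityˡ (f s))

      Res-∉ : ∀ {f s} → pow s u ≢ e → Res f s ≡ 0ℤ
      Res-∉ {f} {s} p = ≡.trans (cong (ℤ._* f s) (⟦no⟧ (pow s u ≟ e) p)) (ℤₚ.*-zeroˡ (f s))

      Res-cong : ∀ {f g} → f ≈ g → Res f ≈ Res g
      Res-cong p = pointwise λ s → cong (⟦ pow s u ≟ e ⟧ ℤ.*_) (at p s)

      -- Multiplication by an element supported on U moves coefficients only within cosets of U.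
      ⋆-Res : ∀ {a} f → Supported u a → a ⋆ Res f ≈ Res (a ⋆ f)
      ⋆-Res {a} f sa = pointwise λ s → ≡.trans (⋆-at a (Res f) s) (≡.trans (sum-cong (λ x → term s x (pow x u ≟ e))) (≡.trans
          (sum-*ˡ ⟦ pow s u ≟ e ⟧ (λ x → a x ℤ.* f (inv x ∙ s))) (cong (⟦ pow s u ≟ e ⟧ ℤ.*_) (≡.sym (⋆-at a f s)))))
        where
        commute : ∀ a b c → a ℤ.* (b ℤ.* c) ≡ b ℤ.* (a ℤ.* c)
        commute = solve-∀
          where open import Data.Integer.Tactic.RingSolver using (solve-∀)
        term : ∀ s x → Dec (pow x u ≡ e) → a x ℤ.* Res f (inv x ∙ s) ≡ ⟦ pow s u ≟ e ⟧ ℤ.* (a x ℤ.* f (inv x ∙ s))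
        term s x (no  x∉) = ≡.trans (cong (ℤ._* Res f (inv x ∙ s)) ax≡0) (≡.trans (ℤₚ.*-zeroˡ (Res f (inv x ∙ s)))
          (≡.sym (≡.trans (cong (λ z → ⟦ pow s u ≟ e ⟧ ℤ.* (z ℤ.* f (inv x ∙ s))) ax≡0) (≡.trans (cong (⟦ pow s u ≟ e ⟧ ℤ.*_) (ℤₚ.*-zeroˡ (f (inv x ∙ s)))) (ℤₚ.*-zeroʳ ⟦ pow s u ≟ e ⟧)))))
          where
          ax≡0 : a x ≡ 0ℤ
          ax≡0 = vanish sa x x∉
        term s x (yes x∈) = ≡.trans (commute (a x) ⟦ pow (inv x ∙ s) u ≟ e ⟧ (f (inv x ∙ s))) (cong (ℤ._* (a x ℤ.* f (inv x ∙ s)))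
          (⟦⟧-cong (pow (inv x ∙ s) u ≟ e) (pow s u ≟ e) (λ p → ≡.trans (≡.sym same) p) (λ p → ≡.trans same p)))
          where
          same : pow (inv x ∙ s) u ≡ pow s u
          same = ≡.trans (pow-∙ (inv x) s u) (≡.trans (cong (_∙ pow s u) (≡.trans (pow-inv x u) (≡.trans (cong inv x∈) inv-e))) (idˡ (pow s u)))

      ρ-at : ∀ f s → push (λ g → pow g M) f s ≡ sum (λ x → f x ℤ.* ⟦ s ≟ pow x M ⟧)
      ρ-at f s = push-def (λ g → pow g M) f s

    -- The image of D X under σ is a translate of D X.

    module Multiplier where

      open import Data.Integer.Base using (+_)
      open Sums
      open Coefficients
      open Structure using (pow-∣; pow-comm; FrobeniusAt)
      open Setting
      open Z using (ι; *-cong; *-congˡ; *-congʳ; *-comm; *-assoc)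
      open Z.Solver

      ι-cancel : ∀ n .{{_ : ℕ.NonZero n}} {f g} → ι (+ n) ⋆ f ≈ ι (+ n) ⋆ g → f ≈ g
      ι-cancel n {f} {g} p = ≈-trans (solve 2 (λ a b → a := (a :- b) :+ b) ≈-refl f g) (≈-trans (Z.+-congʳ (torsion-free n (f ⊕ ⊖ g)
        (≈-trans (solve 3 (λ n a b → n :* (a :- b) := n :* a :- n :* b) ≈-refl (ι (+ n)) f g) (≈-trans (Z.+-congʳ p) (Z.-‿inverseʳ (ι (+ n) ⋆ g)))))) (Z.+-identityˡ g))

      ⋆-rotate : ∀ x y m → (x ⋆ y) ⋆ m ≈ y ⋆ (x ⋆ m)
      ⋆-rotate = solve 3 (λ x y m → (x :* y) :* m := y :* (x :* m)) ≈-refl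

      ⋆-rotate′ : ∀ x y m → y ⋆ (m ⋆ x) ≈ (x ⋆ y) ⋆ m
      ⋆-rotate′ = solve 3 (λ x y m → y :* (m :* x) := (x :* y) :* m) ≈-refl

      module Shift (r : ℕ) (r-γ : ∀ i → pow (pow γ i) r ≡ pow γ i) (f : ℕ) (1≤f : 1 ℕ.≤ f) (r^f : ∀ g → pow g (r ℕ.^ f) ≡ g) where

        φ : Fin v → Fin v
        φ g = pow g r

        φ-∙ : ∀ x y → φ (x ∙ y) ≡ φ x ∙ φ y
        φ-∙ x y = pow-∙ x y r

        σX : push φ Xᵤ ≈ Xᵤ
        σX = fixes-X φ φ-∙ (pow-e r) r-γ

        module U = Uniformizers 1 (λ i → pow-1 (pow γ i)) φ φ-∙ (δ e , ≈-sym (≈-trans (Z.*-identityʳ (push φ Xᵤ)) σX))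
        open U using (_≋_; residue; scaled; ≈⇒≋; ι≋ι; σ; σ-ι; iterφ; iter-fixed)
        module K = U.K
        open U.Norms using (N; N-fixed; N-telescope; iter)

        private
          iterφ≡ : ∀ i g → iterφ i g ≡ pow g (r ℕ.^ i)
          iterφ≡ zero    g = ≡.sym (pow-1 g)
          iterφ≡ (suc i) g = ≡.trans (cong (λ h → pow h r) (iterφ≡ i g)) (≡.trans (≡.sym (pow-* g (r ℕ.^ i) r)) (cong (pow g) (ℕₚ.*-comm (r ℕ.^ i) r)))

          fixed : ∀ g → iterφ f g ≡ g
          fixed g = ≡.trans (iterφ≡ f g) (r^f g)

          unscaled : ∀ {x y} → x ≋ y → x ⋆ Xᵤ ≈ y ⋆ Xᵤ
          unscaled {x} {y} p = ≈-trans (*-congʳ (≈-sym (ρ≈ x))) (≈-trans (scaled p) (*-congʳ (ρ≈ y)))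
            where
            ρ≈ : ∀ x → U.ρ x ≈ x
            ρ≈ x = ≈-trans (push-≗ pow-1 x) (push-id x)

          -- σ is the identity on U, so π is fixed and its norm is π^f without a correcting unit.
          Nπ : ∀ i → ∃ λ ε → ∃ λ ε′ → N f (δ (pow γ i) ⊕ ⊖ δ e) ≋ ε ⋆ (δ (pow γ i) ⊕ ⊖ δ e) K.^ f × ε ⋆ ε′ ≋ δ e
          Nπ i = δ e , δ e , norm , K.*-identityˡ (δ e)
            where
            π : Fin v → ℤ
            π = δ (pow γ i) ⊕ ⊖ δ e
            σπ : σ (δ (pow γ i) ⊕ ⊖ δ e) ≈ δ (pow γ i) ⊕ ⊖ δ e
            σπ = ≈-trans (push-⊕ φ (δ (pow γ i)) (⊖ δ e)) (⊕-cong (≈-trans (push-δ φ (pow γ i)) (pointwise λ x → cong (λ g → δ g x) (r-γ i)))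
              (≈-trans (push-⊖ φ (δ e)) (⊖-cong (push-ι φ (pow-e r) 1ℤ))))
            norm : N f π ≋ δ e ⋆ π K.^ f
            norm = K.trans {N f π} {π K.^ f} (N-fixed f {π} (≈⇒≋ σπ)) (K.sym {δ e ⋆ π K.^ f} {π K.^ f} (K.*-identityˡ (π K.^ f)))

        module _ {n} (1≤n : 1 ℕ.≤ n) (frob : ∀ ℓ → Prime ℓ → ℓ ∣ n → FrobeniusAt γ u φ 1 ℓ)
                 {D : Fin v → ℤ} (DD* : D ⋆ star D ≈ ι (+ n)) where
          private
            instance
              n≢0 : ℕ.NonZero n
              n≢0 = ℕ.>-nonZero 1≤n
            κ = ι (+ n)
            z = σ D ⋆ star D

            -- Multiply by D* and cancel n.
            cancel-D : ∀ y w → D ⋆ y ≋ w ⋆ D → y ≋ w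
            cancel-D y w p = residue (ι-cancel n {U.ρ y ⋆ Xᵤ} {U.ρ w ⋆ Xᵤ} (≈-trans (outside y) (≈-trans (scaled key) (≈-sym (outside w)))))
              where
              outside : ∀ y → κ ⋆ (U.ρ y ⋆ Xᵤ) ≈ U.ρ (κ ⋆ y) ⋆ Xᵤ
              outside y = ≈-trans (≈-sym (*-assoc κ (U.ρ y) Xᵤ)) (*-congʳ {Xᵤ} (≈-trans (*-congʳ {U.ρ y} (≈-sym (U.ρ-ι (+ n)))) (≈-sym (U.ρ-⋆ κ y))))
              left : κ ⋆ y ≈ star D ⋆ (D ⋆ y)
              left = ≈-trans (*-congʳ {y} (≈-sym DD*)) (⋆-rotate D (star D) y)
              right : star D ⋆ (w ⋆ D) ≈ κ ⋆ w
              right = ≈-trans (⋆-rotate′ D (star D) w) (*-congʳ {w} DD*)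
              key : κ ⋆ y ≋ κ ⋆ w
              key = K.trans {κ ⋆ y} {star D ⋆ (D ⋆ y)} {κ ⋆ w} (≈⇒≋ left)
                (K.trans {star D ⋆ (D ⋆ y)} {star D ⋆ (w ⋆ D)} {κ ⋆ w} (K.*-congˡ {star D} {D ⋆ y} {w ⋆ D} p) (≈⇒≋ right))

            n^f : Fin v → ℤ
            n^f = K.ι (+ n) K.^ f

            -- Telescoping gives D ⋆ N f z = n^f σ^f(D) with σ^f = 1, and D cancels because D D* is
            -- the integer n.
            Nz : N f z ≋ n^f
            Nz = cancel-D (N f z) n^f telescoped
              where
              D-norm : D ⋆ star D ≋ K.ι (+ n)
              D-norm = K.trans {D ⋆ star D} {κ} {K.ι (+ n)} (≈⇒≋ DD*) (K.sym {K.ι (+ n)} {κ} (ι≋ι (+ n)))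
              telescoped : D ⋆ N f z ≋ n^f ⋆ D
              telescoped = K.trans {D ⋆ N f z} {n^f ⋆ iter f D} {n^f ⋆ D} (N-telescope f D (star D) (K.ι (+ n)) D-norm (σ-ι (+ n)))
                (K.*-congˡ {n^f} {iter f D} {D} (iter-fixed f fixed D))

            quotient : ∃ λ F → z ≋ κ ⋆ F
            quotient = U.divides-from-norm 1≤f fixed Nπ n 1≤n frob z Nz

            module Coset (F : Fin v → ℤ) (zX : z ⋆ Xᵤ ≈ κ ⋆ (F ⋆ Xᵤ)) where

              Y : Fin v → ℤ
              Y = F ⋆ Xᵤ

              star-κ : star κ ≈ κ
              star-κ = push-ι inv inv-e (+ n)

              open import Relation.Binary.Reasoning.Setoid Z.setoid using (begin_; step-≈-⟩; step-≈-⟨; _∎)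

              zz* : z ⋆ star z ≈ κ ⋆ κ
              zz* = begin
                (σ D ⋆ star D) ⋆ star (σ D ⋆ star D)                ≈⟨ *-congˡ (≈-trans (star-⋆ (σ D) (star D)) (*-cong star-σ (star-star D))) ⟩
                (σ D ⋆ star D) ⋆ (σ (star D) ⋆ D)                   ≈⟨ solve 4 (λ a b c d → (a :* b) :* (c :* d) := (a :* c) :* (d :* b)) ≈-refl (σ D) (star D) (σ (star D)) D ⟩
                (σ D ⋆ σ (star D)) ⋆ (D ⋆ star D)                   ≈⟨ *-cong (≈-trans (≈-sym (push-⋆ φ φ-∙ D (star D))) (≈-trans (push-cong φ DD*) (push-ι φ (pow-e r) (+ n)))) DD* ⟩
                κ ⋆ κ                                               ∎
                where
                star-σ : star (σ D) ≈ σ (star D)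
                star-σ = ≈-trans (push-∘ inv φ D) (≈-trans (push-≗ (λ g → ≡.sym (pow-inv g r)) D) (≈-sym (push-∘ φ inv D)))

              -- Because z z* = σ(D D*) D D* = n², both factors n introduced by n Y = z X cancel.
              YY* : Y ⋆ star Y ≈ Xᵤ ⋆ star Xᵤ
              YY* = ι-cancel n (ι-cancel n (begin
                κ ⋆ (κ ⋆ (Y ⋆ star Y))                    ≈⟨ solve 3 (λ k y s → k :* (k :* (y :* s)) := (k :* y) :* (k :* s)) ≈-refl κ Y (star Y) ⟩
                (κ ⋆ Y) ⋆ (κ ⋆ star Y)                    ≈⟨ *-cong (≈-sym zX) (≈-trans (*-congʳ (≈-sym star-κ)) (≈-trans (≈-sym (star-⋆ κ Y)) (≈-trans (push-cong inv (≈-sym zX)) (star-⋆ z Xᵤ)))) ⟩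
                (z ⋆ Xᵤ) ⋆ (star z ⋆ star Xᵤ)             ≈⟨ solve 4 (λ z x s t → (z :* x) :* (s :* t) := (z :* s) :* (x :* t)) ≈-refl z Xᵤ (star z) (star Xᵤ) ⟩
                (z ⋆ star z) ⋆ (Xᵤ ⋆ star Xᵤ)             ≈⟨ *-congʳ zz* ⟩
                (κ ⋆ κ) ⋆ (Xᵤ ⋆ star Xᵤ)                  ≈⟨ *-assoc κ κ (Xᵤ ⋆ star Xᵤ) ⟩
                κ ⋆ (κ ⋆ (Xᵤ ⋆ star Xᵤ))                  ∎))

              Y-norm : ⟨ Y , Y ⟩ ≡ + (2 ℕ.^ length L)
              Y-norm = ≡.trans (≡.sym (⟨⟩≡⋆star-e Y Y)) (≡.trans (at YY* e) Xᵤ-norm)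

              nonzero : ∃ λ g → Y g ≢ 0ℤ
              nonzero = decide (Finₚ.any? (λ g → nonzero? (Y g)))
                where
                decide : Dec (∃ λ g → Y g ≢ 0ℤ) → ∃ λ g → Y g ≢ 0ℤ
                decide (yes p) = p
                decide (no ¬p) = contradiction (≡.trans (≡.sym Y-norm) (sum-zero _ (λ x → ≡.trans (cong (ℤ._* Y x) (decidable-stable (Y x ℤₚ.≟ 0ℤ) (λ q → ¬p (x , q)))) (ℤₚ.*-zeroˡ (Y x)))))
                  (λ q → ℕₚ.<⇒≢ (ℕₚ.m^n>0 2 (length L)) (≡.sym (ℤₚ.+-injective q)))

              ρ : (Fin v → ℤ) → Fin v → ℤ
              ρ = push (λ g → pow g M)

              ρ-⋆ : ∀ x y → ρ (x ⋆ y) ≈ ρ x ⋆ ρ y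
              ρ-⋆ = push-⋆ (λ g → pow g M) (λ x y → pow-∙ x y M)

              ρX : ρ Xᵤ ≈ Xᵤ
              ρX = fixes-X (λ g → pow g M) (λ x y → pow-∙ x y M) (pow-e M) M-γ

              -- On the image U of the projection σ is trivial, so σ D and D have the same image.
              ρz : ρ z ≈ κ
              ρz = begin
                ρ (σ D ⋆ star D)            ≈⟨ ρ-⋆ (σ D) (star D) ⟩
                ρ (σ D) ⋆ ρ (star D)        ≈⟨ *-congʳ (≈-trans (push-∘ (λ g → pow g M) φ D) (push-≗ projection D)) ⟩
                ρ D ⋆ ρ (star D)            ≈⟨ ρ-⋆ D (star D) ⟨
                ρ (D ⋆ star D)              ≈⟨ push-cong _ DD* ⟩
                ρ κ                         ≈⟨ push-ι (λ g → pow g M) (pow-e M) (+ n) ⟩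
                κ                           ∎
                where
                projection : ∀ g → pow (pow g r) M ≡ pow g M
                projection g = ≡.trans (pow-comm g r M) (go (torsion (pow g M) (M-torsion g)))
                  where
                  go : (∃ λ i → pow g M ≡ pow γ i) → pow (pow g M) r ≡ pow g M
                  go (i , p) = ≡.trans (cong (λ h → pow h r) p) (≡.trans (r-γ i) (≡.sym p))

              -- The projection is injective on each coset of U. Once Y is known to live on one
              -- coset, this identifies it as a translate of Xᵤ.
              ρY : ρ Y ≈ Xᵤ
              ρY = ι-cancel n (begin
                κ ⋆ ρ Y              ≈⟨ *-congʳ (push-ι (λ g → pow g M) (pow-e M) (+ n)) ⟨
                ρ κ ⋆ ρ Y            ≈⟨ ρ-⋆ κ Y ⟨
                ρ (κ ⋆ Y)            ≈⟨ push-cong _ (≈-sym zX) ⟩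
                ρ (z ⋆ Xᵤ)           ≈⟨ ρ-⋆ z Xᵤ ⟩
                ρ z ⋆ ρ Xᵤ           ≈⟨ *-cong ρz ρX ⟩
                κ ⋆ Xᵤ               ∎)

              g₀ = proj₁ nonzero
              -- The component of g₀ in U is removed: the coset stays the same, and g lies in the
              -- kernel of the projection, where translations by it can later be absorbed.
              g = g₀ ∙ inv (pow g₀ M)

              g^M : pow g M ≡ e
              g^M = ≡.trans (pow-∙ g₀ (inv (pow g₀ M)) M) (≡.trans (cong (pow g₀ M ∙_) (≡.trans (pow-inv (pow g₀ M) M) (cong inv (M-fixes (M-torsion g₀))))) (invʳ (pow g₀ M)))

              -- Y is supported on the coset g₀U = gU
              decompose : ∀ x → Y x ≢ 0ℤ → g ∙ pow x M ≡ x
              decompose x Yx≢0 = begin≡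
                  g ∙ pow x M                                              ≡⟨ cong (λ z → g ∙ pow z M) (∙-inv-cancel g₀ x) ⟨
                  g ∙ pow (g₀ ∙ s) M                                       ≡⟨ cong (g ∙_) (≡.trans (pow-∙ g₀ s M) (cong (pow g₀ M ∙_) (M-fixes s∈U))) ⟩
                  (g₀ ∙ inv (pow g₀ M)) ∙ (pow g₀ M ∙ s)                   ≡⟨ assoc g₀ _ _ ⟩
                  g₀ ∙ (inv (pow g₀ M) ∙ (pow g₀ M ∙ s))                   ≡⟨ cong (g₀ ∙_) (inv-∙-cancel (pow g₀ M) s) ⟩
                  g₀ ∙ s                                                   ≡⟨ ∙-inv-cancel g₀ x ⟩
                  x                                                        ∎≡
                where
                open ≡.≡-Reasoning using (step-≡-⟩; step-≡-⟨) renaming (begin_ to begin≡_; _∎ to _∎≡)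
                s = inv g₀ ∙ x
                s∈U : pow s u ≡ e
                s∈U = pow-∣ {s} rad∣u (minimal⇒coset pos distinct (λ q∈ → N̂⋆⋆Xᵤ q∈ F) Y-norm g₀ x (proj₂ nonzero) Yx≢0)

              Y≈ : Y ≈ δ g ⋆ Xᵤ
              Y≈ = ≈-trans (pointwise λ h → ≡.sym (≡.trans (δ⋆-at g (ρ Y) h) (≡.trans (ρ-at Y (inv g ∙ h)) (≡.trans (sum-cong (λ x → term h x (Y x ℤₚ.≟ 0ℤ))) (sum-⟦≟⟧ Y h)))))
                (*-congˡ ρY)
                where
                term : ∀ h x → Dec (Y x ≡ 0ℤ) → Y x ℤ.* ⟦ inv g ∙ h ≟ pow x M ⟧ ≡ Y x ℤ.* ⟦ x ≟ h ⟧
                term h x (yes p) = ≡.trans (cong (ℤ._* ⟦ inv g ∙ h ≟ pow x M ⟧) p) (≡.trans (ℤₚ.*-zeroˡ ⟦ inv g ∙ h ≟ pow x M ⟧) (≡.sym (≡.trans (cong (ℤ._* ⟦ x ≟ h ⟧) p) (ℤₚ.*-zeroˡ ⟦ x ≟ h ⟧))))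
                term h x (no  p) = cong (Y x ℤ.*_) (⟦⟧-cong (inv g ∙ h ≟ pow x M) (x ≟ h)
                  (λ q → ≡.trans (≡.sym (decompose x p)) (≡.trans (cong (g ∙_) (≡.sym q)) (∙-inv-cancel g h)))
                  (λ q → ≡.trans (cong (inv g ∙_) (≡.trans (≡.sym q) (≡.sym (decompose x p)))) (inv-∙-cancel g (pow x M))))

              translate : ∃ λ g → pow g M ≡ e × σ (D ⋆ Xᵤ) ≈ δ g ⋆ (D ⋆ Xᵤ)
              translate = g , g^M , ≈-trans (≈-trans (push-⋆ φ φ-∙ D Xᵤ) (*-congˡ σX)) (ι-cancel n (begin
                κ ⋆ (σ D ⋆ Xᵤ)                       ≈⟨ *-congʳ (≈-sym DD*) ⟩
                (D ⋆ star D) ⋆ (σ D ⋆ Xᵤ)            ≈⟨ solve 4 (λ d s t x → (d :* s) :* (t :* x) := d :* ((t :* s) :* x)) ≈-refl D (star D) (σ D) Xᵤ ⟩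
                D ⋆ (z ⋆ Xᵤ)                         ≈⟨ *-congˡ (≈-trans zX (*-congˡ Y≈)) ⟩
                D ⋆ (κ ⋆ (δ g ⋆ Xᵤ))                 ≈⟨ solve 4 (λ d k g x → d :* (k :* (g :* x)) := k :* (g :* (d :* x))) ≈-refl D κ (δ g) Xᵤ ⟩
                κ ⋆ (δ g ⋆ (D ⋆ Xᵤ))                 ∎))

          multiplier : ∃ λ g → pow g M ≡ e × σ (D ⋆ Xᵤ) ≈ δ g ⋆ (D ⋆ Xᵤ)
          multiplier = Coset.translate (proj₁ quotient) (≈-trans (unscaled (proj₂ quotient)) (*-assoc κ (proj₁ quotient) Xᵤ))

    -- Orbits on the fibres of the projection onto U.

    module Fibres where

      open import Relation.Binary.PropositionalEquality

      open import Data.Nat.DivMod using (_%_; _/_; m≡m%n+[m/n]*n; m%n<n)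
      open import Data.Integer.Base using (+_)
      open Sums
      open Orbits using (orbit-sum)
      open Coefficients
      open Structure using (pow-comm)
      open Setting

      module _ (r w : ℕ) (1≤w : 1 ℕ.≤ w) (r-γ : ∀ i → pow (pow γ i) r ≡ pow γ i)
        (r^w : ∀ x → pow x (r ℕ.^ w) ≡ x)
        (free : ∀ y → pow y M ≡ e → ∀ i → 1 ℕ.≤ i → i ℕ.< w → pow y (r ℕ.^ i) ≡ y → y ≡ e)
        (Y : Fin v → ℤ) (Y-invariant : ∀ x → Y (pow x r) ≡ Y x) where

        private
          instance w≢0 = ℕ.>-nonZero 1≤w

          act : ℕ → Fin v → Fin v
          act i x = pow x (r ℕ.^ i)

          act-+ : ∀ i j x → act j (act i x) ≡ act (i ℕ.+ j) x
          act-+ i j x = trans (sym (pow-* x (r ℕ.^ i) (r ℕ.^ j))) (cong (pow x) (sym (ℕₚ.^-distribˡ-+-* r i j)))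

          act-w* : ∀ k x → act (k ℕ.* w) x ≡ x
          act-w* zero    x = pow-1 x
          act-w* (suc k) x = trans (sym (act-+ w (k ℕ.* w) x)) (trans (act-w* k (act w x)) (r^w x))

          act-% : ∀ i x → act i x ≡ act (i % w) x
          act-% i x = trans (cong (λ j → act j x) (trans (m≡m%n+[m/n]*n i w) (ℕₚ.+-comm (i % w) (i / w ℕ.* w))))
            (trans (sym (act-+ (i / w ℕ.* w) (i % w) x)) (cong (act (i % w)) (act-w* (i / w) x)))

          act-reduce : ∀ i x → ∃ λ (l : Fin w) → act i x ≡ act (toℕ l) x
          act-reduce i x = fromℕ< (m%n<n i w) , trans (act-% i x) (cong (λ j → act j x) (sym (Finₚ.toℕ-fromℕ< (m%n<n i w))))

          act-fixes : ∀ i {s} → pow s u ≡ e → act i s ≡ s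
          act-fixes zero    p = pow-1 _
          act-fixes (suc i) {s} p = trans (cong (pow s) (ℕₚ.*-comm r (r ℕ.^ i))) (trans (pow-* s (r ℕ.^ i) r) (trans (cong (λ z → pow z r) (act-fixes i p)) (fix (torsion s p))))
            where
            fix : (∃ λ i → s ≡ pow γ i) → pow s r ≡ s
            fix (i , s≡) = trans (cong (λ z → pow z r) s≡) (trans (r-γ i) (sym s≡))

          act-M : ∀ i x → pow (act i x) M ≡ pow x M
          act-M i x = trans (pow-comm x (r ℕ.^ i) M) (act-fixes i (M-torsion x))

          Y-act : ∀ i x → Y (act i x) ≡ Y x
          Y-act zero    x = cong Y (pow-1 x)
          Y-act (suc i) x = trans (cong Y (trans (cong (pow x) (ℕₚ.*-comm r (r ℕ.^ i))) (pow-* x (r ℕ.^ i) r))) (trans (Y-invariant (act i x)) (Y-act i x))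

          act-inverse : ∀ (i : Fin w) x → act (w ℕ.∸ toℕ i) (act (toℕ i) x) ≡ x
          act-inverse i x = trans (act-+ (toℕ i) (w ℕ.∸ toℕ i) x) (trans (cong (λ j → act j x) (ℕₚ.m+[n∸m]≡n (ℕₚ.<⇒≤ (Finₚ.toℕ<n i)))) (r^w x))

          act-inverse′ : ∀ (i : Fin w) x → act (toℕ i) (act (w ℕ.∸ toℕ i) x) ≡ x
          act-inverse′ i x = trans (act-+ (w ℕ.∸ toℕ i) (toℕ i) x) (trans (cong (λ j → act j x) (ℕₚ.m∸n+n≡m (ℕₚ.<⇒≤ (Finₚ.toℕ<n i)))) (r^w x))

        module _ {s} (s∈U : pow s u ≡ e) where
          private
            -- Y on the fibre of g ↦ g^M over s, without its fixed point s
            F : Fin v → ℤ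
            F x = ⟦ s ≟ pow x M ⟧ ℤ.* (⟦ ¬? (x ≟ s) ⟧ ℤ.* Y x)

            F-invariant : ∀ (i : Fin w) x → F (act (toℕ i) x) ≡ F x
            F-invariant i x = cong₂ ℤ._*_ (⟦⟧-cong (s ≟ pow (act (toℕ i) x) M) (s ≟ pow x M) (λ p → trans p (act-M (toℕ i) x)) (λ p → trans p (sym (act-M (toℕ i) x))))
              (cong₂ ℤ._*_ (⟦⟧-cong (¬? (act (toℕ i) x ≟ s)) (¬? (x ≟ s)) (λ ¬p p → ¬p (trans (cong (act (toℕ i)) p) (act-fixes (toℕ i) s∈U)))
                (λ ¬p p → ¬p (trans (sym (act-inverse i x)) (trans (cong (act (w ℕ.∸ toℕ i)) p) (act-fixes (w ℕ.∸ toℕ i) s∈U))))) (Y-act (toℕ i) x))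

            -- Since s is fixed too, x s⁻¹ is a fixed element of the kernel of the projection, to
            -- which `free` applies.
            no-fixed-point : ∀ x → pow x M ≡ s → ∀ i → 1 ℕ.≤ i → i ℕ.< w → act i x ≡ x → x ≡ s
            no-fixed-point x x^M i 1≤i i<w p = trans (sym (∙-inv-cancel s x)) (trans (cong (s ∙_) (trans (comm (inv s) x) (free (x ∙ inv s)
                (trans (pow-∙ x (inv s) M) (trans (cong₂ _∙_ x^M (trans (pow-inv s M) (cong inv (M-fixes s∈U)))) (invʳ s))) i 1≤i i<w
                (trans (pow-∙ x (inv s) (r ℕ.^ i)) (cong₂ _∙_ p (trans (pow-inv s (r ℕ.^ i)) (cong inv (act-fixes i s∈U)))))))) (idʳ s))

            F-free : ∀ x → F x ≢ 0ℤ → ∀ (i j : Fin w) → act (toℕ i) x ≡ act (toℕ j) x → i ≡ j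
            F-free x Fx≢0 i j p = decide (s ≟ pow x M) (x ≟ s)
              where
              ordered : ∀ (i j : Fin w) → toℕ i ℕ.< toℕ j → act (toℕ i) x ≡ act (toℕ j) x → pow x M ≡ s → x ≡ s
              ordered i j i<j p x^M = trans (sym (act-inverse i x)) (trans (cong (act (w ℕ.∸ toℕ i)) (no-fixed-point (act (toℕ i) x) (trans (act-M (toℕ i) x) x^M) (toℕ j ℕ.∸ toℕ i)
                  (ℕₚ.m<n⇒0<n∸m i<j) (ℕₚ.≤-<-trans (ℕₚ.m∸n≤m (toℕ j) (toℕ i)) (Finₚ.toℕ<n j))
                  (trans (act-+ (toℕ i) (toℕ j ℕ.∸ toℕ i) x) (trans (cong (λ k → act k x) (ℕₚ.m+[n∸m]≡n (ℕₚ.<⇒≤ i<j))) (sym p))))) (act-fixes (w ℕ.∸ toℕ i) s∈U))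
              compare : pow x M ≡ s → x ≢ s → toℕ i ℕ.< toℕ j ⊎ toℕ j ℕ.≤ toℕ i → i ≡ j
              compare x^M x≢s (inj₁ i<j) = contradiction (ordered i j i<j p x^M) x≢s
              compare x^M x≢s (inj₂ j≤i) = compare′ (ℕₚ.m≤n⇒m<n∨m≡n j≤i)
                where
                compare′ : toℕ j ℕ.< toℕ i ⊎ toℕ j ≡ toℕ i → i ≡ j
                compare′ (inj₁ j<i) = contradiction (ordered j i j<i (sym p) x^M) x≢s
                compare′ (inj₂ j≡i) = sym (Finₚ.toℕ-injective j≡i)
              decide : Dec (s ≡ pow x M) → Dec (x ≡ s) → i ≡ j
              decide (no ¬q) _ = contradiction (trans (cong (ℤ._* (⟦ ¬? (x ≟ s) ⟧ ℤ.* Y x)) (⟦no⟧ (s ≟ pow x M) ¬q)) (ℤₚ.*-zeroˡ (⟦ ¬? (x ≟ s) ⟧ ℤ.* Y x))) Fx≢0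
              decide (yes q) (yes x≡s) = contradiction (trans (cong (⟦ s ≟ pow x M ⟧ ℤ.*_) (trans (cong (ℤ._* Y x) (⟦no⟧ (¬? (x ≟ s)) (λ ¬p → ¬p x≡s))) (ℤₚ.*-zeroˡ (Y x)))) (ℤₚ.*-zeroʳ ⟦ s ≟ pow x M ⟧)) Fx≢0
              decide (yes q) (no x≢s) = compare (sym q) x≢s (ℕₚ.<-≤-connex (toℕ i) (toℕ j))

            F-sum : ∃ λ c → sum F ≡ + w ℤ.* c
            F-sum = orbit-sum 1≤w (λ i x → act (toℕ i) x) (λ i x → act (w ℕ.∸ toℕ i) x) act-inverse act-inverse′
              (λ i j x → proj₁ (act-reduce (toℕ i ℕ.+ toℕ j) x) , trans (act-+ (toℕ i) (toℕ j) x) (proj₂ (act-reduce (toℕ i ℕ.+ toℕ j) x)))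
              (λ i j x → proj₁ (back i j x) , trans (sym (proj₂ (back i j x))) (trans (sym (act-+ (w ℕ.∸ toℕ i) (toℕ j) (act (toℕ i) x))) (cong (act (toℕ j)) (act-inverse i x))))
              F F-invariant F-free
              where
              back : ∀ i j x → ∃ λ (l : Fin w) → act ((w ℕ.∸ toℕ i) ℕ.+ toℕ j) (act (toℕ i) x) ≡ act (toℕ l) (act (toℕ i) x)
              back i j x = act-reduce ((w ℕ.∸ toℕ i) ℕ.+ toℕ j) (act (toℕ i) x)

          fibre-sum : ∃ λ c → push (λ g → pow g M) Y s ≡ Y s ℤ.+ + w ℤ.* c
          fibre-sum = proj₁ F-sum , (begin
            push (λ g → pow g M) Y s                                  ≡⟨ ρ-at Y s ⟩
            sum (λ x → Y x ℤ.* ⟦ s ≟ pow x M ⟧)                       ≡⟨ sum-cong (λ x → split x (x ≟ s)) ⟩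
            sum (λ x → Y x ℤ.* ⟦ x ≟ s ⟧ ℤ.+ F x)                     ≡⟨ ∑-distrib-+ (λ x → Y x ℤ.* ⟦ x ≟ s ⟧) F ⟩
            sum (λ x → Y x ℤ.* ⟦ x ≟ s ⟧) ℤ.+ sum F                   ≡⟨ cong₂ ℤ._+_ (sum-⟦≟⟧ Y s) (proj₂ F-sum) ⟩
            Y s ℤ.+ + w ℤ.* proj₁ F-sum                               ∎)
            where
            open ≡-Reasoning
            split : ∀ x → Dec (x ≡ s) → Y x ℤ.* ⟦ s ≟ pow x M ⟧ ≡ Y x ℤ.* ⟦ x ≟ s ⟧ ℤ.+ F x
            split x (yes x≡s) = trans (cong (Y x ℤ.*_) (trans (⟦yes⟧ (s ≟ pow x M) (trans (sym (M-fixes s∈U)) (cong (λ z → pow z M) (sym x≡s)))) (sym (⟦yes⟧ (x ≟ s) x≡s))))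
              (trans (sym (ℤₚ.+-identityʳ (Y x ℤ.* ⟦ x ≟ s ⟧))) (cong (ℤ._+_ (Y x ℤ.* ⟦ x ≟ s ⟧)) (sym (trans (cong (⟦ s ≟ pow x M ⟧ ℤ.*_) (trans (cong (ℤ._* Y x) (⟦no⟧ (¬? (x ≟ s)) (λ ¬p → ¬p x≡s))) (ℤₚ.*-zeroˡ (Y x)))) (ℤₚ.*-zeroʳ ⟦ s ≟ pow x M ⟧)))))
            split x (no x≢s) = trans (ℤₚ.*-comm (Y x) ⟦ s ≟ pow x M ⟧) (trans (cong (⟦ s ≟ pow x M ⟧ ℤ.*_) (sym (trans (cong (ℤ._* Y x) (⟦yes⟧ (¬? (x ≟ s)) x≢s)) (ℤₚ.*-identityˡ (Y x)))))
              (sym (trans (cong (ℤ._+ F x) (trans (cong (Y x ℤ.*_) (⟦no⟧ (x ≟ s) x≢s)) (ℤₚ.*-zeroʳ (Y x)))) (ℤₚ.+-identityˡ (F x)))))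

        -- On each fibre of the projection, the orbits of x ↦ xʳ other than the fixed point have w elements.
        projection≡restriction : ∃ λ V → push (λ g → pow g M) Y ≈ Res Y ⊕ Z.ι (+ w) ⋆ V
        projection≡restriction = V , pointwise λ s → trans (go s (pow s u ≟ e)) (sym (trans (⊕-at (Res Y) (ι (+ w) ⋆ V) s) (cong (ℤ._+_ (Res Y s)) (ι⋆-at (+ w) V s))))
          where
          open Z using (ι)
          value : ∀ s → Dec (pow s u ≡ e) → ℤ
          value s (yes p) = proj₁ (fibre-sum p)
          value s (no _)  = 0ℤ
          V : Fin v → ℤ
          V s = value s (pow s u ≟ e)
          go : ∀ s (d : Dec (pow s u ≡ e)) → push (λ g → pow g M) Y s ≡ Res Y s ℤ.+ + w ℤ.* value s d
          go s (yes p) = trans (proj₂ (fibre-sum p)) (cong (ℤ._+ + w ℤ.* proj₁ (fibre-sum p)) (sym (Res-∈ {Y} p)))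
          go s (no ∉)  = trans (trans (ρ-at Y s) (sum-zero _ (λ x → trans (cong (Y x ℤ.*_) (⟦no⟧ (s ≟ pow x M) (λ q → ∉ (trans (cong (λ z → pow z u) q) (M-torsion x))))) (ℤₚ.*-zeroʳ (Y x)))))
            (sym (trans (cong₂ ℤ._+_ (Res-∉ {Y} ∉) (ℤₚ.*-zeroʳ (+ w))) refl))

    -- The contradiction in each of the two numerical cases.

    module Cases where

      open import Data.Nat.DivMod using (_%_; _/_; m≡m%n+[m/n]*n; m%n<n)
      open import Data.Integer.Base using (+_; +≤+)
      open import Data.Integer.Tactic.RingSolver using (solve-∀)
      import Data.Nat.Tactic.RingSolver as ℕ-solver
      open import Defs using (φ) renaming (δ to δ#)
      open Arith
      open Totient using (φ-bound; 1≤φ)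
      open Sums
      open Coefficients
      open Structure using (FrobeniusAt)
      open Setting
      open Multiplier using (ι-cancel)
      open Idempotents θ using (W-bound; star-W; X∣W)
      open Z using (ι; *-cong; *-congˡ; *-congʳ; *-comm; *-assoc; +-cong)
      open Z.Solver
      open import Relation.Binary.Reasoning.Setoid Z.setoid using (begin_; step-≈-⟩; step-≈-⟨; _∎)

      private
        ρ : (Fin v → ℤ) → Fin v → ℤ
        ρ = push (λ g → pow g M)

        small-multiple : ∀ {w} z → ℤ.∣ + w ℤ.* z ∣ ℕ.< w → z ≡ 0ℤ
        small-multiple {w} z p = decide (z ℤₚ.≟ 0ℤ)
          where
          decide : Dec (z ≡ 0ℤ) → z ≡ 0ℤ
          decide (yes q) = q
          decide (no  q) = contradiction (ℕₚ.≤-trans (ℕₚ.≤-reflexive (≡.sym (ℕₚ.*-identityʳ w))) (ℕₚ.≤-trans (ℕₚ.*-monoʳ-≤ w (ℕₚ.n≢0⇒n>0 (λ r → q (ℤₚ.∣i∣≡0⇒i≡0 r)))) (ℕₚ.≤-reflexive (≡.sym (ℤₚ.abs-* (+ w) z))))) (ℕₚ.<⇒≱ p)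

        norm-transfer : ∀ n .{{_ : ℕ.NonZero n}} {C} V → C ⋆ star C ≈ ι (+ n) ⋆ ι (+ n) → C ⋆ Xᵤ ≈ ι (+ n) ⋆ V → ⟨ V , V ⟩ ≡ + (2 ℕ.^ length L)
        norm-transfer n {C} V CC* CX = ≡.trans (≡.sym (⟨⟩≡⋆star-e V V)) (≡.trans (at (ι-cancel n (ι-cancel n (begin
            κ ⋆ (κ ⋆ (V ⋆ star V))                    ≈⟨ solve 3 (λ k y s → k :* (k :* (y :* s)) := (k :* y) :* (k :* s)) ≈-refl κ V (star V) ⟩
            (κ ⋆ V) ⋆ (κ ⋆ star V)                    ≈⟨ *-cong (≈-sym CX) (≈-trans (*-congʳ (≈-sym (push-ι inv inv-e (+ n)))) (≈-trans (≈-sym (star-⋆ κ V)) (≈-trans (push-cong inv (≈-sym CX)) (star-⋆ C Xᵤ)))) ⟩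
            (C ⋆ Xᵤ) ⋆ (star C ⋆ star Xᵤ)             ≈⟨ solve 4 (λ z x s t → (z :* x) :* (s :* t) := (z :* s) :* (x :* t)) ≈-refl C Xᵤ (star C) (star Xᵤ) ⟩
            (C ⋆ star C) ⋆ (Xᵤ ⋆ star Xᵤ)             ≈⟨ *-congʳ CC* ⟩
            (κ ⋆ κ) ⋆ (Xᵤ ⋆ star Xᵤ)                  ≈⟨ *-assoc κ κ (Xᵤ ⋆ star Xᵤ) ⟩
            κ ⋆ (κ ⋆ (Xᵤ ⋆ star Xᵤ))                  ∎))) e) Xᵤ-norm)
          where κ = ι (+ n)

        nonzero-point : ∀ {V} → ⟨ V , V ⟩ ≡ + (2 ℕ.^ length L) → ∃ λ g → V g ≢ 0ℤ
        nonzero-point {V} norm = decide (Finₚ.any? (λ g → nonzero? (V g)))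
          where
          decide : Dec (∃ λ g → V g ≢ 0ℤ) → ∃ λ g → V g ≢ 0ℤ
          decide (yes p) = p
          decide (no ¬p) = contradiction (≡.trans (≡.sym norm) (sum-zero _ (λ x → ≡.trans (cong (ℤ._* V x) (decidable-stable (V x ℤₚ.≟ 0ℤ) (λ q → ¬p (x , q)))) (ℤₚ.*-zeroˡ (V x)))))
            (λ q → ℕₚ.<⇒≢ (ℕₚ.m^n>0 2 (length L)) (≡.sym (ℤₚ.+-injective q)))

      module _ {a k w : ℕ} (1≤k : 1 ℕ.≤ k) {D : Fin v → ℤ} (bounded : ∀ g → ℤ.∣ D g ∣ ℕ.≤ a) (DD* : D ⋆ star D ≈ ι (+ (k ℕ.* k)))
        {V : Fin v → ℤ} (congruence : ρ (D ⋆ Xᵤ) ≈ Res (D ⋆ Xᵤ) ⊕ ι (+ w) ⋆ V) where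

        private
          instance k≢0 = ℕ.>-nonZero 1≤k
          Y = D ⋆ Xᵤ
          C = ρ D

          ρX : ρ Xᵤ ≈ Xᵤ
          ρX = fixes-X (λ g → pow g M) (λ x y → pow-∙ x y M) (pow-e M) M-γ

          ρ-⋆ : ∀ x y → ρ (x ⋆ y) ≈ ρ x ⋆ ρ y
          ρ-⋆ = push-⋆ (λ g → pow g M) (λ x y → pow-∙ x y M)

          ρY : ρ Y ≈ C ⋆ Xᵤ
          ρY = ≈-trans (ρ-⋆ D Xᵤ) (*-congˡ ρX)

          ρC : ρ C ≈ C
          ρC = ≈-trans (push-∘ (λ g → pow g M) (λ g → pow g M) D) (push-≗ (λ g → M-fixes (M-torsion g)) D)

          k² : ι (+ (k ℕ.* k)) ≈ ι (+ k) ⋆ ι (+ k)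
          k² = ≈-trans (pointwise λ x → cong (λ z → ι z x) (ℤₚ.pos-* k k)) (Z.ι-* (+ k) (+ k))

          CC* : C ⋆ star C ≈ ι (+ (k ℕ.* k))
          CC* = begin
            ρ D ⋆ star (ρ D)        ≈⟨ *-congˡ (≈-trans (push-∘ inv (λ g → pow g M) D) (≈-trans (push-≗ (λ g → ≡.sym (pow-inv g M)) D) (≈-sym (push-∘ (λ g → pow g M) inv D)))) ⟩
            ρ D ⋆ ρ (star D)        ≈⟨ ρ-⋆ D (star D) ⟨
            ρ (D ⋆ star D)          ≈⟨ push-cong _ DD* ⟩
            ρ (ι (+ (k ℕ.* k)))     ≈⟨ push-ι (λ g → pow g M) (pow-e M) (+ (k ℕ.* k)) ⟩
            ι (+ (k ℕ.* k))         ∎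

          CX : C ⋆ Xᵤ ≈ Res Y ⊕ ι (+ w) ⋆ V
          CX = ≈-trans (≈-sym ρY) congruence

          CX-at : ∀ s → (C ⋆ Xᵤ) s ≡ Res Y s ℤ.+ + w ℤ.* V s
          CX-at s = ≡.trans (at CX s) (≡.trans (⊕-at (Res Y) (ι (+ w) ⋆ V) s) (cong (ℤ._+_ (Res Y s)) (ι⋆-at (+ w) V s)))

          ResY-bound : ∀ s → ℤ.∣ Res Y s ∣ ℕ.≤ 2 ℕ.^ length L ℕ.* a
          ResY-bound s = decide (pow s u ≟ e)
            where
            decide : Dec (pow s u ≡ e) → ℤ.∣ Res Y s ∣ ℕ.≤ 2 ℕ.^ length L ℕ.* a
            decide (yes p) = ≡.subst (ℕ._≤ 2 ℕ.^ length L ℕ.* a) (cong ℤ.∣_∣ (≡.trans (at (⋆-comm Xᵤ D) s) (≡.sym (Res-∈ {Y} p)))) (Idempotents.X-bound θ L bounded s)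
            decide (no ¬p) = ≡.subst (λ z → ℤ.∣ z ∣ ℕ.≤ 2 ℕ.^ length L ℕ.* a) (≡.sym (Res-∉ {Y} ¬p)) ℕ.z≤n

        open Uniformizers M M-γ inv inv-∙ (star-X L) using (scaled; ≈⇒≋; ι≋ι; _≋_)
        private module R = Uniformizers M M-γ inv inv-∙ (star-X L)

        -- C = k η for a unit η, and the coefficients of η X are 0 and ± 1.
        self-conjugate-case : (∀ ℓ → Prime ℓ → ℓ ∣ k → FrobeniusAt γ u inv M ℓ) → 2 ℕ.^ δ# u ℕ.* a ℕ.< k → k ℕ.+ 2 ℕ.^ δ# u ℕ.* a ℕ.< w → ⊥
        self-conjugate-case frob small large = conclude root
          where
          module K = R.K
          -- With t = γⁱ one has π* = t⁻¹ - 1 = -t⁻¹ π, so π π* is π² times the unit -t⁻¹.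
          Nπ : ∀ i → ∃ λ ε → ∃ λ ε′ → R.Norms.N 2 (δ (pow γ i) ⊕ ⊖ δ e) ≋ ε ⋆ (δ (pow γ i) ⊕ ⊖ δ e) K.^ 2 × ε ⋆ ε′ ≋ δ e
          Nπ i = ⊖ t̄ , ⊖ t , ≈⇒≋ norm , ≈⇒≋ unit
            where
            t = δ (pow γ i)
            t̄ = δ (inv (pow γ i))
            π = t ⊕ ⊖ δ e
            t̄t : t̄ ⋆ t ≈ δ e
            t̄t = ≈-trans (≈-sym (δ-∙ (inv (pow γ i)) (pow γ i))) (pointwise λ x → cong (λ g → δ g x) (invˡ (pow γ i)))
            σπ : star π ≈ t̄ ⊕ ⊖ δ e
            σπ = ≈-trans (push-⊕ inv t (⊖ δ e)) (⊕-cong (push-δ inv (pow γ i)) (≈-trans (push-⊖ inv (δ e)) (⊖-cong (push-ι inv inv-e 1ℤ))))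
            norm : π ⋆ star (π ⋆ star (δ e)) ≈ ⊖ t̄ ⋆ (π ⋆ (π ⋆ δ e))
            norm = begin
              π ⋆ star (π ⋆ star (δ e))              ≈⟨ *-congˡ (≈-trans (push-cong inv (≈-trans (*-congˡ (push-ι inv inv-e 1ℤ)) (Z.*-identityʳ π))) σπ) ⟩
              π ⋆ (t̄ ⊕ ⊖ δ e)                        ≈⟨ *-congˡ (+-cong (≈-sym (Z.*-identityʳ t̄)) (⊖-cong (≈-sym t̄t))) ⟩
              π ⋆ (t̄ ⋆ δ e ⊕ ⊖ (t̄ ⋆ t))              ≈⟨ solve 2 (λ t s → (t :- con (+ 1)) :* (s :* con (+ 1) :- s :* t) := (:- s) :* ((t :- con (+ 1)) :* ((t :- con (+ 1)) :* con (+ 1)))) ≈-refl t t̄ ⟩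
              ⊖ t̄ ⋆ (π ⋆ (π ⋆ δ e))                  ∎
            unit : (⊖ t̄) ⋆ (⊖ t) ≈ δ e
            unit = ≈-trans (solve 2 (λ a b → (:- a) :* (:- b) := a :* b) ≈-refl t̄ t) t̄t

          -- The endomorphism is now inversion, of period 2, and the norm of C is C C*.
          norm-C : R.Norms.N 2 C ≋ K.ι (+ k) K.^ 2
          norm-C = K.trans (≈⇒≋ (≈-trans (*-congˡ (push-cong inv (≈-trans (*-congˡ (push-ι inv inv-e 1ℤ)) (Z.*-identityʳ C)))) (≈-trans CC* (≈-trans k² (*-congˡ (≈-sym (Z.*-identityʳ (ι (+ k)))))))))
            (K.sym (K.*-cong (ι≋ι (+ k)) (K.*-cong (ι≋ι (+ k)) K.refl)))

          root : ∃ λ F → C ≋ ι (+ k) ⋆ F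
          root = R.divides-from-norm {2} (ℕ.s≤s ℕ.z≤n) inv-inv Nπ k 1≤k frob C norm-C

          conclude : (∃ λ F → C ≋ ι (+ k) ⋆ F) → ⊥
          conclude (η , C≋) = contradict (nonzero-point norm)
            where
            V₁ = ρ η ⋆ Xᵤ
            CX′ : C ⋆ Xᵤ ≈ ι (+ k) ⋆ V₁
            CX′ = begin
              C ⋆ Xᵤ                        ≈⟨ *-congʳ ρC ⟨
              ρ C ⋆ Xᵤ                      ≈⟨ scaled C≋ ⟩
              ρ (ι (+ k) ⋆ η) ⋆ Xᵤ          ≈⟨ *-congʳ (≈-trans (ρ-⋆ (ι (+ k)) η) (*-congʳ (push-ι (λ g → pow g M) (pow-e M) (+ k)))) ⟩
              (ι (+ k) ⋆ ρ η) ⋆ Xᵤ          ≈⟨ *-assoc (ι (+ k)) (ρ η) Xᵤ ⟩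
              ι (+ k) ⋆ V₁                  ∎
            norm : ⟨ V₁ , V₁ ⟩ ≡ + (2 ℕ.^ length L)
            norm = norm-transfer k V₁ (≈-trans CC* k²) CX′
            V₁-small : ∀ g → ℤ.∣ V₁ g ∣ ℕ.≤ 1
            V₁-small = minimal⇒small pos distinct (λ q∈ → N̂⋆⋆Xᵤ q∈ (ρ η)) norm
            contradict : (∃ λ s → V₁ s ≢ 0ℤ) → ⊥
            contradict (s , V₁s≢0) = ℕₚ.<⇒≱ small (ℕₚ.≤-trans k≤ (ResY-bound s))
              where
              balance : + k ℤ.* V₁ s ≡ Res Y s ℤ.+ + w ℤ.* V s
              balance = ≡.trans (≡.sym (ι⋆-at (+ k) V₁ s)) (≡.trans (≡.sym (at CX′ s)) (CX-at s))
              isolate : ∀ {x y z : ℤ} → x ≡ y ℤ.+ z → z ≡ x ℤ.- y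
              isolate {x} {y} {z} p = ≡.trans (lemma y z) (cong (ℤ._- y) (≡.sym p))
                where
                lemma : ∀ y z → z ≡ (y ℤ.+ z) ℤ.- y
                lemma = solve-∀
              |kV₁|≤k : ℤ.∣ + k ℤ.* V₁ s ∣ ℕ.≤ k
              |kV₁|≤k = ℕₚ.≤-trans (ℕₚ.≤-reflexive (ℤₚ.abs-* (+ k) (V₁ s))) (ℕₚ.≤-trans (ℕₚ.*-monoʳ-≤ k (V₁-small s)) (ℕₚ.≤-reflexive (ℕₚ.*-identityʳ k)))
              -- By `balance`, w V s is a difference of terms of size at most k and 2^δ(u) a, whose
              -- sum is below w. The remaining equation k V₁ s = Res Y s then violates the lower
              -- bound on k.
              Vs≡0 : V s ≡ 0ℤ
              Vs≡0 = small-multiple (V s) (ℕₚ.≤-<-trans (ℕₚ.≤-trans (ℕₚ.≤-reflexive (cong ℤ.∣_∣ (isolate balance))) (ℕₚ.≤-trans (ℤₚ.∣i-j∣≤∣i∣+∣j∣ (+ k ℤ.* V₁ s) (Res Y s)) (ℕₚ.+-mono-≤ |kV₁|≤k (ResY-bound s)))) large)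
              k≤ : k ℕ.≤ ℤ.∣ Res Y s ∣
              k≤ = ℕₚ.≤-trans (ℕₚ.≤-reflexive (≡.sym (ℕₚ.*-identityʳ k))) (ℕₚ.≤-trans (ℕₚ.*-monoʳ-≤ k (ℕₚ.n≢0⇒n>0 (λ q → V₁s≢0 (ℤₚ.∣i∣≡0⇒i≡0 q)))) (ℕₚ.≤-reflexive (≡.trans (≡.sym (ℤₚ.abs-* (+ k) (V₁ s)))
                (cong ℤ.∣_∣ (≡.trans balance (≡.trans (cong (λ z → Res Y s ℤ.+ + w ℤ.* z) Vs≡0) (≡.trans (cong (ℤ._+_ (Res Y s)) (ℤₚ.*-zeroʳ (+ w))) (ℤₚ.+-identityʳ (Res Y s)))))))))

        -- The ℓ²-norm forces V = 0; then compare the Hermitian forms of C and Res D on ℤ[ζᵤ].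
        norm-case : (u ℕ.* a) ℕ.* (u ℕ.* a) ℕ.< k ℕ.* k ℕ.* φ u → 4 ℕ.* (k ℕ.* k) ℕ.* φ u ℕ.< w ℕ.* w → ⊥
        norm-case small large = ℕₚ.<⇒≱ small (ℕₚ.*-cancelʳ-≤ _ _ (product L) {{Idempotents.product-nonZero θ pos}} cleared)
          where
          n = 2 ℕ.^ length L
          N² = k ℕ.* k ℕ.* n
          4k²<w² : 4 ℕ.* (k ℕ.* k) ℕ.< w ℕ.* w
          4k²<w² = ℕₚ.≤-<-trans (ℕₚ.≤-trans (ℕₚ.≤-reflexive (≡.sym (ℕₚ.*-identityʳ _))) (ℕₚ.*-monoʳ-≤ (4 ℕ.* (k ℕ.* k)) (1≤φ u (HasOrder.1≤m oγ)))) large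

          norm-of : ∀ {C} → C ⋆ star C ≈ ι (+ (k ℕ.* k)) → ⟨ C ⋆ Xᵤ , C ⋆ Xᵤ ⟩ ≡ + N²
          norm-of {C} CC* = ≡.trans (≡.sym (⟨⟩≡⋆star-e (C ⋆ Xᵤ) (C ⋆ Xᵤ))) (≡.trans (at (≈-trans (*-congˡ (star-⋆ C Xᵤ))
            (≈-trans (solve 4 (λ z x s t → (z :* x) :* (s :* t) := (z :* s) :* (x :* t)) ≈-refl C Xᵤ (star C) (star Xᵤ)) (*-congʳ CC*))) e)
            (≡.trans (ι⋆-at (+ (k ℕ.* k)) (Xᵤ ⋆ star Xᵤ) e) (≡.trans (cong (+ (k ℕ.* k) ℤ.*_) Xᵤ-norm) (≡.sym (ℤₚ.pos-* (k ℕ.* k) n)))))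

          ResY-norm : ⟨ Res Y , Res Y ⟩ ℤ.≤ + N²
          ResY-norm = ℤₚ.≤-trans (sum-mono _ _ (λ s → term s (pow s u ≟ e))) (ℤₚ.≤-reflexive (norm-of DD*))
            where
            term : ∀ s → Dec (pow s u ≡ e) → Res Y s ℤ.* Res Y s ℤ.≤ Y s ℤ.* Y s
            term s (yes p) = ℤₚ.≤-reflexive (cong₂ ℤ._*_ (Res-∈ {Y} p) (Res-∈ {Y} p))
            term s (no ¬p) = ≡.subst (ℤ._≤ Y s ℤ.* Y s) (≡.sym (≡.trans (cong (ℤ._* Res Y s) (Res-∉ {Y} ¬p)) (ℤₚ.*-zeroˡ (Res Y s)))) (square-nonneg (Y s))

          -- (x - y)² ≤ 2x² + 2y²
          wV-norm : + (w ℕ.* w) ℤ.* ⟨ V , V ⟩ ℤ.≤ + (4 ℕ.* N²)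
          wV-norm = ℤₚ.≤-trans (ℤₚ.≤-reflexive (≡.sym (sum-*ˡ (+ (w ℕ.* w)) (λ s → V s ℤ.* V s)))) (ℤₚ.≤-trans (sum-mono _ _ pointwise-≤)
            (ℤₚ.≤-trans (ℤₚ.≤-reflexive (≡.trans (sum-*ˡ (+ 2) _) (cong (+ 2 ℤ.*_) (∑-distrib-+ (λ s → (C ⋆ Xᵤ) s ℤ.* (C ⋆ Xᵤ) s) (λ s → Res Y s ℤ.* Res Y s)))))
            (ℤₚ.≤-trans (ℤₚ.*-monoˡ-≤-nonNeg (+ 2) (ℤₚ.+-mono-≤ (ℤₚ.≤-reflexive (norm-of CC*)) ResY-norm)) (ℤₚ.≤-reflexive (≡.trans (≡.sym (ℤₚ.pos-* 2 (N² ℕ.+ N²))) (cong +_ (four N²)))))))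
            where
            four : ∀ x → 2 ℕ.* (x ℕ.+ x) ≡ 4 ℕ.* x
            four = ℕ-solver.solve-∀
            pointwise-≤ : ∀ s → + (w ℕ.* w) ℤ.* (V s ℤ.* V s) ℤ.≤ + 2 ℤ.* ((C ⋆ Xᵤ) s ℤ.* (C ⋆ Xᵤ) s ℤ.+ Res Y s ℤ.* Res Y s)
            pointwise-≤ s = ≡.subst₂ ℤ._≤_ (≡.trans (ℤₚ.+-identityʳ _) (≡.trans (square-product (+ w) (V s)) (cong (ℤ._* (V s ℤ.* V s)) (≡.sym (ℤₚ.pos-* w w)))))
                (≡.trans (identity (Res Y s) (+ w ℤ.* V s)) (cong (λ z → + 2 ℤ.* (z ℤ.* z ℤ.+ Res Y s ℤ.* Res Y s)) (≡.sym (CX-at s))))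
                (ℤₚ.+-monoʳ-≤ ((+ w ℤ.* V s) ℤ.* (+ w ℤ.* V s)) (square-nonneg (Res Y s ℤ.+ (Res Y s ℤ.+ + w ℤ.* V s))))
              where
              square-product : ∀ a b → (a ℤ.* b) ℤ.* (a ℤ.* b) ≡ (a ℤ.* a) ℤ.* (b ℤ.* b)
              square-product = solve-∀
              identity : ∀ y z → z ℤ.* z ℤ.+ (y ℤ.+ (y ℤ.+ z)) ℤ.* (y ℤ.+ (y ℤ.+ z)) ≡ + 2 ℤ.* ((y ℤ.+ z) ℤ.* (y ℤ.+ z) ℤ.+ y ℤ.* y)
              identity = solve-∀

          B = Res D

          ResY≈ : Res Y ≈ B ⋆ Xᵤ
          ResY≈ = ≈-trans (Res-cong (⋆-comm D Xᵤ)) (≈-trans (≈-sym (⋆-Res D supported-Xᵤ)) (⋆-comm Xᵤ B))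

          w≢0 : ℕ.NonZero w
          w≢0 = ℕ.≢-nonZero (λ w≡0 → ℕₚ.<⇒≱ 4k²<w² (≡.subst (λ z → z ℕ.* z ℕ.≤ 4 ℕ.* (k ℕ.* k)) (≡.sym w≡0) ℕ.z≤n))

          -- C X and Res Y are both multiples of X, so w V is annihilated, and w cancels. This
          -- brings V under `norm-lower-bound`.
          N̂V≈0 : ∀ {q} → q ∈ L → N̂ q ⋆ V ≈ 𝟘
          N̂V≈0 {q} q∈ = torsion-free w {{w≢0}} (N̂ q ⋆ V) (begin
            ι (+ w) ⋆ (N̂ q ⋆ V)                                                      ≈⟨ solve 4 (λ w n v y → w :* (n :* v) := n :* (y :+ w :* v) :- n :* y) ≈-refl (ι (+ w)) (N̂ q) V (Res Y) ⟩
            N̂ q ⋆ (Res Y ⊕ ι (+ w) ⋆ V) ⊕ ⊖ (N̂ q ⋆ Res Y)                            ≈⟨ ⊕-cong (≈-trans (*-congˡ (≈-sym CX)) (N̂⋆⋆Xᵤ q∈ C)) (⊖-cong (≈-trans (*-congˡ ResY≈) (N̂⋆⋆Xᵤ q∈ B))) ⟩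
            𝟘 ⊕ ⊖ 𝟘                                                                  ≈⟨ Z.-‿inverseʳ 𝟘 ⟩
            𝟘                                                                        ∎)

          -- A non-zero V has norm at least 2^δ(u), whereas w² times its norm is at most 4 k²
          -- 2^δ(u), and 4 k² < w².
          V≈0 : ∀ s → V s ≡ 0ℤ
          V≈0 s = decide (V s ℤₚ.≟ 0ℤ)
            where
            decide : Dec (V s ≡ 0ℤ) → V s ≡ 0ℤ
            decide (yes p) = p
            decide (no ¬p) = contradiction (ℤₚ.drop‿+≤+ (ℤₚ.≤-trans (ℤₚ.≤-reflexive (ℤₚ.pos-* (w ℕ.* w) n)) (ℤₚ.≤-trans (ℤₚ.*-monoˡ-≤-nonNeg (+ (w ℕ.* w)) (norm-lower-bound pos distinct N̂V≈0 s ¬p)) wV-norm)))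
              (ℕₚ.<⇒≱ (≡.subst (ℕ._< w ℕ.* w ℕ.* n) (ℕₚ.*-assoc 4 (k ℕ.* k) n) (ℕₚ.*-monoˡ-< n {{ℕₚ.m^n≢0 2 (length L)}} 4k²<w²)))

          CX≈BX : C ⋆ Xᵤ ≈ B ⋆ Xᵤ
          CX≈BX = ≈-trans CX (≈-trans (≈-trans (pointwise λ s → ≡.trans (⊕-at (Res Y) (ι (+ w) ⋆ V) s) (≡.trans (cong (ℤ._+_ (Res Y s)) (≡.trans (ι⋆-at (+ w) V s) (≡.trans (cong (+ w ℤ.*_) (V≈0 s)) (ℤₚ.*-zeroʳ (+ w))))) (ℤₚ.+-identityʳ (Res Y s)))) ≈-refl) ResY≈)

          -- The equation is carried from X to its multiple W, which is self-adjoint, so that it can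
          -- be used for B and for star B alike in `form`.
          CW≈BW : C ⋆ W L ≈ B ⋆ W L
          CW≈BW = go (X∣W L)
            where
            go : (∃ λ S → W L ≈ Xᵤ ⋆ S) → C ⋆ W L ≈ B ⋆ W L
            go (S , W≈) = ≈-trans (*-congˡ W≈) (≈-trans (≈-sym (*-assoc C Xᵤ S)) (≈-trans (*-congʳ CX≈BX) (≈-trans (*-assoc B Xᵤ S) (*-congˡ (≈-sym W≈)))))

          form : (B ⋆ star B) ⋆ W L ≈ ι (+ (k ℕ.* k)) ⋆ W L
          form = begin
            (B ⋆ star B) ⋆ W L           ≈⟨ solve 3 (λ b s w → (b :* s) :* w := s :* (b :* w)) ≈-refl B (star B) (W L) ⟩
            star B ⋆ (B ⋆ W L)           ≈⟨ *-congˡ (≈-sym CW≈BW) ⟩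
            star B ⋆ (C ⋆ W L)           ≈⟨ solve 3 (λ s c w → s :* (c :* w) := c :* (s :* w)) ≈-refl (star B) C (W L) ⟩
            C ⋆ (star B ⋆ W L)           ≈⟨ *-congˡ (≈-trans (starred B) (≈-trans (push-cong inv (≈-sym CW≈BW)) (≈-sym (starred C)))) ⟩
            C ⋆ (star C ⋆ W L)           ≈⟨ *-assoc C (star C) (W L) ⟨
            (C ⋆ star C) ⋆ W L           ≈⟨ *-congʳ CC* ⟩
            ι (+ (k ℕ.* k)) ⋆ W L        ∎
            where
            starred : ∀ f → star f ⋆ W L ≈ star (f ⋆ W L)
            starred f = ≈-trans (*-congˡ (≈-sym (star-W pos))) (≈-sym (star-⋆ f (W L)))

          R = product (map ℕ.pred L)
          P = product L

          U-size : sum (λ s → ⟦ pow s u ≟ e ⟧) ℤ.≤ + u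
          U-size = ℤₚ.≤-trans (sum-mono _ _ (λ s → term s (pow s u ≟ e))) (ℤₚ.≤-reflexive (≡.trans (∑-comm (λ s (i : Fin u) → ⟦ s ≟ pow γ (toℕ i) ⟧))
            (≡.trans (sum-cong (λ i → ≡.trans (sum-cong (λ s → ≡.sym (ℤₚ.*-identityˡ ⟦ s ≟ pow γ (toℕ i) ⟧))) (sum-⟦≟⟧ (λ _ → 1ℤ) (pow γ (toℕ i))))) (≡.trans (sum-const u 1ℤ) (ℤₚ.*-identityʳ (+ u))))))
            where
            instance u≢0 = ℕ.>-nonZero (HasOrder.1≤m oγ)
            term : ∀ s (d : Dec (pow s u ≡ e)) → ⟦ pow s u ≟ e ⟧ ℤ.≤ sum (λ (i : Fin u) → ⟦ s ≟ pow γ (toℕ i) ⟧)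
            term s (no ¬p) = ≡.subst (λ z → z ℤ.≤ sum (λ (i : Fin u) → ⟦ s ≟ pow γ (toℕ i) ⟧)) (≡.sym (⟦no⟧ (pow s u ≟ e) ¬p)) (sum-nonneg _ (λ i → ⟦⟧-nonneg (s ≟ pow γ (toℕ i))))
            term s (yes p) = generated (torsion s p)
              where
              generated : (∃ λ i → s ≡ pow γ i) → ⟦ pow s u ≟ e ⟧ ℤ.≤ sum (λ (i : Fin u) → ⟦ s ≟ pow γ (toℕ i) ⟧)
              generated (i , s≡) = ℤₚ.≤-trans (ℤₚ.≤-reflexive (≡.trans (⟦yes⟧ (pow s u ≟ e) p) (≡.sym (⟦yes⟧ (s ≟ pow γ (toℕ j)) s≡′))))
                  (term≤sum (λ (i : Fin u) → ⟦ s ≟ pow γ (toℕ i) ⟧) (λ i → ⟦⟧-nonneg (s ≟ pow γ (toℕ i))) j)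
                where
                j = fromℕ< (m%n<n i u)
                s≡′ : s ≡ pow γ (toℕ j)
                s≡′ = ≡.trans s≡ (≡.trans (cong (pow γ) (≡.trans (m≡m%n+[m/n]*n i u) (cong (i % u ℕ.+_) (ℕₚ.*-comm (i / u) u)))) (≡.trans (pow-+ γ (i % u) (u ℕ.* (i / u)))
                  (≡.trans (cong (pow γ (i % u) ∙_) (≡.trans (pow-* γ u (i / u)) (≡.trans (cong (λ z → pow z (i / u)) (HasOrder.pow≡e oγ)) (pow-e (i / u))))) (≡.trans (idʳ _) (cong (pow γ) (≡.sym (Finₚ.toℕ-fromℕ< (m%n<n i u))))))))

          B-norm : ⟨ B , B ⟩ ℤ.≤ + (u ℕ.* (a ℕ.* a))
          B-norm = ℤₚ.≤-trans (sum-mono _ _ (λ s → term s (pow s u ≟ e))) (ℤₚ.≤-trans (ℤₚ.≤-reflexive (sum-*ʳ (+ (a ℕ.* a)) (λ s → ⟦ pow s u ≟ e ⟧)))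
            (ℤₚ.≤-trans (ℤₚ.*-monoʳ-≤-nonNeg (+ (a ℕ.* a)) U-size) (ℤₚ.≤-reflexive (≡.sym (ℤₚ.pos-* u (a ℕ.* a))))))
            where
            term : ∀ s → Dec (pow s u ≡ e) → B s ℤ.* B s ℤ.≤ ⟦ pow s u ≟ e ⟧ ℤ.* + (a ℕ.* a)
            term s (yes p) = ≡.subst₂ ℤ._≤_ (≡.sym (≡.trans (cong₂ ℤ._*_ (Res-∈ {D} p) (Res-∈ {D} p)) (square (D s)))) (≡.sym (≡.trans (cong (ℤ._* + (a ℕ.* a)) (⟦yes⟧ (pow s u ≟ e) p)) (ℤₚ.*-identityˡ (+ (a ℕ.* a)))))
              (+≤+ (ℕₚ.*-mono-≤ (bounded s) (bounded s)))
            term s (no ¬p) = ≡.subst₂ ℤ._≤_ (≡.sym (≡.trans (cong (ℤ._* B s) (Res-∉ {D} ¬p)) (ℤₚ.*-zeroˡ (B s)))) (≡.sym (≡.trans (cong (ℤ._* + (a ℕ.* a)) (⟦no⟧ (pow s u ≟ e) ¬p)) (ℤₚ.*-zeroˡ (+ (a ℕ.* a))))) ℤₚ.≤-refl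

          -- Take the coefficient at e in `form`: on the right W contributes ∏ (q - 1), on the left
          -- `W-bound` applies, and B has at most u non-zero coefficients, each of size at most a.
          form-bound : k ℕ.* k ℕ.* R ℕ.≤ P ℕ.* (u ℕ.* (a ℕ.* a))
          form-bound = ℤₚ.drop‿+≤+ (ℤₚ.≤-trans (ℤₚ.≤-reflexive (≡.trans (ℤₚ.pos-* (k ℕ.* k) R) (≡.trans (cong (+ (k ℕ.* k) ℤ.*_) (≡.sym (W-e pos distinct))) (≡.trans (≡.sym (ι⋆-at (+ (k ℕ.* k)) (W L) e)) (≡.sym (at form e))))))
            (ℤₚ.≤-trans (W-bound pos B) (ℤₚ.≤-trans (ℤₚ.*-monoˡ-≤-nonNeg (+ P) B-norm) (ℤₚ.≤-reflexive (≡.sym (ℤₚ.pos-* P (u ℕ.* (a ℕ.* a))))))))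

          -- As φ(u) ≤ u R / P, the preceding bound gives k² φ(u) ≤ u² a²; both sides are multiplied
          -- by P.
          cleared : k ℕ.* k ℕ.* φ u ℕ.* P ℕ.≤ (u ℕ.* a) ℕ.* (u ℕ.* a) ℕ.* P
          cleared = ℕₚ.≤-trans (ℕₚ.≤-reflexive (ℕₚ.*-assoc (k ℕ.* k) (φ u) P)) (ℕₚ.≤-trans (ℕₚ.*-monoʳ-≤ (k ℕ.* k) (φ-bound u (HasOrder.1≤m oγ)))
            (ℕₚ.≤-trans (ℕₚ.≤-reflexive (lemma₁ (k ℕ.* k) u R)) (ℕₚ.≤-trans (ℕₚ.*-monoʳ-≤ u form-bound) (ℕₚ.≤-reflexive (lemma₂ u P a)))))
            where
            lemma₁ : ∀ x u r → x ℕ.* (u ℕ.* r) ≡ u ℕ.* (x ℕ.* r)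
            lemma₁ = ℕ-solver.solve-∀
            lemma₂ : ∀ u p a → u ℕ.* (p ℕ.* (u ℕ.* (a ℕ.* a))) ≡ (u ℕ.* a) ℕ.* (u ℕ.* a) ℕ.* p
            lemma₂ = ℕ-solver.solve-∀

    -- Translating D so that D X becomes fixed, and closing the argument.

    module Refutation where

      open import Defs using (IsIW)

      open import Data.Integer.Base using (+_)
      open import Defs using (φ) renaming (δ to δ#)
      open Coefficients
      open Structure
      open Setting using (Xᵤ; module Z)
      open Multiplier using (module Shift)
      open Fibres
      open Cases
      open Z using (ι; *-congˡ; *-congʳ; *-assoc)

      module _ {r f q w k a : ℕ} (1≤k : 1 ℕ.≤ k) (1≤w : 1 ℕ.≤ w)
        (r-γ : ∀ i → pow (pow γ i) r ≡ pow γ i) (1≤f : 1 ℕ.≤ f) (r^f : ∀ g → pow g (r ℕ.^ f) ≡ g)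
        (r^q-γ : ∀ i → pow (pow γ i) (r ℕ.^ q) ≡ pow γ i) (r^q^w : ∀ g → pow g ((r ℕ.^ q) ℕ.^ w) ≡ g)
        (free : ∀ y → pow y M ≡ e → ∀ i → 1 ℕ.≤ i → i ℕ.< w → pow y ((r ℕ.^ q) ℕ.^ i) ≡ y → y ≡ e)
        (frobenius : ∀ ℓ → Prime ℓ → ℓ ∣ k → FrobeniusAt γ u (λ g → pow g r) 1 ℓ)
        (quasi-root : ∀ {g} → pow g M ≡ e → ∃ λ h → pow h r ∙ g ≡ h)
        {D} (D-IW : IsIW G a (k ℕ.* k) D) where

        DD* : D ⋆ star D ≈ ι (+ (k ℕ.* k))
        DD* = IW⇒ D-IW

        translated : ∃ λ g → pow g M ≡ e × push (λ x → pow x r) (D ⋆ Xᵤ) ≈ δ g ⋆ (D ⋆ Xᵤ)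
        translated = Shift.multiplier r r-γ f 1≤f r^f (ℕₚ.*-mono-≤ 1≤k 1≤k) (λ ℓ pr ℓ∣ → frobenius ℓ pr (split ℓ pr (euclidsLemma k k pr ℓ∣))) DD*
          where
          split : ∀ ℓ → Prime ℓ → ℓ ∣ k ⊎ ℓ ∣ k → ℓ ∣ k
          split ℓ pr (inj₁ q) = q
          split ℓ pr (inj₂ q) = q

        module Translate {g h} (fixed : push (λ x → pow x r) (D ⋆ Xᵤ) ≈ δ g ⋆ (D ⋆ Xᵤ)) (h^r : pow h r ∙ g ≡ h) where
          D′ = δ h ⋆ D
          Y = D′ ⋆ Xᵤ

          bounded : ∀ x → ℤ.∣ D′ x ∣ ℕ.≤ a
          bounded x = ≡.subst (λ z → ℤ.∣ z ∣ ℕ.≤ a) (≡.sym (δ⋆-at h D x)) (proj₁ D-IW (inv h ∙ x))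

          D′D′* : D′ ⋆ star D′ ≈ ι (+ (k ℕ.* k))
          D′D′* = ≈-trans (*-congˡ (≈-trans (star-⋆ (δ h) D) (*-congʳ (push-δ inv h)))) (≈-trans (solve 4 (λ a b c d → (a :* b) :* (c :* d) := (a :* c) :* (b :* d)) ≈-refl (δ h) D (δ (inv h)) (star D))
            (≈-trans (*-congʳ (≈-trans (≈-sym (δ-∙ h (inv h))) (pointwise λ x → cong (λ g → δ g x) (invʳ h)))) (≈-trans (⋆-identityˡ (D ⋆ star D)) DD*)))
            where open Z.Solver

          -- The choice of h absorbs the translation: σ sends h D X to h^r g D X = h D X.
          push-Y : push (λ x → pow x r) Y ≈ Y
          push-Y = ≈-trans (push-cong (λ x → pow x r) (*-assoc (δ h) D Xᵤ)) (≈-trans (push-⋆ (λ x → pow x r) (λ x y → pow-∙ x y r) (δ h) (D ⋆ Xᵤ))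
            (≈-trans (≈-trans (*-congˡ fixed) (*-congʳ (push-δ (λ x → pow x r) h))) (≈-trans (≈-sym (*-assoc (δ (pow h r)) (δ g) (D ⋆ Xᵤ)))
            (≈-trans (*-congʳ (≈-trans (≈-sym (δ-∙ (pow h r) g)) (pointwise λ x → cong (λ g → δ g x) h^r))) (≈-sym (*-assoc (δ h) D Xᵤ))))))

          r^f-left : ∀ x → pow (pow x r) (r ℕ.^ ℕ.pred f) ≡ x
          r^f-left x = ≡.trans (≡.sym (pow-* x r (r ℕ.^ ℕ.pred f))) (≡.trans (cong (λ j → pow x (r ℕ.^ j)) (ℕₚ.suc-pred f {{ℕ.>-nonZero 1≤f}})) (r^f x))

          Y-invariant : ∀ x → Y (pow x r) ≡ Y x
          Y-invariant x = ≡.trans (≡.sym (at push-Y (pow x r))) (≡.trans (push-bijection (λ x → pow x r) (λ x → pow x (r ℕ.^ ℕ.pred f)) r^f-left (λ x → ≡.trans (pow-comm x (r ℕ.^ ℕ.pred f) r) (r^f-left x)) Y (pow x r))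
            (cong Y (r^f-left x)))

          Y-invariant-^ : ∀ j x → Y (pow x (r ℕ.^ j)) ≡ Y x
          Y-invariant-^ zero    x = cong Y (pow-1 x)
          Y-invariant-^ (suc j) x = ≡.trans (cong Y (pow-* x r (r ℕ.^ j))) (≡.trans (Y-invariant-^ j (pow x r)) (Y-invariant x))

          -- r^q replaces r because the orbits on the fibres must have exactly w elements;
          -- invariance under r passes to its powers.
          congruence = projection≡restriction (r ℕ.^ q) w 1≤w r^q-γ r^q^w free Y (Y-invariant-^ q)

          refute : ((∀ ℓ → Prime ℓ → ℓ ∣ k → FrobeniusAt γ u inv M ℓ) × 2 ℕ.^ δ# u ℕ.* a ℕ.< k × k ℕ.+ 2 ℕ.^ δ# u ℕ.* a ℕ.< w)
            ⊎ ((u ℕ.* a) ℕ.* (u ℕ.* a) ℕ.< k ℕ.* k ℕ.* φ u × 4 ℕ.* (k ℕ.* k) ℕ.* φ u ℕ.< w ℕ.* w) → ⊥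
          refute (inj₁ (conj , small , large)) = self-conjugate-case {w = w} 1≤k bounded D′D′* (proj₂ congruence) conj small large
          refute (inj₂ (small , large)) = norm-case {w = w} 1≤k bounded D′D′* (proj₂ congruence) small large

        refute : ((∀ ℓ → Prime ℓ → ℓ ∣ k → FrobeniusAt γ u inv M ℓ) × 2 ℕ.^ δ# u ℕ.* a ℕ.< k × k ℕ.+ 2 ℕ.^ δ# u ℕ.* a ℕ.< w)
          ⊎ ((u ℕ.* a) ℕ.* (u ℕ.* a) ℕ.< k ℕ.* k ℕ.* φ u × 4 ℕ.* (k ℕ.* k) ℕ.* φ u ℕ.< w ℕ.* w) → ⊥
        refute = go translated
          where
          go : (∃ λ g → pow g M ≡ e × push (λ x → pow x r) (D ⋆ Xᵤ) ≈ δ g ⋆ (D ⋆ Xᵤ)) → _ → ⊥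
          go (g , g^M , fixed) = Translate.refute fixed (proj₂ (quasi-root g^M))

  -- From the arithmetic hypotheses to the data required above.

  module Main where

    open import Defs using (IsExponent; IsIW; IsOrd; SelfConj; FixesPrimesAbove; _≡ᵐ_[mod_])

    open import Data.Integer.Base using (+_)
    open import Data.Integer.DivMod using (_%ℕ_; _/ℕ_; a≡a%ℕn+[a/ℕn]*n)
    open import Defs using (φ) renaming (δ to δ#)
    open Arith
    open Congruences
    open Totient using (1≤φ)
    open GroupRing
    open Coefficients
    open Decomposition using (HasOrder)
    open Structure
    open FixedPrimes using (frobenius-exponent)

    ≅⇒≡ : ∀ {a b n} → a ≅ b [ n ] → + a K.≡ + b [ + n ]
    ≅⇒≡ {a} {b} {n} (shifts {i} {j} eq) = K.diff (+ j ℤ.- + i) (begin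
        + a                                      ≡⟨ solve 3 (λ a i n → a := (a :+ i :* n) :- i :* n) ≡.refl (+ a) (+ i) (+ n) ⟩
        (+ a ℤ.+ + i ℤ.* + n) ℤ.- + i ℤ.* + n    ≡⟨ cong (ℤ._- + i ℤ.* + n) (≡.trans (≡.sym (cast a i)) (≡.trans (cong +_ eq) (cast b j))) ⟩
        (+ b ℤ.+ + j ℤ.* + n) ℤ.- + i ℤ.* + n    ≡⟨ solve 4 (λ b j i n → (b :+ j :* n) :- i :* n := b :+ n :* (j :- i)) ≡.refl (+ b) (+ j) (+ i) (+ n) ⟩
        + b ℤ.+ + n ℤ.* (+ j ℤ.- + i)            ∎)
      where
      open ≡.≡-Reasoning
      open K.Solver
      cast : ∀ a i → + (a ℕ.+ i ℕ.* n) ≡ + a ℤ.+ + i ℤ.* + n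
      cast a i = ≡.trans (ℤₚ.pos-+ a (i ℕ.* n)) (cong (ℤ._+_ (+ a)) (ℤₚ.pos-* i n))

    ∣∸1⇒≡1 : ∀ {a n} → 1 ℕ.≤ a → n ∣ a ℕ.∸ 1 → + a K.≡ 1ℤ [ + n ]
    ∣∸1⇒≡1 1≤a n∣ = ≅⇒≡ (≅-sym (∣∸⇒≅ 1≤a n∣))

    ≡1-^ : ∀ {x n} i → x K.≡ 1ℤ [ n ] → x K.^ i K.≡ 1ℤ [ n ]
    ≡1-^ i h = K.≡-trans (K.≡-^ i h) (K.≡-refl (K.1^n≈1 i))

    power-shift : ∀ {ℓ n} → 1 ℕ.≤ ℓ → 1 ℕ.≤ n → Coprime ℓ n → ∃ λ J → ∀ j → + (ℓ ℕ.^ (j ℕ.+ suc J)) K.≡ + (ℓ ℕ.^ j) [ + n ]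
    power-shift {ℓ} {n} 1≤ℓ 1≤n c = go (power-period 1≤ℓ 1≤n c)
      where
      instance ℓ≢0 = ℕ.>-nonZero 1≤ℓ
      go : (∃ λ J → n ∣ ℓ ℕ.^ suc J ℕ.∸ 1) → ∃ λ J → ∀ j → + (ℓ ℕ.^ (j ℕ.+ suc J)) K.≡ + (ℓ ℕ.^ j) [ + n ]
      go (J , n∣) = J , λ j → K.≡-trans (K.≡-refl (≡.trans (cong +_ (ℕₚ.^-distribˡ-+-* ℓ j (suc J))) (ℤₚ.pos-* (ℓ ℕ.^ j) (ℓ ℕ.^ suc J))))
        (K.≡-trans (K.≡-* (K.≡-refl (≡.refl {x = + (ℓ ℕ.^ j)})) (∣∸1⇒≡1 (ℕₚ.m^n>0 ℓ (suc J)) n∣)) (K.≡-refl (ℤₚ.*-identityʳ (+ (ℓ ℕ.^ j)))))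

    pow-≡ : ∀ {g a b n} → + a K.≡ + b [ + n ] → pow g n ≡ e → pow g a ≡ pow g b
    pow-≡ h = pow-≅ (≡⇒≅ h)

    pow-≡1 : ∀ {g a n} → + a K.≡ 1ℤ [ + n ] → pow g n ≡ e → pow g a ≡ g
    pow-≡1 {g} h p = ≡.trans (pow-≡ h p) (pow-1 g)

    -- The quotient of g^s by g is killed by both m and n.
    pow-fixed : ∀ {m n} → Coprime m n → ∀ g s → pow (pow g m) s ≡ pow g m → pow (pow g n) s ≡ pow g n → pow g s ≡ g
    pow-fixed {m} {n} c g s p q = ≡.trans (≡.sym (∙-inv-cancel g (pow g s))) (≡.trans (cong (g ∙_) (coprime-torsion c (inv g ∙ pow g s) (trivial m p) (trivial n q))) (idʳ g))
      where
      trivial : ∀ m → pow (pow g m) s ≡ pow g m → pow (inv g ∙ pow g s) m ≡ e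
      trivial m p = ≡.trans (pow-∙ (inv g) (pow g s) m) (≡.trans (cong₂ _∙_ (pow-inv g m) (≡.trans (pow-comm g s m) p)) (invˡ (pow g m)))

    module Assembly {u i d′ k p : ℕ} (1≤u : 1 ℕ.≤ u) (1≤k : 1 ℕ.≤ k) (prime-p : Prime p) (v≡ : v ≡ u ℕ.* p ℕ.^ d′)
      (exponent : IsExponent G (u ℕ.* p ℕ.^ suc i)) (u⊥p : Coprime u p) (p⊥k : Coprime p k)
      {t : ℤ} (fixes : FixesPrimesAbove (u ℕ.* p ℕ.^ suc i) t k) (t≡1 : t ≡ᵐ 1ℤ [mod u ]) {w : ℕ} (ord : IsOrd p t w) (2≤w : 2 ℕ.≤ w)
      {r n : ℕ} (r≡1+n : r ≡ suc n) (r≡t : + r K.≡ t [ + (u ℕ.* p ℕ.^ suc i) ]) where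

      P = p ℕ.^ suc i
      m = u ℕ.* P
      1≤w = proj₁ ord

      instance
        p≢0 = prime⇒nonZero prime-p
        u≢0 = ℕ.>-nonZero 1≤u

      P⊥u : Coprime P u
      P⊥u = coprime-^ (Coprimality.sym u⊥p) (suc i)

      1≤P : 1 ℕ.≤ P
      1≤P = ℕₚ.m^n>0 p (suc i)

      pow-m : ∀ g → pow g m ≡ e
      pow-m = proj₁ (proj₂ exponent)

      ω = proj₁ (exponent-attained exponent)
      oω = proj₂ (exponent-attained exponent)
      γ = pow ω P

      oγ : HasOrder γ u
      oγ = HasOrder-pow 1≤u oω

      torsion : ∀ g → pow g u ≡ e → ∃ λ i → g ≡ pow γ i
      torsion = torsion-cyclic oγ v≡ (coprime-^ (Coprimality.sym u⊥p) d′)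

      pow-γ-u : ∀ i → pow (pow γ i) u ≡ e
      pow-γ-u i = ≡.trans (pow-comm γ i u) (≡.trans (cong (λ z → pow z i) (HasOrder.pow≡e oγ)) (pow-e i))

      inverse = inverse-mod P⊥u 1≤P
      -- M is 0 modulo P and 1 modulo u, so g ↦ g^M kills the p-part of G and is the identity on U.
      M = P ℕ.* proj₁ inverse

      M≅1 : M ≅ 1 [ u ]
      M≅1 = shifts {left = 0} {right = proj₁ (proj₂ inverse)} (≡.trans (ℕₚ.+-identityʳ M) (≡.trans (proj₂ (proj₂ inverse)) (cong suc (ℕₚ.*-comm u _))))

      M-γ : ∀ i → pow (pow γ i) M ≡ pow γ i
      M-γ i = ≡.trans (pow-≅ M≅1 (pow-γ-u i)) (pow-1 (pow γ i))

      M-torsion : ∀ g → pow (pow g M) u ≡ e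
      M-torsion g = ≡.trans (≡.sym (pow-* g M u)) (pow-∣ {g} {m} (divides (proj₁ inverse) (rearrange P (proj₁ inverse) u)) (pow-m g))
        where
        open import Data.Nat.Tactic.RingSolver using (solve-∀)
        rearrange : ∀ P h u → P ℕ.* h ℕ.* u ≡ h ℕ.* (u ℕ.* P)
        rearrange = solve-∀

      pow-P-u : ∀ g → pow (pow g P) u ≡ e
      pow-P-u g = ≡.trans (≡.sym (pow-* g P u)) (≡.trans (cong (pow g) (ℕₚ.*-comm P u)) (pow-m g))

      kernel : ∀ {g} → pow g M ≡ e → pow g P ≡ e
      kernel {g} q = ≡.trans (≡.sym (≡.trans (pow-≅ M≅1 (pow-P-u g)) (pow-1 (pow g P)))) (≡.trans (pow-comm g P M) (≡.trans (cong (λ z → pow z P) q) (pow-e P)))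

      r≡t[p] : + r K.≡ t [ + p ]
      r≡t[p] = ≡-∣ (ℕ∣.∣-trans (ℕ∣.m∣m*n (p ℕ.^ i)) (ℕ∣.n∣m*n u)) r≡t

      r≡1[u] : + r K.≡ 1ℤ [ + u ]
      r≡1[u] = K.≡-trans (≡-∣ (ℕ∣.m∣m*n P) r≡t) (to-≡ t≡1)

      r-γ : ∀ i → pow (pow γ i) r ≡ pow γ i
      r-γ i = pow-≡1 r≡1[u] (pow-γ-u i)

      t^≢1 : ∀ j → 1 ℕ.≤ j → j ℕ.< w → ¬ (t K.^ j K.≡ 1ℤ [ + p ])
      t^≢1 j 1≤j j<w h = proj₂ (proj₂ ord) j 1≤j j<w (≡.subst (λ z → z ≡ᵐ 1ℤ [mod p ]) (≡.sym (^≡^ t j)) (from-≡ h))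

      -- r^w ≡ 1 modulo p lifts to r^(w pⁱ) ≡ 1 modulo P = p^(i+1), so σ has period f.
      f = w ℕ.* p ℕ.^ i

      1≤f : 1 ℕ.≤ f
      1≤f = ℕₚ.*-mono-≤ 1≤w (ℕₚ.m^n>0 p i)

      r^f≡1[P] : + (r ℕ.^ f) K.≡ 1ℤ [ + P ]
      r^f≡1[P] = K.≡-trans (K.≡-refl (≡.trans (pos-^ r f) (≡.sym (K.^-assocʳ (+ r) w (p ℕ.^ i)))))
        (lift-≡1 i (K.≡-trans (K.≡-^ w r≡t[p]) (≡.subst (λ z → z K.≡ 1ℤ [ + p ]) (^≡^ t w) (to-≡ (proj₁ (proj₂ ord))))))

      r^≡1[u] : ∀ j → + (r ℕ.^ j) K.≡ 1ℤ [ + u ]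
      r^≡1[u] j = K.≡-trans (K.≡-refl (pos-^ r j)) (≡1-^ j r≡1[u])

      r^f : ∀ g → pow g (r ℕ.^ f) ≡ g
      r^f g = pow-fixed P⊥u g (r ℕ.^ f) (pow-≡1 (r^≡1[u] f) (pow-P-u g)) (pow-≡1 r^f≡1[P] (≡.trans (≡.sym (pow-* g u P)) (pow-m g)))

      -- By Fermat r₁ ≡ r ≡ t modulo p, so no positive power of r₁ below the w-th is 1 modulo p; but
      -- r₁^w = r^f acts trivially on G. Thus w is the exact orbit length.
      r₁ = r ℕ.^ (p ℕ.^ i)

      r₁-γ : ∀ i → pow (pow γ i) r₁ ≡ pow γ i
      r₁-γ j = pow-≡1 (r^≡1[u] (p ℕ.^ i)) (pow-γ-u j)

      r₁^w : ∀ g → pow g (r₁ ℕ.^ w) ≡ g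
      r₁^w g = ≡.trans (cong (pow g) (≡.trans (ℕₚ.^-*-assoc r (p ℕ.^ i) w) (cong (r ℕ.^_) (ℕₚ.*-comm (p ℕ.^ i) w)))) (r^f g)

      r₁^≡t^ : ∀ j → + (r₁ ℕ.^ j) K.≡ t K.^ j [ + p ]
      r₁^≡t^ j = K.≡-trans (K.≡-refl (pos-^ r₁ j)) (K.≡-^ j (K.≡-trans (K.≡-refl (pos-^ r (p ℕ.^ i))) (K.≡-trans (fermat-^ prime-p i r) r≡t[p])))

      coprime-P : ∀ {s} → ¬ (+ suc s K.≡ 1ℤ [ + p ]) → Coprime P s
      coprime-P h = coprime-^ (∤⇒coprime prime-p (λ p∣s → h (∣∸1⇒≡1 (ℕ.s≤s ℕ.z≤n) p∣s))) (suc i)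

      -- If y^s = y, then y^(s-1) = e, and s - 1 is coprime to P. The case s = 0 is separate, as s -
      -- 1 is not a natural number there.
      only-fixed-point : ∀ y s → pow y P ≡ e → ¬ (+ s K.≡ 1ℤ [ + p ]) → pow y s ≡ y → y ≡ e
      only-fixed-point y zero    y^P h q = ≡.sym q
      only-fixed-point y (suc s) y^P h q = coprime-torsion (coprime-P h) y y^P (∙-cancelˡ y (≡.trans q (≡.sym (idʳ y))))

      free : ∀ y → pow y M ≡ e → ∀ j → 1 ℕ.≤ j → j ℕ.< w → pow y (r₁ ℕ.^ j) ≡ y → y ≡ e
      free y y^M j 1≤j j<w = only-fixed-point y (r₁ ℕ.^ j) (kernel y^M) (λ h → t^≢1 j 1≤j j<w (K.≡-trans (K.≡-sym (r₁^≡t^ j)) h))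

      -- 2 ≤ w means that already t¹ is not 1 modulo p.
      r≢1 : ¬ (+ suc n K.≡ 1ℤ [ + p ])
      r≢1 h = t^≢1 1 ℕₚ.≤-refl 2≤w (K.≡-trans (K.≡-refl (ℤₚ.*-identityʳ t)) (K.≡-trans (K.≡-sym r≡t[p]) (≡.subst (λ z → + z K.≡ 1ℤ [ + p ]) (≡.sym r≡1+n) h)))

      -- As r - 1 is invertible modulo P, every g in the kernel is h^(1 - r) for some h.
      quasi-root : ∀ {g} → pow g P ≡ e → ∃ λ h → pow h r ∙ g ≡ h
      quasi-root {g} g^P = go (inverse-mod (Coprimality.sym (coprime-P r≢1)) (ℕₚ.n≢0⇒n>0 (λ n≡0 → r≢1 (K.≡-refl (cong (λ z → + suc z) n≡0)))))
        where
        go : (∃ λ s → ∃ λ l → n ℕ.* s ≡ 1 ℕ.+ P ℕ.* l) → ∃ λ h → pow h r ∙ g ≡ h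
        go (s , l , eq) = h , ≡.trans (cong (λ z → pow h z ∙ g) r≡1+n) (≡.trans (assoc h (pow h n) g) (≡.trans (cong (h ∙_) (≡.trans (cong (_∙ g) h^n) (invˡ g))) (idʳ h)))
          where
          h = pow (inv g) s
          h^n : pow h n ≡ inv g
          h^n = ≡.trans (≡.sym (pow-* (inv g) s n)) (≡.trans (pow-inv g (s ℕ.* n)) (cong inv (≡.trans (cong (pow g) (≡.trans (ℕₚ.*-comm s n) eq))
            (≡.trans (cong (g ∙_) (≡.trans (pow-* g P l) (≡.trans (cong (λ z → pow z l) g^P) (pow-e l)))) (idʳ g)))))

      torsion-in : ∀ {q u′} → 1 ℕ.≤ q → u ≡ q ℕ.* u′ → ∀ x → pow x q ≡ e → ∃ λ c → x ≡ pow γ (u′ ℕ.* c)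
      torsion-in {q} {u′} 1≤q u≡ x x^q = go (torsion x (pow-∣ {x} {q} (divides u′ (≡.trans u≡ (ℕₚ.*-comm q u′))) x^q))
        where
        go : (∃ λ j → x ≡ pow γ j) → ∃ λ c → x ≡ pow γ (u′ ℕ.* c)
        go (j , x≡) = found (ℕ∣.*-cancelˡ-∣ q {{ℕ.>-nonZero 1≤q}} (≡.subst₂ _∣_ u≡ (ℕₚ.*-comm j q)
          (HasOrder.∣-order oγ (j ℕ.* q) (≡.trans (pow-* γ j q) (≡.trans (cong (λ z → pow z q) (≡.sym x≡)) x^q)))))
          where
          found : u′ ∣ j → ∃ λ c → x ≡ pow γ (u′ ℕ.* c)
          found (divides c j≡) = c , ≡.trans x≡ (cong (pow γ) (≡.trans j≡ (ℕₚ.*-comm c u′)))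

      -- r agrees with a power Q of ℓ modulo N, the ℓ-free part of the exponent of G. So g^r and g^Q
      -- differ by powers of g^N, an element killed by ℓ^b, which is therefore a power of γ^(u′).
      frobenius : ∀ ℓ → Prime ℓ → ℓ ∣ k → FrobeniusAt γ u (λ g → pow g r) 1 ℓ
      frobenius ℓ pr ℓ∣k = go (prime-power-part pr u 1≤u)
        where
        instance ℓ≢0 = prime⇒nonZero pr
        1≤ℓ = ℕ.>-nonZero⁻¹ ℓ
        go : (∃ λ b → ∃ λ u′ → u ≡ ℓ ℕ.^ b ℕ.* u′ × ¬ (ℓ ∣ u′)) → FrobeniusAt γ u (λ g → pow g r) 1 ℓ
        go (b , u′ , u≡ , ℓ∤u′) = conclude (frobenius-exponent oω pr b N m≡ ℓ∤N {t} fixes ℓ∣k (from-≡ r≡t)) (power-shift 1≤ℓ 1≤N (∤⇒coprime pr ℓ∤N))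
          where
          N = u′ ℕ.* P
          m≡ : m ≡ ℓ ℕ.^ b ℕ.* N
          m≡ = ≡.trans (cong (ℕ._* P) u≡) (ℕₚ.*-assoc (ℓ ℕ.^ b) u′ P)
          ℓ∤N : ¬ (ℓ ∣ N)
          ℓ∤N ℓ∣N = split (euclidsLemma u′ P pr ℓ∣N)
            where
            split : ℓ ∣ u′ ⊎ ℓ ∣ P → ⊥
            split (inj₁ ℓ∣u′) = ℓ∤u′ ℓ∣u′
            split (inj₂ ℓ∣P)  = prime∤1 pr (≡.subst (ℓ ∣_) (p⊥k (prime∣^ pr (suc i) ℓ∣P , ℓ∣k)) ℕ∣.∣-refl)
          1≤N : 1 ℕ.≤ N
          1≤N = ℕₚ.n≢0⇒n>0 (λ N≡0 → ℓ∤N (≡.subst (ℓ ∣_) (≡.sym N≡0) (ℓ ℕ∣.∣0)))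
          conclude : (∃ λ j → r ≅ ℓ ℕ.^ j [ N ]) → (∃ λ J → ∀ j → + (ℓ ℕ.^ (j ℕ.+ suc J)) K.≡ + (ℓ ℕ.^ j) [ + N ]) → FrobeniusAt γ u (λ g → pow g r) 1 ℓ
          -- The exponent j may be 0; adding a period of ℓ modulo N makes it positive, as the
          -- inequality 2 ≤ Q in `Uniformizer` demands.
          conclude (j , r≅) (J , shift) = record { b = b ; u′ = u′ ; j = j ℕ.+ suc J ; u≡ = u≡ ; 1≤j = ℕₚ.≤-trans (ℕ.s≤s ℕ.z≤n) (ℕₚ.m≤n+m (suc J) j)
              ; same = same (≡⇒≅ (K.≡-trans (≅⇒≡ r≅) (K.≡-sym (shift j)))) }
            where
            Q = ℓ ℕ.^ (j ℕ.+ suc J)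
            same : r ≅ Q [ N ] → ∀ g → ∃ λ c → ∃ λ c′ → pow (pow g r) 1 ∙ pow γ (u′ ℕ.* c) ≡ pow (pow g Q) 1 ∙ pow γ (u′ ℕ.* c′)
            same (shifts {x} {y} eq) g = from (torsion-in (ℕₚ.m^n>0 ℓ b) u≡ (pow g N) (≡.trans (≡.sym (pow-* g N (ℓ ℕ.^ b))) (≡.trans (cong (pow g) (≡.trans (ℕₚ.*-comm N (ℓ ℕ.^ b)) (≡.sym m≡))) (pow-m g))))
              where
              from : (∃ λ c → pow g N ≡ pow γ (u′ ℕ.* c)) → ∃ λ c → ∃ λ c′ → pow (pow g r) 1 ∙ pow γ (u′ ℕ.* c) ≡ pow (pow g Q) 1 ∙ pow γ (u′ ℕ.* c′)
              from (c , g^N) = c ℕ.* x , c ℕ.* y , ≡.trans (shifted r x) (≡.trans (cong (pow g) eq) (≡.sym (shifted Q y)))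
                where
                shifted : ∀ a x → pow (pow g a) 1 ∙ pow γ (u′ ℕ.* (c ℕ.* x)) ≡ pow g (a ℕ.+ x ℕ.* N)
                shifted a x = ≡.trans (cong₂ _∙_ (pow-1 (pow g a)) (≡.trans (cong (pow γ) (≡.sym (ℕₚ.*-assoc u′ c x))) (≡.trans (pow-* γ (u′ ℕ.* c) x) (≡.trans (cong (λ z → pow z x) (≡.sym g^N))
                  (≡.trans (≡.sym (pow-* g N x)) (cong (pow g) (ℕₚ.*-comm N x))))))) (≡.sym (pow-+ g a (x ℕ.* N)))

      -- On the image U, inversion and the Q-th power differ on γ^x by γ^(x (Q + 1)), and u′ divides
      -- Q + 1 for a suitable power Q of ℓ.
      self-conjugate : ∀ ℓ → Prime ℓ → Defs.SelfConjPrime ℓ u → FrobeniusAt γ u inv M ℓ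
      self-conjugate ℓ pr (u′ , (b , u≡ , ℓ∤u′) , j , ℓ^j) = go (power-shift (ℕ.>-nonZero⁻¹ ℓ) 1≤u′ (∤⇒coprime pr ℓ∤u′))
        where
        instance ℓ≢0 = prime⇒nonZero pr
        1≤u′ : 1 ℕ.≤ u′
        1≤u′ = ℕₚ.n≢0⇒n>0 (λ u′≡0 → ℓ∤u′ (≡.subst (ℓ ∣_) (≡.sym u′≡0) (ℓ ℕ∣.∣0)))
        go : (∃ λ J → ∀ j → + (ℓ ℕ.^ (j ℕ.+ suc J)) K.≡ + (ℓ ℕ.^ j) [ + u′ ]) → FrobeniusAt γ u inv M ℓ
        go (J , shift) = record { b = b ; u′ = u′ ; j = j ℕ.+ suc J ; u≡ = u≡ ; 1≤j = ℕₚ.≤-trans (ℕ.s≤s ℕ.z≤n) (ℕₚ.m≤n+m (suc J) j)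
            ; same = λ g → same (from-≡ {y = ℤ.- 1ℤ} (K.≡-trans (shift j) (K.≡-trans (K.≡-refl (≡.trans (pos-^ ℓ j) (≡.sym (^≡^ (+ ℓ) j)))) (to-≡ ℓ^j)))) g (torsion (pow g M) (M-torsion g)) }
          where
          Q = ℓ ℕ.^ (j ℕ.+ suc J)
          same : u′ ∣ Q ℕ.+ 1 → ∀ g → (∃ λ x → pow g M ≡ pow γ x) → ∃ λ c → ∃ λ c′ → pow (inv g) M ∙ pow γ (u′ ℕ.* c) ≡ pow (pow g Q) M ∙ pow γ (u′ ℕ.* c′)
          same (divides z eq) g (x , g^M) = z ℕ.* x , 0 , ≡.trans (cong₂ _∙_ (≡.trans (pow-inv g M) (cong inv g^M)) expanded) (≡.trans (inv-∙-cancel (pow γ x) (pow γ (x ℕ.* Q)))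
              (≡.trans (≡.trans (pow-* γ x Q) (≡.trans (cong (λ y → pow y Q) (≡.sym g^M)) (pow-comm g M Q))) (≡.trans (≡.sym (idʳ (pow (pow g Q) M))) (cong (λ y → pow (pow g Q) M ∙ pow γ y) (≡.sym (ℕₚ.*-zeroʳ u′))))))
            where
            exponents : u′ ℕ.* (z ℕ.* x) ≡ x ℕ.+ x ℕ.* Q
            exponents = ≡.trans (≡.sym (ℕₚ.*-assoc u′ z x)) (≡.trans (cong (ℕ._* x) (≡.trans (ℕₚ.*-comm u′ z) (≡.sym eq))) (≡.trans (ℕₚ.*-comm (Q ℕ.+ 1) x) (≡.trans (cong (x ℕ.*_) (ℕₚ.+-comm Q 1)) (ℕₚ.*-suc x Q))))
            expanded : pow γ (u′ ℕ.* (z ℕ.* x)) ≡ pow γ x ∙ pow γ (x ℕ.* Q)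
            expanded = ≡.trans (cong (pow γ) exponents) (pow-+ γ x (x ℕ.* Q))

      refute : ∀ {a D} → IsIW G a (k ℕ.* k) D →
        (SelfConj k u × 2 ℕ.^ δ# u ℕ.* a ℕ.< k × k ℕ.+ 2 ℕ.^ δ# u ℕ.* a ℕ.< w)
          ⊎ ((u ℕ.* a) ℕ.* (u ℕ.* a) ℕ.< k ℕ.* k ℕ.* φ u × 4 ℕ.* (k ℕ.* k) ℕ.* φ u ℕ.< w ℕ.* w) → ⊥
      refute {D = D} D-IW c = TorsionSubgroup.Refutation.refute oγ torsion M M-γ M-torsion {q = p ℕ.^ i} 1≤k 1≤w r-γ 1≤f r^f r₁-γ r₁^w free frobenius (λ g^M → quasi-root (kernel g^M)) {D} D-IW (convert c)
        where
        convert : _ → _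
        convert (inj₁ (conj , bounds)) = inj₁ ((λ ℓ pr ℓ∣k → self-conjugate ℓ pr (conj ℓ pr ℓ∣k)) , bounds)
        convert (inj₂ bounds) = inj₂ bounds

    main : ∀ {a u d d′ k p} → 1 ℕ.≤ u → 1 ℕ.≤ d → 1 ℕ.≤ k → Prime p → v ≡ u ℕ.* p ℕ.^ d′ →
      IsExponent G (u ℕ.* p ℕ.^ d) → Coprime u p → Coprime p k →
      ∀ {t} → FixesPrimesAbove (u ℕ.* p ℕ.^ d) t k → t ≡ᵐ 1ℤ [mod u ] → ∀ {w} → IsOrd p t w →
      (SelfConj k u × 2 ℕ.^ δ# u ℕ.* a ℕ.< k × k ℕ.+ 2 ℕ.^ δ# u ℕ.* a ℕ.< w)
        ⊎ ((u ℕ.* a) ℕ.* (u ℕ.* a) ℕ.< k ℕ.* k ℕ.* φ u × 4 ℕ.* (k ℕ.* k) ℕ.* φ u ℕ.< w ℕ.* w) →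
      ∀ {D} → ¬ IsIW G a (k ℕ.* k) D
    main {a} {u} {suc i} {d′} {k} {p} 1≤u (ℕ.s≤s _) 1≤k prime-p v≡ exponent u⊥p p⊥k {t} fixes t≡1 {w} ord c {D} D-IW =
      Assembly.refute {i = i} {d′} 1≤u 1≤k prime-p v≡ exponent u⊥p p⊥k fixes t≡1 ord (2≤w c) ≡.refl r≡t {D = D} D-IW c
      where
      m = u ℕ.* p ℕ.^ suc i
      instance
        p≢0 = prime⇒nonZero prime-p
        m≢0 : ℕ.NonZero m
        m≢0 = ℕ.>-nonZero (proj₁ exponent)
      -- The representative is the residue of t plus m: adding m makes it positive, so that r - 1 is
      -- a natural number for `quasi-root`.
      r≡t : + suc (t %ℕ m ℕ.+ ℕ.pred m) K.≡ t [ + m ]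
      r≡t = K.diff (1ℤ ℤ.- t /ℕ m) (begin
          + suc (t %ℕ m ℕ.+ ℕ.pred m)                                    ≡⟨ cong +_ (≡.trans (≡.sym (ℕₚ.+-suc (t %ℕ m) (ℕ.pred m))) (cong (t %ℕ m ℕ.+_) (ℕₚ.suc-pred m))) ⟩
          + (t %ℕ m ℕ.+ m)                                               ≡⟨ ℤₚ.pos-+ (t %ℕ m) m ⟩
          + (t %ℕ m) ℤ.+ + m                                             ≡⟨ solve 3 (λ r m q → r :+ m := (r :+ q :* m) :+ m :* (con 1ℤ :- q)) ≡.refl (+ (t %ℕ m)) (+ m) (t /ℕ m) ⟩
          (+ (t %ℕ m) ℤ.+ t /ℕ m ℤ.* + m) ℤ.+ + m ℤ.* (1ℤ ℤ.- t /ℕ m)    ≡⟨ cong (ℤ._+ + m ℤ.* (1ℤ ℤ.- t /ℕ m)) (a≡a%ℕn+[a/ℕn]*n t m) ⟨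
          t ℤ.+ + m ℤ.* (1ℤ ℤ.- t /ℕ m)                                  ∎)
        where
        open ≡.≡-Reasoning
        open K.Solver
      -- From k ≥ 1: either w > k ≥ 1, or w² > 4 k² φ(u) ≥ 4.
      2≤w : _ → 2 ℕ.≤ w
      2≤w (inj₁ (_ , _ , large)) = ℕₚ.≤-trans (ℕ.s≤s (ℕₚ.≤-trans 1≤k (ℕₚ.m≤m+n k _))) large
      2≤w (inj₂ (_ , large)) = ℕₚ.≮⇒≥ λ { (ℕ.s≤s w≤1) → ℕₚ.<⇒≱ large (ℕₚ.≤-trans (ℕₚ.*-mono-≤ w≤1 w≤1)
        (ℕₚ.*-mono-≤ {1} (ℕₚ.*-mono-≤ {1} (ℕ.s≤s {n = 3} ℕ.z≤n) (ℕₚ.*-mono-≤ 1≤k 1≤k)) (1≤φ u 1≤u))) }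

open import Defs
open import Data.Nat using (ℕ; _+_; _*_; _^_; _<_; _≤_)
open import Data.Nat.Primality using (Prime)
open import Data.Nat.Coprimality using (Coprime)
open import Data.Integer as ℤ using (ℤ; +_; 1ℤ)
open import Data.Product using (Σ; _×_)
open import Data.Sum using (_⊎_)
open import Data.Fin using (Fin)
open import Relation.Nullary using (¬_)

-- The bounds are stated in ℕ: the upper bound of the first alternative has its subtraction moved to
-- the other side, and the two inequalities with √φ(u) are squared and cleared of denominators.
mainTheorem12 :
  (a u d d′ k p : ℕ) →
  1 ≤ a → 1 ≤ u → 1 ≤ d → 1 ≤ d′ → 1 ≤ k →
  Prime p → 3 ≤ p →
  (G : FinAbGroup (u * p ^ d′)) → IsExponent G (u * p ^ d) →
  Coprime u p → Coprime p k →
  Σ ℤ (λ t →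
    Coprime ℤ.∣ t ∣ (u * p) ×
    FixesPrimesAbove (u * p ^ d) t k ×
    t ≡ᵐ 1ℤ [mod u ] ×
    Σ ℕ (λ w → IsOrd p t w ×
      ((SelfConj k u × 2 ^ δ u * a < k × k + 2 ^ δ u * a < w)
       ⊎ ((u * a) * (u * a) < k * k * φ u × 4 * (k * k) * φ u < w * w)))) →
  ¬ Σ (Fin (u * p ^ d′) → ℤ) (λ D → IsIW G a (k * k) D)
mainTheorem12 a u d d′ k p 1≤a 1≤u 1≤d 1≤d′ 1≤k prime-p 3≤p G exponent u⊥p p⊥k (t , t⊥up , fixes , t≡1 , w , ord , c) (D , D-IW) =
  Main.main G {d′ = d′} 1≤u 1≤d 1≤k prime-p ≡.refl exponent u⊥p p⊥k fixes t≡1 ord c {D} D-IW
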